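{- Under the promise that the input simple directed graph on $n$ vertices has no even cycle or has a unique shortest even cycle, one can deterministically output that cycle, or report its absence, in $\widetilde O(n^{\tau+1})$ bit operations and $O(n^2)$ field elements of space.
   Context: Graphs are simple directed graphs without loops; oppositely directed arcs are allowed. A cycle is always directed and simple (no repeated vertices); its length is its number of arcs, and it is even if its length is even. Cycles are distinguished by their arc sets. A shortest even cycle is an even cycle of minimum length among all even cycles. $\tau$ is a fixed real number with $2<\tau\le 3$ for which multiplication of $n\times n$ matrices over the fields in question has a uniform algorithm using $O(n^\tau)$ arithmetic operations; constants may depend on $\tau$. The notation $\widetilde O$ hides logarithmic factors. Field elements are elements of a binary extension field $\mathbb F_{2^d}$ with $d=O(\log n)$. For the space bound, matrix multiplication and fast linear algebra routines with quadratic workspace are assumed. -}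

module Defs where

open import Algebra.Bundles.Raw using (RawRing)
open import Algebra.Core using (Op₁; Op₂)
open import Algebra.Structures using (IsCommutativeRing)
import Algebra.Definitions.RawMonoid as Sums
open import Data.Bool.Base using (Bool; true; false; if_then_else_)
open import Data.Fin.Base as Fin using (Fin; toℕ; punchIn)
import Data.Fin.Properties as Fin
open import Data.List.Base as List
  using (List; []; _∷_; [_]; _++_; length; zip; head; drop; applyUpTo; allFin; concatMap)
open import Data.List.Membership.Propositional using (_∈_)
open import Data.List.Relation.Unary.All using (All)
open import Data.List.Relation.Unary.Unique.Propositional using (Unique)
open import Data.Maybe.Base using (Maybe; just; nothing)
open import Data.Nat.Base
  using (ℕ; zero; suc; _+_; _*_; _∸_; _^_; _≤_; _≡ᵇ_; ⌊_/2⌋)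
open import Data.Nat.Divisibility using (_∣_)
open import Data.Nat.Logarithm using (⌊log₂_⌋)
open import Data.Integer.Base using (∣_∣)
open import Data.Product.Base using (Σ; Σ-syntax; ∃; ∃-syntax; _×_; _,_; proj₁; proj₂)
open import Data.Rational.Base as ℚ using (ℚ; ↥_; ↧ₙ_)
open import Data.Sum.Base using (_⊎_)
open import Data.Unit.Base using (⊤)
open import Function.Bundles using (_⇔_; _↔_)
open import Function.Properties.Inverse using (Inverse⇒Injection)
open import Relation.Binary.Definitions using (DecidableEquality)
open import Relation.Binary.PropositionalEquality using (_≡_; _≢_)
open import Relation.Nullary.Decidable using (does; via-injection)
open import Relation.Nullary.Negation using (¬_)

------------------------------------------------------------------------
-- Directed graphs and even cycles

record Digraph (n : ℕ) : Set where
  field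
    adj      : Fin n → Fin n → Bool
    loopless : ∀ v → adj v v ≡ false

open Digraph public

-- A cycle is listed from an arbitrary starting vertex; the closing arc is
-- implicit, so the length of the list is the number of arcs.
arcs : ∀ {n} → List (Fin n) → List (Fin n × Fin n)
arcs []       = []
arcs (v ∷ vs) = zip (v ∷ vs) (vs ++ [ v ])

record IsCycle {n} (G : Digraph n) (c : List (Fin n)) : Set where
  field
    nonempty : c ≢ []
    simple   : Unique c
    closed   : All (λ (u , v) → adj G u v ≡ true) (arcs c)

IsEvenCycle : ∀ {n} → Digraph n → List (Fin n) → Set
IsEvenCycle G c = IsCycle G c × 2 ∣ length c

IsShortestEvenCycle : ∀ {n} → Digraph n → List (Fin n) → Set
IsShortestEvenCycle G c =
  IsEvenCycle G c × (∀ c′ → IsEvenCycle G c′ → length c ≤ length c′)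

SameArcs : ∀ {n} → List (Fin n) → List (Fin n) → Set
SameArcs c c′ = ∀ a → a ∈ arcs c ⇔ a ∈ arcs c′

NoEvenCycle : ∀ {n} → Digraph n → Set
NoEvenCycle G = ∀ c → ¬ IsEvenCycle G c

UniqueShortestEvenCycle : ∀ {n} → Digraph n → Set
UniqueShortestEvenCycle G =
  ∃[ c ] IsShortestEvenCycle G c × (∀ c′ → IsShortestEvenCycle G c′ → SameArcs c c′)

CorrectAnswer : ∀ {n} → Digraph n → Maybe (List (Fin n)) → Set
CorrectAnswer G nothing  = NoEvenCycle G
CorrectAnswer G (just c) = IsShortestEvenCycle G c

------------------------------------------------------------------------
-- Real exponents

-- Two-sided Dedekind cuts.
record ℝ : Set₁ where
  field
    lower upper     : ℚ → Set
    lower-inhabited : ∃ lower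
    upper-inhabited : ∃ upper
    lower-rounded   : ∀ q → lower q ⇔ (∃[ r ] q ℚ.< r × lower r)
    upper-rounded   : ∀ r → upper r ⇔ (∃[ q ] q ℚ.< r × upper q)
    disjoint        : ∀ q → ¬ (lower q × upper q)
    located         : ∀ q r → q ℚ.< r → lower q ⊎ upper r

infix 4 _<ℝ_ _≤ℝ_

_<ℝ_ : ℚ → ℝ → Set
q <ℝ x = ℝ.lower x q

_≤ℝ_ : ℝ → ℚ → Set
x ≤ℝ q = ¬ (q <ℝ x)

-- For x ≥ 1 and a positive real τ, the inequality t ≤ m · x ^ τ: it holds
-- iff t ≤ m · x ^ (a / b) for every rational a / b > τ, and that inequality
-- is raised to the power b.
infix 4 _≤_·_^ℝ_

_≤_·_^ℝ_ : ℕ → ℕ → ℕ → ℝ → Set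
t ≤ m · x ^ℝ τ =
  ∀ r → ℝ.upper τ r → t ^ (↧ₙ r) ≤ m ^ (↧ₙ r) * x ^ ∣ ↥ r ∣

-- Length of the binary representation, with 0 having one digit.
bits : ℕ → ℕ
bits n = suc ⌊log₂ n ⌋

------------------------------------------------------------------------
-- Memories

Memory : Set → Set
Memory A = ℕ → A

infixl 8 _[_≔_]

_[_≔_] : ∀ {A} → Memory A → ℕ → A → Memory A
(m [ a ≔ x ]) b = if a ≡ᵇ b then x else m b

initial : ∀ {A} → A → List A → Memory A
initial z []       _       = z
initial z (x ∷ _)  zero    = x
initial z (_ ∷ xs) (suc a) = initial z xs a

StartsWith : ∀ {A} → Memory A → List A → Set
StartsWith m xs = applyUpTo m (length xs) ≡ xs

ZeroFrom : ∀ {A} → ℕ → A → Memory A → Set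
ZeroFrom s z m = ∀ a → s ≤ a → m a ≡ z

WordSize : ℕ → Memory ℕ → Set
WordSize w m = ∀ a → bits (m a) ≤ w

Matrix : Set → ℕ → ℕ → Set
Matrix A m n = Fin m → Fin n → A

rowMajor : ∀ {A m n} → Matrix A m n → List A
rowMajor {m = m} {n} M = concatMap (λ i → List.map (M i) (allFin n)) (allFin m)

------------------------------------------------------------------------
-- Deterministic programs

-- A configuration is a program counter with a store.  A program halts when
-- the counter leaves it; a halted configuration does not change.
Config : Set → Set
Config S = ℕ × S

module Execution {I S : Set} (execute : I → Config S → Config S) where

  fetch : List I → Config S → Maybe I
  fetch p (pc , _) = head (drop pc p)

  step : List I → Config S → Config S
  step p c with fetch p c
  ... | nothing = c
  ... | just i  = execute i c

  run : List I → ℕ → Config S → Config S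
  run p zero    c = c
  run p (suc t) c = run p t (step p c)

  Halted : List I → Config S → Set
  Halted p c = fetch p c ≡ nothing

------------------------------------------------------------------------
-- Random-access machines over ℕ, with costs counted in bit operations

data Instr : Set where
  const       : (i k : ℕ) → Instr     -- R i := k
  add sub mul : (i j k : ℕ) → Instr   -- R i := R j ∘ R k, subtraction truncated
  half        : (i j : ℕ) → Instr     -- R i := ⌊ R j / 2 ⌋
  load        : (i j : ℕ) → Instr     -- R i := R (R j)
  store       : (i j : ℕ) → Instr     -- R (R i) := R j
  jz          : (i l : ℕ) → Instr     -- jump to l if R i = 0
  jmp         : (l : ℕ) → Instr

execute : Instr → Config (Memory ℕ) → Config (Memory ℕ)
execute (const i k) (pc , R) = suc pc , R [ i ≔ k ]
execute (add i j k) (pc , R) = suc pc , R [ i ≔ R j + R k ]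
execute (sub i j k) (pc , R) = suc pc , R [ i ≔ R j ∸ R k ]
execute (mul i j k) (pc , R) = suc pc , R [ i ≔ R j * R k ]
execute (half i j)  (pc , R) = suc pc , R [ i ≔ ⌊ R j /2⌋ ]
execute (load i j)  (pc , R) = suc pc , R [ i ≔ R (R j) ]
execute (store i j) (pc , R) = suc pc , R [ R i ≔ R j ]
execute (jz i l)    (pc , R) = (if R i ≡ᵇ 0 then l else suc pc) , R
execute (jmp l)     (pc , R) = l , R

-- Logarithmic cost: the lengths of the numbers and of the computed addresses
-- involved; multiplication is charged as schoolbook multiplication.  The
-- register indices written in the program contribute only a constant factor.
bitCost : Instr → Memory ℕ → ℕ
bitCost (const i k) R = bits k
bitCost (add i j k) R = bits (R j) + bits (R k)
bitCost (sub i j k) R = bits (R j) + bits (R k)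
bitCost (mul i j k) R = bits (R j) * bits (R k)
bitCost (half i j)  R = bits (R j)
bitCost (load i j)  R = bits (R j) + bits (R (R j))
bitCost (store i j) R = bits (R i) + bits (R j)
bitCost (jz i l)    R = bits (R i)
bitCost (jmp l)     R = 1

module RAM where
  open Execution execute public

  stepCost : List Instr → Config (Memory ℕ) → ℕ
  stepCost p c with fetch p c
  ... | nothing = 0
  ... | just i  = bitCost i (proj₂ c)

  bitOperations : List Instr → ℕ → Config (Memory ℕ) → ℕ
  bitOperations p zero    c = 0
  bitOperations p (suc t) c = stepCost p c + bitOperations p t (step p c)

------------------------------------------------------------------------
-- Binary extension fields

-- An arbitrary field with 2 ^ degree elements.  The value of 0# ⁻¹ is
-- irrelevant.
record BinaryField : Set₁ where
  infixl 6 _⊕_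
  infixl 7 _⊗_
  field
    degree            : ℕ
    Carrier           : Set
    _⊕_ _⊗_           : Op₂ Carrier
    ⊖_ _⁻¹            : Op₁ Carrier
    0# 1#             : Carrier
    isCommutativeRing : IsCommutativeRing _≡_ _⊕_ _⊗_ ⊖_ 0# 1#
    0#≢1#             : 0# ≢ 1#
    ⁻¹-inverse        : ∀ x → x ≢ 0# → x ⊗ x ⁻¹ ≡ 1#
    enumeration       : Carrier ↔ Fin (2 ^ degree)

  _≟_ : DecidableEquality Carrier
  _≟_ = via-injection (Inverse⇒Injection enumeration) Fin._≟_

  rawRing : RawRing _ _
  rawRing = record
    { _≈_ = _≡_ ; _+_ = _⊕_ ; _*_ = _⊗_ ; -_ = ⊖_ ; 0# = 0# ; 1# = 1# }

  open RawRing rawRing public using (+-rawMonoid)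
  open Sums +-rawMonoid public using (sum)

module MatrixAlgebra (F : BinaryField) where
  open BinaryField F

  _·_ : ∀ {k m n} → Matrix Carrier k m → Matrix Carrier m n → Matrix Carrier k n
  (A · B) i j = sum (λ l → A i l ⊗ B l j)

  identity : ∀ {n} → Matrix Carrier n n
  identity i j = if does (i Fin.≟ j) then 1# else 0#

  alternate : ℕ → Carrier → Carrier
  alternate zero    x = x
  alternate (suc k) x = ⊖ (alternate k x)

  -- Laplace expansion along the first row.
  det : ∀ {n} → Matrix Carrier n n → Carrier
  det {zero}  A = 1#
  det {suc n} A =
    sum (λ j → alternate (toℕ j)
                 (A Fin.zero j ⊗ det (λ i k → A (Fin.suc i) (punchIn j k))))

  IsInverse : ∀ {n} → Matrix Carrier n n → Matrix Carrier n n → Set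
  IsInverse A B = (∀ i j → (A · B) i j ≡ identity i j)
                × (∀ i j → (B · A) i j ≡ identity i j)

  InKernel : ∀ {n} → Matrix Carrier n n → (Fin n → Carrier) → Set
  InKernel A x = ∀ i → sum (λ j → A i j ⊗ x j) ≡ 0#

  combination : ∀ {k n} → (Fin k → Carrier) → Matrix Carrier k n → Fin n → Carrier
  combination c B j = sum (λ i → c i ⊗ B i j)

  record IsKernelBasis {k n} (A : Matrix Carrier n n) (B : Matrix Carrier k n) : Set where
    field
      inKernel    : ∀ i → InKernel A (B i)
      independent : ∀ c → (∀ j → combination c B j ≡ 0#) → ∀ i → c i ≡ 0#
      spanning    : ∀ x → InKernel A x → ∃[ c ] (∀ j → x j ≡ combination c B j)

------------------------------------------------------------------------
-- Uniform algebraic algorithms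

-- Field elements live in a memory of their own and are accessed only through
-- the field operations and zero tests, with addresses taken from the integer
-- registers.  A program mentions neither the field nor the dimension.
data FieldInstr : Set where
  int         : Instr → FieldInstr
  fzero fone  : (i : ℕ) → FieldInstr       -- M (R i) := 0, 1
  fadd fmul   : (i j k : ℕ) → FieldInstr   -- M (R i) := M (R j) ∘ M (R k)
  finv        : (i j : ℕ) → FieldInstr     -- M (R i) := (M (R j)) ⁻¹
  fjz         : (i l : ℕ) → FieldInstr     -- jump to l if M (R i) = 0

module FieldRAM (F : BinaryField) where
  open BinaryField F

  Store : Set
  Store = Memory ℕ × Memory Carrier

  executeF : FieldInstr → Config Store → Config Store
  executeF (int i)      (pc , R , M) with execute i (pc , R)
  ... | pc′ , R′ = pc′ , R′ , M
  executeF (fzero i)    (pc , R , M) = suc pc , R , M [ R i ≔ 0# ]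
  executeF (fone i)     (pc , R , M) = suc pc , R , M [ R i ≔ 1# ]
  executeF (fadd i j k) (pc , R , M) = suc pc , R , M [ R i ≔ M (R j) ⊕ M (R k) ]
  executeF (fmul i j k) (pc , R , M) = suc pc , R , M [ R i ≔ M (R j) ⊗ M (R k) ]
  executeF (finv i j)   (pc , R , M) = suc pc , R , M [ R i ≔ M (R j) ⁻¹ ]
  executeF (fjz i l)    (pc , R , M) =
    (if does (M (R i) ≟ 0#) then l else suc pc) , R , M

  open Execution executeF public

-- A computational problem about n × n matrices over F: its instances, their
-- layout in the field memory, and which final memories are correct.
record Problem : Set₁ where
  field
    Instance : BinaryField → ℕ → Set
    layout   : ∀ {F n} → Instance F n → List (BinaryField.Carrier F)
    Solved   : ∀ {F n} → Instance F n → Memory ℕ → Memory (BinaryField.Carrier F) → Set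

open Problem

SquareMatrix : BinaryField → ℕ → Set
SquareMatrix F n = Matrix (BinaryField.Carrier F) n n

multiplication : Problem
multiplication .Instance F n = SquareMatrix F n × SquareMatrix F n
multiplication .layout (A , B) = rowMajor A ++ rowMajor B
multiplication .Solved {F} (A , B) R M = StartsWith M (rowMajor (A · B))
  where open MatrixAlgebra F

determinant : Problem
determinant .Instance = SquareMatrix
determinant .layout A = rowMajor A
determinant .Solved {F} A R M = M 0 ≡ det A
  where open MatrixAlgebra F

inversion : Problem
inversion .Instance = SquareMatrix
inversion .layout A = rowMajor A
inversion .Solved {F} {n} A R M =
    (R 0 ≡ 1 × Σ[ B ∈ SquareMatrix F n ] (IsInverse A B × StartsWith M (rowMajor B)))
  ⊎ (R 0 ≡ 0 × (∀ B → ¬ IsInverse A B))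
  where open MatrixAlgebra F

kernel : Problem
kernel .Instance = SquareMatrix
kernel .layout A = rowMajor A
kernel .Solved {F} {n} A R M =
  Σ[ k ∈ ℕ ] Σ[ B ∈ Matrix (BinaryField.Carrier F) k n ]
    (R 0 ≡ k × IsKernelBasis A B × StartsWith M (rowMajor B))
  where open MatrixAlgebra F

-- Requirements on the number of cells in use: none, or O(n²).
data Workspace : Set where
  unrestricted quadratic : Workspace

CellsWithin : Workspace → (C n : ℕ) → ∀ {A} → A → Memory A → Set
CellsWithin unrestricted C n z m = ⊤
CellsWithin quadratic    C n z m = ZeroFrom (C * suc n ^ 2) z m

-- One program solves the problem over all binary fields and in all dimensions
-- with O(n ^ τ) operations, every executed instruction being counted, and
-- with index registers of O(log n) bits.  Bounds are in terms of n + 1, here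
-- and below, so that they make sense for n = 0.
FastAlgorithm : Workspace → ℝ → Problem → Set₁
FastAlgorithm w τ P =
  Σ[ p ∈ List FieldInstr ] Σ[ C ∈ ℕ ]
    ((F : BinaryField) (n : ℕ) (x : P .Instance F n) →
     let open BinaryField F
         open FieldRAM F
         start = 0 , initial 0 [ n ] , initial 0# (P .layout x)
     in Σ[ t ∈ ℕ ]
          ( Halted p (run p t start)
          × P .Solved x (proj₁ (proj₂ (run p t start))) (proj₂ (proj₂ (run p t start)))
          × t ≤ C · suc n ^ℝ τ
          × (∀ s → s ≤ t →
               let (_ , R , M) = run p s start in
                 WordSize (C * bits n) R
               × CellsWithin w C n 0 R
               × CellsWithin w C n 0# M)))

FastMatrixMultiplication : ℝ → Set₁
FastMatrixMultiplication τ = FastAlgorithm unrestricted τ multiplication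

record QuadraticWorkspaceLinearAlgebra (τ : ℝ) : Set₁ where
  field
    fastMultiplication : FastAlgorithm quadratic τ multiplication
    fastDeterminant    : FastAlgorithm quadratic τ determinant
    fastInversion      : FastAlgorithm quadratic τ inversion
    fastKernel         : FastAlgorithm quadratic τ kernel

------------------------------------------------------------------------
-- Computing the cycle

graphInput : ∀ {n} → Digraph n → List ℕ
graphInput {n} G = n ∷ rowMajor (λ u v → if adj G u v then 1 else 0)

-- Cycles are nonempty, so length 0 is free to report absence.
answerOutput : ∀ {n} → Maybe (List (Fin n)) → List ℕ
answerOutput nothing  = [ 0 ]
answerOutput (just c) = length c ∷ List.map toℕ c

-- A field element of 𝔽_(2 ^ d), d = O(log n), occupies one cell of O(log n)
-- bits, so space of O(n²) field elements is a memory of O(n²) such cells.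
SpaceWithin : Workspace → (C n : ℕ) → Memory ℕ → Set
SpaceWithin unrestricted C n R = ⊤
SpaceWithin quadratic    C n R =
  WordSize (C * bits n) R × CellsWithin quadratic C n 0 R

-- With n ^ (τ + 1) written as n · n ^ τ, the time bound is
-- C · (log n) ^ k · n ^ (τ + 1) bit operations.
FindsUniqueShortestEvenCycle : Workspace → ℝ → Set
FindsUniqueShortestEvenCycle w τ =
  Σ[ p ∈ List Instr ] Σ[ C ∈ ℕ ] Σ[ k ∈ ℕ ]
    ((n : ℕ) (G : Digraph n) → NoEvenCycle G ⊎ UniqueShortestEvenCycle G →
     let open RAM
         start = 0 , initial 0 (graphInput G)
     in Σ[ t ∈ ℕ ]
          ( Halted p (run p t start)
          × (∃[ answer ] CorrectAnswer G answer
                       × StartsWith (proj₂ (run p t start)) (answerOutput answer))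
          × bitOperations p t start ≤ (C * bits n ^ k * suc n) · suc n ^ℝ τ
          × (∀ s → s ≤ t → SpaceWithin w C n (proj₂ (run p s start)))))

module Submission where

-- Let A be the adjacency matrix over 𝔽₂ and M = I + y A over the power series,
-- with inverse N = Σ yᵐ Aᵐ and determinant d, and let h be the sum of the
-- products of the entries of M along the odd permutations.  A permutation moves
-- its points along the arcs of disjoint cycles, and an odd one has an even
-- cycle among them.  So if the shortest even cycle D is unique and has length
-- k, then h ≡ 0 modulo yᵏ, and for an arc u v the lowest coefficient of the
-- partial derivative H of h at the entry u v, that of yᵏ⁻¹, says whether u v
-- belongs to D.  In characteristic 2 pairing σ with σ ∘ (i j) yields
--   H u v = h N v u + d X u v,   Mᵀ X Mᵀ = Wᵀ + Mᵀ,   W s t = (M s t)² N t s,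
-- so X has the same lowest coefficients as H.  They are computed by a recurrence
-- with three matrix products over 𝔽₂ per coefficient: the first m for which
-- some arc u v has X m u v = 1 is k - 1 < n, and these arcs form D.

-- The parity condition in `h` is what no determinant expresses directly. It disappears for a matrix
-- with two equal rows: each pair `σ`, `σ ∘ (i j)` has one odd member, so the odd permutations can
-- be exchanged for those with `σ i < σ j`, and the sum becomes one of second-order minors, that is,
-- of entries of N times d. Linearity then recovers all partial derivatives from such values, which
-- is the origin of the equation for X. The given multiplication is a program for another machine
-- that expects a blank memory. Since no array has a known end, arrays are interleaved instead of
-- laid out one after the other. Finally, the input starts in the cells that the program needs as
-- registers, so its first bits are packed into a single number before anything else, and the first
-- cells of the answer are written last.

module Parity where

  -- Signs of permutations.

  open import Algebra.Bundles using (CommutativeRing)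
  open import Data.Bool.Base using (Bool; true; false; not; _xor_)
  open import Data.Bool.Properties using (xor-∧-commutativeRing)
  import Data.Bool.Solver as Bool
  open import Data.Fin.Base using (Fin; zero; suc; toℕ)
  import Data.Fin.Properties as Fin
  open import Data.Fin.Permutation using (transpose)
  import Data.Fin.Permutation.Components as PC
  open import Data.Nat.Base using (zero; suc; _<ᵇ_)
  open import Data.Product.Base using (_,_)
  open import Function.Base using (_∘_; case_of_)
  open import Relation.Binary.PropositionalEquality
  open import Relation.Nullary using (yes; no; does; contradiction)

  Inj : ∀ {m n} → (Fin m → Fin n) → Set
  Inj σ = ∀ {i j} → σ i ≡ σ j → i ≡ j

  open import Algebra.Properties.CommutativeMonoid.Sum
    (CommutativeRing.+-commutativeMonoid xor-∧-commutativeRing)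
    using (sum; sum-permute; sum-cong-≗)

  infix 4 _<ᶠ_

  _<ᶠ_ : ∀ {n} → Fin n → Fin n → Bool
  a <ᶠ b = toℕ a <ᵇ toℕ b

  <ᵇ-flip : ∀ a b → a ≢ b → (a <ᵇ b) ≡ not (b <ᵇ a)
  <ᵇ-flip zero    zero    a≢b = contradiction refl a≢b
  <ᵇ-flip zero    (suc b) a≢b = refl
  <ᵇ-flip (suc a) zero    a≢b = refl
  <ᵇ-flip (suc a) (suc b) a≢b = <ᵇ-flip a b (a≢b ∘ cong suc)

  <ᶠ-flip : ∀ {n} {a b : Fin n} → a ≢ b → (a <ᶠ b) ≡ not (b <ᶠ a)
  <ᶠ-flip a≢b = <ᵇ-flip _ _ (a≢b ∘ Fin.toℕ-injective)

  <ᶠ-irrefl : ∀ {n} (a : Fin n) → (a <ᶠ a) ≡ false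
  <ᶠ-irrefl a = lemma (toℕ a)
    where
    lemma : ∀ a → (a <ᵇ a) ≡ false
    lemma zero    = refl
    lemma (suc a) = lemma a

  -- Parity of the number of inversions; the parity of σ as a permutation when
  -- σ is injective.
  odd : ∀ {m n} → (Fin m → Fin n) → Bool
  odd {zero}  σ = false
  odd {suc m} σ = sum (λ l → σ (suc l) <ᶠ σ zero) xor odd (σ ∘ suc)

  odd-cong : ∀ {m n} {σ τ : Fin m → Fin n} → (∀ i → σ i ≡ τ i) → odd σ ≡ odd τ
  odd-cong {zero}  eq = refl
  odd-cong {suc m} eq = cong₂ _xor_
    (sum-cong-≗ (λ l → cong₂ _<ᶠ_ (eq (suc l)) (eq zero)))
    (odd-cong (eq ∘ suc))

  -- The bookkeeping for exchanging the first two values: `x` compares them, `p` and `q` count the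
  -- later values below each, and `r` is the parity of the rest. The counts trade places and only
  -- the comparison is negated.
  xor-exchange : ∀ x p q r → (not x xor p) xor (q xor r) ≡ not ((x xor q) xor (p xor r))
  xor-exchange true true true true = refl
  xor-exchange true true true false = refl
  xor-exchange true true false true = refl
  xor-exchange true true false false = refl
  xor-exchange true false true true = refl
  xor-exchange true false true false = refl
  xor-exchange true false false true = refl
  xor-exchange true false false false = refl
  xor-exchange false true true true = refl
  xor-exchange false true true false = refl
  xor-exchange false true false true = refl
  xor-exchange false true false false = refl
  xor-exchange false false true true = refl
  xor-exchange false false true false = refl
  xor-exchange false false false true = refl
  xor-exchange false false false false = refl

  xor-not : ∀ x y → x xor not y ≡ not (x xor y)
  xor-not true  y = refl
  xor-not false y = refl

  not-not : ∀ x → not (not x) ≡ x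
  not-not true  = refl
  not-not false = refl

  transpose-ˡ : ∀ {n} (i j : Fin n) → PC.transpose i j i ≡ j
  transpose-ˡ i j with i Fin.≟ i
  ... | yes _ = refl
  ... | no ¬p = contradiction refl ¬p

  transpose-ʳ : ∀ {n} (i j : Fin n) → PC.transpose i j j ≡ i
  transpose-ʳ i j with j Fin.≟ i
  ... | yes refl = refl
  ... | no _ with j Fin.≟ j
  ...   | yes _ = refl
  ...   | no ¬p = contradiction refl ¬p

  transpose-≢ : ∀ {n} (i j : Fin n) {k} → k ≢ i → k ≢ j → PC.transpose i j k ≡ k
  transpose-≢ i j {k} k≢i k≢j with k Fin.≟ i
  ... | yes k≡i = contradiction k≡i k≢i
  ... | no _ with k Fin.≟ j
  ...   | yes k≡j = contradiction k≡j k≢j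
  ...   | no _ = refl

  transpose-comm : ∀ {n} (i j k : Fin n) → PC.transpose i j k ≡ PC.transpose j i k
  transpose-comm i j k = case ((k Fin.≟ i) , (k Fin.≟ j)) of λ where
    (yes refl , _)       → trans (transpose-ˡ i j) (sym (transpose-ʳ j i))
    (no _ , yes refl)    → trans (transpose-ʳ i j) (sym (transpose-ˡ j i))
    (no k≢i , no k≢j)    → trans (transpose-≢ i j k≢i k≢j) (sym (transpose-≢ j i k≢j k≢i))

  transpose-involutive : ∀ {n} (i j k : Fin n) → PC.transpose i j (PC.transpose i j k) ≡ k
  transpose-involutive i j k =
    trans (cong (PC.transpose i j) (transpose-comm i j k)) (PC.transpose-inverse i j)

  transpose-injective : ∀ {n} (i j : Fin n) → Inj (PC.transpose i j)
  transpose-injective i j {k} {l} eq =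
    trans (sym (transpose-involutive i j k))
      (trans (cong (PC.transpose i j) eq) (transpose-involutive i j l))

  odd-adjacent : ∀ {m n} (σ : Fin (suc (suc m)) → Fin n) → Inj σ →
                 odd (σ ∘ PC.transpose zero (suc zero)) ≡ not (odd σ)
  odd-adjacent σ inj = trans
    (cong (λ b → (b xor cnt (σ (suc zero))) xor (cnt (σ zero) xor odd τ))
          (<ᶠ-flip (λ eq → contradiction (inj eq) λ ())))
    (xor-exchange (σ (suc zero) <ᶠ σ zero) (cnt (σ (suc zero))) (cnt (σ zero)) (odd τ))
    where
    τ : Fin _ → Fin _
    τ l = σ (suc (suc l))
    cnt : Fin _ → Bool
    cnt a = sum (λ l → τ l <ᶠ a)

  -- The comparisons with `σ zero` are merely permuted among themselves, so their sum stays the same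
  -- and the whole change of parity happens in the tail.
  odd-suc : ∀ {m n} (σ : Fin (suc m) → Fin n) (i j : Fin m) →
            odd (σ ∘ suc ∘ PC.transpose i j) ≡ not (odd (σ ∘ suc)) →
            odd (σ ∘ PC.transpose (suc i) (suc j)) ≡ not (odd σ)
  odd-suc σ i j flips = begin
    sum (λ l → σ (PC.transpose (suc i) (suc j) (suc l)) <ᶠ σ zero)
      xor odd (σ ∘ PC.transpose (suc i) (suc j) ∘ suc)
      ≡⟨ cong₂ _xor_ (sum-cong-≗ (λ l → cong (λ k → σ k <ᶠ σ zero) (lift l)))
                     (odd-cong (cong σ ∘ lift)) ⟩
    sum (λ l → σ (suc (PC.transpose i j l)) <ᶠ σ zero) xor odd (σ ∘ suc ∘ PC.transpose i j)
      ≡⟨ cong₂ _xor_ (sym (sum-permute (λ l → σ (suc l) <ᶠ σ zero) (transpose i j))) flips ⟩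
    sum (λ l → σ (suc l) <ᶠ σ zero) xor not (odd (σ ∘ suc))
      ≡⟨ xor-not (sum (λ l → σ (suc l) <ᶠ σ zero)) (odd (σ ∘ suc)) ⟩
    not (odd σ) ∎
    where
    open ≡-Reasoning
    lift : ∀ l → PC.transpose (suc i) (suc j) (suc l) ≡ suc (PC.transpose i j l)
    lift l with does (l Fin.≟ i)
    ... | true = refl
    ... | false with does (l Fin.≟ j)
    ...   | true  = refl
    ...   | false = refl

  ∘-inj : ∀ {l m n} {σ : Fin m → Fin n} {τ : Fin l → Fin m} → Inj σ → Inj τ → Inj (σ ∘ τ)
  ∘-inj σ-inj τ-inj eq = τ-inj (σ-inj eq)

  -- By induction on `j`, conjugating with the adjacent transposition: (0 j+2) = (0 1)(1 j+2)(0 1),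
  -- three changes of parity in all. The middle factor acts on the tail, where the induction
  -- hypothesis applies.
  odd-transpose₀ : ∀ {m n} (σ : Fin (suc m) → Fin n) → Inj σ → ∀ j →
                   odd (σ ∘ PC.transpose zero (suc j)) ≡ not (odd σ)
  odd-transpose₀ {suc m} σ inj zero = odd-adjacent σ inj
  odd-transpose₀ {suc m} σ inj (suc j) = begin
    odd (σ ∘ PC.transpose zero (suc (suc j)))  ≡⟨ odd-cong conjugate ⟩
    odd (ρ ∘ t)                                ≡⟨ odd-adjacent ρ ρ-inj ⟩
    not (odd ρ)
      ≡⟨ cong not (odd-suc (σ ∘ t) zero (suc j)
           (odd-transpose₀ (σ ∘ t ∘ suc) (∘-inj σt-inj Fin.suc-injective) j)) ⟩
    not (not (odd (σ ∘ t)))                    ≡⟨ cong (not ∘ not) (odd-adjacent σ inj) ⟩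
    not (not (not (odd σ)))                    ≡⟨ not-not _ ⟩
    not (odd σ)                                ∎
    where
    open ≡-Reasoning
    t t′ : Fin (suc (suc m)) → Fin (suc (suc m))
    t  = PC.transpose zero (suc zero)
    t′ = PC.transpose (suc zero) (suc (suc j))
    ρ : Fin (suc (suc m)) → Fin _
    ρ = σ ∘ t ∘ t′
    σt-inj : Inj (σ ∘ t)
    σt-inj = ∘-inj {σ = σ} inj (transpose-injective zero (suc zero))
    ρ-inj : Inj ρ
    ρ-inj = ∘-inj {σ = σ ∘ t} {τ = t′} σt-inj (transpose-injective (suc zero) (suc (suc j)))
    conjugate : ∀ k → σ (PC.transpose zero (suc (suc j)) k) ≡ ρ (t k)
    conjugate zero = refl
    conjugate (suc zero) = refl
    conjugate (suc (suc k)) with does (k Fin.≟ j)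
    ... | true  = refl
    ... | false = refl

  odd-transpose : ∀ {m n} (σ : Fin m → Fin n) → Inj σ → ∀ {i j} → i ≢ j →
                  odd (σ ∘ PC.transpose i j) ≡ not (odd σ)
  odd-transpose σ inj {zero}  {zero}  i≢j = contradiction refl i≢j
  odd-transpose σ inj {zero}  {suc j} i≢j = odd-transpose₀ σ inj j
  odd-transpose σ inj {suc i} {zero}  i≢j = trans
    (odd-cong (λ k → cong σ (transpose-comm (suc i) zero k)))
    (odd-transpose₀ σ inj i)
  odd-transpose σ inj {suc i} {suc j} i≢j =
    odd-suc σ i j (odd-transpose (σ ∘ suc) (∘-inj inj Fin.suc-injective) (i≢j ∘ cong suc))

  sum-false : ∀ {n} (f : Fin n → Bool) → (∀ i → f i ≡ false) → sum f ≡ false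
  sum-false {zero}  f eq = refl
  sum-false {suc n} f eq rewrite eq zero = sum-false (f ∘ suc) (eq ∘ suc)

  -- Different sizes `m` and `n` keep the induction going: the tail of the identity is `suc`, which
  -- is increasing but no longer an identity.
  odd-increasing : ∀ {m n} (σ : Fin m → Fin n) →
                   (∀ i j → (j <ᶠ i) ≡ false → (σ j <ᶠ σ i) ≡ false) → odd σ ≡ false
  odd-increasing {zero}  σ mono = refl
  odd-increasing {suc m} σ mono = cong₂ _xor_
    (sum-false _ (λ l → mono zero (suc l) refl))
    (odd-increasing (σ ∘ suc) (λ i j → mono (suc i) (suc j)))

  odd-id : ∀ {n} (σ : Fin n → Fin n) → (∀ i → σ i ≡ i) → odd σ ≡ false
  odd-id {n} σ eq = trans (odd-cong eq) (odd-increasing {n} {n} (λ i → i) (λ i j p → p))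

-- Sums over permutations in characteristic 2.

open import Algebra.Bundles using (CommutativeSemiring)

module Identity {c ℓ} (R : CommutativeSemiring c ℓ)
  (char2 : ∀ x → CommutativeSemiring._≈_ R (CommutativeSemiring._+_ R x x) (CommutativeSemiring.0# R)) where

  open CommutativeSemiring R hiding (zero)

  open import Algebra.Solver.Ring.AlmostCommutativeRing
    using (fromCommutativeSemiring; _-Raw-AlmostCommutative⟶_)
  open import Algebra.Bundles.Raw using (RawRing)
  import Algebra.Solver.Ring
  open import Level using (0ℓ)
  open import Data.Bool.Base using (Bool; true; false; _xor_; _∧_)
  import Data.Bool.Properties as Bool
  open import Data.Fin.Base using (Fin; zero; suc; finToFun; funToFin; combine)
  open import Data.Fin.Properties as Fin using (_≟_; all?; finToFun-funToFin; funToFin-finToFin)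
  open import Data.Fin.Permutation using (permutation; Permutation)
  import Data.Fin.Permutation.Components as PC
  open import Data.Maybe.Base using (Maybe; just; nothing)
  open import Data.Nat.Base as ℕ using (ℕ; _^_)
  open import Data.Product.Base using (∃; ∃-syntax)
  open import Data.Vec.Functional using (updateAt)
  open import Data.Vec.Functional.Properties using (updateAt-updates; updateAt-minimal)
  open import Function.Base using (_∘_; const)
  open import Relation.Binary.PropositionalEquality as ≡ using (_≡_; _≢_; _≗_)
  open import Relation.Nullary using (Dec; yes; no; does; contradiction)
  open import Relation.Nullary.Decidable using (_→-dec_; dec-true; dec-false)
  open Parity

  open import Algebra.Properties.Semiring.Sum semiring public
  open import Algebra.Properties.CommutativeMonoid.Sum *-commutativeMonoid
    using () renaming (sum to product; sum-cong-≋ to product-cong) public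
  open import Relation.Binary.Reasoning.Setoid setoid

  ⟦_⟧ : Bool → Carrier
  ⟦ true  ⟧ = 1#
  ⟦ false ⟧ = 0#

  ⟦xor⟧ : ∀ a b → ⟦ a xor b ⟧ ≈ ⟦ a ⟧ + ⟦ b ⟧
  ⟦xor⟧ true  true  = sym (char2 1#)
  ⟦xor⟧ true  false = sym (+-identityʳ 1#)
  ⟦xor⟧ false b     = sym (+-identityˡ ⟦ b ⟧)

  ⟦∧⟧ : ∀ a b → ⟦ a ∧ b ⟧ ≈ ⟦ a ⟧ * ⟦ b ⟧
  ⟦∧⟧ true  b = sym (*-identityˡ ⟦ b ⟧)
  ⟦∧⟧ false b = sym (zeroˡ ⟦ b ⟧)

  private
    -- Polynomials are normalised with coefficients in 𝔽₂, mapped into `R` by `⟦_⟧`; this is how the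
    -- solver learns that `x + x` vanishes.
    coefficients : RawRing 0ℓ 0ℓ
    coefficients = record
      { Carrier = Bool ; _≈_ = _≡_ ; _+_ = _xor_ ; _*_ = _∧_ ; -_ = λ b → b ; 0# = false ; 1# = true }

    homomorphism : coefficients -Raw-AlmostCommutative⟶ fromCommutativeSemiring R
    homomorphism = record
      { ⟦_⟧    = ⟦_⟧
      ; +-homo = ⟦xor⟧
      ; *-homo = ⟦∧⟧
      ; -‿homo = λ _ → refl
      ; 0-homo = refl
      ; 1-homo = refl
      }

    coeff≟ : ∀ a b → Maybe (⟦ a ⟧ ≈ ⟦ b ⟧)
    coeff≟ a b with a Bool.≟ b
    ... | yes eq = just (reflexive (≡.cong ⟦_⟧ eq))
    ... | no _   = nothing

  open Algebra.Solver.Ring coefficients (fromCommutativeSemiring R) homomorphism coeff≟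
    using (solve; _:=_; _:+_; _:*_; con) public

  -- Sums

  sum-zero : ∀ {n} {f : Fin n → Carrier} → (∀ i → f i ≈ 0#) → sum f ≈ 0#
  sum-zero {ℕ.zero}  f≈0 = refl
  sum-zero {ℕ.suc n} f≈0 = trans (+-cong (f≈0 zero) (sum-zero (f≈0 ∘ suc))) (+-identityˡ 0#)

  sum-single : ∀ {n} {f : Fin n → Carrier} i → (∀ j → j ≢ i → f j ≈ 0#) → sum f ≈ f i
  sum-single zero f≈0 =
    trans (+-congˡ (sum-zero (λ j → f≈0 (suc j) λ ()))) (+-identityʳ _)
  sum-single (suc i) f≈0 = trans
    (+-cong (f≈0 zero λ ()) (sum-single i λ j j≢i → f≈0 (suc j) (j≢i ∘ Fin.suc-injective)))
    (+-identityˡ _)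

  sum-pair : ∀ {n} {f : Fin n → Carrier} {i j} → i ≢ j →
             (∀ l → l ≢ i → l ≢ j → f l ≈ 0#) → sum f ≈ f i + f j
  sum-pair {i = zero}  {zero}  i≢j f≈0 = contradiction ≡.refl i≢j
  sum-pair {i = zero}  {suc j} i≢j f≈0 =
    +-congˡ (sum-single j λ l l≢j → f≈0 (suc l) (λ ()) (l≢j ∘ Fin.suc-injective))
  sum-pair {i = suc i} {zero}  i≢j f≈0 =
    trans (+-congˡ (sum-single i λ l l≢i → f≈0 (suc l) (l≢i ∘ Fin.suc-injective) (λ ())))
          (+-comm _ _)
  sum-pair {i = suc i} {suc j} i≢j f≈0 = trans
    (+-cong (f≈0 zero (λ ()) (λ ()))
            (sum-pair (i≢j ∘ ≡.cong suc) λ l l≢i l≢j →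
               f≈0 (suc l) (l≢i ∘ Fin.suc-injective) (l≢j ∘ Fin.suc-injective)))
    (+-identityˡ _)

  δ : ∀ {n} → Fin n → Fin n → Carrier
  δ i j = ⟦ does (i ≟ j) ⟧

  δ-refl : ∀ {n} (i : Fin n) → δ i i ≈ 1#
  δ-refl i = reflexive (≡.cong ⟦_⟧ (dec-true (i ≟ i) ≡.refl))

  δ-≢ : ∀ {n} {i j : Fin n} → i ≢ j → δ i j ≈ 0#
  δ-≢ {i = i} {j} i≢j = reflexive (≡.cong ⟦_⟧ (dec-false (i ≟ j) i≢j))

  sum-δʳ : ∀ {n} (s : Fin n → Carrier) a → sum (λ v → s v * δ v a) ≈ s a
  sum-δʳ s a = trans
    (sum-single a λ v v≢a → trans (*-congˡ (δ-≢ v≢a)) (zeroʳ (s v)))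
    (trans (*-congˡ (δ-refl a)) (*-identityʳ (s a)))

  sum-δˡ : ∀ {n} (s : Fin n → Carrier) a → sum (λ v → s v * δ a v) ≈ s a
  sum-δˡ s a = trans
    (sum-single a λ v v≢a → trans (*-congˡ (δ-≢ (v≢a ∘ ≡.sym))) (zeroʳ (s v)))
    (trans (*-congˡ (δ-refl a)) (*-identityʳ (s a)))

  sum-assoc : ∀ {m n} (x : Fin m → Carrier) (y : Fin m → Fin n → Carrier) (z : Fin n → Carrier) →
              sum (λ s → x s * sum (λ t → y s t * z t)) ≈ sum (λ t → sum (λ s → x s * y s t) * z t)
  sum-assoc x y z = begin
    sum (λ s → x s * sum (λ t → y s t * z t))
      ≈⟨ sum-cong-≋ (λ s → *-distribˡ-sum (x s) (λ t → y s t * z t)) ⟩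
    sum (λ s → sum (λ t → x s * (y s t * z t)))
      ≈⟨ ∑-comm (λ s t → x s * (y s t * z t)) ⟩
    sum (λ t → sum (λ s → x s * (y s t * z t)))
      ≈⟨ sum-cong-≋ (λ t → sum-cong-≋ (λ s → sym (*-assoc (x s) (y s t) (z t)))) ⟩
    sum (λ t → sum (λ s → x s * y s t * z t))
      ≈⟨ sum-cong-≋ (λ t → sym (*-distribʳ-sum (z t) (λ s → x s * y s t))) ⟩
    sum (λ t → sum (λ s → x s * y s t) * z t) ∎

  -- Multiply by the left inverse `Q`. In `gradient` it removes a factor on either side of a matrix,
  -- once with `P = M` and once with the transpose.
  cancel : ∀ {n} {P Q : Fin n → Fin n → Carrier} →
           (∀ p t → sum (λ u → Q p u * P u t) ≈ δ p t) →
           ∀ {x} → (∀ u → sum (λ s → P u s * x s) ≈ 0#) → ∀ p → x p ≈ 0#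
  cancel {P = P} {Q} QP {x} Px≈0 p = begin
    x p                                               ≈⟨ sum-δˡ x p ⟨
    sum (λ t → x t * δ p t)                           ≈⟨ sum-cong-≋ (λ t → *-comm (x t) (δ p t)) ⟩
    sum (λ t → δ p t * x t)                           ≈⟨ sum-cong-≋ (λ t → *-congʳ (QP p t)) ⟨
    sum (λ t → sum (λ u → Q p u * P u t) * x t)       ≈⟨ sum-assoc (Q p) P x ⟨
    sum (λ u → Q p u * sum (λ t → P u t * x t))
      ≈⟨ sum-zero (λ u → trans (*-congˡ (Px≈0 u)) (zeroʳ (Q p u))) ⟩
    0#                                                ∎

  -- Below the diagonal the summand of the double sum repeats the one above it.
  sum-off-diagonal : ∀ {n} (x z : Fin n → Carrier) →
    sum (λ a → sum (λ b → ⟦ a <ᶠ b ⟧ * (x a * z b + x b * z a)))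
      ≈ sum x * sum z + sum (λ a → x a * z a)
  sum-off-diagonal x z = begin
    sum (λ a → sum (λ b → ⟦ a <ᶠ b ⟧ * (x a * z b + x b * z a)))
      ≈⟨ sum-cong-≋ (λ a → sum-cong-≋ (λ b → distribˡ ⟦ a <ᶠ b ⟧ (x a * z b) (x b * z a))) ⟩
    sum (λ a → sum (λ b → ⟦ a <ᶠ b ⟧ * (x a * z b) + ⟦ a <ᶠ b ⟧ * (x b * z a)))
      ≈⟨ sum-cong-≋ (λ a → ∑-distrib-+ (λ b → ⟦ a <ᶠ b ⟧ * (x a * z b)) (λ b → ⟦ a <ᶠ b ⟧ * (x b * z a))) ⟩
    sum (λ a → sum (λ b → ⟦ a <ᶠ b ⟧ * (x a * z b)) + sum (λ b → ⟦ a <ᶠ b ⟧ * (x b * z a)))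
      ≈⟨ ∑-distrib-+ (λ a → sum (λ b → ⟦ a <ᶠ b ⟧ * (x a * z b))) (λ a → sum (λ b → ⟦ a <ᶠ b ⟧ * (x b * z a))) ⟩
    sum (λ a → sum (λ b → ⟦ a <ᶠ b ⟧ * (x a * z b))) + sum (λ a → sum (λ b → ⟦ a <ᶠ b ⟧ * (x b * z a)))
      ≈⟨ +-congˡ (∑-comm (λ a b → ⟦ a <ᶠ b ⟧ * (x b * z a))) ⟩
    sum (λ a → sum (λ b → ⟦ a <ᶠ b ⟧ * (x a * z b))) + sum (λ a → sum (λ b → ⟦ b <ᶠ a ⟧ * (x a * z b)))
      ≈⟨ ∑-distrib-+ (λ a → sum (λ b → ⟦ a <ᶠ b ⟧ * (x a * z b))) (λ a → sum (λ b → ⟦ b <ᶠ a ⟧ * (x a * z b))) ⟨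
    sum (λ a → sum (λ b → ⟦ a <ᶠ b ⟧ * (x a * z b)) + sum (λ b → ⟦ b <ᶠ a ⟧ * (x a * z b)))
      ≈⟨ sum-cong-≋ (λ a → ∑-distrib-+ (λ b → ⟦ a <ᶠ b ⟧ * (x a * z b)) (λ b → ⟦ b <ᶠ a ⟧ * (x a * z b))) ⟨
    sum (λ a → sum (λ b → ⟦ a <ᶠ b ⟧ * (x a * z b) + ⟦ b <ᶠ a ⟧ * (x a * z b)))
      ≈⟨ sum-cong-≋ (λ a → sum-cong-≋ (entry a)) ⟩
    sum (λ a → sum (λ b → x a * z b + x a * z b * δ a b))
      ≈⟨ sum-cong-≋ (λ a → ∑-distrib-+ (λ b → x a * z b) (λ b → x a * z b * δ a b)) ⟩
    sum (λ a → sum (λ b → x a * z b) + sum (λ b → x a * z b * δ a b))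
      ≈⟨ sum-cong-≋ (λ a → +-cong (sym (*-distribˡ-sum (x a) z)) (sum-δˡ (λ b → x a * z b) a)) ⟩
    sum (λ a → x a * sum z + x a * z a)
      ≈⟨ ∑-distrib-+ (λ a → x a * sum z) (λ a → x a * z a) ⟩
    sum (λ a → x a * sum z) + sum (λ a → x a * z a)
      ≈⟨ +-congʳ (*-distribʳ-sum (sum z) x) ⟨
    sum x * sum z + sum (λ a → x a * z a) ∎
    where
    entry : ∀ a b → ⟦ a <ᶠ b ⟧ * (x a * z b) + ⟦ b <ᶠ a ⟧ * (x a * z b) ≈ x a * z b + x a * z b * δ a b
    entry a b with a ≟ b
    ... | yes ≡.refl rewrite <ᶠ-irrefl a =
      solve 1 (λ p → con false :* p :+ con false :* p := p :+ p :* con true) refl (x a * z a)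
    ... | no a≢b rewrite <ᶠ-flip a≢b with b <ᶠ a
    ...   | true  = solve 1 (λ p → con false :* p :+ con true :* p := p :+ p :* con false) refl (x a * z b)
    ...   | false = solve 1 (λ p → con true :* p :+ con false :* p := p :+ p :* con false) refl (x a * z b)

  -- The Frobenius map is additive: for `z = x` the mixed products in `sum-off-diagonal` occur twice
  -- and cancel.
  sum-square : ∀ {n} (x : Fin n → Carrier) → sum (λ a → x a * x a) ≈ sum x * sum x
  sum-square x = begin
    sum (λ a → x a * x a)
      ≈⟨ solve 2 (λ p q → q := p :* p :+ (p :* p :+ q)) refl (sum x) (sum (λ a → x a * x a)) ⟩
    sum x * sum x + (sum x * sum x + sum (λ a → x a * x a))
      ≈⟨ +-congˡ (sum-off-diagonal x x) ⟨
    sum x * sum x + sum (λ a → sum (λ b → ⟦ a <ᶠ b ⟧ * (x a * x b + x b * x a)))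
      ≈⟨ +-congˡ (sum-zero (λ a → sum-zero (λ b →
           solve 3 (λ l p q → l :* (p :* q :+ q :* p) := con false) refl ⟦ a <ᶠ b ⟧ (x a) (x b)))) ⟩
    sum x * sum x + 0#  ≈⟨ +-identityʳ _ ⟩
    sum x * sum x       ∎

  -- Sums over all functions

  injective? : ∀ {n} (σ : Fin n → Fin n) → _
  injective? σ = all? λ i → all? λ j → (σ i ≟ σ j) →-dec (i ≟ j)

  injᵇ : ∀ {n} → (Fin n → Fin n) → Bool
  injᵇ σ = does (injective? σ)

  does-sound : ∀ {p} {P : Set p} (P? : Dec P) → does P? ≡ true → P
  does-sound (yes p) _ = p

  injᵇ-sound : ∀ {n} (σ : Fin n → Fin n) → injᵇ σ ≡ true → Inj σ
  injᵇ-sound σ eq {i} {j} = does-sound (injective? σ) eq i j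

  injᵇ-complete : ∀ {n} (σ : Fin n → Fin n) → Inj σ → injᵇ σ ≡ true
  injᵇ-complete σ inj = dec-true (injective? σ) (λ i j → inj)

  bool-ext : ∀ {a b} → (a ≡ true → b ≡ true) → (b ≡ true → a ≡ true) → a ≡ b
  bool-ext {true}  {b}     f g = ≡.sym (f ≡.refl)
  bool-ext {false} {true}  f g = g ≡.refl
  bool-ext {false} {false} f g = ≡.refl

  injᵇ-cong : ∀ {n} {σ τ : Fin n → Fin n} → σ ≗ τ → injᵇ σ ≡ injᵇ τ
  injᵇ-cong {σ = σ} {τ} eq = bool-ext
    (λ p → injᵇ-complete τ λ {i} {j} q →
       injᵇ-sound σ p (≡.trans (eq i) (≡.trans q (≡.sym (eq j)))))
    (λ p → injᵇ-complete σ λ {i} {j} q →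
       injᵇ-sound τ p (≡.trans (≡.sym (eq i)) (≡.trans q (eq j))))

  injᵇ-transpose : ∀ {n} (σ : Fin n → Fin n) i j → injᵇ (σ ∘ PC.transpose i j) ≡ injᵇ σ
  injᵇ-transpose σ i j = bool-ext
    (λ p → injᵇ-complete σ (λ {k} {l} q →
       transpose-injective i j (injᵇ-sound _ p
         (≡.trans (≡.cong σ (transpose-involutive i j k))
           (≡.trans q (≡.cong σ (≡.sym (transpose-involutive i j l))))))))
    (λ p → injᵇ-complete _ (∘-inj {σ = σ} (injᵇ-sound σ p) (transpose-injective i j)))

  -- All maps are summed over, coded as numbers below `n ^ n`, and permutations are singled out by a
  -- Boolean weight. Reindexing then takes a bijection of the codes, never an enumeration of the
  -- permutations.
  Σᶠ : ∀ {n} → ((Fin n → Fin n) → Carrier) → Carrier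
  Σᶠ {n} g = sum {n ^ n} (λ k → g (finToFun k))

  Σᶠ-cong : ∀ {n} {g h : (Fin n → Fin n) → Carrier} → (∀ σ → g σ ≈ h σ) → Σᶠ g ≈ Σᶠ h
  Σᶠ-cong {n} eq = sum-cong-≋ {n ^ n} (λ k → eq (finToFun k))

  Σᶠ-+ : ∀ {n} (g h : (Fin n → Fin n) → Carrier) → Σᶠ (λ σ → g σ + h σ) ≈ Σᶠ g + Σᶠ h
  Σᶠ-+ {n} g h = ∑-distrib-+ {n ^ n} (λ k → g (finToFun k)) (λ k → h (finToFun k))

  Σᶠ-* : ∀ {n} x (g : (Fin n → Fin n) → Carrier) → x * Σᶠ g ≈ Σᶠ (λ σ → x * g σ)
  Σᶠ-* {n} x g = *-distribˡ-sum {n ^ n} x (λ k → g (finToFun k))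

  Σᶠ-sum : ∀ {m n} (g : Fin m → (Fin n → Fin n) → Carrier) →
           sum (λ l → Σᶠ (g l)) ≈ Σᶠ (λ σ → sum (λ l → g l σ))
  Σᶠ-sum {m} {n} g = ∑-comm {m} {n ^ n} (λ l k → g l (finToFun k))

  funToFin-cong : ∀ {m n} {f g : Fin m → Fin n} → f ≗ g → funToFin f ≡ funToFin g
  funToFin-cong {ℕ.zero}  eq = ≡.refl
  funToFin-cong {ℕ.suc m} eq = ≡.cong₂ combine (eq zero) (funToFin-cong (eq ∘ suc))

  -- Encoding and decoding a map returns it only up to pointwise equality, so reindexing needs
  -- summands that do not see the difference.
  Respectful : ∀ {n} → ((Fin n → Fin n) → Carrier) → Set ℓ
  Respectful g = ∀ {σ τ} → σ ≗ τ → g σ ≈ g τ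

  Σᶠ-transpose : ∀ {n} {g : (Fin n → Fin n) → Carrier} → Respectful g → ∀ i j →
                 Σᶠ g ≈ Σᶠ (λ σ → g (σ ∘ PC.transpose i j))
  Σᶠ-transpose {n} {g} resp i j = trans
    (sum-permute (λ k → g (finToFun k)) π)
    (Σᶠ-cong (λ σ → resp (finToFun-funToFin (σ ∘ PC.transpose i j))))
    where
    to : Fin (n ^ n) → Fin (n ^ n)
    to k = funToFin (finToFun k ∘ PC.transpose i j)
    to-involutive : ∀ k → to (to k) ≡ k
    to-involutive k = ≡.trans
      (funToFin-cong (λ l → ≡.trans
        (finToFun-funToFin (finToFun k ∘ PC.transpose i j) (PC.transpose i j l))
        (≡.cong (finToFun k) (transpose-involutive i j l))))
      (funToFin-finToFin {n} {n} k)
    π : Permutation (n ^ n) (n ^ n)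
    π = permutation to to to-involutive to-involutive

  Σᶠ-single : ∀ {n} {g : (Fin n → Fin n) → Carrier} → Respectful g → ∀ σ →
              (∀ τ → (∃[ i ] τ i ≢ σ i) → g τ ≈ 0#) → Σᶠ g ≈ g σ
  Σᶠ-single {n} {g} resp σ g≈0 = trans
    (sum-single (funToFin σ) λ k k≢σ →
       g≈0 (finToFun k) (different k k≢σ))
    (resp (finToFun-funToFin σ))
    where
    different : ∀ k → k ≢ funToFin σ → ∃[ i ] finToFun {n} {n} k i ≢ σ i
    different k k≢σ = Fin.¬∀⟶∃¬ n _ (λ i → finToFun {n} {n} k i ≟ σ i) λ eq →
      k≢σ (≡.trans (≡.sym (funToFin-finToFin {n} {n} k)) (funToFin-cong eq))

  Mat : ℕ → Set c
  Mat n = Fin n → Fin n → Carrier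

  prod : ∀ {n} → Mat n → (Fin n → Fin n) → Carrier
  prod M σ = product (λ l → M l (σ l))

  infixl 8 _[_]≔_

  _[_]≔_ : ∀ {n} → Mat n → Fin n → (Fin n → Carrier) → Mat n
  M [ i ]≔ s = updateAt M i (const s)

  same : ∀ {n} (M : Mat n) i {s} a → (M [ i ]≔ s) i a ≈ s a
  same M i a = reflexive (≡.cong (λ r → r a) (updateAt-updates i M))

  other : ∀ {n} (M : Mat n) {i l s} → l ≢ i → ∀ a → (M [ i ]≔ s) l a ≈ M l a
  other M {i} {l} l≢i a = reflexive (≡.cong (λ r → r a) (updateAt-minimal l i M l≢i))

  ones : ∀ {n} → Fin n → Carrier
  ones _ = 1#

  product-split : ∀ {n} {f g : Fin n → Carrier} i →
                  (∀ l → l ≢ i → f l ≈ g l) → g i ≈ 1# → product f ≈ f i * product g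
  product-split zero eq g≈1 =
    *-congˡ (trans (product-cong (λ l → eq (suc l) λ ()))
                   (sym (trans (*-congʳ g≈1) (*-identityˡ _))))
  product-split {f = f} {g} (suc i) eq g≈1 = begin
    f zero * product (f ∘ suc)
      ≈⟨ *-cong (eq zero λ ()) (product-split i (λ l l≢i → eq (suc l) (l≢i ∘ Fin.suc-injective)) g≈1) ⟩
    g zero * (f (suc i) * product (g ∘ suc))
      ≈⟨ solve 3 (λ x y z → x :* (y :* z) := y :* (x :* z)) refl (g zero) (f (suc i)) (product (g ∘ suc)) ⟩
    f (suc i) * product g ∎

  prod-row : ∀ {n} (M : Mat n) i s σ → prod (M [ i ]≔ s) σ ≈ s (σ i) * prod (M [ i ]≔ ones) σ
  prod-row M i s σ = trans
    (product-split i (λ l l≢i → trans (other M l≢i (σ l)) (sym (other M l≢i (σ l))))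
                     (same M i (σ i)))
    (*-congʳ (same M i (σ i)))

  -- The contribution of the rows other than `i` and `j`. Filling these two with ones, instead of
  -- deleting them, keeps the index set `Fin n`.
  rest : ∀ {n} → Mat n → Fin n → Fin n → (Fin n → Fin n) → Carrier
  rest M i j = prod (M [ i ]≔ ones [ j ]≔ ones)

  prod-rows : ∀ {n} (M : Mat n) {i j} → i ≢ j → ∀ s r σ →
              prod (M [ i ]≔ s [ j ]≔ r) σ ≈ s (σ i) * r (σ j) * rest M i j σ
  prod-rows M {i} {j} i≢j s r σ = begin
    prod (M [ i ]≔ s [ j ]≔ r) σ                      ≈⟨ prod-row (M [ i ]≔ s) j r σ ⟩
    r (σ j) * prod (M [ i ]≔ s [ j ]≔ ones) σ         ≈⟨ *-congˡ split ⟩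
    r (σ j) * (s (σ i) * rest M i j σ)
      ≈⟨ solve 3 (λ x y z → x :* (y :* z) := y :* x :* z) refl (r (σ j)) (s (σ i)) (rest M i j σ) ⟩
    s (σ i) * r (σ j) * rest M i j σ                  ∎
    where
    row : ∀ s′ l → l ≢ i → (M [ i ]≔ s′ [ j ]≔ ones) l (σ l) ≈ (M [ i ]≔ ones [ j ]≔ ones) l (σ l)
    row s′ l l≢i with l ≟ j
    ... | yes ≡.refl = trans (same (M [ i ]≔ s′) j (σ j)) (sym (same (M [ i ]≔ ones) j (σ j)))
    ... | no l≢j = trans
      (trans (other (M [ i ]≔ s′) l≢j (σ l)) (other M l≢i (σ l)))
      (sym (trans (other (M [ i ]≔ ones) l≢j (σ l)) (other M l≢i (σ l))))
    at : ∀ s′ → (M [ i ]≔ s′ [ j ]≔ ones) i (σ i) ≈ s′ (σ i)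
    at s′ = trans (other (M [ i ]≔ s′) i≢j (σ i)) (same M i (σ i))
    split : prod (M [ i ]≔ s [ j ]≔ ones) σ ≈ s (σ i) * rest M i j σ
    split = trans (product-split i (row s) (at ones)) (*-congʳ (at s))

  prod-cong : ∀ {n} (M M′ : Mat n) σ τ → (∀ l → M l (σ l) ≈ M′ l (τ l)) → prod M σ ≈ prod M′ τ
  prod-cong M M′ σ τ eq = product-cong eq

  rest-transpose : ∀ {n} (M : Mat n) {i j} → i ≢ j → ∀ σ →
                   rest M i j (σ ∘ PC.transpose i j) ≈ rest M i j σ
  rest-transpose M {i} {j} i≢j σ = prod-cong (M₁ [ j ]≔ ones) (M₁ [ j ]≔ ones) (σ ∘ PC.transpose i j) σ entry
    where
    M₁ = M [ i ]≔ ones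
    one-i : ∀ a → (M₁ [ j ]≔ ones) i a ≈ 1#
    one-i a = trans (other M₁ i≢j a) (same M i a)
    entry : ∀ l → (M₁ [ j ]≔ ones) l (σ (PC.transpose i j l)) ≈ (M₁ [ j ]≔ ones) l (σ l)
    entry l with l ≟ i
    ... | yes ≡.refl = trans (one-i _) (sym (one-i _))
    ... | no l≢i with l ≟ j
    ...   | yes ≡.refl = trans (same M₁ j _) (sym (same M₁ j _))
    ...   | no _ = refl

  -- Determinants

  -- No signs appear because 1 = -1: for the indicator of the injective maps this is the determinant
  -- and the permanent at once. The weight `f` is left open so that the odd part shares the basic
  -- properties.
  D : ∀ {n} → ((Fin n → Fin n) → Bool) → Mat n → Carrier
  D f M = Σᶠ (λ σ → ⟦ f σ ⟧ * prod M σ)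

  D-cong : ∀ {n} f {M M′ : Mat n} → (∀ i a → M i a ≈ M′ i a) → D f M ≈ D f M′
  D-cong f {M} {M′} eq = Σᶠ-cong
    {g = λ σ → ⟦ f σ ⟧ * prod M σ} {h = λ σ → ⟦ f σ ⟧ * prod M′ σ}
    (λ σ → *-congˡ (prod-cong M M′ σ σ (λ l → eq l (σ l))))

  -- Every summand contains exactly one entry of row `i`, whatever the weight is; hence `d` and `h`
  -- are linear in each row alike.
  D-linear : ∀ {m n} f (M : Mat n) i (c : Fin m → Carrier) (S : Fin m → Fin n → Carrier) →
             D f (M [ i ]≔ (λ a → sum (λ l → c l * S l a))) ≈ sum (λ l → c l * D f (M [ i ]≔ S l))
  D-linear {m} {n} f M i c S = begin
    D f (M [ i ]≔ (λ a → sum (λ l → c l * S l a)))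
      ≈⟨ Σᶠ-cong (λ σ → *-congˡ {⟦ f σ ⟧} (prod-row M i (λ a → sum (λ l → c l * S l a)) σ)) ⟩
    Σᶠ (λ σ → ⟦ f σ ⟧ * (sum (λ l → c l * S l (σ i)) * P σ))
      ≈⟨ Σᶠ-cong term ⟩
    Σᶠ (λ σ → sum (λ l → c l * (⟦ f σ ⟧ * (S l (σ i) * P σ))))
      ≈⟨ Σᶠ-sum (λ l σ → c l * (⟦ f σ ⟧ * (S l (σ i) * P σ))) ⟨
    sum (λ l → Σᶠ (λ σ → c l * (⟦ f σ ⟧ * (S l (σ i) * P σ))))
      ≈⟨ sum-cong-≋ (λ l → Σᶠ-* (c l) (λ σ → ⟦ f σ ⟧ * (S l (σ i) * P σ))) ⟨
    sum (λ l → c l * Σᶠ (λ σ → ⟦ f σ ⟧ * (S l (σ i) * P σ)))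
      ≈⟨ sum-cong-≋ (λ l → *-congˡ (Σᶠ-cong (λ σ → *-congˡ {⟦ f σ ⟧} (prod-row M i (S l) σ)))) ⟨
    sum (λ l → c l * D f (M [ i ]≔ S l)) ∎
    where
    P = prod (M [ i ]≔ ones)
    term : ∀ σ → ⟦ f σ ⟧ * (sum (λ l → c l * S l (σ i)) * P σ) ≈ sum (λ l → c l * (⟦ f σ ⟧ * (S l (σ i) * P σ)))
    term σ = begin
      ⟦ f σ ⟧ * (sum (λ l → c l * S l (σ i)) * P σ)
        ≈⟨ solve 3 (λ x y z → x :* (y :* z) := x :* z :* y) refl ⟦ f σ ⟧ (sum (λ l → c l * S l (σ i))) (P σ) ⟩
      ⟦ f σ ⟧ * P σ * sum (λ l → c l * S l (σ i))
        ≈⟨ *-distribˡ-sum (⟦ f σ ⟧ * P σ) (λ l → c l * S l (σ i)) ⟩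
      sum (λ l → ⟦ f σ ⟧ * P σ * (c l * S l (σ i)))
        ≈⟨ sum-cong-≋ (λ l → solve 4 (λ x p y s → x :* p :* (y :* s) := y :* (x :* (s :* p))) refl
             ⟦ f σ ⟧ (P σ) (c l) (S l (σ i))) ⟩
      sum (λ l → c l * (⟦ f σ ⟧ * (S l (σ i) * P σ))) ∎

  Preserved : ∀ {n} → ((Fin n → Fin n) → Bool) → Set
  Preserved f = ∀ {σ τ} → σ ≗ τ → f σ ≡ f τ

  -- Pairing σ with σ ∘ (i j) folds the sum onto the σ with σ i < σ j.
  fold-transpose : ∀ {n} {f : (Fin n → Fin n) → Bool} {u} {i j} → i ≢ j → Preserved f →
    (∀ σ → f σ ≡ true → Inj σ) → Respectful u → (∀ σ → u (σ ∘ PC.transpose i j) ≈ u σ) →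
    Σᶠ (λ σ → ⟦ f σ ⟧ * u σ)
      ≈ Σᶠ (λ σ → ⟦ (f σ xor f (σ ∘ PC.transpose i j)) ∧ (σ i <ᶠ σ j) ⟧ * u σ)
  fold-transpose {n} {f} {u} {i} {j} i≢j f-resp f-inj u-resp u-sym = begin
    Σᶠ (λ σ → ⟦ f σ ⟧ * u σ)
      ≈⟨ Σᶠ-cong split ⟩
    Σᶠ (λ σ → ⟦ f σ ∧ (σ i <ᶠ σ j) ⟧ * u σ + ⟦ f σ ∧ (σ j <ᶠ σ i) ⟧ * u σ)
      ≈⟨ Σᶠ-+ (λ σ → ⟦ f σ ∧ (σ i <ᶠ σ j) ⟧ * u σ)
                             (λ σ → ⟦ f σ ∧ (σ j <ᶠ σ i) ⟧ * u σ) ⟩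
    Σᶠ (λ σ → ⟦ f σ ∧ (σ i <ᶠ σ j) ⟧ * u σ) + Σᶠ (λ σ → ⟦ f σ ∧ (σ j <ᶠ σ i) ⟧ * u σ)
      ≈⟨ +-congˡ (Σᶠ-transpose {g = λ σ → ⟦ f σ ∧ (σ j <ᶠ σ i) ⟧ * u σ} resp i j) ⟩
    Σᶠ (λ σ → ⟦ f σ ∧ (σ i <ᶠ σ j) ⟧ * u σ)
      + Σᶠ (λ σ → ⟦ f (σ ∘ t) ∧ (σ (t j) <ᶠ σ (t i)) ⟧ * u (σ ∘ t))
      ≈⟨ Σᶠ-+ (λ σ → ⟦ f σ ∧ (σ i <ᶠ σ j) ⟧ * u σ)
           (λ σ → ⟦ f (σ ∘ t) ∧ (σ (t j) <ᶠ σ (t i)) ⟧ * u (σ ∘ t)) ⟨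
    Σᶠ (λ σ → ⟦ f σ ∧ (σ i <ᶠ σ j) ⟧ * u σ + ⟦ f (σ ∘ t) ∧ (σ (t j) <ᶠ σ (t i)) ⟧ * u (σ ∘ t))
      ≈⟨ Σᶠ-cong merge ⟩
    Σᶠ (λ σ → ⟦ (f σ xor f (σ ∘ t)) ∧ (σ i <ᶠ σ j) ⟧ * u σ) ∎
    where
    t = PC.transpose i j
    resp : Respectful (λ σ → ⟦ f σ ∧ (σ j <ᶠ σ i) ⟧ * u σ)
    resp eq = *-cong (reflexive (≡.cong ⟦_⟧ (≡.cong₂ _∧_ (f-resp eq) (≡.cong₂ _<ᶠ_ (eq j) (eq i)))))
                     (u-resp eq)
    split : ∀ σ → ⟦ f σ ⟧ * u σ ≈ ⟦ f σ ∧ (σ i <ᶠ σ j) ⟧ * u σ + ⟦ f σ ∧ (σ j <ᶠ σ i) ⟧ * u σ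
    split σ with f σ | f-inj σ
    ... | false | _ = solve 1 (λ x → con false :* x := con false :* x :+ con false :* x) refl (u σ)
    ... | true  | inj rewrite <ᶠ-flip (λ eq → i≢j (inj ≡.refl eq)) with σ j <ᶠ σ i
    ...   | true  = solve 1 (λ x → con true :* x := con false :* x :+ con true :* x) refl (u σ)
    ...   | false = solve 1 (λ x → con true :* x := con true :* x :+ con false :* x) refl (u σ)
    merge : ∀ σ → ⟦ f σ ∧ (σ i <ᶠ σ j) ⟧ * u σ + ⟦ f (σ ∘ t) ∧ (σ (t j) <ᶠ σ (t i)) ⟧ * u (σ ∘ t)
                  ≈ ⟦ (f σ xor f (σ ∘ t)) ∧ (σ i <ᶠ σ j) ⟧ * u σ
    merge σ rewrite transpose-ˡ i j | transpose-ʳ i j = begin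
      ⟦ a ∧ l ⟧ * u σ + ⟦ b ∧ l ⟧ * u (σ ∘ t)
        ≈⟨ +-cong (*-congʳ (⟦∧⟧ a l)) (*-cong (⟦∧⟧ b l) (u-sym σ)) ⟩
      ⟦ a ⟧ * ⟦ l ⟧ * u σ + ⟦ b ⟧ * ⟦ l ⟧ * u σ
        ≈⟨ solve 4 (λ a b l u → a :* l :* u :+ b :* l :* u := (a :+ b) :* l :* u) refl ⟦ a ⟧ ⟦ b ⟧ ⟦ l ⟧ (u σ) ⟩
      (⟦ a ⟧ + ⟦ b ⟧) * ⟦ l ⟧ * u σ
        ≈⟨ *-congʳ (trans (⟦∧⟧ (a xor b) l) (*-congʳ (⟦xor⟧ a b))) ⟨
      ⟦ (a xor b) ∧ l ⟧ * u σ ∎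
      where
      a = f σ
      b = f (σ ∘ t)
      l = σ i <ᶠ σ j

  oddᵇ : ∀ {n} → (Fin n → Fin n) → Bool
  oddᵇ σ = injᵇ σ ∧ odd σ

  -- Unlike `d`, `h` is linear in the rows without being alternating: its values on matrices with
  -- two equal rows are nonzero in general, and they carry the information about odd permutations.
  d h : ∀ {n} → Mat n → Carrier
  d = D injᵇ
  h = D oddᵇ

  oddᵇ-cong : ∀ {n} → Preserved (oddᵇ {n})
  oddᵇ-cong eq = ≡.cong₂ _∧_ (injᵇ-cong eq) (odd-cong eq)

  oddᵇ-inj : ∀ {n} (σ : Fin n → Fin n) → oddᵇ σ ≡ true → Inj σ
  oddᵇ-inj σ eq with injᵇ σ in p
  ... | true = injᵇ-sound σ p

  -- Matrices with two equal rows.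

  module _ {n} (M : Mat n) {i j : Fin n} (i≢j : i ≢ j) where

    form : (Fin n → Fin n → Carrier) → (Fin n → Fin n) → Carrier
    form q σ = q (σ i) (σ j) * rest M i j σ

    form-resp : ∀ q → Respectful (form q)
    form-resp q {σ} {τ} eq = *-cong
      (reflexive (≡.cong₂ q (eq i) (eq j)))
      (prod-cong (M [ i ]≔ ones [ j ]≔ ones) (M [ i ]≔ ones [ j ]≔ ones) σ τ
        (λ l → reflexive (≡.cong ((M [ i ]≔ ones [ j ]≔ ones) l) (eq l))))

    form-transpose : ∀ q σ → form q (σ ∘ PC.transpose i j) ≈ form (λ a b → q b a) σ
    form-transpose q σ = *-cong
      (reflexive (≡.cong₂ q (≡.cong σ (transpose-ˡ i j)) (≡.cong σ (transpose-ʳ i j))))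
      (rest-transpose M i≢j σ)

    D-form : ∀ f s r → D f (M [ i ]≔ s [ j ]≔ r) ≈ Σᶠ (λ σ → ⟦ f σ ⟧ * form (λ a b → s a * r b) σ)
    D-form f s r = Σᶠ-cong (λ σ → *-congˡ {⟦ f σ ⟧} (prod-rows M i≢j s r σ))

    symmetric : ∀ (r : Fin n → Carrier) σ → form (λ a b → r a * r b) (σ ∘ PC.transpose i j) ≈ form (λ a b → r a * r b) σ
    symmetric r σ = trans (form-transpose (λ a b → r a * r b) σ) (*-congʳ (*-comm (r (σ j)) (r (σ i))))

    -- Composition with the transposition preserves injectivity, so the two weights that
    -- `fold-transpose` adds are equal and cancel.
    d-alternating : ∀ r → d (M [ i ]≔ r [ j ]≔ r) ≈ 0#
    d-alternating r = begin
      d (M [ i ]≔ r [ j ]≔ r)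
        ≈⟨ D-form injᵇ r r ⟩
      Σᶠ (λ σ → ⟦ injᵇ σ ⟧ * form (λ a b → r a * r b) σ)
        ≈⟨ fold-transpose i≢j injᵇ-cong injᵇ-sound (form-resp (λ a b → r a * r b)) (symmetric r) ⟩
      Σᶠ (λ σ → ⟦ (injᵇ σ xor injᵇ (σ ∘ PC.transpose i j)) ∧ (σ i <ᶠ σ j) ⟧ * form (λ a b → r a * r b) σ)
        ≈⟨ sum-zero {n ^ n} (λ k → vanish (finToFun k)) ⟩
      0# ∎
      where
      vanish : ∀ σ → ⟦ (injᵇ σ xor injᵇ (σ ∘ PC.transpose i j)) ∧ (σ i <ᶠ σ j) ⟧ * form (λ a b → r a * r b) σ ≈ 0#
      vanish σ rewrite injᵇ-transpose σ i j | Bool.xor-same (injᵇ σ) = zeroˡ _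

    d-swap : ∀ s r → d (M [ i ]≔ s [ j ]≔ r) ≈ d (M [ i ]≔ r [ j ]≔ s)
    d-swap s r = begin
      d (M [ i ]≔ s [ j ]≔ r)
        ≈⟨ D-form injᵇ s r ⟩
      Σᶠ (λ σ → ⟦ injᵇ σ ⟧ * form (λ a b → s a * r b) σ)
        ≈⟨ Σᶠ-transpose (λ eq → *-cong (reflexive (≡.cong ⟦_⟧ (injᵇ-cong eq))) (form-resp (λ a b → s a * r b) eq)) i j ⟩
      Σᶠ (λ σ → ⟦ injᵇ (σ ∘ PC.transpose i j) ⟧ * form (λ a b → s a * r b) (σ ∘ PC.transpose i j))
        ≈⟨ Σᶠ-cong (λ σ → *-cong
             (reflexive (≡.cong ⟦_⟧ (injᵇ-transpose σ i j)))
             (trans (form-transpose (λ a b → s a * r b) σ) (*-congʳ (*-comm (s (σ j)) (r (σ i)))))) ⟩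
      Σᶠ (λ σ → ⟦ injᵇ σ ⟧ * form (λ a b → r a * s b) σ)
        ≈⟨ D-form injᵇ r s ⟨
      d (M [ i ]≔ r [ j ]≔ s) ∎

    -- As a function of the two rows the sum is bilinear, hence determined by pairs of unit rows.
    -- This turns a weight that is not a product, such as an order comparison, into determinants.
    expand : ∀ q → Σᶠ (λ σ → ⟦ injᵇ σ ⟧ * form q σ)
                     ≈ sum (λ a → sum (λ b → q a b * d (M [ i ]≔ δ a [ j ]≔ δ b)))
    expand q = sym (begin
      sum (λ a → sum (λ b → q a b * d (M [ i ]≔ δ a [ j ]≔ δ b)))
        ≈⟨ sum-cong-≋ (λ a → sum-cong-≋ (λ b → trans
             (*-congˡ (D-form injᵇ (δ a) (δ b)))
             (Σᶠ-* (q a b) (λ σ → ⟦ injᵇ σ ⟧ * form (λ a′ b′ → δ a a′ * δ b b′) σ)))) ⟩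
      sum (λ a → sum (λ b → Σᶠ (X a b)))
        ≈⟨ sum-cong-≋ (λ a → Σᶠ-sum (X a)) ⟩
      sum (λ a → Σᶠ (λ σ → sum (λ b → X a b σ)))
        ≈⟨ Σᶠ-sum (λ a σ → sum (λ b → X a b σ)) ⟩
      Σᶠ (λ σ → sum (λ a → sum (λ b → X a b σ)))
        ≈⟨ Σᶠ-cong collapse ⟩
      Σᶠ (λ σ → ⟦ injᵇ σ ⟧ * form q σ) ∎)
      where
      X : Fin n → Fin n → (Fin n → Fin n) → Carrier
      X a b σ = q a b * (⟦ injᵇ σ ⟧ * form (λ a′ b′ → δ a a′ * δ b b′) σ)
      collapse : ∀ σ → sum (λ a → sum (λ b → X a b σ)) ≈ ⟦ injᵇ σ ⟧ * form q σ
      collapse σ = begin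
        sum (λ a → sum (λ b → X a b σ))
          ≈⟨ sum-cong-≋ (λ a → sum-cong-≋ (λ b →
               solve 5 (λ q x y p r → q :* (x :* (y :* p :* r)) := x :* r :* (q :* p) :* y) refl
                 (q a b) ⟦ injᵇ σ ⟧ (δ a (σ i)) (δ b (σ j)) (rest M i j σ))) ⟩
        sum (λ a → sum (λ b → w * (q a b * δ b (σ j)) * δ a (σ i)))
          ≈⟨ sum-cong-≋ (λ a → *-distribʳ-sum (δ a (σ i)) (λ b → w * (q a b * δ b (σ j)))) ⟨
        sum (λ a → sum (λ b → w * (q a b * δ b (σ j))) * δ a (σ i))
          ≈⟨ sum-δʳ (λ a → sum (λ b → w * (q a b * δ b (σ j)))) (σ i) ⟩
        sum (λ b → w * (q (σ i) b * δ b (σ j)))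
          ≈⟨ *-distribˡ-sum w (λ b → q (σ i) b * δ b (σ j)) ⟨
        w * sum (λ b → q (σ i) b * δ b (σ j))
          ≈⟨ *-congˡ (sum-δʳ (q (σ i)) (σ j)) ⟩
        w * q (σ i) (σ j)
          ≈⟨ solve 3 (λ x r q → x :* r :* q := x :* (q :* r)) refl ⟦ injᵇ σ ⟧ (rest M i j σ) (q (σ i) (σ j)) ⟩
        ⟦ injᵇ σ ⟧ * form q σ ∎
        where w = ⟦ injᵇ σ ⟧ * rest M i j σ

    -- Of `σ` and `σ ∘ (i j)` exactly one is odd, so folding trades the parity condition for the
    -- order condition `σ i < σ j` on all permutations. Parity is gone and `expand` leaves
    -- determinants only.
    h-equal-rows : ∀ r → h (M [ i ]≔ r [ j ]≔ r)
      ≈ sum (λ a → sum (λ b → ⟦ a <ᶠ b ⟧ * (r a * r b) * d (M [ i ]≔ δ a [ j ]≔ δ b)))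
    h-equal-rows r = begin
      h (M [ i ]≔ r [ j ]≔ r)
        ≈⟨ D-form oddᵇ r r ⟩
      Σᶠ (λ σ → ⟦ oddᵇ σ ⟧ * form (λ a b → r a * r b) σ)
        ≈⟨ fold-transpose i≢j oddᵇ-cong oddᵇ-inj (form-resp (λ a b → r a * r b)) (symmetric r) ⟩
      Σᶠ (λ σ → ⟦ (oddᵇ σ xor oddᵇ (σ ∘ PC.transpose i j)) ∧ (σ i <ᶠ σ j) ⟧ * form (λ a b → r a * r b) σ)
        ≈⟨ Σᶠ-cong ordered ⟩
      Σᶠ (λ σ → ⟦ injᵇ σ ⟧ * form (λ a b → ⟦ a <ᶠ b ⟧ * (r a * r b)) σ)
        ≈⟨ expand (λ a b → ⟦ a <ᶠ b ⟧ * (r a * r b)) ⟩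
      sum (λ a → sum (λ b → ⟦ a <ᶠ b ⟧ * (r a * r b) * d (M [ i ]≔ δ a [ j ]≔ δ b))) ∎
      where
      parity : ∀ σ → oddᵇ σ xor oddᵇ (σ ∘ PC.transpose i j) ≡ injᵇ σ
      parity σ rewrite injᵇ-transpose σ i j with injᵇ σ in p
      ... | false = ≡.refl
      ... | true rewrite odd-transpose σ (injᵇ-sound σ p) i≢j with odd σ
      ...   | true  = ≡.refl
      ...   | false = ≡.refl
      ordered : ∀ σ → ⟦ (oddᵇ σ xor oddᵇ (σ ∘ PC.transpose i j)) ∧ (σ i <ᶠ σ j) ⟧ * form (λ a b → r a * r b) σ
                      ≈ ⟦ injᵇ σ ⟧ * form (λ a b → ⟦ a <ᶠ b ⟧ * (r a * r b)) σ
      ordered σ rewrite parity σ = trans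
        (*-congʳ (⟦∧⟧ (injᵇ σ) (σ i <ᶠ σ j)))
        (solve 4 (λ x l p q → x :* l :* (p :* q) := x :* (l :* p :* q)) refl
          ⟦ injᵇ σ ⟧ ⟦ σ i <ᶠ σ j ⟧ (r (σ i) * r (σ j)) (rest M i j σ))

  module _ {n} (M : Mat n) where

    row-self : ∀ i l a → (M [ i ]≔ M i) l a ≈ M l a
    row-self i l a with l ≟ i
    ... | yes ≡.refl = same M i a
    ... | no l≢i     = other M l≢i a

    row-commute : ∀ {i j} s r → i ≢ j → ∀ l a → (M [ i ]≔ s [ j ]≔ r) l a ≈ (M [ j ]≔ r [ i ]≔ s) l a
    row-commute {i} {j} s r i≢j l a with l ≟ i
    ... | yes ≡.refl = trans (trans (other (M [ i ]≔ s) i≢j a) (same M i a)) (sym (same (M [ j ]≔ r) i a))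
    ... | no l≢i with l ≟ j
    ...   | yes ≡.refl = trans (same (M [ i ]≔ s) j a) (sym (trans (other (M [ j ]≔ r) l≢i a) (same M j a)))
    ...   | no l≢j = trans (trans (other (M [ i ]≔ s) l≢j a) (other M l≢i a))
                           (sym (trans (other (M [ j ]≔ r) l≢i a) (other M l≢j a)))

    row-cong : ∀ i {s r} → (∀ a → s a ≈ r a) → ∀ l a → (M [ i ]≔ s) l a ≈ (M [ i ]≔ r) l a
    row-cong i eq l a with l ≟ i
    ... | yes ≡.refl = trans (same M i a) (trans (eq a) (sym (same M i a)))
    ... | no l≢i     = trans (other M l≢i a) (sym (other M l≢i a))

    row-copy : ∀ {i j} → i ≢ j → ∀ l a → (M [ i ]≔ M j) l a ≈ (M [ i ]≔ M j [ j ]≔ M j) l a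
    row-copy {i} {j} i≢j l a with l ≟ j
    ... | yes ≡.refl = trans (other M (i≢j ∘ ≡.sym) a) (sym (same (M [ i ]≔ M l) l a))
    ... | no l≢j     = sym (other (M [ i ]≔ M j) l≢j a)

    d-repeated : ∀ {i j} → i ≢ j → d (M [ i ]≔ M j) ≈ 0#
    d-repeated {i} {j} i≢j = trans (D-cong injᵇ (row-copy i≢j)) (d-alternating M i≢j (M j))

  -- Minors of an invertible matrix and the partial derivatives of `h`.

  module _ {n} (M N : Mat n)
    (NM : ∀ a b → sum (λ l → N a l * M l b) ≈ δ a b) where

    -- Cramer's rule: `δ b` is the combination of the rows of `M` with coefficients `N b l`, and
    -- substituting any row but the `i`th repeats a row.
    cramer : ∀ i b → d (M [ i ]≔ δ b) ≈ N b i * d M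
    cramer i b = begin
      d (M [ i ]≔ δ b)                              ≈⟨ D-cong injᵇ (row-cong M i (λ a → sym (NM b a))) ⟩
      d (M [ i ]≔ (λ a → sum (λ l → N b l * M l a))) ≈⟨ D-linear injᵇ M i (N b) M ⟩
      sum (λ l → N b l * d (M [ i ]≔ M l))
        ≈⟨ sum-single i (λ l l≢i → trans (*-congˡ (d-repeated M (l≢i ∘ ≡.sym))) (zeroʳ (N b l))) ⟩
      N b i * d (M [ i ]≔ M i)                      ≈⟨ *-congˡ (D-cong injᵇ (row-self M i)) ⟩
      N b i * d M                                   ∎

    -- Jacobi's formula for second-order minors, its minus sign being a plus here. Among the rows
    -- that combine to `δ a` only the rows `i` and `j` survive; the latter is brought to its place
    -- by exchanging two rows.
    cramer₂ : ∀ {i j} → i ≢ j → ∀ a b →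
              d (M [ i ]≔ δ a [ j ]≔ δ b) ≈ (N a i * N b j + N a j * N b i) * d M
    cramer₂ {i} {j} i≢j a b = begin
      d (M [ i ]≔ δ a [ j ]≔ δ b)
        ≈⟨ D-cong injᵇ (row-commute M (δ a) (δ b) i≢j) ⟩
      d (Mⱼ [ i ]≔ δ a)
        ≈⟨ D-cong injᵇ (row-cong Mⱼ i (λ c → sym (NM a c))) ⟩
      d (Mⱼ [ i ]≔ (λ c → sum (λ l → N a l * M l c)))
        ≈⟨ D-linear injᵇ Mⱼ i (N a) M ⟩
      sum (λ l → N a l * d (Mⱼ [ i ]≔ M l))
        ≈⟨ sum-pair i≢j (λ l l≢i l≢j → trans
             (*-congˡ (trans (D-cong injᵇ (row-cong Mⱼ i (λ c → sym (other M l≢j c))))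
                             (d-repeated Mⱼ (l≢i ∘ ≡.sym))))
             (zeroʳ (N a l))) ⟩
      N a i * d (Mⱼ [ i ]≔ M i) + N a j * d (Mⱼ [ i ]≔ M j)
        ≈⟨ +-cong (*-congˡ first) (*-congˡ second) ⟩
      N a i * (N b j * d M) + N a j * (N b i * d M)
        ≈⟨ solve 5 (λ p q r s x → p :* (q :* x) :+ r :* (s :* x) := (p :* q :+ r :* s) :* x) refl
             (N a i) (N b j) (N a j) (N b i) (d M) ⟩
      (N a i * N b j + N a j * N b i) * d M ∎
      where
      Mⱼ = M [ j ]≔ δ b
      first : d (Mⱼ [ i ]≔ M i) ≈ N b j * d M
      first = trans (D-cong injᵇ (λ l c → trans (row-cong Mⱼ i (λ c → sym (other M i≢j c)) l c) (row-self Mⱼ i l c)))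
                    (cramer j b)
      second : d (Mⱼ [ i ]≔ M j) ≈ N b i * d M
      second = trans (d-swap M (i≢j ∘ ≡.sym) (δ b) (M j))
        (trans (D-cong injᵇ (λ l c → trans (row-commute M (M j) (δ b) (i≢j ∘ ≡.sym) l c)
                                       (trans (row-cong (M [ i ]≔ δ b) j (λ c → sym (other M (i≢j ∘ ≡.sym) c)) l c)
                                              (row-self (M [ i ]≔ δ b) j l c))))
               (cramer i b))

    module _ (MN : ∀ a b → sum (λ l → M a l * N l b) ≈ δ a b) where

      -- Once the minors are written with `N`, the sum over pairs `a < b` is that of
      -- `sum-off-diagonal`. The product of the two full sums vanishes because `sum x` is the entry
      -- `j i` of the identity `M N`, and the diagonal remains.
      h-repeated : ∀ {i j} → i ≢ j →
                   h (M [ i ]≔ M j) ≈ d M * sum (λ a → M j a * M j a * N a j * N a i)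
      h-repeated {i} {j} i≢j = begin
        h (M [ i ]≔ M j)
          ≈⟨ D-cong oddᵇ (row-copy M i≢j) ⟩
        h (M [ i ]≔ M j [ j ]≔ M j)
          ≈⟨ h-equal-rows M i≢j (M j) ⟩
        sum (λ a → sum (λ b → ⟦ a <ᶠ b ⟧ * (M j a * M j b) * d (M [ i ]≔ δ a [ j ]≔ δ b)))
          ≈⟨ sum-cong-≋ (λ a → trans
               (sum-cong-≋ (λ b → trans (*-congˡ (cramer₂ i≢j a b)) (arrange a b)))
               (sym (*-distribˡ-sum (d M) (λ b → ⟦ a <ᶠ b ⟧ * (x a * z b + x b * z a))))) ⟩
        sum (λ a → d M * sum (λ b → ⟦ a <ᶠ b ⟧ * (x a * z b + x b * z a)))
          ≈⟨ *-distribˡ-sum (d M) (λ a → sum (λ b → ⟦ a <ᶠ b ⟧ * (x a * z b + x b * z a))) ⟨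
        d M * sum (λ a → sum (λ b → ⟦ a <ᶠ b ⟧ * (x a * z b + x b * z a)))
          ≈⟨ *-congˡ (sum-off-diagonal x z) ⟩
        d M * (sum x * sum z + sum (λ a → x a * z a))
          ≈⟨ *-congˡ (+-cong (trans (*-congʳ (trans (MN j i) (δ-≢ (i≢j ∘ ≡.sym)))) (zeroˡ (sum z)))
                             (sum-cong-≋ (λ a → solve 3 (λ m p q → m :* p :* (m :* q) := m :* m :* q :* p) refl
                                (M j a) (N a i) (N a j)))) ⟩
        d M * (0# + sum (λ a → M j a * M j a * N a j * N a i))
          ≈⟨ *-congˡ (+-identityˡ _) ⟩
        d M * sum (λ a → M j a * M j a * N a j * N a i) ∎
        where
        x z : Fin n → Carrier
        x a = M j a * N a i
        z b = M j b * N b j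
        arrange : ∀ a b → ⟦ a <ᶠ b ⟧ * (M j a * M j b) * ((N a i * N b j + N a j * N b i) * d M)
                          ≈ d M * (⟦ a <ᶠ b ⟧ * (x a * z b + x b * z a))
        arrange a b = solve 8 (λ l ma mb nai nbj naj nbi e →
            l :* (ma :* mb) :* ((nai :* nbj :+ naj :* nbi) :* e)
              := e :* (l :* (ma :* nai :* (mb :* nbj) :+ mb :* nbi :* (ma :* naj)))) refl
          ⟦ a <ᶠ b ⟧ (M j a) (M j b) (N a i) (N b j) (N a j) (N b i) (d M)

      -- For `i = j` the bracket is 1 + 1, its sum being the square of a diagonal entry of `M N` by
      -- `sum-square`. One formula for both cases lets `gradient` treat all rows as a single matrix
      -- equation.
      h-row : ∀ i j → h (M [ i ]≔ M j)
                      ≈ h M * δ j i + d M * (sum (λ a → M j a * M j a * N a j * N a i) + δ j i)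
      h-row i j with j ≟ i
      ... | no j≢i = trans (h-repeated (j≢i ∘ ≡.sym))
        (solve 3 (λ x y s → x :* s := y :* con false :+ x :* (s :+ con false)) refl (d M) (h M) _)
      ... | yes ≡.refl = begin
        h (M [ i ]≔ M i)  ≈⟨ D-cong oddᵇ (row-self M i) ⟩
        h M               ≈⟨ solve 2 (λ x y → y := y :* con true :+ x :* (con true :+ con true)) refl (d M) (h M) ⟩
        h M * 1# + d M * (1# + 1#) ≈⟨ +-congˡ (*-congˡ (+-congʳ one)) ⟨
        h M * 1# + d M * (sum (λ a → M i a * M i a * N a i * N a i) + 1#) ∎
        where
        one : sum (λ a → M i a * M i a * N a i * N a i) ≈ 1#
        one = begin
          sum (λ a → M i a * M i a * N a i * N a i)
            ≈⟨ sum-cong-≋ (λ a → solve 2 (λ m p → m :* m :* p :* p := m :* p :* (m :* p)) refl (M i a) (N a i)) ⟩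
          sum (λ a → M i a * N a i * (M i a * N a i))
            ≈⟨ sum-square (λ a → M i a * N a i) ⟩
          sum (λ a → M i a * N a i) * sum (λ a → M i a * N a i)
            ≈⟨ *-cong (trans (MN i i) (δ-refl i)) (trans (MN i i) (δ-refl i)) ⟩
          1# * 1#  ≈⟨ *-identityˡ 1# ⟩
          1#       ∎

      -- Both sides agree after multiplication by Mᵀ on the left and on the right.
      gradient : (X : Mat n) →
        (∀ u v → sum (λ s → M s u * sum (λ t → M v t * X s t)) ≈ M v u * M v u * N u v + M v u) →
        ∀ u v → h (M [ u ]≔ δ v) + h M * N v u + d M * X u v ≈ 0#
      gradient X MXM u v = cancel {P = M} {N} NM {x = E u} (λ v → cancel {P = λ u s → M s u} {λ p u → N u p}
          (λ p t → trans (sum-cong-≋ (λ u → *-comm (N u p) (M t u))) (trans (MN t p) (δ-sym t p)))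
          {x = λ s → sum (λ t → M v t * E s t)} (λ u → vanish u v) u) v
        where
        δ-sym : ∀ i j → δ i j ≈ δ j i
        δ-sym i j with i ≟ j
        ... | yes ≡.refl = sym (δ-refl i)
        ... | no i≢j     = sym (δ-≢ (i≢j ∘ ≡.sym))
        E : Mat n
        E u v = h (M [ u ]≔ δ v) + h M * N v u + d M * X u v
        S : Fin n → Fin n → Carrier
        S s v = sum (λ a → M v a * M v a * N a v * N a s)
        Y : Fin n → Fin n → Carrier
        Y s v = sum (λ t → M v t * X s t)
        row : ∀ s v → sum (λ t → M v t * E s t) ≈ d M * (S s v + δ v s + Y s v)
        row s v = begin
          sum (λ t → M v t * E s t)
            ≈⟨ sum-cong-≋ (λ t → solve 6 (λ m a b c e f → m :* (a :+ b :* c :+ e :* f)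
                                     := m :* a :+ b :* (m :* c) :+ e :* (m :* f)) refl
                 (M v t) (h (M [ s ]≔ δ t)) (h M) (N t s) (d M) (X s t)) ⟩
          sum (λ t → M v t * h (M [ s ]≔ δ t) + h M * (M v t * N t s) + d M * (M v t * X s t))
            ≈⟨ trans (∑-distrib-+ (λ t → M v t * h (M [ s ]≔ δ t) + h M * (M v t * N t s)) (λ t → d M * (M v t * X s t)))
                     (+-congʳ (∑-distrib-+ (λ t → M v t * h (M [ s ]≔ δ t)) (λ t → h M * (M v t * N t s)))) ⟩
          sum (λ t → M v t * h (M [ s ]≔ δ t)) + sum (λ t → h M * (M v t * N t s)) + sum (λ t → d M * (M v t * X s t))
            -- Linearity assembles the partial derivatives in row `s` into `h` of a matrix with row
            -- `s` replaced by row `v`, which `h-row` evaluates. The term `h M * N` of `E` is there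
            -- to cancel the `h M` that this produces.
            ≈⟨ +-cong (+-cong
                 (trans (sym (D-linear oddᵇ M s (M v) δ))
                   (trans (D-cong oddᵇ (row-cong M s (sum-δʳ (M v)))) (h-row s v)))
                 (trans (sym (*-distribˡ-sum (h M) (λ t → M v t * N t s))) (*-congˡ (MN v s))))
                 (sym (*-distribˡ-sum (d M) (λ t → M v t * X s t))) ⟩
          h M * δ v s + d M * (S s v + δ v s) + h M * δ v s + d M * Y s v
            ≈⟨ solve 5 (λ x e w p y → x :* e :+ p :* (w :+ e) :+ x :* e :+ p :* y := p :* (w :+ e :+ y)) refl
                 (h M) (δ v s) (S s v) (d M) (Y s v) ⟩
          d M * (S s v + δ v s + Y s v) ∎
        collapse : ∀ u v → sum (λ s → M s u * S s v) ≈ M v u * M v u * N u v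
        collapse u v = begin
          sum (λ s → M s u * S s v)
            ≈⟨ sum-cong-≋ (λ s → *-congˡ (sum-cong-≋ (λ a → *-comm (M v a * M v a * N a v) (N a s)))) ⟩
          sum (λ s → M s u * sum (λ a → N a s * (M v a * M v a * N a v)))
            ≈⟨ sum-assoc (λ s → M s u) (λ s a → N a s) (λ a → M v a * M v a * N a v) ⟩
          sum (λ a → sum (λ s → M s u * N a s) * (M v a * M v a * N a v))
            ≈⟨ sum-cong-≋ (λ a → trans (*-comm _ _)
                 (*-congˡ (trans (sum-cong-≋ (λ s → *-comm (M s u) (N a s))) (NM a u)))) ⟩
          sum (λ a → M v a * M v a * N a v * δ a u)
            ≈⟨ sum-δʳ (λ a → M v a * M v a * N a v) u ⟩
          M v u * M v u * N u v ∎
        vanish : ∀ u v → sum (λ s → M s u * sum (λ t → M v t * E s t)) ≈ 0#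
        vanish u v = begin
          sum (λ s → M s u * sum (λ t → M v t * E s t))
            ≈⟨ sum-cong-≋ (λ s → trans (*-congˡ (row s v))
                 (solve 5 (λ m p a b c → m :* (p :* (a :+ b :+ c)) := p :* (m :* a :+ m :* b :+ m :* c)) refl
                   (M s u) (d M) (S s v) (δ v s) (Y s v))) ⟩
          sum (λ s → d M * (M s u * S s v + M s u * δ v s + M s u * Y s v))
            ≈⟨ *-distribˡ-sum (d M) (λ s → M s u * S s v + M s u * δ v s + M s u * Y s v) ⟨
          d M * sum (λ s → M s u * S s v + M s u * δ v s + M s u * Y s v)
            ≈⟨ *-congˡ (trans (∑-distrib-+ (λ s → M s u * S s v + M s u * δ v s) (λ s → M s u * Y s v))
                              (+-congʳ (∑-distrib-+ (λ s → M s u * S s v) (λ s → M s u * δ v s)))) ⟩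
          d M * (sum (λ s → M s u * S s v) + sum (λ s → M s u * δ v s) + sum (λ s → M s u * Y s v))
            ≈⟨ *-congˡ (+-cong (+-cong (collapse u v) (sum-δˡ (λ s → M s u) v)) (MXM u v)) ⟩
          d M * (M v u * M v u * N u v + M v u + (M v u * M v u * N u v + M v u))
            ≈⟨ solve 3 (λ p a b → p :* (a :+ b :+ (a :+ b)) := con false) refl (d M) (M v u * M v u * N u v) (M v u) ⟩
          0# ∎

open import Defs

-- Power series over 𝔽₂ and the recurrence for the coefficients.

module Series where

  open import Algebra.Bundles using (CommutativeRing; CommutativeSemiring)
  open import Algebra.Structures.Biased using (isCommutativeSemiringˡ)
  open import Data.Bool.Base using (Bool; true; false; not; _xor_; _∧_; _∨_)
  import Data.Bool.Properties as Bool
  open import Data.Fin.Base using (Fin; zero; suc; finToFun)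
  open import Data.Fin.Properties as Fin using (_≟_)
  open import Data.Nat.Base using (ℕ; zero; suc; _+_; _^_; _<_; _≤_; z≤n; s≤s; s≤s⁻¹; _≡ᵇ_)
  import Data.Nat.Properties as ℕ
  open import Data.Product.Base using (_×_; _,_; proj₁; proj₂; ∃; ∃-syntax)
  open import Data.Sum.Base using (_⊎_; inj₁; inj₂)
  open import Function.Base using (_∘_; id)
  open import Function.Properties.Inverse using (↔-sym)
  open import Level using (0ℓ)
  open import Relation.Binary.PropositionalEquality hiding (J)
  open import Relation.Binary.Structures using (IsEquivalence)
  open import Relation.Nullary using (yes; no; does; contradiction)
  open import Relation.Nullary.Decidable using (dec-true; dec-false)

  open CommutativeRing Bool.xor-∧-commutativeRing
    using (+-assoc; +-comm; distribˡ; distribʳ; isCommutativeRing)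
    renaming (commutativeSemiring to 𝔽₂-semiring)

  𝔽₂ : BinaryField
  𝔽₂ = record
    { degree            = 1
    ; Carrier           = Bool
    ; _⊕_               = _xor_
    ; _⊗_               = _∧_
    ; ⊖_                = λ b → b
    ; _⁻¹               = λ b → b
    ; 0#                = false
    ; 1#                = true
    ; isCommutativeRing = isCommutativeRing
    ; 0#≢1#             = λ ()
    ; ⁻¹-inverse        = λ { true _ → refl ; false 0≢0 → contradiction refl 0≢0 }
    ; enumeration       = ↔-sym Fin.2↔Bool
    }

  open MatrixAlgebra 𝔽₂ using (_·_)

  module B = Identity 𝔽₂-semiring Bool.xor-same

  -- Power series over 𝔽₂

  Series : Set
  Series = ℕ → Bool

  infixl 7 _⊛_

  _⊛_ : Series → Series → Series
  (f ⊛ g) zero    = f 0 ∧ g 0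
  (f ⊛ g) (suc m) = (f 0 ∧ g (suc m)) xor ((f ∘ suc) ⊛ g) m

  _⊞_ : Series → Series → Series
  (f ⊞ g) m = f m xor g m

  0ₛ 1ₛ : Series
  0ₛ _       = false
  1ₛ zero    = true
  1ₛ (suc _) = false

  ⊛-cong : ∀ {f f′ g g′} → f ≗ f′ → g ≗ g′ → f ⊛ g ≗ f′ ⊛ g′
  ⊛-cong p q zero    = cong₂ _∧_ (p 0) (q 0)
  ⊛-cong p q (suc m) = cong₂ _xor_ (cong₂ _∧_ (p 0) (q (suc m))) (⊛-cong (p ∘ suc) q m)

  ⊛-zeroˡ : ∀ g → 0ₛ ⊛ g ≗ 0ₛ
  ⊛-zeroˡ g zero    = refl
  ⊛-zeroˡ g (suc m) = ⊛-zeroˡ g m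

  ⊛-identityˡ : ∀ g → 1ₛ ⊛ g ≗ g
  ⊛-identityˡ g zero    = refl
  ⊛-identityˡ g (suc m) = trans (cong (g (suc m) xor_) (⊛-zeroˡ g m)) (Bool.xor-identityʳ _)

  ⊛-distribʳ : ∀ h f g → (f ⊞ g) ⊛ h ≗ (f ⊛ h) ⊞ (g ⊛ h)
  ⊛-distribʳ h f g zero    = distribʳ (h 0) (f 0) (g 0)
  ⊛-distribʳ h f g (suc m) = trans
    (cong (((f 0 xor g 0) ∧ h (suc m)) xor_) (⊛-distribʳ h (f ∘ suc) (g ∘ suc) m))
    (B.solve 5 (λ a b c x y → (a B.:+ b) B.:* c B.:+ (x B.:+ y) B.:= a B.:* c B.:+ x B.:+ (b B.:* c B.:+ y))
      refl (f 0) (g 0) (h (suc m)) (((f ∘ suc) ⊛ h) m) (((g ∘ suc) ⊛ h) m))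

  ⊛-scale : ∀ b f g m → ((λ k → b ∧ f k) ⊛ g) m ≡ b ∧ (f ⊛ g) m
  ⊛-scale b f g zero    = Bool.∧-assoc b (f 0) (g 0)
  ⊛-scale b f g (suc m) = trans
    (cong₂ _xor_ (Bool.∧-assoc b (f 0) (g (suc m))) (⊛-scale b (f ∘ suc) g m))
    (sym (distribˡ b (f 0 ∧ g (suc m)) (((f ∘ suc) ⊛ g) m)))

  ⊛-assoc : ∀ f g h → (f ⊛ g) ⊛ h ≗ f ⊛ (g ⊛ h)
  ⊛-assoc f g h zero    = Bool.∧-assoc (f 0) (g 0) (h 0)
  ⊛-assoc f g h (suc m) = begin
    (f 0 ∧ g 0) ∧ h (suc m) xor (((λ k → f 0 ∧ g (suc k)) ⊞ ((f ∘ suc) ⊛ g)) ⊛ h) m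
      ≡⟨ cong (((f 0 ∧ g 0) ∧ h (suc m)) xor_) (⊛-distribʳ h (λ k → f 0 ∧ g (suc k)) ((f ∘ suc) ⊛ g) m) ⟩
    (f 0 ∧ g 0) ∧ h (suc m) xor (((λ k → f 0 ∧ g (suc k)) ⊛ h) m xor (((f ∘ suc) ⊛ g) ⊛ h) m)
      ≡⟨ cong (((f 0 ∧ g 0) ∧ h (suc m)) xor_) (cong₂ _xor_ (⊛-scale (f 0) (g ∘ suc) h m) (⊛-assoc (f ∘ suc) g h m)) ⟩
    (f 0 ∧ g 0) ∧ h (suc m) xor (f 0 ∧ ((g ∘ suc) ⊛ h) m xor ((f ∘ suc) ⊛ (g ⊛ h)) m)
      ≡⟨ B.solve 5 (λ a b c x y → a B.:* b B.:* c B.:+ (a B.:* x B.:+ y) B.:= a B.:* (b B.:* c B.:+ x) B.:+ y)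
           refl (f 0) (g 0) (h (suc m)) (((g ∘ suc) ⊛ h) m) (((f ∘ suc) ⊛ (g ⊛ h)) m) ⟩
    f 0 ∧ (g 0 ∧ h (suc m) xor ((g ∘ suc) ⊛ h) m) xor ((f ∘ suc) ⊛ (g ⊛ h)) m ∎
    where open ≡-Reasoning

  ⊛-sucʳ : ∀ f g m → (f ⊛ g) (suc m) ≡ (f ⊛ (g ∘ suc)) m xor (f (suc m) ∧ g 0)
  ⊛-sucʳ f g zero    = refl
  ⊛-sucʳ f g (suc m) = trans
    (cong ((f 0 ∧ g (suc (suc m))) xor_) (⊛-sucʳ (f ∘ suc) g m))
    (sym (+-assoc (f 0 ∧ g (suc (suc m))) (((f ∘ suc) ⊛ (g ∘ suc)) m) (f (suc (suc m)) ∧ g 0)))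

  ⊛-comm : ∀ f g → f ⊛ g ≗ g ⊛ f
  ⊛-comm f g zero    = Bool.∧-comm (f 0) (g 0)
  ⊛-comm f g (suc m) = begin
    f 0 ∧ g (suc m) xor ((f ∘ suc) ⊛ g) m  ≡⟨ cong₂ _xor_ (Bool.∧-comm (f 0) (g (suc m))) (⊛-comm (f ∘ suc) g m) ⟩
    g (suc m) ∧ f 0 xor (g ⊛ (f ∘ suc)) m  ≡⟨ +-comm (g (suc m) ∧ f 0) ((g ⊛ (f ∘ suc)) m) ⟩
    (g ⊛ (f ∘ suc)) m xor g (suc m) ∧ f 0  ≡⟨ ⊛-sucʳ g f m ⟨
    (g ⊛ f) (suc m)                        ∎
    where open ≡-Reasoning

  series : CommutativeSemiring 0ℓ 0ℓ
  series = record
    { Carrier = Series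
    ; _≈_     = _≗_
    ; _+_     = _⊞_
    ; _*_     = _⊛_
    ; 0#      = 0ₛ
    ; 1#      = 1ₛ
    ; isCommutativeSemiring = isCommutativeSemiringˡ record
      { +-isCommutativeMonoid = record
        { isMonoid = record
          { isSemigroup = record
            { isMagma = record
              { isEquivalence = ≗-isEquivalence
              ; ∙-cong = λ p q m → cong₂ _xor_ (p m) (q m)
              }
            ; assoc = λ f g h m → +-assoc (f m) (g m) (h m)
            }
          ; identity = (λ f m → refl) , (λ f m → Bool.xor-identityʳ (f m))
          }
        ; comm = λ f g m → +-comm (f m) (g m)
        }
      ; *-isCommutativeMonoid = record
        { isMonoid = record
          { isSemigroup = record
            { isMagma = record { isEquivalence = ≗-isEquivalence ; ∙-cong = ⊛-cong }
            ; assoc = ⊛-assoc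
            }
          ; identity = ⊛-identityˡ , λ f m → trans (⊛-comm f 1ₛ m) (⊛-identityˡ f m)
          }
        ; comm = ⊛-comm
        }
      ; distribʳ = ⊛-distribʳ
      ; zeroˡ = ⊛-zeroˡ
      }
    }
    where
    ≗-isEquivalence : IsEquivalence (_≗_ {A = ℕ} {B = Bool})
    ≗-isEquivalence = record { refl = λ _ → refl ; sym = λ p m → sym (p m) ; trans = λ p q m → trans (p m) (q m) }

  module S = Identity series (λ f m → Bool.xor-same (f m))

  sum-coefficient : ∀ {n} (f : Fin n → Series) m → S.sum f m ≡ B.sum (λ i → f i m)
  sum-coefficient {zero}  f m = refl
  sum-coefficient {suc n} f m = cong (f zero m xor_) (sum-coefficient (f ∘ suc) m)

  -- c₀ + c₁ y
  linear : Bool → Bool → Series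
  linear c₀ c₁ 0 = c₀
  linear c₀ c₁ 1 = c₁
  linear c₀ c₁ (suc (suc _)) = false

  linear-⊛ : ∀ c₀ c₁ g m → (linear c₀ c₁ ⊛ g) (suc m) ≡ c₀ ∧ g (suc m) xor c₁ ∧ g m
  linear-⊛ c₀ c₁ g zero    = refl
  linear-⊛ c₀ c₁ g (suc m) = cong ((c₀ ∧ g (suc (suc m))) xor_)
    (trans (cong ((c₁ ∧ g (suc m)) xor_) (⊛-zeroˡ g m)) (Bool.xor-identityʳ _))

  ⟦⟧-⊛ : ∀ b g m → (S.⟦ b ⟧ ⊛ g) m ≡ b ∧ g m
  ⟦⟧-⊛ true  g m = ⊛-identityˡ g m
  ⟦⟧-⊛ false g m = ⊛-zeroˡ g m

  -- A unit multiple has the same lowest coefficient.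
  lowest : ∀ f g k → f 0 ≡ true → (∀ e → e < k → (f ⊛ g) e ≡ false) →
           (∀ e → e < k → g e ≡ false) × (f ⊛ g) k ≡ g k
  lowest f g zero f₀ low = (λ _ ()) , cong (_∧ g 0) f₀
  lowest f g (suc k) f₀ low =
    (λ e e<1+k → below e (ℕ.m≤n⇒m<n∨m≡n (s≤s⁻¹ e<1+k))) , top
    where
    IH = lowest f g k f₀ (λ e e<k → low e (ℕ.m<n⇒m<1+n e<k))
    below : ∀ e → e < k ⊎ e ≡ k → g e ≡ false
    below e (inj₁ e<k)  = proj₁ IH e e<k
    below e (inj₂ refl) = trans (sym (proj₂ IH)) (low e ℕ.≤-refl)
    vanish : ∀ (f′ : Series) m → (∀ e → e ≤ m → g e ≡ false) → (f′ ⊛ g) m ≡ false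
    vanish f′ zero    z = trans (cong (f′ 0 ∧_) (z 0 z≤n)) (Bool.∧-zeroʳ (f′ 0))
    vanish f′ (suc m) z = cong₂ _xor_
      (trans (cong (f′ 0 ∧_) (z (suc m) ℕ.≤-refl)) (Bool.∧-zeroʳ (f′ 0)))
      (vanish (f′ ∘ suc) m (λ e e≤m → z e (ℕ.m≤n⇒m≤1+n e≤m)))
    top : (f ⊛ g) (suc k) ≡ g (suc k)
    top = trans (cong₂ _xor_ (cong (_∧ g (suc k)) f₀)
                   (vanish (f ∘ suc) k (λ e e≤k → below e (ℕ.m≤n⇒m<n∨m≡n e≤k))))
                (Bool.xor-identityʳ (g (suc k)))

  low-⊛ : ∀ f g k → (∀ e → e < k → f e ≡ false) → ∀ e → e < k → (f ⊛ g) e ≡ false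
  low-⊛ f g (suc k) low zero    e<k       = cong (_∧ g 0) (low 0 (s≤s z≤n))
  low-⊛ f g (suc k) low (suc e) (s≤s e<k) = cong₂ _xor_
    (cong (_∧ g (suc e)) (low 0 (s≤s z≤n)))
    (low-⊛ (f ∘ suc) g k (λ e′ e′<k → low (suc e′) (s≤s e′<k)) e e<k)

  -- Products of monomials

  bit : Bool → ℕ
  bit true  = 1
  bit false = 0

  degree : ∀ {n} → (Fin n → Bool) → ℕ
  degree {zero}  b = 0
  degree {suc n} b = bit (b zero) + degree (b ∘ suc)

  implies : ∀ {n} → (b c : Fin n → Bool) → Bool
  implies {zero}  b c = true
  implies {suc n} b c = (not (b zero) ∨ c zero) ∧ implies (b ∘ suc) (c ∘ suc)

  implies-sound : ∀ {n} (b c : Fin n → Bool) → implies b c ≡ true → ∀ i → b i ≡ true → c i ≡ true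
  implies-sound b c eq zero    bi with b zero | c zero
  ... | true | true = refl
  implies-sound b c eq (suc i) bi = implies-sound (b ∘ suc) (c ∘ suc) (tail eq) i bi
    where
    tail : ∀ {x y} → x ∧ y ≡ true → y ≡ true
    tail {true} p = p

  implies-complete : ∀ {n} (b c : Fin n → Bool) → (∀ i → b i ≡ true → c i ≡ true) → implies b c ≡ true
  implies-complete {zero}  b c imp = refl
  implies-complete {suc n} b c imp with b zero in p
  ... | false = implies-complete (b ∘ suc) (c ∘ suc) (imp ∘ suc)
  ... | true rewrite imp zero p = implies-complete (b ∘ suc) (c ∘ suc) (imp ∘ suc)

  -- Here `b` marks the moved points and `c` the arcs: a factor is 1 at a fixed point, `y` along an
  -- arc and 0 otherwise, so the product is 0 or a power of `y`.
  product-monomials : ∀ {n} (b c : Fin n → Bool) e →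
    S.product (λ i → linear (not (b i)) (b i ∧ c i)) e ≡ implies b c ∧ (e ≡ᵇ degree b)
  product-monomials {zero}  b c zero    = refl
  product-monomials {zero}  b c (suc e) = refl
  product-monomials {suc n} b c zero with b zero
  ... | false = product-monomials (b ∘ suc) (c ∘ suc) zero
  ... | true  = sym (Bool.∧-zeroʳ _)
  product-monomials {suc n} b c (suc e) = trans
    (linear-⊛ (not (b zero)) (b zero ∧ c zero) _ e) step
    where
    step : not (b zero) ∧ S.product (λ i → linear (not (b (suc i))) (b (suc i) ∧ c (suc i))) (suc e)
             xor (b zero ∧ c zero) ∧ S.product (λ i → linear (not (b (suc i))) (b (suc i) ∧ c (suc i))) e
           ≡ implies b c ∧ (suc e ≡ᵇ degree b)
    step with b zero
    ... | false = trans (Bool.xor-identityʳ _) (product-monomials (b ∘ suc) (c ∘ suc) (suc e))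
    ... | true  = trans (cong (c zero ∧_) (product-monomials (b ∘ suc) (c ∘ suc) e))
                        (sym (Bool.∧-assoc (c zero) (implies (b ∘ suc) (c ∘ suc)) _))

  -- The matrix I + y A of a digraph, its inverse and the series to compute

  BoolMatrix : ℕ → Set
  BoolMatrix n = Matrix Bool n n

  module Sequences {n} (G : Digraph n) where

    A Aᵀ I J O : BoolMatrix n
    A = adj G
    Aᵀ u v = adj G v u
    I u v = does (u ≟ v)
    J u v = true
    O u v = false

    infixl 6 _⊕_
    infixl 7 _⊙_

    _⊕_ _⊙_ : BoolMatrix n → BoolMatrix n → BoolMatrix n
    (X ⊕ Y) u v = X u v xor Y u v
    (X ⊙ Y) u v = X u v ∧ Y u v

    -- `power`, `P` and `X` are the coefficients of N, of Mᵀ X and of X. Squaring an entry of I + y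
    -- A leaves no mixed term, only I + y² A, so `Aᵀ` meets the power whose exponent is smaller by
    -- two; `previous` supplies it. The value `J` of `previous` at 0 accounts for the summand Mᵀ,
    -- which contributes `Aᵀ` in degree one; in degree zero its `I` cancels the one from W, hence
    -- the initial `O`.
    power previous P X : ℕ → BoolMatrix n
    power zero    = I
    power (suc m) = A · power m
    previous zero    = J
    previous (suc m) = power m
    P zero    = O
    P (suc m) = P m · Aᵀ ⊕ I ⊙ power (suc m) ⊕ Aᵀ ⊙ previous m
    X zero    = O
    X (suc m) = Aᵀ · X m ⊕ P (suc m)

    M N Z : S.Mat n
    M u v = linear (I u v) (A u v)
    N u v m = power m u v
    Z u v m = X m u v

    I-sym : ∀ u v → I u v ≡ I v u
    I-sym u v with u ≟ v
    ... | yes refl = sym (dec-true (u ≟ u) refl)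
    ... | no u≢v = sym (dec-false (v ≟ u) (u≢v ∘ sym))

    δ-coefficient : ∀ u v → S.δ u v ≗ linear (I u v) false
    δ-coefficient u v m with u ≟ v
    δ-coefficient u v zero          | yes _ = refl
    δ-coefficient u v (suc zero)    | yes _ = refl
    δ-coefficient u v (suc (suc m)) | yes _ = refl
    δ-coefficient u v zero          | no _ = refl
    δ-coefficient u v (suc zero)    | no _ = refl
    δ-coefficient u v (suc (suc m)) | no _ = refl

    sum-linear₀ : ∀ (c₀ c₁ : Fin n → Bool) (x : Fin n → Series) →
      S.sum (λ s → linear (c₀ s) (c₁ s) ⊛ x s) 0 ≡ B.sum (λ s → c₀ s ∧ x s 0)
    sum-linear₀ c₀ c₁ x = sum-coefficient (λ s → linear (c₀ s) (c₁ s) ⊛ x s) 0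

    sum-linear : ∀ (c₀ c₁ : Fin n → Bool) (x : Fin n → Series) m →
      S.sum (λ s → linear (c₀ s) (c₁ s) ⊛ x s) (suc m)
        ≡ B.sum (λ s → c₀ s ∧ x s (suc m)) xor B.sum (λ s → c₁ s ∧ x s m)
    sum-linear c₀ c₁ x m = begin
      S.sum (λ s → linear (c₀ s) (c₁ s) ⊛ x s) (suc m)
        ≡⟨ sum-coefficient (λ s → linear (c₀ s) (c₁ s) ⊛ x s) (suc m) ⟩
      B.sum (λ s → (linear (c₀ s) (c₁ s) ⊛ x s) (suc m))
        ≡⟨ B.sum-cong-≋ (λ s → linear-⊛ (c₀ s) (c₁ s) (x s) m) ⟩
      B.sum (λ s → c₀ s ∧ x s (suc m) xor c₁ s ∧ x s m)
        ≡⟨ B.∑-distrib-+ (λ s → c₀ s ∧ x s (suc m)) (λ s → c₁ s ∧ x s m) ⟩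
      B.sum (λ s → c₀ s ∧ x s (suc m)) xor B.sum (λ s → c₁ s ∧ x s m) ∎
      where open ≡-Reasoning

    pick : ∀ (x : Fin n → Bool) u → B.sum (λ s → I u s ∧ x s) ≡ x u
    pick x u = trans
      (B.sum-cong-≋ (λ s → trans (Bool.∧-comm (I u s) (x s)) (cong (x s ∧_) (⟦⟧-id (I u s)))))
      (B.sum-δˡ x u)
      where
      ⟦⟧-id : ∀ b → b ≡ B.⟦ b ⟧
      ⟦⟧-id true  = refl
      ⟦⟧-id false = refl

    pick′ : ∀ (x : Fin n → Bool) u → B.sum (λ s → I s u ∧ x s) ≡ x u
    pick′ x u = trans (B.sum-cong-≋ (λ s → cong (_∧ x s) (I-sym s u))) (pick x u)

    xor-cancel : ∀ {a b} → a ≡ b → a xor b ≡ false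
    xor-cancel {a} refl = Bool.xor-same a

    MN : ∀ a b → S.sum (λ l → M a l ⊛ N l b) ≗ S.δ a b
    MN a b zero = trans (sum-linear₀ (I a) (A a) (λ l → N l b))
      (trans (pick (λ l → I l b) a) (sym (δ-coefficient a b 0)))
    MN a b (suc m) = trans (sum-linear (I a) (A a) (λ l → N l b) m)
      (trans (xor-cancel (pick (λ l → power (suc m) l b) a)) (sym (off m)))
      where
      off : ∀ m → S.δ a b (suc m) ≡ false
      off zero    = δ-coefficient a b 1
      off (suc m) = δ-coefficient a b (suc (suc m))

    power-comm : ∀ m a b → (power m · A) a b ≡ power (suc m) a b
    power-comm zero a b = trans (pick (λ l → A l b) a)
      (sym (trans (B.sum-cong-≋ (λ l → Bool.∧-comm (A a l) (I l b))) (pick′ (A a) b)))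
    power-comm (suc m) a b = trans
      (sym (B.sum-assoc (A a) (power m) (λ l → A l b)))
      (B.sum-cong-≋ (λ l → cong (A a l ∧_) (power-comm m l b)))

    NM : ∀ a b → S.sum (λ l → N a l ⊛ M l b) ≗ S.δ a b
    NM a b m = trans (S.sum-cong-≋ (λ l → ⊛-comm (N a l) (M l b)) m) (lemma m)
      where
      lemma : ∀ m → S.sum (λ l → M l b ⊛ N a l) m ≡ S.δ a b m
      lemma zero = trans (sum-linear₀ (λ l → I l b) (λ l → A l b) (N a))
        (trans (pick′ (I a) b) (sym (δ-coefficient a b 0)))
      lemma (suc m) = trans (sum-linear (λ l → I l b) (λ l → A l b) (N a) m)
        (trans (xor-cancel (trans (pick′ (power (suc m) a) b) (sym (trans
          (B.sum-cong-≋ (λ l → Bool.∧-comm (A l b) (power m a l))) (power-comm m a b)))))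
        (sym (off m)))
        where
        off : ∀ m → S.δ a b (suc m) ≡ false
        off zero    = δ-coefficient a b 1
        off (suc m) = δ-coefficient a b (suc (suc m))

    MᵀZ : ∀ u t m → S.sum (λ s → M s u ⊛ Z s t) m ≡ P m u t
    MᵀZ u t zero = trans (sum-linear₀ (λ s → I s u) (λ s → A s u) (λ s → Z s t))
      (pick′ (λ s → X 0 s t) u)
    MᵀZ u t (suc m) = begin
      S.sum (λ s → M s u ⊛ Z s t) (suc m)
        ≡⟨ sum-linear (λ s → I s u) (λ s → A s u) (λ s → Z s t) m ⟩
      B.sum (λ s → I s u ∧ X (suc m) s t) xor (Aᵀ · X m) u t
        ≡⟨ cong (_xor (Aᵀ · X m) u t) (pick′ (λ s → X (suc m) s t) u) ⟩
      ((Aᵀ · X m) u t xor P (suc m) u t) xor (Aᵀ · X m) u t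
        ≡⟨ B.solve 2 (λ x y → x B.:+ y B.:+ x B.:= y) refl ((Aᵀ · X m) u t) (P (suc m) u t) ⟩
      P (suc m) u t ∎
      where open ≡-Reasoning

    MᵀZMᵀ : ∀ u v → S.sum (λ s → M s u ⊛ S.sum (λ t → M v t ⊛ Z s t)) ≗ (M v u ⊛ M v u ⊛ N u v) ⊞ M v u
    MᵀZMᵀ u v m = trans (exchange m) (trans (S.sum-cong-≋ (λ t → ⊛-cong {M v t} (λ _ → refl) (MᵀZ u t)) m) (lemma m))
      where
      exchange : S.sum (λ s → M s u ⊛ S.sum (λ t → M v t ⊛ Z s t)) ≗ S.sum (λ t → M v t ⊛ S.sum (λ s → M s u ⊛ Z s t))
      exchange = begin
        S.sum (λ s → M s u ⊛ S.sum (λ t → M v t ⊛ Z s t))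
          ≈⟨ S.sum-cong-≋ (λ s → S.*-distribˡ-sum (M s u) (λ t → M v t ⊛ Z s t)) ⟩
        S.sum (λ s → S.sum (λ t → M s u ⊛ (M v t ⊛ Z s t)))
          ≈⟨ S.∑-comm (λ s t → M s u ⊛ (M v t ⊛ Z s t)) ⟩
        S.sum (λ t → S.sum (λ s → M s u ⊛ (M v t ⊛ Z s t)))
          ≈⟨ S.sum-cong-≋ (λ t → S.sum-cong-≋ (λ s →
               S.solve 3 (λ x y z → x S.:* (y S.:* z) S.:= y S.:* (x S.:* z)) (λ _ → refl) (M s u) (M v t) (Z s t))) ⟩
        S.sum (λ t → S.sum (λ s → M v t ⊛ (M s u ⊛ Z s t)))
          ≈⟨ S.sum-cong-≋ (λ t → S.*-distribˡ-sum (M v t) (λ s → M s u ⊛ Z s t)) ⟨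
        S.sum (λ t → M v t ⊛ S.sum (λ s → M s u ⊛ Z s t)) ∎
        where open import Relation.Binary.Reasoning.Setoid (CommutativeSemiring.setoid series)
      -- Both sides are compared with `W`: `left` undoes the summand `P m · Aᵀ` of the recurrence,
      -- and `right` expands the square.
      W : ℕ → BoolMatrix n
      W zero    = O
      W (suc m) = I ⊙ power (suc m) ⊕ Aᵀ ⊙ previous m
      left : ∀ m → S.sum (λ t → M v t ⊛ λ e → P e u t) m ≡ W m u v
      left zero = trans (sum-linear₀ (I v) (A v) (λ t e → P e u t)) (pick (P 0 u) v)
      left (suc m) = begin
        S.sum (λ t → M v t ⊛ λ e → P e u t) (suc m)
          ≡⟨ sum-linear (I v) (A v) (λ t e → P e u t) m ⟩
        B.sum (λ t → I v t ∧ P (suc m) u t) xor B.sum (λ t → A v t ∧ P m u t)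
          ≡⟨ cong₂ _xor_ (pick (P (suc m) u) v) (B.sum-cong-≋ (λ t → Bool.∧-comm (A v t) (P m u t))) ⟩
        (((P m · Aᵀ) u v xor (I ⊙ power (suc m)) u v) xor (Aᵀ ⊙ previous m) u v) xor (P m · Aᵀ) u v
          ≡⟨ B.solve 3 (λ p i a → p B.:+ i B.:+ a B.:+ p B.:= i B.:+ a) refl
               ((P m · Aᵀ) u v) ((I ⊙ power (suc m)) u v) ((Aᵀ ⊙ previous m) u v) ⟩
        W (suc m) u v ∎
        where open ≡-Reasoning
      entry₁ : ∀ c₀ c₁ x → c₀ ∧ x xor c₁ ∧ true ≡ (c₀ ∧ (c₀ ∧ x xor c₁ ∧ c₀) xor c₁ ∧ c₀ ∧ c₀) xor c₁
      entry₁ true  true  x = B.solve 1 (λ x → x B.:+ B.con true B.:= x B.:+ B.con true B.:+ B.con true B.:+ B.con true) refl x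
      entry₁ true  false x = cong (_xor false) (sym (trans (Bool.xor-identityʳ (x xor false)) (Bool.xor-identityʳ x)))
      entry₁ false true  x = refl
      entry₁ false false x = refl
      right : ∀ m → W m u v ≡ ((M v u ⊛ M v u ⊛ N u v) ⊞ M v u) m
      right zero rewrite I-sym v u with u ≟ v
      ... | yes _ = refl
      ... | no _  = refl
      right (suc zero) = trans (entry₁ (I u v) (A v u) (power 1 u v))
        (cong (_xor A v u) (sym (trans (⊛-assoc (M v u) (M v u) (N u v) 1)
          (cong₂ (λ c x → c ∧ (c ∧ x xor A v u ∧ I u v) xor A v u ∧ c ∧ I u v) (I-sym v u) refl))))
      right (suc (suc m)) = trans (entry (I u v) (A v u) (power (suc (suc m)) u v) (power (suc m) u v) (power m u v))
        (sym (trans (Bool.xor-identityʳ (((M v u ⊛ M v u) ⊛ N u v) (suc (suc m)))) (trans (⊛-assoc (M v u) (M v u) (N u v) (suc (suc m)))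
          (trans (linear-⊛ (I v u) (A v u) (M v u ⊛ N u v) (suc m))
            (trans (cong₂ (λ x y → I v u ∧ x xor A v u ∧ y)
                     (linear-⊛ (I v u) (A v u) (N u v) (suc m)) (linear-⊛ (I v u) (A v u) (N u v) m))
              (cong (λ c → c ∧ (c ∧ power (suc (suc m)) u v xor A v u ∧ power (suc m) u v)
                           xor A v u ∧ (c ∧ power (suc m) u v xor A v u ∧ power m u v)) (I-sym v u)))))))
        where
        entry : ∀ c₀ c₁ x y z → c₀ ∧ x xor c₁ ∧ z ≡ c₀ ∧ (c₀ ∧ x xor c₁ ∧ y) xor c₁ ∧ (c₀ ∧ y xor c₁ ∧ z)
        entry true  true  x y z = B.solve 3 (λ x y z → x B.:+ z B.:= x B.:+ y B.:+ (y B.:+ z)) refl x y z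
        entry true  false x y z = cong (_xor false) (sym (Bool.xor-identityʳ x))
        entry false true  x y z = refl
        entry false false x y z = refl
      lemma : ∀ m → S.sum (λ t → M v t ⊛ λ e → P e u t) m ≡ ((M v u ⊛ M v u ⊛ N u v) ⊞ M v u) m
      lemma m = trans (left m) (right m)

    nonfixed : (Fin n → Fin n) → Fin n → Bool
    nonfixed σ i = not (I i (σ i))

    -- Whether σ moves exactly e points, all of them along arcs.
    coefficient : (Fin n → Fin n) → ℕ → Bool
    coefficient σ e = implies (nonfixed σ) (λ i → A i (σ i)) ∧ (e ≡ᵇ degree (nonfixed σ))

    arc-≢ : ∀ {u v} → A u v ≡ true → u ≢ v
    arc-≢ {u} uv refl = contradiction (trans (sym uv) (loopless G u)) λ ()

    prod-coefficient : ∀ σ → S.prod M σ ≗ coefficient σ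
    prod-coefficient σ e = trans
      (S.product-cong (λ l m → cong₂ (λ a b → linear a b m) (sym (Bool.not-involutive (I l (σ l)))) (arc l)) e)
      (product-monomials (nonfixed σ) (λ i → A i (σ i)) e)
      where
      arc : ∀ l → A l (σ l) ≡ nonfixed σ l ∧ A l (σ l)
      arc l with l ≟ σ l
      ... | yes eq = trans (cong (A l) (sym eq)) (loopless G l)
      ... | no _   = refl

    D-coefficient : ∀ f (M : S.Mat n) e → S.D f M e ≡ B.Σᶠ (λ σ → f σ ∧ S.prod M σ e)
    D-coefficient f M e = trans
      (sum-coefficient {n ^ n} (λ k → let σ = finToFun k in S.⟦ f σ ⟧ ⊛ S.prod M σ) e)
      (B.Σᶠ-cong (λ σ → ⟦⟧-⊛ (f σ) (S.prod M σ) e))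

    -- Since `u v` is an arc, the entry replaced was exactly `y`, and putting 1 in its place lowers
    -- the degree by one: hence `suc e`.
    row-coefficient : ∀ {u v} → A u v ≡ true → ∀ σ e →
                      S.prod (M S.[ u ]≔ S.δ v) σ e ≡ I v (σ u) ∧ coefficient σ (suc e)
    row-coefficient {u} {v} uv σ e = trans (S.prod-row M u (S.δ v) σ e)
      (trans (⟦⟧-⊛ (I v (σ u)) (S.prod (M S.[ u ]≔ S.ones) σ) e) shifted)
      where
      shifted : I v (σ u) ∧ S.prod (M S.[ u ]≔ S.ones) σ e ≡ I v (σ u) ∧ coefficient σ (suc e)
      shifted with v ≟ σ u
      ... | no _     = refl
      ... | yes refl = begin
        S.prod (M S.[ u ]≔ S.ones) σ e
          ≡⟨ trans (linear-⊛ false true (S.prod (M S.[ u ]≔ S.ones) σ) e) refl ⟨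
        (linear false true ⊛ S.prod (M S.[ u ]≔ S.ones) σ) (suc e)
          ≡⟨ ⊛-cong {g = S.prod (M S.[ u ]≔ S.ones) σ} entry (λ _ → refl) (suc e) ⟨
        (M u (σ u) ⊛ S.prod (M S.[ u ]≔ S.ones) σ) (suc e)
          ≡⟨ S.prod-row M u (M u) σ (suc e) ⟨
        S.prod (M S.[ u ]≔ M u) σ (suc e)
          ≡⟨ S.prod-cong (M S.[ u ]≔ M u) M σ σ (λ l → S.row-self M u l (σ l)) (suc e) ⟩
        S.prod M σ (suc e)
          ≡⟨ prod-coefficient σ (suc e) ⟩
        coefficient σ (suc e) ∎
        where
        open ≡-Reasoning
        entry : M u (σ u) ≗ linear false true
        entry m = cong₂ (λ a b → linear a b m) (dec-false (u ≟ σ u) (arc-≢ uv)) uv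

    degree-positive : ∀ {m} (b : Fin m → Bool) i → b i ≡ true → degree b ≢ 0
    degree-positive b zero    bi eq with b zero
    degree-positive b zero    refl () | true
    degree-positive b (suc i) bi eq = degree-positive (b ∘ suc) i bi (ℕ.m+n≡0⇒n≡0 (bit (b zero)) eq)

    degree-false : ∀ {m} (b : Fin m → Bool) → (∀ i → b i ≡ false) → degree b ≡ 0
    degree-false {zero}  b eq = refl
    degree-false {suc m} b eq rewrite eq zero = degree-false (b ∘ suc) (eq ∘ suc)

    degree-cong : ∀ {m} {b c : Fin m → Bool} → b ≗ c → degree b ≡ degree c
    degree-cong {zero}  eq = refl
    degree-cong {suc m} eq = cong₂ (λ x y → bit x + y) (eq zero) (degree-cong (eq ∘ suc))

    implies-cong : ∀ {m} {b b′ c c′ : Fin m → Bool} → b ≗ b′ → c ≗ c′ → implies b c ≡ implies b′ c′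
    implies-cong {zero}  p q = refl
    implies-cong {suc m} p q =
      cong₂ _∧_ (cong₂ (λ x y → not x ∨ y) (p zero) (q zero)) (implies-cong (p ∘ suc) (q ∘ suc))

    coefficient-cong : ∀ {σ τ} → σ ≗ τ → coefficient σ ≗ coefficient τ
    coefficient-cong eq e = cong₂ _∧_
      (implies-cong (λ i → cong (λ x → not (I i x)) (eq i)) (λ i → cong (A i) (eq i)))
      (cong (e ≡ᵇ_) (degree-cong (λ i → cong (λ x → not (I i x)) (eq i))))

    ≡ᵇ-false : ∀ e m → e ≢ m → (e ≡ᵇ m) ≡ false
    ≡ᵇ-false zero    zero    e≢m = contradiction refl e≢m
    ≡ᵇ-false zero    (suc m) e≢m = refl
    ≡ᵇ-false (suc e) zero    e≢m = refl
    ≡ᵇ-false (suc e) (suc m) e≢m = ≡ᵇ-false e m (e≢m ∘ cong suc)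

    -- The identity is the only map that moves no point, so it alone contributes a constant term.
    d-unit : S.d M 0 ≡ true
    d-unit = begin
      S.d M 0
        ≡⟨ D-coefficient S.injᵇ M 0 ⟩
      B.Σᶠ (λ σ → S.injᵇ σ ∧ S.prod M σ 0)
        ≡⟨ B.Σᶠ-cong (λ σ → cong (S.injᵇ σ ∧_) (prod-coefficient σ 0)) ⟩
      B.Σᶠ (λ σ → S.injᵇ σ ∧ coefficient σ 0)
        ≡⟨ B.Σᶠ-single (λ eq → cong₂ _∧_ (S.injᵇ-cong eq) (coefficient-cong eq 0)) id moves ⟩
      S.injᵇ {n} id ∧ coefficient id 0
        ≡⟨ cong₂ _∧_ (S.injᵇ-complete {n} id id) (cong₂ _∧_ (implies-complete (nonfixed id) _ fixed)
             (cong (0 ≡ᵇ_) (degree-false (nonfixed id) (λ i → cong not (dec-true (i ≟ i) refl))))) ⟩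
      true ∎
      where
      open ≡-Reasoning
      fixed : ∀ i → nonfixed id i ≡ true → A i i ≡ true
      fixed i p with i ≟ i
      ... | no ¬p = contradiction refl ¬p
      moves : ∀ τ → ∃[ i ] τ i ≢ i → S.injᵇ τ ∧ coefficient τ 0 ≡ false
      moves τ (i , τi≢i) = trans (cong (S.injᵇ τ ∧_) (trans
        (cong (implies (nonfixed τ) (λ i → A i (τ i)) ∧_)
          (≡ᵇ-false 0 _ (λ eq → degree-positive (nonfixed τ) i
             (cong not (dec-false (i ≟ τ i) (λ eq → τi≢i (sym eq)))) (sym eq))))
        (Bool.∧-zeroʳ (implies (nonfixed τ) (λ i → A i (τ i))))))
        (Bool.∧-zeroʳ (S.injᵇ τ))

    Σᶠ-false : ∀ {g : (Fin n → Fin n) → Bool} → (∀ σ → g σ ≡ false) → B.Σᶠ g ≡ false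
    Σᶠ-false eq = B.sum-zero {n ^ n} (λ k → eq (finToFun k))

    -- By hypothesis `h` vanishes up to degree `k`, so there `gradient` reduces to H = d X, and `d`
    -- is a unit. Differentiation lowers degrees by one, whence `suc k`: when a shortest even cycle
    -- exists, `k` will be its length minus one.
    lowest-coefficient : ∀ k →
      (∀ σ → S.oddᵇ σ ≡ true → ∀ e → e ≤ k → coefficient σ e ≡ false) →
      ∀ u v → A u v ≡ true →
      (∀ e → e < k → X e u v ≡ false) ×
      X k u v ≡ B.Σᶠ (λ σ → S.oddᵇ σ ∧ (I v (σ u) ∧ coefficient σ (suc k)))
    lowest-coefficient k none u v uv =
      let below , top = lowest (S.d M) (Z u v) k d-unit (λ e e<k → trans (dZ e (ℕ.<⇒≤ e<k)) (H-low e e<k))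
      in below , trans (sym top) (trans (dZ k ℕ.≤-refl) (H-coefficient k))
      where
      H : Series
      H = S.h (M S.[ u ]≔ S.δ v)
      H-coefficient : ∀ e → H e ≡ B.Σᶠ (λ σ → S.oddᵇ σ ∧ (I v (σ u) ∧ coefficient σ (suc e)))
      H-coefficient e = trans (D-coefficient S.oddᵇ (M S.[ u ]≔ S.δ v) e)
        (B.Σᶠ-cong (λ σ → cong (S.oddᵇ σ ∧_) (row-coefficient uv σ e)))
      H-low : ∀ e → e < k → H e ≡ false
      H-low e e<k = trans (H-coefficient e) (Σᶠ-false term)
        where
        term : ∀ σ → S.oddᵇ σ ∧ (I v (σ u) ∧ coefficient σ (suc e)) ≡ false
        term σ with S.oddᵇ σ in odd
        ... | false = refl
        ... | true  = trans (cong (I v (σ u) ∧_) (none σ odd (suc e) e<k)) (Bool.∧-zeroʳ (I v (σ u)))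
      h-low : ∀ e → e < suc k → S.h M e ≡ false
      h-low e e≤k = trans (D-coefficient S.oddᵇ M e) (Σᶠ-false term)
        where
        term : ∀ σ → S.oddᵇ σ ∧ S.prod M σ e ≡ false
        term σ with S.oddᵇ σ in odd
        ... | false = refl
        ... | true  = trans (prod-coefficient σ e) (none σ odd e (s≤s⁻¹ e≤k))
      dZ : ∀ e → e ≤ k → (S.d M ⊛ Z u v) e ≡ H e
      dZ e e≤k = begin
        (S.d M ⊛ Z u v) e
          ≡⟨ B.solve 2 (λ x y → x B.:= y B.:+ B.con false B.:+ x B.:+ y) refl ((S.d M ⊛ Z u v) e) (H e) ⟩
        ((H e xor false) xor (S.d M ⊛ Z u v) e) xor H e
          ≡⟨ cong (λ x → ((H e xor x) xor (S.d M ⊛ Z u v) e) xor H e)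
               (low-⊛ (S.h M) (N v u) (suc k) h-low e (s≤s e≤k)) ⟨
        ((H e xor (S.h M ⊛ N v u) e) xor (S.d M ⊛ Z u v) e) xor H e
          ≡⟨ cong (_xor H e) (S.gradient M N NM MN Z MᵀZMᵀ u v e) ⟩
        H e ∎
        where open ≡-Reasoning

-- Cycles of a digraph and cycles of permutations.

module Cycles where

  open import Data.Bool.Base using (Bool; true; false; not; _xor_; _∧_; if_then_else_)
  import Data.Bool.Properties as Bool
  open import Data.Fin.Base using (Fin; zero; suc)
  open import Data.Fin.Properties as Fin using (_≟_)
  import Data.Fin.Permutation.Components as PC
  open import Data.List.Base using (List; []; _∷_; [_]; _++_; length; map; zip)
  import Data.List.Properties as List
  open import Data.List.Membership.Propositional using (_∈_; _∉_)
  open import Data.List.Membership.Propositional.Properties using (∈-++⁻; ∈-∃++)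
  open import Data.List.Relation.Unary.All as All using (All; []; _∷_)
  import Data.List.Relation.Unary.All.Properties as All
  open import Data.List.Relation.Unary.AllPairs using ([]; _∷_)
  open import Data.List.Relation.Unary.Any using (here; there)
  open import Data.List.Relation.Unary.Unique.Propositional using (Unique)
  import Data.List.Relation.Unary.Unique.Propositional.Properties as Unique
  open import Data.List.Relation.Binary.Permutation.Propositional using (_↭_; ↭-sym)
  open import Data.List.Relation.Binary.Permutation.Propositional.Properties using (∷↭∷ʳ; ∈-resp-↭; All-resp-↭)
  open import Data.Nat.Base using (ℕ; zero; suc; _<_; _≤_; z≤n; s≤s; _≡ᵇ_)
  open import Data.Nat.Divisibility using (_∣_; divides)
  import Data.Nat.Properties as ℕ
  open import Data.Nat.Induction using (<-wellFounded)
  open import Data.Product.Base using (_×_; _,_; proj₁; proj₂; ∃; ∃-syntax)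
  open import Data.Sum.Base using (inj₁; inj₂)
  open import Function.Base using (_∘_; case_of_)
  open import Function.Bundles using (Equivalence)
  open import Induction.WellFounded using (Acc; acc)
  open import Relation.Binary.PropositionalEquality hiding ([_])
  open import Relation.Nullary using (yes; no; does; ¬_; contradiction)
  open import Relation.Nullary.Decidable using (dec-true; dec-false)
  open Parity
  open Series using (degree; bit)

  module _ {n : ℕ} where
    open import Data.List.Membership.DecPropositional (_≟_ {n}) using (_∈?_) public

  -- Arcs of a cycle

  -- An end independent of the start makes the arcs of a cycle accessible to induction;
  -- `arcs (u ∷ us)` is the case where both are `u`.
  path : ∀ {A : Set} → A → List A → A → List (A × A)
  path u []       e = [ (u , e) ]
  path u (w ∷ ws) e = (u , w) ∷ path w ws e

  arcs-path : ∀ {n} (u : Fin n) us → arcs (u ∷ us) ≡ path u us u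
  arcs-path u us = lemma u us
    where
    lemma : ∀ v vs → zip (v ∷ vs) (vs ++ [ u ]) ≡ path v vs u
    lemma v []       = refl
    lemma v (w ∷ ws) = cong ((v , w) ∷_) (lemma w ws)

  path-snoc : ∀ {A : Set} (u : A) ws x e → path u (ws ++ [ x ]) e ≡ path u ws x ++ [ (x , e) ]
  path-snoc u []       x e = refl
  path-snoc u (w ∷ ws) x e = cong ((u , w) ∷_) (path-snoc w ws x e)

  module _ {n : ℕ} where

    rotate-arcs : ∀ (u : Fin n) us → arcs (u ∷ us) ↭ arcs (us ++ [ u ])
    rotate-arcs u [] = _↭_.refl
    rotate-arcs u (w ∷ ws)
      rewrite arcs-path u (w ∷ ws) | arcs-path w (ws ++ [ u ]) | path-snoc w ws u w
      = ∷↭∷ʳ (u , w) (path w ws u)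

    unique-snoc : ∀ {u : Fin n} {us} → Unique (u ∷ us) → Unique (us ++ [ u ])
    unique-snoc (u∉us ∷ us!) = Unique.++⁺ us! ([] ∷ []) λ where
      (u∈us , here refl) → All.lookup u∉us u∈us refl

    record Rotation (G : Digraph n) (c c′ : List (Fin n)) : Set where
      field
        cycle  : IsCycle G c → IsCycle G c′
        size   : length c′ ≡ length c
        to     : ∀ {a} → a ∈ arcs c → a ∈ arcs c′
        from   : ∀ {a} → a ∈ arcs c′ → a ∈ arcs c

    rotate₁ : ∀ {G} u us → Rotation G (u ∷ us) (us ++ [ u ])
    rotate₁ u us = record
      { cycle = λ C → let open IsCycle C in record
        { nonempty = λ eq → case trans (sym (List.length-++ us)) (cong length eq) of λ p →
            contradiction (trans (ℕ.+-comm 1 (length us)) p) λ ()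
        ; simple   = unique-snoc simple
        ; closed   = All-resp-↭ (rotate-arcs u us) closed
        }
      ; size = trans (List.length-++ us) (ℕ.+-comm (length us) 1)
      ; to   = ∈-resp-↭ (rotate-arcs u us)
      ; from = ∈-resp-↭ (↭-sym (rotate-arcs u us))
      }

    rotate : ∀ {G} ps qs → Rotation G (ps ++ qs) (qs ++ ps)
    rotate [] qs rewrite List.++-identityʳ qs =
      record { cycle = λ C → C ; size = refl ; to = λ a∈ → a∈ ; from = λ a∈ → a∈ }
    rotate {G} (p ∷ ps) qs = record
      { cycle = R₂.cycle ∘ R₁.cycle
      ; size  = trans R₂.size R₁.size
      ; to    = R₂.to ∘ R₁.to
      ; from  = R₁.from ∘ R₂.from
      }
      where
      R₁ : Rotation G (p ∷ ps ++ qs) (ps ++ (qs ++ [ p ]))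
      R₁ = subst (Rotation G (p ∷ ps ++ qs)) (List.++-assoc ps qs [ p ]) (rotate₁ p (ps ++ qs))
      R₂ : Rotation G (ps ++ (qs ++ [ p ])) (qs ++ p ∷ ps)
      R₂ = subst (Rotation G (ps ++ (qs ++ [ p ]))) (List.++-assoc qs [ p ] ps) (rotate ps (qs ++ [ p ]))
      module R₁ = Rotation R₁
      module R₂ = Rotation R₂

    out-arc : ∀ {u : Fin n} {us e y} → y ∈ u ∷ us → ∃[ b ] (y , b) ∈ path u us e
    out-arc {us = []}     (here refl) = _ , here refl
    out-arc {us = w ∷ us} (here refl) = _ , here refl
    out-arc {us = w ∷ us} (there y∈)  = let b , p = out-arc y∈ in b , there p

    source : ∀ {u : Fin n} {us e y b} → (y , b) ∈ path u us e → y ∈ u ∷ us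
    source {us = []}     (here refl) = here refl
    source {us = w ∷ us} (here refl) = here refl
    source {us = w ∷ us} (there p)   = there (source p)

    target : ∀ {u : Fin n} {us e y b} → (y , b) ∈ path u us e → b ∈ us ++ [ e ]
    target {us = []}     (here refl) = here refl
    target {us = w ∷ us} (here refl) = here refl
    target {us = w ∷ us} (there p)   = there (target p)

    cyclic-target : ∀ {u : Fin n} {us y b} → (y , b) ∈ path u us u → b ∈ u ∷ us
    cyclic-target {us = us} p with ∈-++⁻ us (target p)
    ... | inj₁ b∈us       = there b∈us
    ... | inj₂ (here eq)  = here eq

    functional : ∀ {u : Fin n} {us e y b b′} → Unique (u ∷ us) →
                 (y , b) ∈ path u us e → (y , b′) ∈ path u us e → b ≡ b′
    functional {us = []}     _ (here refl) (here refl) = refl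
    functional {us = w ∷ us} _ (here refl) (here refl) = refl
    functional {us = w ∷ us} (u∉ ∷ _) (here refl) (there q) = contradiction refl (All.lookup u∉ (source q))
    functional {us = w ∷ us} (u∉ ∷ _) (there p) (here refl) = contradiction refl (All.lookup u∉ (source p))
    functional {us = w ∷ us} (_ ∷ us!) (there p) (there q) = functional us! p q

    injective : ∀ {u : Fin n} {us e y y′ b} → Unique (us ++ [ e ]) →
                (y , b) ∈ path u us e → (y′ , b) ∈ path u us e → y ≡ y′
    injective {us = []}     _ (here refl) (here refl) = refl
    injective {us = w ∷ us} _ (here refl) (here refl) = refl
    injective {us = w ∷ us} (w∉ ∷ _) (here refl) (there q) = contradiction refl (All.lookup w∉ (target q))
    injective {us = w ∷ us} (w∉ ∷ _) (there p) (here refl) = contradiction refl (All.lookup w∉ (target p))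
    injective {us = w ∷ us} (_ ∷ us!) (there p) (there q) = injective us! p q

    path-irreflexive : ∀ {u : Fin n} {us e} → Unique (u ∷ us) → All (_≢ e) (u ∷ us) →
                       All (λ (a , b) → a ≢ b) (path u us e)
    path-irreflexive {us = []}     _ (u≢e ∷ []) = u≢e ∷ []
    path-irreflexive {us = w ∷ us} ((u≢w ∷ _) ∷ us!) (_ ∷ us≢e) = u≢w ∷ path-irreflexive us! us≢e

    cycle-irreflexive : ∀ {u w : Fin n} {us} → Unique (u ∷ w ∷ us) →
                        All (λ (a , b) → a ≢ b) (path u (w ∷ us) u)
    cycle-irreflexive ((u≢w ∷ u∉us) ∷ us!) =
      u≢w ∷ path-irreflexive us! ((u≢w ∘ sym) ∷ All.map (_∘ sym) u∉us)

  -- Counting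

  bit-mono : ∀ x y → (y ≡ true → x ≡ true) → bit y ≤ bit x
  bit-mono x     false _ = z≤n
  bit-mono x true  p rewrite p refl = ℕ.≤-refl

  degree-mono : ∀ {n} {b c : Fin n → Bool} → (∀ i → c i ≡ true → b i ≡ true) → degree c ≤ degree b
  degree-mono {zero}  imp = z≤n
  degree-mono {suc n} {b} {c} imp =
    ℕ.+-mono-≤ (bit-mono (b zero) (c zero) (imp zero)) (degree-mono (imp ∘ suc))

  degree-strict : ∀ {n} {b c : Fin n → Bool} w → (∀ i → c i ≡ true → b i ≡ true) →
                  b w ≡ true → c w ≡ false → degree c < degree b
  degree-strict zero imp bw cw rewrite bw | cw = s≤s (degree-mono (imp ∘ suc))
  degree-strict {b = b} {c} (suc w) imp bw cw =
    ℕ.+-mono-≤-< (bit-mono (b zero) (c zero) (imp zero)) (degree-strict w (imp ∘ suc) bw cw)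

  without : ∀ {n} → (Fin n → Bool) → Fin n → Fin n → Bool
  without b x i = b i ∧ not (does (x ≟ i))

  without-⊆ : ∀ {n} {b : Fin n → Bool} x i → without b x i ≡ true → b i ≡ true
  without-⊆ {b = b} x i p with b i
  ... | true = refl

  without-self : ∀ {n} {b : Fin n → Bool} x → without b x x ≡ false
  without-self {b = b} x rewrite dec-true (x ≟ x) refl = Bool.∧-zeroʳ (b x)

  without-other : ∀ {n} {b : Fin n → Bool} {x i} → x ≢ i → without b x i ≡ b i
  without-other {b = b} {x} {i} x≢i rewrite dec-false (x ≟ i) x≢i = Bool.∧-identityʳ (b i)

  degree-without : ∀ {n} (b : Fin n → Bool) x → degree b ≤ suc (degree (without b x))
  degree-without b zero with b zero
  ... | true  = s≤s (degree-mono (λ i p → trans (Bool.∧-identityʳ (b (suc i))) p))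
  ... | false = ℕ.m≤n⇒m≤1+n (degree-mono (λ i p → trans (Bool.∧-identityʳ (b (suc i))) p))
  degree-without b (suc x) rewrite Bool.∧-identityʳ (b zero) =
    ℕ.≤-trans (ℕ.+-monoʳ-≤ (bit (b zero)) (degree-without (b ∘ suc) x))
      (ℕ.≤-reflexive (ℕ.+-suc (bit (b zero)) _))

  unique-length : ∀ {n} (b : Fin n → Bool) c → Unique c → All (λ x → b x ≡ true) c → length c ≤ degree b
  unique-length b []      _           _          = z≤n
  unique-length b (x ∷ c) (x∉c ∷ c!) (bx ∷ bc) = ℕ.≤-trans
    (s≤s (unique-length (without b x) c c! (All.zipWith (λ (x≢y , by) → trans (without-other {b = b} x≢y) by) (x∉c , bc))))
    (degree-strict x (without-⊆ {b = b} x) bx (without-self {b = b} x))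

  cover-length : ∀ {n} (b : Fin n → Bool) c → (∀ x → b x ≡ true → x ∈ c) → degree b ≤ length c
  cover-length {n} b [] cover = ℕ.≤-trans
    (degree-mono {b = λ _ → false} (λ i bi → case cover i bi of λ ())) (ℕ.≤-reflexive (none n))
    where
    none : ∀ n → degree {n} (λ _ → false) ≡ 0
    none zero    = refl
    none (suc n) = none n
  cover-length b (x ∷ c) cover = ℕ.≤-trans (degree-without b x) (s≤s (cover-length (without b x) c step))
    where
    step : ∀ y → without b x y ≡ true → y ∈ c
    step y p with cover y (without-⊆ {b = b} x y p)
    ... | there y∈c = y∈c
    ... | here refl = contradiction (trans (sym p) (without-self {b = b} y)) λ ()

  -- Pigeonhole: a missed element could be put in front, and the list without repetitions would be
  -- longer than the number of marked elements.
  full-cover : ∀ {n} (b : Fin n → Bool) c → Unique c → All (λ x → b x ≡ true) c →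
               degree b ≤ length c → ∀ x → b x ≡ true → x ∈ c
  full-cover b c c! bc le x bx with x ∈? c
  ... | yes x∈c = x∈c
  ... | no x∉c = contradiction
    (ℕ.≤-trans (unique-length b (x ∷ c) (All.¬Any⇒All¬ c x∉c ∷ c!) (bx ∷ bc)) le)
    (ℕ.<-irrefl refl)

  degree-≤ : ∀ {n} (b : Fin n → Bool) → degree b ≤ n
  degree-≤ {zero}  b = z≤n
  degree-≤ {suc n} b with b zero
  ... | true  = s≤s (degree-≤ (b ∘ suc))
  ... | false = ℕ.m≤n⇒m≤1+n (degree-≤ (b ∘ suc))

  parity : ℕ → Bool
  parity zero    = false
  parity (suc m) = not (parity m)

  parity-even : ∀ m → parity m ≡ false → 2 ∣ m
  parity-even zero          _ = divides 0 refl
  parity-even (suc (suc m)) p with parity-even m (trans (sym (not-not (parity m))) p)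
  ... | divides q eq = divides (suc q) (cong (λ m → suc (suc m)) eq)

  even-parity : ∀ m → 2 ∣ m → parity m ≡ false
  even-parity _ (divides q refl) = lemma q
    where
    lemma : ∀ q → parity (q Data.Nat.Base.* 2) ≡ false
    lemma zero    = refl
    lemma (suc q) = trans (not-not _) (lemma q)

  -- Cycles of an injective map

  module _ {n : ℕ} where

    moved : (Fin n → Fin n) → Fin n → Bool
    moved σ i = not (does (i ≟ σ i))

    moved-true : ∀ {σ i} → σ i ≢ i → moved σ i ≡ true
    moved-true {σ} {i} p = cong not (dec-false (i ≟ σ i) (p ∘ sym))

    moved-false : ∀ {σ i} → σ i ≡ i → moved σ i ≡ false
    moved-false {σ} {i} p = cong not (dec-true (i ≟ σ i) (sym p))

    moved-≢ : ∀ {σ i} → moved σ i ≡ true → σ i ≢ i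
    moved-≢ {σ} {i} p eq = contradiction (trans (sym p) (moved-false {σ} eq)) λ ()

    Follows : (Fin n → Fin n) → Fin n × Fin n → Set
    Follows σ (a , b) = σ a ≡ b

    -- The induction step for statements about cycles of `σ`: one transposition flips the parity,
    -- lowers the number of moved points and takes only `w` out of the cycle through `u`.
    module Contract (σ : Fin n → Fin n) (inj : Inj σ) {u} (σu≢u : σ u ≢ u) where
      w = σ u

      -- Short-cuts u → w → σ w to u → σ w and fixes w.
      contracted : Fin n → Fin n
      contracted = σ ∘ PC.transpose u w

      contracted-inj : Inj contracted
      contracted-inj = ∘-inj {σ = σ} inj (transpose-injective u w)

      at-u : contracted u ≡ σ w
      at-u = cong σ (transpose-ˡ u w)

      at-w : contracted w ≡ w
      at-w = cong σ (transpose-ʳ u w)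

      elsewhere : ∀ {x} → x ≢ u → x ≢ w → contracted x ≡ σ x
      elsewhere x≢u x≢w = cong σ (transpose-≢ u w x≢u x≢w)

      flips : odd contracted ≡ not (odd σ)
      flips = odd-transpose σ inj (σu≢u ∘ sym)

      σw≢w : σ w ≢ w
      σw≢w = σu≢u ∘ inj

      decreases : degree (moved contracted) < degree (moved σ)
      decreases = degree-strict w ⊆ (moved-true {σ} σw≢w) (moved-false {contracted} at-w)
        where
        ⊆ : ∀ x → moved contracted x ≡ true → moved σ x ≡ true
        ⊆ x p = case (x ≟ u) of λ where
          (yes refl) → moved-true {σ} σu≢u
          (no x≢u) → case (x ≟ w) of λ where
            (yes refl) → moved-true {σ} σw≢w
            (no x≢w) → trans (cong (λ y → not (does (x ≟ y))) (sym (elsewhere x≢u x≢w))) p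

      follow-back : ∀ {us e} → All (λ x → x ≢ u × x ≢ w) us →
                    All (Follows contracted) (path u us e) → All (Follows σ) (path w us e)
      follow-back {[]}     _ (p ∷ []) = trans (sym at-u) p ∷ []
      follow-back {x ∷ us} ok (p ∷ ps) = trans (sym at-u) p ∷ same ok ps
        where
        same : ∀ {x us e} → All (λ x → x ≢ u × x ≢ w) (x ∷ us) →
               All (Follows contracted) (path x us e) → All (Follows σ) (path x us e)
        same {us = []}     ((a , b) ∷ []) (p ∷ []) = trans (sym (elsewhere a b)) p ∷ []
        same {us = _ ∷ us} ((a , b) ∷ ok) (p ∷ ps) = trans (sym (elsewhere a b)) p ∷ same ok ps

      follow-on : ∀ {us e} → All (λ x → x ≢ u × x ≢ w) us →
                  All (Follows σ) (path w us e) → All (Follows contracted) (path u us e)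
      follow-on {[]}     _ (p ∷ []) = trans at-u p ∷ []
      follow-on {x ∷ us} ok (p ∷ ps) = trans at-u p ∷ same ok ps
        where
        same : ∀ {x us e} → All (λ x → x ≢ u × x ≢ w) (x ∷ us) →
               All (Follows σ) (path x us e) → All (Follows contracted) (path x us e)
        same {us = []}     ((a , b) ∷ []) (p ∷ []) = trans (elsewhere a b) p ∷ []
        same {us = _ ∷ us} ((a , b) ∷ ok) (p ∷ ps) = trans (elsewhere a b) p ∷ same ok ps

    record Orbit (σ : Fin n → Fin n) (u : Fin n) : Set where
      field
        rest    : List (Fin n)
        unique  : Unique (u ∷ rest)
        follows : All (Follows σ) (path u rest u)
        moving  : All (λ x → σ x ≢ x) rest

    -- Induction on the number of moved points replaces iterating `σ` until it returns: the orbit of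
    -- `u` under the contracted map lacks only `w`, which is put back right after `u`. That `w` is
    -- fixed there, while the other points of the orbit are moved, shows that it is new.
    orbit : ∀ σ → Inj σ → ∀ u → Orbit σ u
    orbit σ inj u = go σ inj (<-wellFounded _)
      where
      go : ∀ σ → Inj σ → Acc _<_ (degree (moved σ)) → Orbit σ u
      go σ inj (acc smaller) with σ u ≟ u
      ... | yes σu≡u = record { rest = [] ; unique = [] ∷ [] ; follows = σu≡u ∷ [] ; moving = [] }
      ... | no σu≢u = record
        { rest    = w ∷ rest
        ; unique  = ((σu≢u ∘ sym) ∷ AllPairs-head unique) ∷ (All.map (λ (_ , x≢w) → x≢w ∘ sym) apart ∷ AllPairs-tail unique)
        ; follows = refl ∷ follow-back apart follows
        ; moving  = σw≢w ∷ All.zipWith (λ ((x≢u , x≢w) , p) → p ∘ trans (elsewhere x≢u x≢w)) (apart , moving)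
        }
        where
        open Contract σ inj σu≢u
        open Orbit (go contracted contracted-inj (smaller decreases))
        AllPairs-head : ∀ {x : Fin n} {xs} → Unique (x ∷ xs) → All (x ≢_) xs
        AllPairs-head (p ∷ _) = p
        AllPairs-tail : ∀ {x : Fin n} {xs} → Unique (x ∷ xs) → Unique xs
        AllPairs-tail (_ ∷ p) = p
        apart : All (λ x → x ≢ u × x ≢ w) rest
        apart = All.zipWith (λ (u≢x , p) → u≢x ∘ sym , λ { refl → p at-w }) (AllPairs-head unique , moving)

    -- The result of dissolving the cycle `c` into fixed points by `flips` transpositions. A cycle
    -- takes one fewer than its length, so dissolving an even cycle changes the parity and
    -- dissolving an odd one does not.
    record Flattened (σ : Fin n → Fin n) (c : List (Fin n)) (flips : ℕ) : Set where
      field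
        map′      : Fin n → Fin n
        injective′ : Inj map′
        inside    : ∀ {x} → x ∈ c → map′ x ≡ x
        outside   : ∀ {x} → x ∉ c → map′ x ≡ σ x
        sign      : odd map′ ≡ odd σ xor parity flips

    flatten : ∀ us σ u → Inj σ → Unique (u ∷ us) → All (Follows σ) (path u us u) →
              Flattened σ (u ∷ us) (length us)
    flatten [] σ u inj _ (σu≡u ∷ []) = record
      { map′ = σ ; injective′ = inj
      ; inside = λ { (here refl) → σu≡u }
      ; outside = λ _ → refl ; sign = sym (Bool.xor-identityʳ (odd σ)) }
    flatten (w ∷ us) σ u inj ((u≢w ∷ u∉us) ∷ (w∉us ∷ us!)) (refl ∷ ps) = record
      { map′ = map′ ; injective′ = injective′
      ; inside = λ where
          (here refl) → inside (here refl)
          (there (here refl)) → trans (outside w∉) at-w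
          (there (there x∈us)) → inside (there x∈us)
      ; outside = λ {x} x∉ → trans
          (outside (λ { (here eq) → x∉ (here eq) ; (there x∈) → x∉ (there (there x∈)) }))
          (elsewhere (x∉ ∘ here) (x∉ ∘ there ∘ here))
      ; sign = trans sign (trans (cong (_xor parity (length us)) flips) (flip-xor (odd σ) (parity (length us))))
      }
      where
      open Contract σ inj (u≢w ∘ sym) hiding (w)
      apart : All (λ x → x ≢ u × x ≢ w) us
      apart = All.zipWith (λ (p , q) → p ∘ sym , q ∘ sym) (u∉us , w∉us)
      open Flattened (flatten us contracted u contracted-inj (u∉us ∷ us!) (follow-on apart ps))
      w∉ : w ∉ u ∷ us
      w∉ (here eq)  = u≢w (sym eq)
      w∉ (there w∈) = All.lookup w∉us w∈ refl
      flip-xor : ∀ a b → not a xor b ≡ a xor not b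
      flip-xor true  true  = refl
      flip-xor true  false = refl
      flip-xor false true  = refl
      flip-xor false false = refl

    record EvenOrbit (σ : Fin n → Fin n) : Set where
      field
        start   : Fin n
        rest    : List (Fin n)
        unique  : Unique (start ∷ rest)
        follows : All (Follows σ) (path start rest start)
        -- `rest` lacks the start, so its length is odd when that of the cycle is even.
        even    : parity (length rest) ≡ true

      moves : ∀ {y} → y ∈ start ∷ rest → σ y ≢ y
      moves y∈ σy≡y with rest | unique | follows | even
      ... | w ∷ us | u! | fs | _ =
        let b , p = out-arc y∈ in
        All.lookup (cycle-irreflexive u!) p (trans (sym σy≡y) (All.lookup fs p))

    -- Dissolving a cycle of odd length keeps the parity and lowers the number of moved points; if
    -- there were no others, the identity would end up odd. A cycle found later consists of points
    -- moved by `map′`, so it avoids the dissolved one and is a cycle of `σ` itself.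
    even-orbit : ∀ σ → Inj σ → odd σ ≡ true → EvenOrbit σ
    even-orbit σ inj odd-σ = go σ inj odd-σ (<-wellFounded _)
      where
      go : ∀ σ → Inj σ → odd σ ≡ true → Acc _<_ (degree (moved σ)) → EvenOrbit σ
      go σ inj odd-σ (acc smaller) with Fin.all? (λ i → σ i ≟ i)
      ... | yes id = contradiction (trans (sym odd-σ) (odd-id σ id)) λ ()
      ... | no ¬id with Fin.¬∀⟶∃¬ n _ (λ i → σ i ≟ i) ¬id
      ... | u , σu≢u with orbit σ inj u
      ... | O with parity (length (Orbit.rest O)) in even
      ... | true = record { start = u ; rest = rest ; unique = unique ; follows = follows ; even = even }
        where open Orbit O
      ... | false = record
        { start = E.start ; rest = E.rest ; unique = E.unique ; even = E.even
        ; follows = All.tabulate λ {(a , b)} p →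
            trans (sym (unaffected (source p))) (All.lookup E.follows p) }
        where
        open Orbit O
        open Flattened (flatten rest σ u inj unique follows)
        σ-moves : ∀ {x} → x ∈ u ∷ rest → σ x ≢ x
        σ-moves (here refl) = σu≢u
        σ-moves (there x∈)  = All.lookup moving x∈
        ⊆ : ∀ x → moved map′ x ≡ true → moved σ x ≡ true
        ⊆ x p with x ∈? (u ∷ rest)
        ... | yes x∈ = moved-true {σ} (σ-moves x∈)
        ... | no x∉  = trans (cong (λ y → not (does (x ≟ y))) (sym (outside x∉))) p
        module E = EvenOrbit (go map′ injective′
          (trans sign (trans (cong (odd σ xor_) even) (trans (Bool.xor-identityʳ (odd σ)) odd-σ)))
          (smaller (degree-strict u ⊆ (moved-true {σ} σu≢u) (moved-false {map′} (inside (here refl))))))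
        unaffected : ∀ {x} → x ∈ E.start ∷ E.rest → map′ x ≡ σ x
        unaffected {x} x∈E with x ∈? (u ∷ rest)
        ... | yes x∈ = contradiction (inside x∈) (E.moves x∈E)
        ... | no x∉  = outside x∉

  -- Odd permutations of a digraph

  module _ {n} (G : Digraph n) where
    open Series.Sequences G
    open Series using (module S; module B; implies; implies-sound; implies-complete)

    -- `covers` is the equality case: a cycle with as many vertices as `σ` moves points leaves
    -- nothing else in `σ`.
    record Witness (σ : Fin n → Fin n) (e : ℕ) : Set where
      field
        cycle   : List (Fin n)
        isEven  : IsEvenCycle G cycle
        short   : length cycle ≤ e
        follows : ∀ {a b} → (a , b) ∈ arcs cycle → σ a ≡ b
        covers  : e ≤ length cycle → ∀ x → σ x ≢ x → ∃[ b ] (x , b) ∈ arcs cycle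

    coefficient-sound : ∀ σ e → coefficient σ e ≡ true →
                        (∀ i → σ i ≢ i → A i (σ i) ≡ true) × e ≡ degree (moved σ)
    coefficient-sound σ e eq with implies (moved σ) (λ i → A i (σ i)) in imp | e ≡ᵇ degree (moved σ) in deg
    ... | true | true =
      (λ i p → implies-sound (moved σ) (λ i → A i (σ i)) imp i (moved-true {σ = σ} p)) ,
      ℕ.≡ᵇ⇒≡ e _ (subst Data.Bool.Base.T (sym deg) _)

    -- The even cycle inside an odd permutation is a cycle of the digraph, because a nonzero
    -- coefficient means that all moved points go along arcs; their number is `e`, which bounds the
    -- length.
    witness : ∀ σ e → S.oddᵇ σ ≡ true → coefficient σ e ≡ true → Witness σ e
    witness σ e odd-σ co = record
      { cycle   = start ∷ rest
      ; isEven  = record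
        { nonempty = λ ()
        ; simple   = unique
        ; closed   = subst (All _) (sym (arcs-path start rest))
            (All.tabulate λ {(a , b)} p → subst (λ b → A a b ≡ true) (All.lookup follows p)
               (compatible a (moves (source p)))) }
        , parity-even (length (start ∷ rest)) (cong not even)
      ; short   = subst (length (start ∷ rest) ≤_) (sym e≡) (unique-length (moved σ) (start ∷ rest) unique all-moved)
      ; follows = λ {a} {b} p → All.lookup follows (subst ((a , b) ∈_) (arcs-path start rest) p)
      ; covers  = λ e≤ x p →
          let b , q = out-arc (full-cover (moved σ) (start ∷ rest) unique all-moved
                (subst (_≤ length (start ∷ rest)) e≡ e≤) x (moved-true {σ = σ} p))
          in b , subst ((x , b) ∈_) (sym (arcs-path start rest)) q
      }
      where
      split : Inj σ × odd σ ≡ true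
      split with S.injᵇ σ in p
      ... | true = S.injᵇ-sound σ p , odd-σ
      open EvenOrbit (even-orbit σ (proj₁ split) (proj₂ split))
      compatible = proj₁ (coefficient-sound σ e co)
      e≡ = proj₂ (coefficient-sound σ e co)
      all-moved : All (λ x → moved σ x ≡ true) (start ∷ rest)
      all-moved = All.tabulate (λ y∈ → moved-true {σ = σ} (moves y∈))

    false-if-not : ∀ {b} → ¬ (b ≡ true) → b ≡ false
    false-if-not {true}  p = contradiction refl p
    false-if-not {false} p = refl

    module _ {k} (long : ∀ c → IsEvenCycle G c → k < length c) where

      none : ∀ σ → S.oddᵇ σ ≡ true → ∀ e → e ≤ k → coefficient σ e ≡ false
      none σ odd-σ e e≤k = false-if-not λ co → let open Witness (witness σ e odd-σ co) in
        ℕ.<-irrefl refl (ℕ.<-≤-trans (long cycle isEven) (ℕ.≤-trans short e≤k))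

      no-hit : ∀ e → e < k → ∀ u v → A u v ≡ true → X e u v ≡ false
      no-hit e e<k u v uv = proj₁ (lowest-coefficient k none u v uv) e e<k

    -- The default `y` makes vertices without a listed arc fixed points, so that the arcs of a cycle
    -- define a permutation.
    lookup-arc : Fin n → List (Fin n × Fin n) → Fin n
    lookup-arc y []             = y
    lookup-arc y ((a , b) ∷ ps) = if does (y ≟ a) then b else lookup-arc y ps

    lookup-arc-∈ : ∀ {y b ps} → (∀ {b′} → (y , b′) ∈ ps → b ≡ b′) → (y , b) ∈ ps → lookup-arc y ps ≡ b
    lookup-arc-∈ {y} {b} {(a , b′) ∷ ps} unique p with y ≟ a
    ... | yes refl = sym (unique (here refl))
    ... | no y≢a with p
    ...   | here refl = contradiction refl y≢a
    ...   | there p′  = lookup-arc-∈ (unique ∘ there) p′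

    lookup-arc-∉ : ∀ {y ps} → (∀ {b} → ¬ ((y , b) ∈ ps)) → lookup-arc y ps ≡ y
    lookup-arc-∉ {y} {[]}           ∉ps = refl
    lookup-arc-∉ {y} {(a , b) ∷ ps} ∉ps with y ≟ a
    ... | yes refl = contradiction (here refl) ∉ps
    ... | no _     = lookup-arc-∉ (∉ps ∘ there)

    module Unique-Cycle u us (D-shortest : IsShortestEvenCycle G (u ∷ us))
      (D-unique : ∀ c → IsShortestEvenCycle G c → SameArcs (u ∷ us) c) where

      D = u ∷ us
      k = length us
      D! : Unique D
      D! = IsCycle.simple (proj₁ (proj₁ D-shortest))

      long : ∀ c → IsEvenCycle G c → k < length c
      long = proj₂ D-shortest

      D-arcs : List (Fin n × Fin n)
      D-arcs = path u us u

      -- Rotates the cycle D and fixes everything else.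
      σᴰ : Fin n → Fin n
      σᴰ y = lookup-arc y D-arcs

      σᴰ-∈ : ∀ {y b} → (y , b) ∈ D-arcs → σᴰ y ≡ b
      σᴰ-∈ p = lookup-arc-∈ (functional D! p) p

      σᴰ-∉ : ∀ {y} → y ∉ D → σᴰ y ≡ y
      σᴰ-∉ y∉ = lookup-arc-∉ (y∉ ∘ source)

      D-adjacent : ∀ {a b} → (a , b) ∈ D-arcs → A a b ≡ true
      D-adjacent {a} {b} p = All.lookup (IsCycle.closed (proj₁ (proj₁ D-shortest)))
        (subst ((a , b) ∈_) (sym (arcs-path u us)) p)

      σᴰ-moves : ∀ {y} → y ∈ D → σᴰ y ≢ y
      σᴰ-moves y∈ eq = let b , p = out-arc y∈ in arc-≢ (D-adjacent p) (trans (sym eq) (σᴰ-∈ p))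

      σᴰ-injective : Inj σᴰ
      σᴰ-injective {y} {z} eq with y ∈? D | z ∈? D
      ... | yes y∈ | yes z∈ = let b , p = out-arc y∈ ; b′ , q = out-arc z∈ in
        injective (unique-snoc D!) p
          (subst (λ b → (z , b) ∈ D-arcs) (trans (sym (σᴰ-∈ q)) (trans (sym eq) (σᴰ-∈ p))) q)
      ... | yes y∈ | no z∉ = let b , p = out-arc y∈ in
        contradiction (subst (_∈ D) (trans (sym (σᴰ-∈ p)) (trans eq (σᴰ-∉ z∉))) (cyclic-target p)) z∉
      ... | no y∉ | yes z∈ = let b , q = out-arc z∈ in
        contradiction (subst (_∈ D) (trans (sym (σᴰ-∈ q)) (trans (sym eq) (σᴰ-∉ y∉))) (cyclic-target q)) y∉
      ... | no y∉ | no z∉ = trans (sym (σᴰ-∉ y∉)) (trans eq (σᴰ-∉ z∉))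

      -- Dissolving `D` takes `k` transpositions and leaves the identity; `k` is odd because `suc k`
      -- is the even length of `D`.
      σᴰ-odd : S.oddᵇ σᴰ ≡ true
      σᴰ-odd = cong₂ _∧_ (S.injᵇ-complete σᴰ σᴰ-injective) (xor-true (odd σᴰ) (parity k)
        (trans (sym sign) (odd-id map′ id))
        (trans (sym (not-not (parity k))) (cong not (even-parity (suc k) (proj₂ (proj₁ D-shortest))))))
        where
        along : All (λ (a , b) → σᴰ a ≡ b) D-arcs
        along = All.tabulate λ {(a , b)} p → σᴰ-∈ p
        open Flattened (flatten us σᴰ u σᴰ-injective D! along)
        id : ∀ x → map′ x ≡ x
        id x with x ∈? D
        ... | yes x∈ = inside x∈
        ... | no x∉  = trans (outside x∉) (σᴰ-∉ x∉)
        xor-true : ∀ a b → a xor b ≡ false → b ≡ true → a ≡ true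
        xor-true true b _ _ = refl
        xor-true false true () _
        xor-true false false _ ()

      σᴰ-coefficient : coefficient σᴰ (suc k) ≡ true
      σᴰ-coefficient = cong₂ _∧_
        (implies-complete (moved σᴰ) _ λ i p → let i∈ = moved-∈ i p ; b , q = out-arc i∈ in
          subst (λ b → A i b ≡ true) (sym (σᴰ-∈ q)) (D-adjacent q))
        (≡ᵇ-true (ℕ.≤-antisym
          (unique-length (moved σᴰ) D D! (All.tabulate (λ y∈ → moved-true {σ = σᴰ} (σᴰ-moves y∈))))
          (cover-length (moved σᴰ) D moved-∈)))
        where
        ≡ᵇ-true : ∀ {a b} → a ≡ b → (a ≡ᵇ b) ≡ true
        ≡ᵇ-true {a} {b} eq = Equivalence.to Bool.T-≡ (ℕ.≡⇒≡ᵇ a b eq)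
        moved-∈ : ∀ i → moved σᴰ i ≡ true → i ∈ D
        moved-∈ i p with i ∈? D
        ... | yes i∈ = i∈
        ... | no i∉  = contradiction (σᴰ-∉ i∉) (moved-≢ {σ = σᴰ} p)

      -- The even cycle in `σ` has at most `suc k` arcs, so it is a shortest one and shares its arcs
      -- with `D`. Being as long as the number of moved points, it accounts for all of them.
      only-σᴰ : ∀ σ → S.oddᵇ σ ≡ true → coefficient σ (suc k) ≡ true → ∀ x → σ x ≡ σᴰ x
      only-σᴰ σ odd-σ co x = case (σ x ≟ x) of λ where
          (no σx≢x) → let b , p = covers (long cycle isEven) x σx≢x in
            trans (follows p) (sym (σᴰ-∈ (to-D p)))
          (yes σx≡x) → case (x ∈? D) of λ where
            (yes x∈) → let b , p = out-arc x∈ in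
              contradiction (trans (sym σx≡x) (follows (from-D p))) (arc-≢ (D-adjacent p))
            (no x∉) → trans σx≡x (sym (σᴰ-∉ x∉))
        where
        open Witness (witness σ (suc k) odd-σ co)
        same : SameArcs D cycle
        same = D-unique cycle (isEven , λ c even → ℕ.≤-trans short (long c even))
        to-D : ∀ {a} → a ∈ arcs cycle → a ∈ D-arcs
        to-D {a} p = subst (a ∈_) (arcs-path u us) (Equivalence.from (same a) p)
        from-D : ∀ {a} → a ∈ D-arcs → a ∈ arcs cycle
        from-D {a} p = Equivalence.to (same a) (subst (a ∈_) (sym (arcs-path u us)) p)

      term : Fin n → Fin n → (Fin n → Fin n) → Bool
      term a b σ = S.oddᵇ σ ∧ (I b (σ a) ∧ coefficient σ (suc k))

      term-cong : ∀ a b → B.Respectful (term a b)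
      term-cong a b eq = cong₂ _∧_ (S.oddᵇ-cong eq)
        (cong₂ _∧_ (cong (I b) (eq a)) (coefficient-cong eq (suc k)))

      ∧-true : ∀ {x y} → x ∧ y ≡ true → x ≡ true × y ≡ true
      ∧-true {true} {true} _ = refl , refl

      term-others : ∀ a b τ → ∃[ i ] τ i ≢ σᴰ i → term a b τ ≡ false
      term-others a b τ (i , τi≢) = false-if-not λ p → let p₁ , p₂ = ∧-true {S.oddᵇ τ} p in
        τi≢ (only-σᴰ τ p₁ (proj₂ (∧-true {I b (τ a)} p₂)) i)

      -- The sum in `lowest-coefficient` has a single summand that can be nonzero, that of `σᴰ`.
      X-top : ∀ a b → A a b ≡ true → X k a b ≡ I b (σᴰ a)
      X-top a b ab = begin
        X k a b           ≡⟨ proj₂ (lowest-coefficient k (none long) a b ab) ⟩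
        B.Σᶠ (term a b)   ≡⟨ B.Σᶠ-single {g = term a b} (term-cong a b) σᴰ (term-others a b) ⟩
        term a b σᴰ       ≡⟨ cong₂ (λ x y → x ∧ (I b (σᴰ a) ∧ y)) σᴰ-odd σᴰ-coefficient ⟩
        I b (σᴰ a) ∧ true ≡⟨ Bool.∧-identityʳ _ ⟩
        I b (σᴰ a)        ∎
        where open ≡-Reasoning

      hit-sound : ∀ {a b} → A a b ≡ true → X k a b ≡ true → (a , b) ∈ D-arcs
      hit-sound {a} {b} ab hit = case (a ∈? D) of λ where
          (no a∉)  → contradiction (trans (sym (σᴰ-∉ a∉)) (sym b≡)) (arc-≢ ab)
          (yes a∈) → let b′ , p = out-arc a∈ in
            subst (λ b → (a , b) ∈ D-arcs) (trans (sym (σᴰ-∈ p)) (sym b≡)) p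
        where
        b≡ : b ≡ σᴰ a
        b≡ = S.does-sound (b ≟ σᴰ a) (trans (sym (X-top a b ab)) hit)

      hit-complete : ∀ {a b} → (a , b) ∈ D-arcs → A a b ≡ true × X k a b ≡ true
      hit-complete {a} {b} p = D-adjacent p ,
        trans (X-top a b (D-adjacent p)) (dec-true (b ≟ σᴰ a) (sym (σᴰ-∈ p)))

      k<n : k < n
      k<n = ℕ.≤-trans (unique-length (λ _ → true) D D! (All.tabulate (λ _ → refl))) (degree-≤ (λ _ → true))

      -- The successive vertices of D from a given one on; the last step returns
      -- to the start.
      record Tour (a : Fin n) : Set where
        field
          rest     : List (Fin n)
          size     : length rest ≡ k
          shortest : IsShortestEvenCycle G (a ∷ rest)
          next     : ∀ {x y} → (x , y) ∈ path a rest a → (x , y) ∈ D-arcs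

      -- A rotation of `D`. It is needed because the search may return the source of any hit as the
      -- starting vertex.
      tour : ∀ {a} → a ∈ D → Tour a
      tour {a} a∈ with ∈-∃++ a∈
      ... | ps , qs , eq = record
        { rest     = qs ++ ps
        ; size     = ℕ.suc-injective size′
        ; shortest = (cycle (proj₁ (proj₁ D-shortest)) , subst (2 ∣_) (sym size′) (proj₂ (proj₁ D-shortest)))
                   , λ c even → subst (_≤ length c) (sym size′) (long c even)
        ; next     = λ {x} {y} p → subst ((x , y) ∈_) (arcs-path u us)
                       (from (subst ((x , y) ∈_) (sym (arcs-path a (qs ++ ps))) p))
        }
        where
        R : Rotation G D (a ∷ qs ++ ps)
        R = subst (λ c → Rotation G c (a ∷ qs ++ ps)) (sym eq) (rotate ps (a ∷ qs))
        open Rotation R renaming (size to size′)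

-- The program and its verification.

open import Data.Bool.Base using (Bool; true; false; T; if_then_else_; _xor_; _∧_)
import Data.Bool.Properties as Bool
open import Data.Empty using (⊥)
open import Data.Fin using (#_)
open import Data.Fin.Base using (Fin; zero; suc; toℕ; fromℕ<; combine)
open import Data.Fin.Properties as Fin
  using (toℕ<n; toℕ-injective; toℕ-fromℕ<; toℕ-combine; combine-surjective)
open import Data.Integer.Base as ℤ using (-[1+_]; ∣_∣)
import Data.Integer.Properties as ℤ
open import Data.List.Base
  using (List; []; _∷_; [_]; _++_; length; head; drop; map; concatMap; allFin; tabulate)
open import Data.List.Membership.Propositional using (_∈_)
import Data.List.Properties as List
import Data.List.Relation.Unary.All as All
open import Data.List.Relation.Unary.Any using (here; there)
open import Data.Maybe.Base using (Maybe; just; nothing)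
open import Data.Nat.Base hiding (_/_)
open import Data.Nat.Logarithm using (⌊log₂⌋-mono-≤; ⌊log₂⌊n/2⌋⌋≡⌊log₂n⌋∸1)
open import Data.Nat.Properties
open import Data.Nat.Solver using (module +-*-Solver)
open import Data.Product.Base using (_×_; _,_; proj₁; proj₂; ∃; ∃₂; ∃-syntax; Σ-syntax)
open import Data.Rational.Base as ℚ using (↥_; ↧ₙ_; mkℚ; _/_)
import Data.Rational.Properties as ℚ
open import Data.Sum.Base using (_⊎_; inj₁; inj₂)
open import Data.Unit.Base using (⊤; tt)
open import Function.Base using (_∘_)
open import Function.Bundles using (Equivalence)
open import Relation.Binary.Definitions using (tri<; tri≈; tri>)
open import Relation.Binary.PropositionalEquality hiding ([_]; J)
open import Relation.Nullary using (yes; no; does; ¬_; contradiction)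
open Cycles
open Series using (𝔽₂; bit; BoolMatrix; module Sequences)
open FieldRAM 𝔽₂ using (Store; executeF; run)
open MatrixAlgebra 𝔽₂ using (_·_)

-- Memory updates

module _ {A : Set} where

  ≡ᵇ-refl : ∀ a → (a ≡ᵇ a) ≡ true
  ≡ᵇ-refl zero    = refl
  ≡ᵇ-refl (suc a) = ≡ᵇ-refl a

  ≡ᵇ-≢ : ∀ {a b} → a ≢ b → (a ≡ᵇ b) ≡ false
  ≡ᵇ-≢ {zero}  {zero}  a≢b = contradiction refl a≢b
  ≡ᵇ-≢ {zero}  {suc b} a≢b = refl
  ≡ᵇ-≢ {suc a} {zero}  a≢b = refl
  ≡ᵇ-≢ {suc a} {suc b} a≢b = ≡ᵇ-≢ {a} {b} (a≢b ∘ cong suc)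

  upd-≡ : ∀ (m : Memory A) a {x} → (m [ a ≔ x ]) a ≡ x
  upd-≡ m a rewrite ≡ᵇ-refl a = refl

  upd-≢ : ∀ (m : Memory A) {a b x} → a ≢ b → (m [ a ≔ x ]) b ≡ m b
  upd-≢ m a≢b rewrite ≡ᵇ-≢ a≢b = refl

-- Code in a program

At : List Instr → ℕ → List Instr → Set
At p a []       = ⊤
At p a (i ∷ is) = head (drop a p) ≡ just i × At p (suc a) is

At-++ : ∀ {p} a xs {ys} → At p a (xs ++ ys) → At p a xs × At p (a + length xs) ys
At-++ {p} a [] {ys} at = tt , subst (λ a → At p a ys) (sym (+-identityʳ a)) at
At-++ {p} a (x ∷ xs) {ys} (i , at) =
  let l , r = At-++ (suc a) xs at in
  (i , l) , subst (λ a → At p a ys) (sym (+-suc a (length xs))) r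

At-self : ∀ p → At p 0 p
At-self p = go [] p
  where
  drop-++ : ∀ xs (ys : List Instr) → drop (length xs) (xs ++ ys) ≡ ys
  drop-++ []       ys = refl
  drop-++ (x ∷ xs) ys = drop-++ xs ys
  go : ∀ xs ys → At (xs ++ ys) (length xs) ys
  go xs []       = tt
  go xs (y ∷ ys) = cong head (drop-++ xs (y ∷ ys)) ,
    subst₂ (λ p a → At p a ys) (List.++-assoc xs [ y ] ys)
      (trans (List.length-++ xs) (+-comm (length xs) 1)) (go (xs ++ [ y ]) ys)

-- Jump targets are absolute, so code is emitted for the address where it will lie. Its length must
-- not depend on that address, since forward targets are computed from it.
record Code : Set where
  no-eta-equality
  field
    size  : ℕ
    emit  : ℕ → List Instr
    sized : ∀ a → length (emit a) ≡ size

open Code public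

-- A structured view of the memory

-- Register 0 holds the address G of the arrays and register 1 the number L
-- of arrays; register 2 is scratch.  The variables follow, then the cells up
-- to G, and entry i of array j is kept in cell i * L + j + G.
numVars : ℕ
numVars = 24

firstFree : ℕ
firstFree = 3 + numVars

Var : Set
Var = Fin numVars

reg : Var → ℕ
reg x = 3 + toℕ x

record St : Set where
  constructor st
  field
    var : Memory ℕ
    raw : Memory ℕ
    arr : ℕ → Memory ℕ

open St public

infix 9 _⟨_⟩

_⟨_⟩ : St → Var → ℕ
s ⟨ x ⟩ = var s (toℕ x)

setv : St → Var → ℕ → St
setv s x k = record s { var = var s [ toℕ x ≔ k ] }

seta : St → ℕ → ℕ → ℕ → St
seta s j i k = record s { arr = arr s [ j ≔ arr s j [ i ≔ k ] ] }

setr : St → ℕ → ℕ → St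
setr s a k = record s { raw = raw s [ a ≔ k ] }

data Op : Set where
  cst           : Var → ℕ → Op
  add! sub! mul! : Var → Var → Var → Op
  hlf           : Var → Var → Op
  get put       : Var → Var → Var → Op
  rget rput     : Var → Var → Op

effect : Op → St → St
effect (cst x k)    s = setv s x k
effect (add! x y z) s = setv s x (s ⟨ y ⟩ + s ⟨ z ⟩)
effect (sub! x y z) s = setv s x (s ⟨ y ⟩ ∸ s ⟨ z ⟩)
effect (mul! x y z) s = setv s x (s ⟨ y ⟩ * s ⟨ z ⟩)
effect (hlf x y)    s = setv s x ⌊ s ⟨ y ⟩ /2⌋
effect (get x j i)  s = setv s x (arr s (s ⟨ j ⟩) (s ⟨ i ⟩))
effect (put j i x)  s = seta s (s ⟨ j ⟩) (s ⟨ i ⟩) (s ⟨ x ⟩)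
effect (rget x i)   s = setv s x (raw s (s ⟨ i ⟩))
effect (rput i x)   s = setr s (s ⟨ i ⟩) (s ⟨ x ⟩)

effects : List Op → St → St
effects []       s = s
effects (o ∷ os) s = effects os (effect o s)

address : Var → Var → List Instr
address j i = mul 2 (reg i) 1 ∷ add 2 2 (reg j) ∷ add 2 2 0 ∷ []

emitOp : Op → List Instr
emitOp (cst x k)    = [ const (reg x) k ]
emitOp (add! x y z) = [ add (reg x) (reg y) (reg z) ]
emitOp (sub! x y z) = [ sub (reg x) (reg y) (reg z) ]
emitOp (mul! x y z) = [ mul (reg x) (reg y) (reg z) ]
emitOp (hlf x y)    = [ half (reg x) (reg y) ]
emitOp (get x j i)  = address j i ++ [ load (reg x) 2 ]
emitOp (put j i x)  = address j i ++ [ store 2 (reg x) ]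
emitOp (rget x i)   = [ load (reg x) (reg i) ]
emitOp (rput i x)   = [ store (reg i) (reg x) ]

emitOps : List Op → List Instr
emitOps = concatMap emitOp

ops : List Op → Code
ops os .size    = length (emitOps os)
ops os .emit _  = emitOps os
ops os .sized _ = refl

infixr 4 _⨾_

_⨾_ : Code → Code → Code
(c ⨾ d) .size    = size c + size d
(c ⨾ d) .emit a  = emit c a ++ emit d (a + size c)
(c ⨾ d) .sized a = trans (List.length-++ (emit c a)) (cong₂ _+_ (sized c a) (sized d (a + size c)))

when : Var → Code → Code
when x c .size    = suc (size c)
when x c .emit a  = jz (reg x) (suc a + size c) ∷ emit c (suc a)
when x c .sized a = cong suc (sized c (suc a))

loop : Var → Code → Code
loop x c .size    = suc (size c + 1)
loop x c .emit a  = jz (reg x) (a + suc (size c + 1)) ∷ emit c (suc a) ++ [ jmp a ]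
loop x c .sized a = cong suc (trans (List.length-++ (emit c (suc a))) (cong (_+ 1) (sized c (suc a))))

-- Hoare triples with running times

-- All cells stay below B, and the cells in Out stay zero; OutI describes the
-- latter in terms of array indices.
record Bounds : Set₁ where
  field
    -- `B₁` bounds the stored values, among them array indices; the larger `B` also bounds the
    -- addresses computed from them.
    G L B₁ B  : ℕ
    Out OutI  : ℕ → Set
    free≤G    : firstFree ≤ G
    address<B : ∀ {i j} → i < B₁ → j < L → i * L + j + G < B
    B₁≤B      : B₁ ≤ B
    out-low   : ∀ {a} → a < G → ¬ Out a
    out-array : ∀ {j i} → j < L → Out (i * L + j + G) → OutI i

module Logic (bounds : Bounds) where
  open Bounds bounds

  Good : Memory ℕ → Set
  Good R = (∀ a → R a < B) × (∀ a → Out a → R a ≡ 0)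

  -- Every configuration on the way carries `Good`, since word sizes and space are claimed at all
  -- times and not only at the end.
  data Exec (p : List Instr) : ℕ → Config (Memory ℕ) → Config (Memory ℕ) → Set where
    done : ∀ {a R} → Good R → Exec p 0 (a , R) (a , R)
    tick : ∀ {a R i t c} → Good R → head (drop a p) ≡ just i →
           Exec p t (execute i (a , R)) c → Exec p (suc t) (a , R) c

  infixr 5 _▷_

  _▷_ : ∀ {p t t′ c c′ c″} → Exec p t c c′ → Exec p t′ c′ c″ → Exec p (t + t′) c c″
  done _      ▷ e′ = e′
  tick g f e  ▷ e′ = tick g f (e ▷ e′)

  Good-upd : ∀ {R a x} → Good R → x < B → (Out a → x ≡ 0) → Good (R [ a ≔ x ])
  Good-upd {R} {a} {x} (lt , out) x<B x-out = below , zeros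
    where
    below : ∀ b → (R [ a ≔ x ]) b < B
    below b with a ≟ b
    ... | yes refl = subst (_< B) (sym (upd-≡ R a)) x<B
    ... | no a≢b   = subst (_< B) (sym (upd-≢ R a≢b)) (lt b)
    zeros : ∀ b → Out b → (R [ a ≔ x ]) b ≡ 0
    zeros b ob with a ≟ b
    ... | yes refl = trans (upd-≡ R a) (x-out ob)
    ... | no a≢b   = trans (upd-≢ R a≢b) (out b ob)

  record Wf (s : St) : Set where
    field
      var< : ∀ x → s ⟨ x ⟩ < B₁
      raw< : ∀ a → firstFree ≤ a → a < G → raw s a < B₁
      arr< : ∀ j i → j < L → arr s j i < B₁
      arr0 : ∀ j i → j < L → OutI i → arr s j i ≡ 0

  record Rep (R : Memory ℕ) (s : St) : Set where
    field
      good : Good R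
      R0   : R 0 ≡ G
      R1   : R 1 ≡ L
      vars : ∀ x → R (reg x) ≡ s ⟨ x ⟩
      raws : ∀ a → firstFree ≤ a → a < G → R a ≡ raw s a
      arrs : ∀ j i → j < L → R (i * L + j + G) ≡ arr s j i
      wf   : Wf s
    open Wf wf public

  G≤addr : ∀ i j → G ≤ i * L + j + G
  G≤addr i j = m≤n+m G (i * L + j)

  reg<free : ∀ x → reg x < firstFree
  reg<free x = +-monoʳ-< 3 (toℕ<n x)

  reg<G : ∀ x → reg x < G
  reg<G x = <-≤-trans (reg<free x) free≤G

  ≢-< : ∀ {a b} → a < b → a ≢ b
  ≢-< a<b refl = <-irrefl refl a<b

  -- Uniqueness of quotient and remainder modulo `L`. It is why interleaved arrays cannot collide,
  -- however far each of them extends.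
  addr-injective : ∀ {j i j′ i′} → j < L → j′ < L →
                   i * L + j + G ≡ i′ * L + j′ + G → j ≡ j′ × i ≡ i′
  addr-injective {j} {i} {j′} {i′} j<L j′<L eq =
    go i i′ (+-cancelʳ-≡ G (i * L + j) (i′ * L + j′) eq)
    where
    big : ∀ i → j < L → L ≤ L + i * L + j
    big i _ = ≤-trans (m≤m+n L (i * L)) (m≤m+n (L + i * L) j)
    go : ∀ i i′ → i * L + j ≡ i′ * L + j′ → j ≡ j′ × i ≡ i′
    go zero    zero     eq = eq , refl
    go zero    (suc i′) eq = contradiction j<L
      (≤⇒≯ (subst (L ≤_) (sym eq) (≤-trans (m≤m+n L (i′ * L)) (m≤m+n (L + i′ * L) j′))))
    go (suc i) zero     eq = contradiction j′<L
      (≤⇒≯ (subst (L ≤_) eq (≤-trans (m≤m+n L (i * L)) (m≤m+n (L + i * L) j))))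
    go (suc i) (suc i′) eq =
      let p , q = go i i′ (+-cancelˡ-≡ L (i * L + j) (i′ * L + j′)
                    (trans (sym (+-assoc L (i * L) j)) (trans eq (+-assoc L (i′ * L) j′))))
      in p , cong suc q

  rep-scratch : ∀ {R s k} → Rep R s → k < B → Rep (R [ 2 ≔ k ]) s
  rep-scratch {R} rep k<B = record
    { good = Good-upd good k<B (λ o → contradiction o (out-low (≤-trans (s≤s (s≤s (s≤s z≤n))) free≤G)))
    ; R0 = R0 ; R1 = R1 ; vars = vars
    ; raws = λ a f≤a a<G → trans (upd-≢ R (≢-< (<-≤-trans (s≤s (s≤s (s≤s z≤n))) f≤a))) (raws a f≤a a<G)
    ; arrs = λ j i j<L → trans
        (upd-≢ R (≢-< (<-≤-trans (≤-trans (s≤s (s≤s (s≤s z≤n))) free≤G) (G≤addr i j)))) (arrs j i j<L)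
    ; wf = wf
    }
    where open Rep rep

  rep-var : ∀ {R s k} x → Rep R s → k < B₁ → Rep (R [ reg x ≔ k ]) (setv s x k)
  rep-var {R} {s} {k} x rep k<B₁ = record
    { good = Good-upd good (<-≤-trans k<B₁ B₁≤B) (λ o → contradiction o (out-low (reg<G x)))
    ; R0 = R0 ; R1 = R1 ; vars = λ y → cong (if toℕ x ≡ᵇ toℕ y then k else_) (vars y)
    ; raws = λ a f≤a a<G → trans (upd-≢ R (≢-< (<-≤-trans (reg<free x) f≤a))) (raws a f≤a a<G)
    ; arrs = λ j i j<L → trans (upd-≢ R (≢-< (<-≤-trans (reg<G x) (G≤addr i j)))) (arrs j i j<L)
    ; wf = record { var< = below ; raw< = raw< ; arr< = arr< ; arr0 = arr0 }
    }
    where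
    open Rep rep
    below : ∀ y → setv s x k ⟨ y ⟩ < B₁
    below y with toℕ x ≡ᵇ toℕ y
    ... | true  = k<B₁
    ... | false = var< y

  rep-raw : ∀ {R s a k} → Rep R s → k < B₁ → firstFree ≤ a → a < G → Rep (R [ a ≔ k ]) (setr s a k)
  rep-raw {R} {s} {a} {k} rep k<B₁ f≤a a<G = record
    { good = Good-upd good (<-≤-trans k<B₁ B₁≤B) (λ o → contradiction o (out-low a<G))
    ; R0 = trans (upd-≢ R (a≢ 0 (s≤s z≤n))) R0
    ; R1 = trans (upd-≢ R (a≢ 1 (s≤s (s≤s z≤n)))) R1
    ; vars = λ x → trans (upd-≢ R (a≢ (reg x) (reg<free x))) (vars x)
    ; raws = λ b f≤b b<G → cong (if a ≡ᵇ b then k else_) (raws b f≤b b<G)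
    ; arrs = λ j i j<L → trans (upd-≢ R (≢-< (<-≤-trans a<G (G≤addr i j)))) (arrs j i j<L)
    ; wf = record { var< = var< ; raw< = below ; arr< = arr< ; arr0 = arr0 }
    }
    where
    open Rep rep
    a≢ : ∀ b → b < firstFree → a ≢ b
    a≢ b b<f eq = ≢-< (<-≤-trans b<f f≤a) (sym eq)
    below : ∀ b → firstFree ≤ b → b < G → (raw s [ a ≔ k ]) b < B₁
    below b f≤b b<G with a ≡ᵇ b
    ... | true  = k<B₁
    ... | false = raw< b f≤b b<G

  rep-arr : ∀ {R s j i k} → Rep R s → k < B₁ → j < L → (OutI i → k ≡ 0) →
            Rep (R [ i * L + j + G ≔ k ]) (seta s j i k)
  rep-arr {R} {s} {j} {i} {k} rep k<B₁ j<L out = record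
    { good = Good-upd good (<-≤-trans k<B₁ B₁≤B) (out ∘ out-array j<L)
    ; R0 = trans (upd-≢ R (a≢ 0 (≤-trans (s≤s z≤n) free≤G))) R0
    ; R1 = trans (upd-≢ R (a≢ 1 (≤-trans (s≤s (s≤s z≤n)) free≤G))) R1
    ; vars = λ x → trans (upd-≢ R (a≢ (reg x) (reg<G x))) (vars x)
    ; raws = λ a f≤a a<G → trans (upd-≢ R (a≢ a a<G)) (raws a f≤a a<G)
    ; arrs = entries
    ; wf = record { var< = var< ; raw< = raw< ; arr< = below ; arr0 = zeros }
    }
    where
    open Rep rep
    addr = i * L + j + G
    a≢ : ∀ b → b < G → addr ≢ b
    a≢ b b<G eq = ≢-< (<-≤-trans b<G (G≤addr i j)) (sym eq)
    entries : ∀ j′ i′ → j′ < L → (R [ addr ≔ k ]) (i′ * L + j′ + G) ≡ (arr s [ j ≔ arr s j [ i ≔ k ] ]) j′ i′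
    entries j′ i′ j′<L with j ≟ j′
    ... | no j≢j′ = trans (upd-≢ R (j≢j′ ∘ proj₁ ∘ addr-injective {j} {i} {j′} {i′} j<L j′<L))
      (trans (arrs j′ i′ j′<L) (cong (λ f → f i′) (sym (upd-≢ (arr s) j≢j′))))
    ... | yes refl = trans (row (i ≟ i′)) (cong (λ f → f i′) (sym (upd-≡ (arr s) j)))
      where
      row : _ → (R [ addr ≔ k ]) (i′ * L + j + G) ≡ (arr s j [ i ≔ k ]) i′
      row (yes refl) = trans (upd-≡ R addr) (sym (upd-≡ (arr s j) i))
      row (no i≢i′)  = trans (upd-≢ R (i≢i′ ∘ proj₂ ∘ addr-injective {j} {i} {j} {i′} j<L j<L))
        (trans (arrs j i′ j<L) (sym (upd-≢ (arr s j) i≢i′)))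
    below : ∀ j′ i′ → j′ < L → (arr s [ j ≔ arr s j [ i ≔ k ] ]) j′ i′ < B₁
    below j′ i′ j′<L with j ≡ᵇ j′
    ... | false = arr< j′ i′ j′<L
    ... | true with i ≡ᵇ i′
    ...   | true  = k<B₁
    ...   | false = arr< j i′ j<L
    zeros : ∀ j′ i′ → j′ < L → OutI i′ → (arr s [ j ≔ arr s j [ i ≔ k ] ]) j′ i′ ≡ 0
    zeros j′ i′ j′<L o with j ≡ᵇ j′
    ... | false = arr0 j′ i′ j′<L o
    ... | true with i ≟ i′
    ...   | yes refl = trans (upd-≡ (arr s j) i) (out o)
    ...   | no i≢i′  = trans (upd-≢ (arr s j) i≢i′) (arr0 j i′ j<L o)

  Ok : Op → St → Set
  Ok (cst x k)    s = k < B₁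
  Ok (add! x y z) s = s ⟨ y ⟩ + s ⟨ z ⟩ < B₁
  Ok (sub! x y z) s = ⊤
  Ok (mul! x y z) s = s ⟨ y ⟩ * s ⟨ z ⟩ < B₁
  Ok (hlf x y)    s = ⊤
  Ok (get x j i)  s = s ⟨ j ⟩ < L
  Ok (put j i x)  s = s ⟨ j ⟩ < L × (OutI (s ⟨ i ⟩) → s ⟨ x ⟩ ≡ 0)
  Ok (rget x i)   s = firstFree ≤ s ⟨ i ⟩ × s ⟨ i ⟩ < G
  Ok (rput i x)   s = firstFree ≤ s ⟨ i ⟩ × s ⟨ i ⟩ < G

  Oks : List Op → St → Set
  Oks []       s = ⊤
  Oks (o ∷ os) s = Ok o s × Oks os (effect o s)

  module _ {p : List Instr} where

    var-step : ∀ {a R s i x k} → Rep R s → head (drop a p) ≡ just i →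
               execute i (a , R) ≡ (suc a , R [ reg x ≔ k ]) → k < B₁ →
               ∃[ R′ ] Exec p 1 (a , R) (a + 1 , R′) × Rep R′ (setv s x k)
    var-step {a} {R} {s} {i} {x} {k} rep at eq k<B₁ = _ ,
      tick (Rep.good rep) at (subst (λ c → Exec p 0 c (a + 1 , R [ reg x ≔ k ])) (sym eq)
        (subst (λ b → Exec p 0 (suc a , R [ reg x ≔ k ]) (b , R [ reg x ≔ k ])) (+-comm 1 a) (done (Rep.good rep′)))) , rep′
      where rep′ = rep-var x rep k<B₁

    address-steps : ∀ {a R s j i} → Rep R s → s ⟨ j ⟩ < L → At p a (address j i) →
                    ∃[ R′ ] Exec p 3 (a , R) (3 + a , R′) × Rep R′ s
                          × R′ 2 ≡ s ⟨ i ⟩ * L + s ⟨ j ⟩ + G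
    address-steps {a} {R} {s} {j} {i} rep j<L (i₁ , i₂ , i₃ , _) = _ ,
        tick good i₁ (tick (Rep.good rep₁) i₂ (tick (Rep.good rep₂) i₃ (done (Rep.good rep₃)))) , rep₃ ,
        cong₂ _+_ (cong₂ _+_ (cong₂ _*_ (vars i) R1) (vars j)) R0
      where
      open Rep rep
      bound : s ⟨ i ⟩ * L + s ⟨ j ⟩ + G < B
      bound = address<B (var< i) j<L
      e₁ : R (reg i) * R 1 ≡ s ⟨ i ⟩ * L
      e₁ = cong₂ _*_ (vars i) R1
      rep₁ : Rep (R [ 2 ≔ R (reg i) * R 1 ]) s
      rep₁ = rep-scratch rep (≤-<-trans (≤-trans (≤-reflexive e₁) (≤-trans (m≤m+n _ (s ⟨ j ⟩)) (m≤m+n _ G))) bound)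
      rep₂ : Rep (R [ 2 ≔ R (reg i) * R 1 ] [ 2 ≔ R (reg i) * R 1 + R (reg j) ]) s
      rep₂ = rep-scratch rep₁ (≤-<-trans (≤-trans (≤-reflexive (cong₂ _+_ e₁ (vars j))) (m≤m+n _ G)) bound)
      rep₃ : Rep (R [ 2 ≔ R (reg i) * R 1 ] [ 2 ≔ R (reg i) * R 1 + R (reg j) ]
                    [ 2 ≔ R (reg i) * R 1 + R (reg j) + R 0 ]) s
      rep₃ = rep-scratch rep₂ (≤-<-trans (≤-reflexive (cong₂ _+_ (cong₂ _+_ e₁ (vars j)) R0)) bound)

    op-exec : ∀ o {a R s} → Rep R s → Ok o s → At p a (emitOp o) →
              ∃[ R′ ] Exec p (length (emitOp o)) (a , R) (a + length (emitOp o) , R′) × Rep R′ (effect o s)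
    op-exec (cst x k) rep ok (at , _) = var-step {x = x} rep at refl ok
    op-exec (add! x y z) {a} {R} rep ok (at , _) = var-step {x = x} rep at
      (cong (λ k → suc a , R [ reg x ≔ k ]) (cong₂ _+_ (vars y) (vars z))) ok
      where open Rep rep
    op-exec (sub! x y z) {a} {R} {s} rep ok (at , _) = var-step {x = x} rep at
      (cong (λ k → suc a , R [ reg x ≔ k ]) (cong₂ _∸_ (vars y) (vars z))) (≤-<-trans (m∸n≤m (s ⟨ y ⟩) (s ⟨ z ⟩)) (var< y))
      where open Rep rep
    op-exec (mul! x y z) {a} {R} rep ok (at , _) = var-step {x = x} rep at
      (cong (λ k → suc a , R [ reg x ≔ k ]) (cong₂ _*_ (vars y) (vars z))) ok
      where open Rep rep
    op-exec (hlf x y) {a} {R} rep ok (at , _) = var-step {x = x} rep at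
      (cong (λ k → suc a , R [ reg x ≔ k ]) (cong ⌊_/2⌋ (vars y))) (≤-<-trans (⌊n/2⌋≤n _) (var< y))
      where open Rep rep
    op-exec (rget x i) {a} {R} rep (f≤ , <G) (at , _) = var-step {x = x} rep at
      (cong (λ k → suc a , R [ reg x ≔ k ]) (trans (cong R (vars i)) (raws _ f≤ <G))) (raw< _ f≤ <G)
      where open Rep rep
    op-exec (rput i x) {a} {R} {s} rep (f≤ , <G) (at , _) = _ ,
      tick good at (subst₂ (λ b m → Exec p 0 (suc a , R [ R (reg i) ≔ R (reg x) ]) (b , m))
        (+-comm 1 a) (cong₂ (λ b k → R [ b ≔ k ]) (vars i) (vars x))
        (done (subst Good (sym (cong₂ (λ b k → R [ b ≔ k ]) (vars i) (vars x))) (Rep.good rep′)))) , rep′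
      where
      open Rep rep
      rep′ = rep-raw rep (var< x) f≤ <G
    op-exec (get x j i) {a} {R} {s} rep j<L at with At-++ a (address j i) at
    ... | at₁ , at₂ with address-steps {i = i} rep j<L at₁
    ... | R′ , e , rep′ , R′2 with var-step {x = x} rep′ (subst (λ b → head (drop b p) ≡ just (load (reg x) 2)) (+-comm a 3) (proj₁ at₂))
            (cong (λ k → 4 + a , R′ [ reg x ≔ k ]) (trans (cong R′ R′2) (Rep.arrs rep′ (s ⟨ j ⟩) (s ⟨ i ⟩) j<L)))
            (Rep.arr< rep _ _ j<L)
    ... | R″ , e′ , rep″ = R″ , subst (λ b → Exec p 4 (a , R) (b , R″)) (trans (+-comm (3 + a) 1) (+-comm 4 a)) (e ▷ e′) , rep″
    op-exec (put j i x) {a} {R} {s} rep (j<L , out) at with At-++ a (address j i) at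
    ... | at₁ , at₂ with address-steps {i = i} rep j<L at₁
    ... | R′ , e , rep′ , R′2 = _ ,
      subst (λ b → Exec p 4 (a , R) (b , R′ [ s ⟨ i ⟩ * L + s ⟨ j ⟩ + G ≔ s ⟨ x ⟩ ])) (+-comm 4 a)
        (e ▷ tick (Rep.good rep′) (subst (λ b → head (drop b p) ≡ just (store 2 (reg x))) (+-comm a 3) (proj₁ at₂))
          (subst (λ m → Exec p 0 (4 + a , R′ [ R′ 2 ≔ R′ (reg x) ]) (4 + a , m)) same
            (done (subst Good (sym same) (Rep.good rep″))))) , rep″
      where
      rep″ : Rep (R′ [ s ⟨ i ⟩ * L + s ⟨ j ⟩ + G ≔ s ⟨ x ⟩ ]) (seta s (s ⟨ j ⟩) (s ⟨ i ⟩) (s ⟨ x ⟩))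
      rep″ = rep-arr rep′ (Rep.var< rep x) j<L out
      same : R′ [ R′ 2 ≔ R′ (reg x) ] ≡ R′ [ s ⟨ i ⟩ * L + s ⟨ j ⟩ + G ≔ s ⟨ x ⟩ ]
      same = cong₂ (λ b k → R′ [ b ≔ k ]) R′2 (Rep.vars rep′ x)

    ops-exec : ∀ os {a R s} → Rep R s → Oks os s → At p a (emitOps os) →
               ∃[ R′ ] Exec p (length (emitOps os)) (a , R) (a + length (emitOps os) , R′) × Rep R′ (effects os s)
    ops-exec [] {a} {R} rep _ _ = R , subst (λ b → Exec p 0 (a , R) (b , R)) (sym (+-identityʳ a)) (done (Rep.good rep)) , rep
    ops-exec (o ∷ os) {a} {R} rep (ok , oks) at with At-++ a (emitOp o) at
    ... | at₁ , at₂ with op-exec o rep ok at₁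
    ... | R′ , e , rep′ with ops-exec os rep′ oks at₂
    ... | R″ , e′ , rep″ = R″ ,
      subst₂ (λ t b → Exec p t (a , R) (b , R″)) (sym (List.length-++ (emitOp o)))
        (trans (+-assoc a (length (emitOp o)) _) (cong (a +_) (sym (List.length-++ (emitOp o)))))
        (e ▷ e′) , rep″

  -- Quantified over the surrounding program, the address and the memory, so that triples compose;
  -- `t` is only an upper bound because branches take different times.
  record Triple (P : St → Set) (c : Code) (Q : St → Set) (t : ℕ) : Set where
    constructor triple
    field
      exec : ∀ {p a R s} → At p a (emit c a) → Rep R s → P s →
        ∃[ t′ ] t′ ≤ t × ∃[ R′ ] ∃[ s′ ] Exec p t′ (a , R) (a + size c , R′) × Rep R′ s′ × Q s′

  open Triple public

  ops-triple : ∀ {P Q : St → Set} os → (∀ s → Wf s → P s → Oks os s × Q (effects os s)) →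
               Triple P (ops os) Q (length (emitOps os))
  ops-triple os h .exec {s = s} at rep Ps =
    let oks , Qs = h s (Rep.wf rep) Ps
        R′ , e , rep′ = ops-exec os rep oks at
    in _ , ≤-refl , R′ , _ , e , rep′ , Qs

  infixr 4 _⨟_

  _⨟_ : ∀ {P Q S c d t u} → Triple P c Q t → Triple Q d S u → Triple P (c ⨾ d) S (t + u)
  _⨟_ {c = c} {d} f g .exec {p} {a} {R} at rep Ps =
    let at₁ , at₂ = At-++ a (emit c a) at
        t₁ , t≤ , R₁ , s₁ , e₁ , rep₁ , Q₁ = f .exec at₁ rep Ps
        t₂ , u≤ , R₂ , s₂ , e₂ , rep₂ , S₂ =
          g .exec (subst (λ n → At p (a + n) (emit d (a + size c))) (sized c a) at₂) rep₁ Q₁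
    in t₁ + t₂ , +-mono-≤ t≤ u≤ , R₂ , s₂ ,
       subst (λ b → Exec p (t₁ + t₂) (a , R) (b , R₂)) (+-assoc a (size c) (size d)) (e₁ ▷ e₂) , rep₂ , S₂

  conseq : ∀ {P P′ Q Q′ : St → Set} {c t t′} → (∀ s → Wf s → P′ s → P s) → (∀ s → Wf s → Q s → Q′ s) →
           t ≤ t′ → Triple P c Q t → Triple P′ c Q′ t′
  conseq pre post t≤ f .exec at rep Ps =
    let t , le , R′ , s′ , e , rep′ , Q = f .exec at rep (pre _ (Rep.wf rep) Ps)
    in t , ≤-trans le t≤ , R′ , s′ , e , rep′ , post s′ (Rep.wf rep′) Q

  when-triple : ∀ {P Q : St → Set} {x c t} → (∀ s → Wf s → P s → s ⟨ x ⟩ ≡ 0 → Q s) →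
                Triple (λ s → P s × s ⟨ x ⟩ ≢ 0) c Q t → Triple P (when x c) Q (suc t)
  when-triple {P} {Q} {x} {c} skip body .exec {p} {a} {R} {s} (i , at) rep Ps with s ⟨ x ⟩ in eq
  ... | zero = 1 , s≤s z≤n , R , s ,
    tick good i (subst (λ b → Exec p 0 ((if R (reg x) ≡ᵇ 0 then suc a + size c else suc a) , R) (b , R)) (sym (+-suc a (size c)))
      (subst (λ k → Exec p 0 ((if k ≡ᵇ 0 then suc a + size c else suc a) , R) (suc a + size c , R))
        (sym (trans (vars x) eq)) (done good))) ,
    rep , skip s wf Ps eq
    where open Rep rep
  ... | suc k =
    let t , le , R′ , s′ , e , rep′ , Qs = body .exec at rep (Ps , λ eq₀ → contradiction (trans (sym eq) eq₀) λ ())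
    in suc t , s≤s le , R′ , s′ ,
       tick good i (subst₂ (λ k b → Exec p t ((if k ≡ᵇ 0 then suc a + size c else suc a) , R) (b , R′))
         (sym (trans (vars x) eq)) (sym (+-suc a (size c))) e) , rep′ , Qs
    where open Rep rep

  -- `I k` is the invariant with `k` rounds to go. A round may end in `E` instead, where the counter
  -- is zero: this is how the main loop stops early when a cycle has been found. The 2 is the test
  -- and the jump back.
  loop-triple : ∀ {I : ℕ → St → Set} {E : St → Set} {x c t} →
    (∀ k s → I k s → s ⟨ x ⟩ ≡ k) → (∀ s → E s → s ⟨ x ⟩ ≡ 0) →
    (∀ k → Triple (I (suc k)) c (λ s → I k s ⊎ E s) t) →
    ∀ k → Triple (I k) (loop x c) (λ s → I 0 s ⊎ E s) (suc (k * (2 + t)))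
  loop-triple {I} {E} {x} {c} {t} count exit body k .exec {p} {a} {R} {s} at@(i , at₁) rep Is =
    go k rep (inj₁ Is) ≤-refl
    where
    leave : ∀ {R s} → Rep R s → s ⟨ x ⟩ ≡ 0 → Exec p 1 (a , R) (a + size (loop x c) , R)
    leave {R} rep eq = tick good i
      (subst (λ k → Exec p 0 ((if k ≡ᵇ 0 then a + size (loop x c) else suc a) , R) (a + size (loop x c) , R))
        (sym (trans (vars x) eq)) (done good))
      where open Rep rep
    enter : ∀ {R s k t c′} → Rep R s → s ⟨ x ⟩ ≡ suc k → Exec p t (suc a , R) c′ → Exec p (suc t) (a , R) c′
    enter {R} {t = t} {c′} rep eq e = tick good i
      (subst (λ k → Exec p t ((if k ≡ᵇ 0 then a + size (loop x c) else suc a) , R) c′)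
        (sym (trans (vars x) eq)) e)
      where open Rep rep
    at₂ = At-++ (suc a) (emit c (suc a)) at₁
    back : ∀ {R} → Good R → Exec p 1 (suc a + size c , R) (a , R)
    back {R} good = tick good (subst (λ n → head (drop (suc a + n) p) ≡ just (jmp a)) (sized c (suc a)) (proj₁ (proj₂ at₂))) (done good)
    go : ∀ k {R s} → Rep R s → I k s ⊎ E s → ∀ {u} → suc (k * (2 + t)) ≤ u →
         ∃[ t′ ] t′ ≤ u × ∃[ R′ ] ∃[ s′ ] Exec p t′ (a , R) (a + size (loop x c) , R′) × Rep R′ s′ × (I 0 s′ ⊎ E s′)
    go k {R} {s} rep (inj₂ Es) le = 1 , ≤-trans (s≤s z≤n) le , R , s , leave rep (exit s Es) , rep , inj₂ Es
    go zero {R} {s} rep (inj₁ Is) le = 1 , le , R , s , leave rep (count 0 s Is) , rep , inj₁ Is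
    go (suc k) {R} {s} rep (inj₁ Is) {u} le =
      let t₁ , t₁≤ , R₁ , s₁ , e₁ , rep₁ , post = body k .exec (proj₁ at₂) rep Is
          t₂ , t₂≤ , R₂ , s₂ , e₂ , rep₂ , post₂ = go k rep₁ post ≤-refl
      in suc (t₁ + (1 + t₂)) ,
         ≤-trans (s≤s (≤-trans (+-mono-≤ t₁≤ (s≤s t₂≤))
           (≤-reflexive (trans (+-suc t (suc (k * (2 + t)))) (cong suc (+-suc t (k * (2 + t)))))))) le ,
         R₂ , s₂ , enter rep (count (suc k) s Is) (e₁ ▷ back (Rep.good rep₁) ▷ e₂) , rep₂ , post₂

-- Compilation of field programs over 𝔽₂

-- The index registers are kept in array vρ and the field memory in array vμ.
vN vQ vS vρ vμ vM vC vI vK vE : Var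
vN = # 0
vQ = # 1
vS = # 2
vρ = # 3
vμ = # 4
vM = # 5
vC = # 6
vI = # 7
vK = # 8
vE = # 9

firstTemp : ℕ
firstTemp = 10

ty tx tz tt′ : Var
ty  = # 10
tx  = # 11
tz  = # 12
tt′ = # 13

-- What happens after the temporaries ty and tx have been computed.
data Action : Set where
  toR toM      : Action
  branch goto  : ℕ → Action

readR readM : ℕ → Var → List Op
readR i x = cst x i ∷ get x vρ x ∷ []
readM i x = cst x i ∷ get x vρ x ∷ get x vμ x ∷ []

prepare : FieldInstr → List Op
prepare (int (const i k)) = cst ty i ∷ cst tx k ∷ []
prepare (int (add i j k)) = readR j tx ++ readR k tz ++ add! tx tx tz ∷ cst ty i ∷ []
prepare (int (sub i j k)) = readR j tx ++ readR k tz ++ sub! tx tx tz ∷ cst ty i ∷ []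
prepare (int (mul i j k)) = readR j tx ++ readR k tz ++ mul! tx tx tz ∷ cst ty i ∷ []
prepare (int (half i j))  = readR j tx ++ hlf tx tx ∷ cst ty i ∷ []
prepare (int (load i j))  = readR j tx ++ get tx vρ tx ∷ cst ty i ∷ []
prepare (int (store i j)) = readR j tx ++ readR i ty
prepare (int (jz i l))    = readR i tx
prepare (int (jmp l))     = []
prepare (fzero i)         = readR i ty ++ cst tx 0 ∷ []
prepare (fone i)          = readR i ty ++ cst tx 1 ∷ []
prepare (fadd i j k)      =
  readM j tx ++ readM k tz ++ sub! tt′ tx tz ∷ sub! tz tz tx ∷ add! tx tt′ tz ∷ readR i ty
prepare (fmul i j k)      = readM j tx ++ readM k tz ++ mul! tx tx tz ∷ readR i ty
prepare (finv i j)        = readM j tx ++ readR i ty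
prepare (fjz i l)         = readM i tx

action : FieldInstr → Action
action (int (jz i l))   = branch l
action (int (jmp l))    = goto l
action (int _)          = toR
action (fjz i l)        = branch l
action _                = toM

emitAction : (ℕ → ℕ) → Action → List Instr
emitAction tgt toR        = emitOp (put vρ ty tx)
emitAction tgt toM        = emitOp (put vμ ty tx)
emitAction tgt (branch l) = jz (reg tx) (tgt l) ∷ []
emitAction tgt (goto l)   = jmp (tgt l) ∷ []

actionSize : Action → ℕ
actionSize toR        = 4
actionSize toM        = 4
actionSize (branch _) = 1
actionSize (goto _)   = 1

emitF : (ℕ → ℕ) → FieldInstr → List Instr
emitF tgt i = emitOps (prepare i) ++ emitAction tgt (action i)

sizeF : FieldInstr → ℕ
sizeF i = length (emitOps (prepare i)) + actionSize (action i)

action-sized : ∀ tgt A → length (emitAction tgt A) ≡ actionSize A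
action-sized tgt toR        = refl
action-sized tgt toM        = refl
action-sized tgt (branch _) = refl
action-sized tgt (goto _)   = refl

sizedF : ∀ tgt i → length (emitF tgt i) ≡ sizeF i
sizedF tgt i = trans (List.length-++ (emitOps (prepare i)))
  (cong (length (emitOps (prepare i)) +_) (action-sized tgt (action i)))

-- Counters beyond the end of the program go to the end of the code.
pos : List FieldInstr → ℕ → ℕ
pos []      l       = 0
pos (i ∷ p) zero    = 0
pos (i ∷ p) (suc l) = sizeF i + pos p l

total : List FieldInstr → ℕ
total []      = 0
total (i ∷ p) = sizeF i + total p

emitAll : (ℕ → ℕ) → List FieldInstr → List Instr
emitAll tgt []      = []
emitAll tgt (i ∷ p) = emitF tgt i ++ emitAll tgt p

sizedAll : ∀ tgt p → length (emitAll tgt p) ≡ total p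
sizedAll tgt []      = refl
sizedAll tgt (i ∷ p) = trans (List.length-++ (emitF tgt i)) (cong₂ _+_ (sizedF tgt i) (sizedAll tgt p))

simulate : List FieldInstr → Code
simulate p .size    = total p
simulate p .emit a  = emitAll (λ l → a + pos p l) p
simulate p .sized a = sizedAll (λ l → a + pos p l) p

pos-zero : ∀ p → pos p 0 ≡ 0
pos-zero []      = refl
pos-zero (_ ∷ _) = refl

locate : ∀ {prog} tgt p a l {i} → At prog a (emitAll tgt p) → head (drop l p) ≡ just i →
         At prog (a + pos p l) (emitF tgt i) × pos p (suc l) ≡ pos p l + sizeF i
locate {prog} tgt (i ∷ p) a zero at refl =
  subst (λ a → At prog a (emitF tgt i)) (sym (+-identityʳ a)) (proj₁ (At-++ a (emitF tgt i) at)) ,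
  trans (cong (sizeF i +_) (pos-zero p)) (+-identityʳ (sizeF i))
locate {prog} tgt (i ∷ p) a (suc l) {i′} at eq =
  let at′ , next = locate tgt p (a + sizeF i) l
        (subst (λ n → At prog (a + n) (emitAll tgt p)) (sizedF tgt i) (proj₂ (At-++ a (emitF tgt i) at))) eq
  in subst (λ a → At prog a (emitF tgt i′)) (+-assoc a (sizeF i) (pos p l)) at′ ,
     trans (cong (sizeF i +_) next) (sym (+-assoc (sizeF i) (pos p l) (sizeF i′)))
locate tgt [] a zero    at ()
locate tgt [] a (suc l) at ()

pos-halted : ∀ p l → head (drop l p) ≡ nothing → pos p l ≡ total p
pos-halted []      l       eq = refl
pos-halted (i ∷ p) (suc l) eq = cong (sizeF i +_) (pos-halted p l eq)

-- Every constant occurring in the compiled operations is at most this.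
constants : List Op → ℕ
constants []             = 0
constants (cst x k ∷ os) = k + constants os
constants (_ ∷ os)       = constants os

allConstants : List FieldInstr → ℕ
allConstants []      = 0
allConstants (i ∷ p) = constants (prepare i) + allConstants p

constants-≤ : ∀ p l {i} → head (drop l p) ≡ just i → constants (prepare i) ≤ allConstants p
constants-≤ (i ∷ p) zero    refl = m≤m+n _ (allConstants p)
constants-≤ (i ∷ p) (suc l) eq   = ≤-trans (constants-≤ p l eq) (m≤n+m (allConstants p) (constants (prepare i)))

bit-xor : ∀ a b → bit a ∸ bit b + (bit b ∸ bit a) ≡ bit (a xor b)
bit-xor true  true  = refl
bit-xor true  false = refl
bit-xor false true  = refl
bit-xor false false = refl

bit-∧ : ∀ a b → bit a * bit b ≡ bit (a ∧ b)
bit-∧ true  true  = refl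
bit-∧ true  false = refl
bit-∧ false b     = refl

bit-≤1 : ∀ b → bit b ≤ 1
bit-≤1 true  = s≤s z≤n
bit-≤1 false = z≤n

-- The operations that only write temporaries.
TempOp : Op → Set
TempOp (cst x _)    = T (firstTemp ≤ᵇ toℕ x)
TempOp (add! x _ _) = T (firstTemp ≤ᵇ toℕ x)
TempOp (sub! x _ _) = T (firstTemp ≤ᵇ toℕ x)
TempOp (mul! x _ _) = T (firstTemp ≤ᵇ toℕ x)
TempOp (hlf x _)    = T (firstTemp ≤ᵇ toℕ x)
TempOp (get x _ _)  = T (firstTemp ≤ᵇ toℕ x)
TempOp (put _ _ _)  = ⊥
TempOp (rget x _)   = ⊥
TempOp (rput _ _)   = ⊥

TempOps : List Op → Set
TempOps []       = ⊤
TempOps (o ∷ os) = TempOp o × TempOps os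

-- Correctness of the compiled programs

module Correctness (bounds : Bounds) (1<B₁ : 1 < Bounds.B₁ bounds) (s₀ : St)
  (ρ<L : s₀ ⟨ vρ ⟩ < Bounds.L bounds) (μ<L : s₀ ⟨ vμ ⟩ < Bounds.L bounds) (ρ≢μ : s₀ ⟨ vρ ⟩ ≢ s₀ ⟨ vμ ⟩) where

  open Bounds bounds
  open Logic bounds

  record Agrees (s : St) (R : Memory ℕ) (M : Memory Bool) : Set where
    field
      arrR   : ∀ a → arr s (s₀ ⟨ vρ ⟩) a ≡ R a
      arrM   : ∀ a → arr s (s₀ ⟨ vμ ⟩) a ≡ bit (M a)
      others : ∀ j → j ≢ s₀ ⟨ vρ ⟩ → j ≢ s₀ ⟨ vμ ⟩ → arr s j ≡ arr s₀ j
      vars≡  : ∀ x → toℕ x < firstTemp → s ⟨ x ⟩ ≡ s₀ ⟨ x ⟩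
      raw≡   : raw s ≡ raw s₀

    ρ≡ : s ⟨ vρ ⟩ ≡ s₀ ⟨ vρ ⟩
    ρ≡ = vars≡ vρ (≤ᵇ⇒≤ 4 10 tt)
    μ≡ : s ⟨ vμ ⟩ ≡ s₀ ⟨ vμ ⟩
    μ≡ = vars≡ vμ (≤ᵇ⇒≤ 5 10 tt)
    ρ< : s ⟨ vρ ⟩ < L
    ρ< = subst (_< L) (sym ρ≡) ρ<L
    μ< : s ⟨ vμ ⟩ < L
    μ< = subst (_< L) (sym μ≡) μ<L
    valR : ∀ a → arr s (s ⟨ vρ ⟩) a ≡ R a
    valR a = trans (cong (λ j → arr s j a) ρ≡) (arrR a)
    valM : ∀ {a b} → arr s (s ⟨ vρ ⟩) a ≡ b → arr s (s ⟨ vμ ⟩) (arr s (s ⟨ vρ ⟩) a) ≡ bit (M b)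
    valM {a} refl = trans (cong (λ j → arr s j (arr s (s ⟨ vρ ⟩) a)) μ≡) (arrM _)

  agrees-temp : ∀ {s R M} x {k} → T (firstTemp ≤ᵇ toℕ x) → Agrees s R M → Agrees (setv s x k) R M
  agrees-temp {s} x temp ag = record
    { arrR = arrR ; arrM = arrM ; others = others ; raw≡ = raw≡
    ; vars≡ = λ y y< → trans (upd-≢ (var s) (λ eq → <-irrefl refl
        (≤-<-trans (≤ᵇ⇒≤ firstTemp (toℕ x) temp) (subst (_< firstTemp) (sym eq) y<)))) (vars≡ y y<)
    }
    where open Agrees ag

  agrees-temps : ∀ os {s R M} → TempOps os → Agrees s R M → Agrees (effects os s) R M
  agrees-temps []                 _        ag = ag
  agrees-temps (cst x _ ∷ os)    (t , ts) ag = agrees-temps os ts (agrees-temp x t ag)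
  agrees-temps (add! x _ _ ∷ os) (t , ts) ag = agrees-temps os ts (agrees-temp x t ag)
  agrees-temps (sub! x _ _ ∷ os) (t , ts) ag = agrees-temps os ts (agrees-temp x t ag)
  agrees-temps (mul! x _ _ ∷ os) (t , ts) ag = agrees-temps os ts (agrees-temp x t ag)
  agrees-temps (hlf x _ ∷ os)    (t , ts) ag = agrees-temps os ts (agrees-temp x t ag)
  agrees-temps (get x _ _ ∷ os)  (t , ts) ag = agrees-temps os ts (agrees-temp x t ag)

  upd-cong : ∀ {A : Set} {m m′ : Memory A} {f : A → ℕ} (m″ : Memory ℕ) {i i′ k x} →
             (∀ a → m″ a ≡ f (m a)) → i ≡ i′ → k ≡ f x → ∀ a → (m″ [ i ≔ k ]) a ≡ f ((m [ i′ ≔ x ]) a)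
  upd-cong m″ {i} eq refl refl a with i ≡ᵇ a
  ... | true  = refl
  ... | false = eq a

  agrees-ρ : ∀ {s R M i k i′ k′} → Agrees s R M → i ≡ i′ → k ≡ k′ →
             Agrees (seta s (s ⟨ vρ ⟩) i k) (R [ i′ ≔ k′ ]) M
  agrees-ρ {s} {R} {i = i} {k} ag p q rewrite Agrees.ρ≡ ag = record
    { arrR = λ a → trans (cong (λ f → f a) (upd-≡ (arr s) (s₀ ⟨ vρ ⟩)))
        (upd-cong {m = R} {R} {λ x → x} (arr s (s₀ ⟨ vρ ⟩)) arrR p q a)
    ; arrM = λ a → trans (cong (λ f → f a) (upd-≢ (arr s) ρ≢μ)) (arrM a)
    ; others = λ j j≢ρ j≢μ → trans (upd-≢ (arr s) (j≢ρ ∘ sym)) (others j j≢ρ j≢μ)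
    ; vars≡ = vars≡ ; raw≡ = raw≡ }
    where open Agrees ag

  agrees-μ : ∀ {s R M i k i′ b} → Agrees s R M → i ≡ i′ → k ≡ bit b →
             Agrees (seta s (s ⟨ vμ ⟩) i k) R (M [ i′ ≔ b ])
  agrees-μ {s} {R} {M} {i = i} {k} ag p q rewrite Agrees.μ≡ ag = record
    { arrM = λ a → trans (cong (λ f → f a) (upd-≡ (arr s) (s₀ ⟨ vμ ⟩)))
        (upd-cong {m = M} {M} {bit} (arr s (s₀ ⟨ vμ ⟩)) arrM p q a)
    ; arrR = λ a → trans (cong (λ f → f a) (upd-≢ (arr s) (ρ≢μ ∘ sym))) (arrR a)
    ; others = λ j j≢ρ j≢μ → trans (upd-≢ (arr s) (j≢μ ∘ sym)) (others j j≢ρ j≢μ)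
    ; vars≡ = vars≡ ; raw≡ = raw≡ }
    where open Agrees ag

  Bounded : Config Store → Set
  Bounded (_ , R , M) = (∀ a → R a < B₁) × (∀ a → OutI a → R a ≡ 0) × (∀ a → OutI a → M a ≡ false)

  -- The values computed by the preparation of an instruction, and what they
  -- are used for.
  Finish : Action → St → ℕ × Memory ℕ × Memory Bool → ℕ × Memory ℕ × Memory Bool → Set
  Finish toR s (pc , R , M) c = c ≡ (suc pc , R [ s ⟨ ty ⟩ ≔ s ⟨ tx ⟩ ] , M)
  Finish toM s (pc , R , M) c = ∃[ b ] s ⟨ tx ⟩ ≡ bit b × c ≡ (suc pc , R , M [ s ⟨ ty ⟩ ≔ b ])
  Finish (branch l) s (pc , R , M) c = c ≡ ((if s ⟨ tx ⟩ ≡ᵇ 0 then l else suc pc) , R , M)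
  Finish (goto l) s (pc , R , M) c = c ≡ (l , R , M)

  below : ∀ {K k} c → c ≤ K → K < B₁ → k ≤ c → k < B₁
  below c c≤K K<B₁ k≤c = ≤-<-trans (≤-trans k≤c c≤K) K<B₁

  written : ∀ {R : Memory ℕ} {i k} → (∀ a → (R [ i ≔ k ]) a < B₁) → k < B₁
  written {R} {i} lt = subst (_< B₁) (upd-≡ R i) (lt i)

  fjz-bit : ∀ b {l m : ℕ} → (if does (BinaryField._≟_ 𝔽₂ b false) then l else m) ≡ (if bit b ≡ᵇ 0 then l else m)
  fjz-bit true  = refl
  fjz-bit false = refl

  -- No separate analysis of overflow is made: a computed sum or product is the very value that the
  -- simulated instruction stores, and it is bounded because the configuration after that
  -- instruction is.
  prepared : ∀ i {pc s R M} → constants (prepare i) < B₁ → Agrees s R M → Bounded (executeF i (pc , R , M)) →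
             TempOps (prepare i) × Oks (prepare i) s
             × Finish (action i) (effects (prepare i) s) (pc , R , M) (executeF i (pc , R , M))
  prepared (int (const i k)) {pc} {s} {R} {M} cs ag bd = _ ,
    (≤-<-trans (m≤m+n i _) cs , ≤-<-trans (≤-trans (m≤m+n k 0) (m≤n+m _ i)) cs , _) , refl
  prepared (int (add i j k)) {pc} {s} {R} {M} cs ag (bd , _) = _ ,
    (≤-<-trans (m≤m+n j _) cs , ρ< , ≤-<-trans (≤-trans (m≤m+n k _) (m≤n+m _ j)) cs , ρ< ,
     subst (_< B₁) (sym eq) (written {R} {i} bd) ,
     ≤-<-trans (≤-trans (m≤m+n i _) (≤-trans (m≤n+m _ k) (m≤n+m _ j))) cs , _) ,
    cong (λ v → suc pc , R [ i ≔ v ] , M) (sym eq)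
    where
    open Agrees ag
    eq = cong₂ _+_ (valR j) (valR k)
  prepared (int (sub i j k)) {pc} {s} {R} {M} cs ag (bd , _) = _ ,
    (≤-<-trans (m≤m+n j _) cs , ρ< , ≤-<-trans (≤-trans (m≤m+n k _) (m≤n+m _ j)) cs , ρ< , _ ,
     ≤-<-trans (≤-trans (m≤m+n i _) (≤-trans (m≤n+m _ k) (m≤n+m _ j))) cs , _) ,
    cong (λ v → suc pc , R [ i ≔ v ] , M) (sym (cong₂ _∸_ (valR j) (valR k)))
    where open Agrees ag
  prepared (int (mul i j k)) {pc} {s} {R} {M} cs ag (bd , _) = _ ,
    (≤-<-trans (m≤m+n j _) cs , ρ< , ≤-<-trans (≤-trans (m≤m+n k _) (m≤n+m _ j)) cs , ρ< ,
     subst (_< B₁) (sym eq) (written {R} {i} bd) ,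
     ≤-<-trans (≤-trans (m≤m+n i _) (≤-trans (m≤n+m _ k) (m≤n+m _ j))) cs , _) ,
    cong (λ v → suc pc , R [ i ≔ v ] , M) (sym eq)
    where
    open Agrees ag
    eq = cong₂ _*_ (valR j) (valR k)
  prepared (int (half i j)) {pc} {s} {R} {M} cs ag bd = _ ,
    (≤-<-trans (m≤m+n j _) cs , ρ< , _ , ≤-<-trans (≤-trans (m≤m+n i _) (m≤n+m _ j)) cs , _) ,
    cong (λ v → suc pc , R [ i ≔ v ] , M) (sym (cong ⌊_/2⌋ (valR j)))
    where open Agrees ag
  prepared (int (load i j)) {pc} {s} {R} {M} cs ag bd = _ ,
    (≤-<-trans (m≤m+n j _) cs , ρ< , ρ< , ≤-<-trans (≤-trans (m≤m+n i _) (m≤n+m _ j)) cs , _) ,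
    cong (λ v → suc pc , R [ i ≔ v ] , M) (sym (trans (valR _) (cong R (valR j))))
    where open Agrees ag
  prepared (int (store i j)) {pc} {s} {R} {M} cs ag bd = _ ,
    (≤-<-trans (m≤m+n j _) cs , ρ< , ≤-<-trans (≤-trans (m≤m+n i _) (m≤n+m _ j)) cs , ρ< , _) ,
    cong₂ (λ u v → suc pc , R [ u ≔ v ] , M) (sym (valR i)) (sym (valR j))
    where open Agrees ag
  prepared (int (jz i l)) {pc} {s} {R} {M} cs ag bd = _ , (≤-<-trans (m≤m+n i _) cs , ρ< , _) ,
    cong (λ v → (if v ≡ᵇ 0 then l else suc pc) , R , M) (sym (valR i))
    where open Agrees ag
  prepared (int (jmp l)) {pc} {s} {R} {M} cs ag bd = _ , _ , refl
  prepared (fzero i) {pc} {s} {R} {M} cs ag bd = _ , (≤-<-trans (m≤m+n i _) cs , ρ< , <-trans (s≤s z≤n) 1<B₁ , _) ,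
    false , refl , cong (λ u → suc pc , R , M [ u ≔ false ]) (sym (valR i))
    where open Agrees ag
  prepared (fone i) {pc} {s} {R} {M} cs ag bd = _ , (≤-<-trans (m≤m+n i _) cs , ρ< , 1<B₁ , _) ,
    true , refl , cong (λ u → suc pc , R , M [ u ≔ true ]) (sym (valR i))
    where open Agrees ag
  prepared (fadd i j k) {pc} {s} {R} {M} cs ag bd = _ ,
    (≤-<-trans (m≤m+n j _) cs , ρ< , μ< , ≤-<-trans (≤-trans (m≤m+n k _) (m≤n+m _ j)) cs , ρ< , μ< , _ , _ ,
     subst (_< B₁) (sym eq) (≤-<-trans (bit-≤1 (M (R j) xor M (R k))) 1<B₁) ,
     ≤-<-trans (≤-trans (m≤m+n i _) (≤-trans (m≤n+m _ k) (m≤n+m _ j))) cs , ρ< , _) ,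
    (M (R j) xor M (R k)) , eq , cong (λ u → suc pc , R , M [ u ≔ M (R j) xor M (R k) ]) (sym (valR i))
    where
    open Agrees ag
    eq = trans (cong₂ (λ x z → x ∸ z + (z ∸ x)) (valM (valR j)) (valM (valR k))) (bit-xor (M (R j)) (M (R k)))
  prepared (fmul i j k) {pc} {s} {R} {M} cs ag bd = _ ,
    (≤-<-trans (m≤m+n j _) cs , ρ< , μ< , ≤-<-trans (≤-trans (m≤m+n k _) (m≤n+m _ j)) cs , ρ< , μ< ,
     subst (_< B₁) (sym eq) (≤-<-trans (bit-≤1 (M (R j) ∧ M (R k))) 1<B₁) ,
     ≤-<-trans (≤-trans (m≤m+n i _) (≤-trans (m≤n+m _ k) (m≤n+m _ j))) cs , ρ< , _) ,
    (M (R j) ∧ M (R k)) , eq , cong (λ u → suc pc , R , M [ u ≔ M (R j) ∧ M (R k) ]) (sym (valR i))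
    where
    open Agrees ag
    eq = trans (cong₂ _*_ (valM (valR j)) (valM (valR k))) (bit-∧ (M (R j)) (M (R k)))
  prepared (finv i j) {pc} {s} {R} {M} cs ag bd = _ ,
    (≤-<-trans (m≤m+n j _) cs , ρ< , μ< , ≤-<-trans (≤-trans (m≤m+n i _) (m≤n+m _ j)) cs , ρ< , _) ,
    M (R j) , valM (valR j) , cong (λ u → suc pc , R , M [ u ≔ M (R j) ]) (sym (valR i))
    where open Agrees ag
  prepared (fjz i l) {pc} {s} {R} {M} cs ag bd = _ ,
    (≤-<-trans (m≤m+n i _) cs , ρ< , μ< , _) ,
    cong (λ v → v , R , M) (trans (fjz-bit (M (R i)))
      (cong (λ v → if v ≡ᵇ 0 then l else suc pc) (sym (valM (valR i)))))
    where open Agrees ag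

  perStep : ℕ
  -- A round bound for the compiled length of any instruction.
  perStep = 60

  sizeF-≤ : ∀ i → sizeF i ≤ perStep
  sizeF-≤ (int (const i k)) = ≤ᵇ⇒≤ _ perStep tt
  sizeF-≤ (int (add i j k)) = ≤ᵇ⇒≤ _ perStep tt
  sizeF-≤ (int (sub i j k)) = ≤ᵇ⇒≤ _ perStep tt
  sizeF-≤ (int (mul i j k)) = ≤ᵇ⇒≤ _ perStep tt
  sizeF-≤ (int (half i j))  = ≤ᵇ⇒≤ _ perStep tt
  sizeF-≤ (int (load i j))  = ≤ᵇ⇒≤ _ perStep tt
  sizeF-≤ (int (store i j)) = ≤ᵇ⇒≤ _ perStep tt
  sizeF-≤ (int (jz i l))    = ≤ᵇ⇒≤ _ perStep tt
  sizeF-≤ (int (jmp l))     = ≤ᵇ⇒≤ _ perStep tt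
  sizeF-≤ (fzero i)         = ≤ᵇ⇒≤ _ perStep tt
  sizeF-≤ (fone i)          = ≤ᵇ⇒≤ _ perStep tt
  sizeF-≤ (fadd i j k)      = ≤ᵇ⇒≤ _ perStep tt
  sizeF-≤ (fmul i j k)      = ≤ᵇ⇒≤ _ perStep tt
  sizeF-≤ (finv i j)        = ≤ᵇ⇒≤ _ perStep tt
  sizeF-≤ (fjz i l)         = ≤ᵇ⇒≤ _ perStep tt

  module _ (p : List FieldInstr) (cs : allConstants p < B₁) {prog a} (at : At prog a (emit (simulate p) a)) where

    tgt : ℕ → ℕ
    tgt l = a + pos p l

    Goal : ℕ → ℕ × Memory ℕ → Config Store → Set
    Goal t c (pc , R , M) =
      ∃[ t′ ] t′ ≤ t × ∃[ m ] ∃[ s ] Exec prog t′ c (tgt pc , m) × Rep m s × Agrees s R M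

    finish : ∀ A {b pc m s R M c} → Rep m s → Agrees s R M → Finish A s (pc , R , M) c → Bounded c →
             At prog b (emitAction tgt A) → tgt (suc pc) ≡ b + actionSize A → Goal (actionSize A) (b , m) c
    finish toR {b} {pc} {m} {s} {R} rep ag refl (lt , out , _) at next
      with op-exec (put vρ ty tx) rep (Agrees.ρ< ag , λ o → trans (sym (upd-≡ R (s ⟨ ty ⟩))) (out _ o)) at
    ... | m′ , e , rep′ = 4 , ≤-refl , m′ , _ ,
      subst (λ n → Exec prog 4 (b , m) (n , m′)) (sym next) e , rep′ , agrees-ρ {i = s ⟨ ty ⟩} {k = s ⟨ tx ⟩} ag refl refl
    finish toM {b} {pc} {m} {s} {R} {M} rep ag (v , tx≡ , refl) (_ , _ , out) at next
      with op-exec (put vμ ty tx) rep (Agrees.μ< ag , λ o →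
             trans tx≡ (cong bit (trans (sym (upd-≡ M (s ⟨ ty ⟩))) (out _ o)))) at
    ... | m′ , e , rep′ = 4 , ≤-refl , m′ , _ ,
      subst (λ n → Exec prog 4 (b , m) (n , m′)) (sym next) e , rep′ , agrees-μ {i = s ⟨ ty ⟩} {k = s ⟨ tx ⟩} ag refl tx≡
    finish (branch l) {b} {pc} {m} {s} rep ag refl bd (i , _) next = 1 , ≤-refl , m , s ,
      tick good i (subst (λ v → Exec prog 0 ((if v ≡ᵇ 0 then tgt l else suc b) , m) (tgt (if s ⟨ tx ⟩ ≡ᵇ 0 then l else suc pc) , m))
        (sym (vars tx)) (subst (λ n → Exec prog 0 (n , m) (tgt (if s ⟨ tx ⟩ ≡ᵇ 0 then l else suc pc) , m)) choose (done good))) ,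
      rep , ag
      where
      open Rep rep
      choose : tgt (if s ⟨ tx ⟩ ≡ᵇ 0 then l else suc pc) ≡ (if s ⟨ tx ⟩ ≡ᵇ 0 then tgt l else suc b)
      choose with s ⟨ tx ⟩ ≡ᵇ 0
      ... | true  = refl
      ... | false = trans next (+-comm b 1)
    finish (goto l) {m = m} {s} rep ag refl bd (i , _) next =
      1 , ≤-refl , m , s , tick good i (done good) , rep , ag
      where open Rep rep

    step-sim : ∀ {pc i m s R M} → head (drop pc p) ≡ just i → Rep m s → Agrees s R M →
               Bounded (executeF i (pc , R , M)) → Goal perStep (tgt pc , m) (executeF i (pc , R , M))
    step-sim {pc} {i} {m} {s} {R} {M} eq rep ag bd =
      let temps , oks , fin = prepared i {pc} (≤-<-trans (constants-≤ p pc eq) cs) ag bd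
          at-i , next = locate tgt p a pc at eq
          at₁ , at₂ = At-++ (tgt pc) (emitOps (prepare i)) at-i
          m₁ , e₁ , rep₁ = ops-exec (prepare i) rep oks at₁
          t , t≤ , m₂ , s₂ , e₂ , rep₂ , ag₂ = finish (action i) rep₁ (agrees-temps (prepare i) temps ag) fin bd at₂
            (trans (cong (a +_) next) (trans (sym (+-assoc a (pos p pc) (sizeF i)))
              (sym (+-assoc (tgt pc) (length (emitOps (prepare i))) (actionSize (action i))))))
      in _ , ≤-trans (+-monoʳ-≤ (length (emitOps (prepare i))) t≤) (sizeF-≤ i) , m₂ , s₂ , e₁ ▷ e₂ , rep₂ , ag₂

    -- The simulated run may halt before time `t`. No code corresponds to its remaining steps, which
    -- is why `Goal` asks only for an inequality.
    run-sim : ∀ t {pc m s R M} → Rep m s → Agrees s R M → (∀ u → u ≤ t → Bounded (run p u (pc , R , M))) →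
              Goal (t * perStep) (tgt pc , m) (run p t (pc , R , M))
    run-sim zero {m = m} {s} rep ag bd = 0 , z≤n , m , s , done (Rep.good rep) , rep , ag
    run-sim (suc t) {pc} {m} {s} {R} {M} rep ag bd with head (drop pc p) in eq | bd 1 (s≤s z≤n) | (λ u u≤t → bd (suc u) (s≤s u≤t))
    ... | nothing | _ | bd′ =
      let t′ , le , rest = run-sim t rep ag bd′ in t′ , ≤-trans le (m≤n+m _ perStep) , rest
    ... | just i | bd₁ | bd′ =
      let t₁ , le₁ , m₁ , s₁ , e₁ , rep₁ , ag₁ = step-sim {pc} {i} eq rep ag bd₁
          t₂ , le₂ , m₂ , s₂ , e₂ , rep₂ , ag₂ = run-sim t rep₁ ag₁ bd′
      in t₁ + t₂ , +-mono-≤ le₁ le₂ , m₂ , s₂ , e₁ ▷ e₂ , rep₂ , ag₂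

-- The program

vCur vU vV vFound vStart vSrc vDst vOff vLim : Var
vCur   = # 14
vU     = # 15
vV     = # 16
vFound = # 17
vStart = # 18
vSrc   = # 20
vDst   = # 21
vOff   = # 22
vLim   = # 23

aOut aA aAᵀ aI aN aPrev aP aX aT firstSim : ℕ
aOut  = 0
aA    = 1
aAᵀ   = 2
aI    = 3
aN    = 4
aPrev = 5
aP    = 6
aX    = 7
aT    = 8
firstSim = 9

mov : Var → Var → List Op
mov x y = cst tz 0 ∷ add! x y tz ∷ []

advance : List Op
advance = cst tz 1 ∷ add! vI vI tz ∷ sub! vK vK tz ∷ []

-- Run the body with vI = 0, 1, …, count - 1.
forEach : Var → List Op → Code
forEach count body =
  ops (cst tz 0 ∷ add! vK count tz ∷ cst vI 0 ∷ []) ⨾ loop vK (ops (body ++ advance))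

zeroSim copyEntry : List Op
zeroSim = cst tx 0 ∷ put vρ vI tx ∷ put vμ vI tx ∷ []
copyEntry = get tx vSrc vI ∷ add! ty vI vOff ∷ put vDst ty tx ∷ []

-- Fresh arrays for every call if the workspace is unrestricted; otherwise the
-- same two arrays are used again.
stride : Workspace → ℕ
stride unrestricted = 2
stride quadratic    = 0

freshOps : Workspace → List Op
freshOps w = cst tz (stride w) ∷ add! vρ vρ tz ∷ cst tz 1 ∷ add! vμ vρ tz ∷ []

fresh : Workspace → Code
fresh w = ops (freshOps w) ⨾ forEach vS zeroSim

inOps₁ inOps₂ outOps : ℕ → List Op
inOps₁ j = cst vSrc j ∷ mov vDst vμ ++ cst vOff 0 ∷ []
inOps₂ j = cst vSrc j ∷ mov vDst vμ ++ mov vOff vQ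
outOps j = mov vSrc vμ ++ cst vDst j ∷ cst vOff 0 ∷ []

dimOps : List Op
dimOps = cst tx 0 ∷ put vρ tx vN ∷ []

copy : List Op → Code
copy os = ops os ⨾ forEach vQ copyEntry

multiply : Workspace → List FieldInstr → ℕ → ℕ → ℕ → Code
multiply w p j₁ j₂ j₃ =
  fresh w ⨾ copy (inOps₁ j₁) ⨾ copy (inOps₂ j₂) ⨾ ops dimOps ⨾ simulate p ⨾ copy (outOps j₃)

-- Addition modulo 2 as (x ∸ y) + (y ∸ x).
xor! : Var → Var → List Op
xor! x y = sub! tt′ x y ∷ sub! y y x ∷ add! x tt′ y ∷ []

getA putA : ℕ → Var → List Op
getA j x = cst ty j ∷ get x ty vI ∷ []
putA j x = cst ty j ∷ put ty vI x ∷ []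

-- Array d gets the entrywise sum of itself and the product of arrays x and y.
maccEntry : ℕ → ℕ → ℕ → List Op
maccEntry d x y = getA x tx ++ getA y tz ++ mul! tx tx tz ∷ getA d tz ++ xor! tz tx ++ putA d tz

moveOps : ℕ → ℕ → List Op
moveOps j j′ = cst vSrc j ∷ cst vDst j′ ∷ cst vOff 0 ∷ []

update : Code
update = forEach vQ (maccEntry aP aI aT) ⨾ forEach vQ (maccEntry aP aAᵀ aPrev) ⨾
  -- Entries are bits, so `aP ⊙ aP` is `aP` and this adds the new `P` to `Aᵀ · X`. The new power
  -- waits in `aT` until the old one has been saved.
  forEach vQ (maccEntry aX aP aP) ⨾ copy (moveOps aN aPrev) ⨾ copy (moveOps aT aN)

-- vU * n + vV = vI; after incrementing vV, carry into vU if it equals n.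
nextBlock hitBlock foundBlock targetBlock searchEntry : List Op
nextBlock =
  cst tz 1 ∷ add! vV vV tz ∷ sub! tx vN vV ∷ sub! tx tz tx ∷ add! vU vU tx ∷
  mul! tx tx vN ∷ sub! vV vV tx ∷ []

-- Record the arcs (u , v) found in T[u] := v, and one such u in vStart.
hitBlock = getA aA tx ++ getA aX tz ++ mul! tx tx tz ∷ []
foundBlock =
  add! vFound vFound tx ∷
  mul! tz vStart tx ∷ sub! vStart vStart tz ∷ mul! tz vU tx ∷ add! vStart vStart tz ∷ []
targetBlock =
  cst ty aT ∷ get tt′ ty vU ∷
  mul! tz tt′ tx ∷ sub! tt′ tt′ tz ∷ mul! tz vV tx ∷ add! tt′ tt′ tz ∷ put ty vU tt′ ∷ []
searchEntry = hitBlock ++ foundBlock ++ targetBlock ++ nextBlock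

tourEntry : List Op
tourEntry =
  cst ty aOut ∷ cst tz 1 ∷ add! tx vI tz ∷ put ty tx vCur ∷ cst ty aT ∷ get vCur ty vCur ∷ []

reportOps stepOps : List Op
reportOps = cst ty aOut ∷ cst tx 0 ∷ cst tz 1 ∷ add! vLim vM tz ∷ put ty tx vLim ∷ mov vCur vStart
stepOps =
  cst tz 1 ∷ add! vM vM tz ∷ sub! vC vC tz ∷ cst vFound 0 ∷ cst vStart 0 ∷ cst vU 0 ∷ cst vV 0 ∷ []

report : Code
-- Leaving no rounds in `vC` ends the main loop.
report = ops reportOps ⨾ forEach vLim tourEntry ⨾ ops (cst vC 0 ∷ [])

iteration : Workspace → List FieldInstr → Code
iteration w p =
  multiply w p aA aN aT ⨾ multiply w p aP aAᵀ aP ⨾ multiply w p aAᵀ aX aX ⨾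
  update ⨾
  ops stepOps ⨾ forEach vQ searchEntry ⨾
  when vFound report

-- The first input cells are those of the registers: the prologue frees them by
-- packing their bits into one cell.
packed : ℕ
packed = 26

unpackEntry relocateEntry transposeBlock equalBlock tablesBlock tableEntry outputEntry : List Op
unpackEntry = hlf tx vE ∷ add! tz tx tx ∷ sub! tz vE tz ∷ putA aA tz ++ mov vE tx
relocateEntry =
  cst tz firstFree ∷ add! tx vI tz ∷ rget tx tx ∷ cst tz packed ∷ add! tt′ vI tz ∷ cst ty aA ∷ put ty tt′ tx ∷ []
transposeBlock = getA aA tx ++ mul! tz vV vN ∷ add! tz tz vU ∷ cst ty aAᵀ ∷ put ty tz tx ∷ []
equalBlock = sub! tx vU vV ∷ sub! tz vV vU ∷ add! tx tx tz ∷ cst tz 1 ∷ sub! tx tz tx ∷ []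
tablesBlock = putA aI tx ++ putA aN tx ++ putA aPrev tz
tableEntry = transposeBlock ++ equalBlock ++ tablesBlock ++ nextBlock
outputEntry =
  cst tz firstFree ∷ add! tx vI tz ∷ cst ty aOut ∷ get tz ty tx ∷ rput tx tz ∷ []

-- R (m + 1) := Σ 2 ^ i * R (m + 1 + i), in place and from the top.
packing : ℕ → List Instr
packing zero    = []
packing (suc m) = add (suc m) (suc m) (suc (suc m)) ∷ add (suc m) (suc m) (suc (suc m)) ∷ packing m

-- Registers 0 and 1 hold `n` and the packed bits, which move to `vN` and `vE`. They receive
-- `G = n² + 28`, beyond the `n² + 1` input cells and all variables, and `L = 3 * stride * n + 11`:
-- nine fixed arrays, two for the simulation, and `stride` more for each of the three calls in a
-- round.
prologue : Workspace → List Instr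
prologue w =
  const 2 0 ∷ add (reg vN) 0 2 ∷ add (reg vE) 1 2 ∷
  mul 0 0 0 ∷ const 2 (suc firstFree) ∷ add 0 0 2 ∷
  const 1 (3 * stride w) ∷ mul 1 1 (reg vN) ∷ const 2 (firstSim + 2) ∷ add 1 1 2 ∷ []

setupOps : ℕ → List Op
setupOps C =
  mul! vQ vN vN ∷ cst tz 1 ∷ add! tx vN tz ∷ mul! tx tx tx ∷ cst tz (C + 30) ∷ mul! vS tz tx ∷
  cst vρ firstSim ∷ cst vM 0 ∷ cst tz 1 ∷ sub! vC vN tz ∷ cst vLim packed ∷ []

beyondPacked : Var → List Op
beyondPacked x = cst tz packed ∷ sub! vLim x tz ∷ []

main : Workspace → List FieldInstr → ℕ → Code
main w p C =
  ops (setupOps C) ⨾ forEach vLim unpackEntry ⨾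
  ops (beyondPacked vQ) ⨾ forEach vLim relocateEntry ⨾
  ops (cst vU 0 ∷ cst vV 0 ∷ []) ⨾ forEach vQ tableEntry ⨾
  loop vC (iteration w p) ⨾
  ops (beyondPacked vN) ⨾ forEach vLim outputEntry

-- Overwrites the registers by the first entries of `aOut`, which is array 0 so that entry `i` lies
-- at `i * L + G`. The order is downward because the loads take `L` and `G` from registers 1 and 0,
-- which must therefore go last.
lowCells : ℕ → List Instr
lowCells 0 = load 0 0 ∷ []
lowCells 1 = add 1 1 0 ∷ load 1 1 ∷ lowCells 0
lowCells (suc (suc a)) =
  const (2 + a) (2 + a) ∷ mul (2 + a) (2 + a) 1 ∷ add (2 + a) (2 + a) 0 ∷ load (2 + a) (2 + a) ∷ lowCells (suc a)

program : Workspace → List FieldInstr → ℕ → List Instr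
program w p C = start ++ emit (main w p C) (length start) ++ lowCells packed
  where start = packing (packed ∸ 1) ++ prologue w

-- Loops over straight-line code

-- The variables that survive the loop overhead and the computation of
-- temporaries.
record Regs : Set where
  constructor mkRegs
  field
    rN rQ rS rρ rμ rM rC rE rCur rU rV rFound rStart rSrc rDst rOff rLim : ℕ

open Regs public

regs : St → Regs
regs s = mkRegs (s ⟨ vN ⟩) (s ⟨ vQ ⟩) (s ⟨ vS ⟩) (s ⟨ vρ ⟩) (s ⟨ vμ ⟩) (s ⟨ vM ⟩) (s ⟨ vC ⟩) (s ⟨ vE ⟩)
  (s ⟨ vCur ⟩) (s ⟨ vU ⟩) (s ⟨ vV ⟩) (s ⟨ vFound ⟩) (s ⟨ vStart ⟩)
  (s ⟨ vSrc ⟩) (s ⟨ vDst ⟩) (s ⟨ vOff ⟩) (s ⟨ vLim ⟩)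

Pred : Set₁
Pred = Regs → (ℕ → Memory ℕ) → Memory ℕ → Set

On : Pred → St → Set
On J s = J (regs s) (arr s) (raw s)

module Loops (bounds : Bounds) (100<B₁ : 100 < Bounds.B₁ bounds) where
  open Bounds bounds
  open Logic bounds

  small : ∀ {k} → k ≤ 100 → k < B₁
  small k≤ = ≤-<-trans k≤ 100<B₁

  effects-++ : ∀ os {os′} s → effects (os ++ os′) s ≡ effects os′ (effects os s)
  effects-++ []       s = refl
  effects-++ (o ∷ os) s = effects-++ os (effect o s)

  Oks-++ : ∀ os {os′ s} → Oks os s → Oks os′ (effects os s) → Oks (os ++ os′) s
  Oks-++ []       _          oks = oks
  Oks-++ (o ∷ os) (ok , oks) oks′ = ok , Oks-++ os oks oks′

  forEachTime : ℕ → List Op → ℕ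
  forEachTime c body = 3 + suc (c * (2 + length (emitOps (body ++ advance))))

  forEach-triple : ∀ count body {c} (J : ℕ → Pred) →
    (∀ s k → setv s tz k ⟨ count ⟩ ≡ s ⟨ count ⟩) →
    (∀ i s → Wf s → i < c → On (J i) s → s ⟨ vI ⟩ ≡ i →
       Oks body s × On (J (suc i)) (effects body s)
       × effects body s ⟨ vI ⟩ ≡ s ⟨ vI ⟩ × effects body s ⟨ vK ⟩ ≡ s ⟨ vK ⟩) →
    Triple (λ s → On (J 0) s × s ⟨ count ⟩ ≡ c) (forEach count body) (On (J c)) (forEachTime c body)
  forEach-triple count body {c} J tz-free step .exec at rep (J₀ , count≡) =
    _⨟_ {P = λ s → On (J 0) s × s ⟨ count ⟩ ≡ c} {Q = Inv c}
      (ops-triple setup init)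
      (conseq (λ _ _ P → P) (λ s _ → exit s) ≤-refl
        (loop-triple {I = Inv} {E = λ _ → ⊥} (λ k s (_ , _ , _ , _ , eq) → eq) (λ _ ()) body-triple c)) .exec
      at rep (J₀ , count≡)
    where
    setup = cst tz 0 ∷ add! vK count tz ∷ cst vI 0 ∷ []
    c<B₁ : c < B₁
    c<B₁ = subst (_< B₁) count≡ (Wf.var< (Rep.wf rep) count)
    Inv : ℕ → St → Set
    Inv k s = ∃[ i ] i + k ≡ c × On (J i) s × s ⟨ vI ⟩ ≡ i × s ⟨ vK ⟩ ≡ k
    exit : ∀ s → Inv 0 s ⊎ ⊥ → On (J c) s
    exit s (inj₁ (i , eq , Ji , _)) = subst (λ i → On (J i) s) (trans (sym (+-identityʳ i)) eq) Ji
    init : ∀ s → Wf s → On (J 0) s × s ⟨ count ⟩ ≡ c → Oks setup s × Inv c (effects setup s)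
    init s wf (J₀ , eq) = (small z≤n , subst (_< B₁) (sym value) c<B₁ , small z≤n , tt) ,
      0 , refl , J₀ , refl , value
      where
      value : setv s tz 0 ⟨ count ⟩ + 0 ≡ c
      value = trans (+-identityʳ _) (trans (tz-free s 0) eq)
    body-triple : ∀ k → Triple (Inv (suc k)) (ops (body ++ advance)) (λ s → Inv k s ⊎ ⊥) (length (emitOps (body ++ advance)))
    body-triple k = ops-triple {P = Inv (suc k)} (body ++ advance) λ s wf (i , eq , Ji , vI≡ , vK≡) →
      let i<c = subst (i <_) eq (m<m+n i (s≤s z≤n))
          oks , J′ , keepI , keepK = step i s wf i<c Ji vI≡
          e = effects body s
          next : e ⟨ vI ⟩ + 1 ≡ suc i
          next = trans (+-comm (e ⟨ vI ⟩) 1) (cong suc (trans keepI vI≡))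
      in Oks-++ body oks (small (s≤s z≤n) , ≤-<-trans (≤-trans (≤-reflexive next) i<c) c<B₁ , tt , tt) ,
         inj₁ (subst (Inv k) (sym (effects-++ body s))
           (suc i , trans (sym (+-suc i k)) eq , J′ , next , cong (_∸ 1) (trans keepK vK≡)))

  -- Names the state before the code runs, so that loop invariants and postconditions can refer to
  -- it.
  ghost : ∀ {P Q c t} → (∀ s₀ → Wf s₀ → P s₀ → Triple (λ s → s ≡ s₀) c Q t) → Triple P c Q t
  ghost h .exec {s = s} at rep Ps = h s (Rep.wf rep) Ps .exec at rep refl

  exact : ∀ {s₀} os → Oks os s₀ → Triple (λ s → s ≡ s₀) (ops os) (λ s → s ≡ effects os s₀) (length (emitOps os))
  exact os oks = ops-triple os λ { s wf refl → oks , refl }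

  -- Straight-line code in small pieces, to keep the states small.
  record Block (P : St → Set) (os : List Op) (Q : St → Set) : Set where
    constructor block
    field
      step : ∀ s → P s → Oks os s × Q (effects os s)

  open Block public

  infixr 4 _▸_

  _▸_ : ∀ {P Q R os os′} → Block P os Q → Block Q os′ R → Block P (os ++ os′) R
  _▸_ {R = R} {os} {os′} f g .step s Ps =
    let oks , Qs = f .step s Ps
        oks′ , Rs = g .step (effects os s) Qs
    in Oks-++ os oks oks′ , subst R (sym (effects-++ os s)) Rs

  record Exactly (κ : Regs) (a : ℕ → Memory ℕ) (i k : ℕ) (s : St) : Set where
    constructor exactly
    field
      regs≡ : regs s ≡ κ
      arr≡  : arr s ≡ a
      vI≡   : s ⟨ vI ⟩ ≡ i
      vK≡   : s ⟨ vK ⟩ ≡ k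

-- Lists in memory

module _ {A : Set} (z : A) where

  initial-++ˡ : ∀ xs ys {i} → i < length xs → initial z (xs ++ ys) i ≡ initial z xs i
  initial-++ˡ (x ∷ xs) ys {zero}  _       = refl
  initial-++ˡ (x ∷ xs) ys {suc i} (s≤s p) = initial-++ˡ xs ys p

  initial-++ʳ : ∀ xs ys i → initial z (xs ++ ys) (length xs + i) ≡ initial z ys i
  initial-++ʳ []       ys i = refl
  initial-++ʳ (x ∷ xs) ys i = initial-++ʳ xs ys i

  initial-beyond : ∀ xs {i} → length xs ≤ i → initial z xs i ≡ z
  initial-beyond []       _       = refl
  initial-beyond (x ∷ xs) (s≤s p) = initial-beyond xs p

  initial-tabulate : ∀ {n} (f : Fin n → A) i → initial z (tabulate f) (toℕ i) ≡ f i
  initial-tabulate f zero    = refl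
  initial-tabulate f (suc i) = initial-tabulate (f ∘ suc) i

  startsWith⇒initial : ∀ m xs → StartsWith m xs → ∀ {i} → i < length xs → m i ≡ initial z xs i
  startsWith⇒initial m (x ∷ xs) eq {zero}  _       = List.∷-injectiveˡ eq
  startsWith⇒initial m (x ∷ xs) eq {suc i} (s≤s p) =
    startsWith⇒initial (m ∘ suc) xs (List.∷-injectiveʳ eq) p

  initial⇒startsWith : ∀ m xs → (∀ i → i < length xs → m i ≡ initial z xs i) → StartsWith m xs
  initial⇒startsWith m []       eq = refl
  initial⇒startsWith m (x ∷ xs) eq =
    cong₂ _∷_ (eq 0 (s≤s z≤n)) (initial⇒startsWith (m ∘ suc) xs (λ i p → eq (suc i) (s≤s p)))

  rows : ∀ {m n} → Matrix A m n → List A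
  rows {zero}  X = []
  rows {suc m} X = tabulate (X zero) ++ rows (X ∘ suc)

  rowMajor-rows : ∀ {m n} (X : Matrix A m n) → rowMajor X ≡ rows X
  rowMajor-rows {m} {n} X = go (λ i → i)
    where
    go : ∀ {k} (f : Fin k → Fin m) → concatMap (λ i → map (X i) (allFin n)) (tabulate f) ≡ rows (X ∘ f)
    go {zero}  f = refl
    go {suc k} f = cong₂ _++_ (List.map-tabulate (λ i → i) (X (f zero))) (go (f ∘ suc))

  length-rows : ∀ {m n} (X : Matrix A m n) → length (rows X) ≡ m * n
  length-rows {zero}      X = refl
  length-rows {suc m} {n} X = trans (List.length-++ (tabulate (X zero)))
    (cong₂ _+_ (List.length-tabulate (X zero)) (length-rows (X ∘ suc)))

  length-rowMajor : ∀ {m n} (X : Matrix A m n) → length (rowMajor X) ≡ m * n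
  length-rowMajor X = trans (cong length (rowMajor-rows X)) (length-rows X)

  initial-rowMajor : ∀ {m n} (X : Matrix A m n) u v → initial z (rowMajor X) (toℕ u * n + toℕ v) ≡ X u v
  initial-rowMajor {m} {n} X u v = trans (cong (λ xs → initial z xs (toℕ u * n + toℕ v)) (rowMajor-rows X)) (go X u)
    where
    go : ∀ {m} (X : Matrix A m n) (u : Fin m) → initial z (rows X) (toℕ u * n + toℕ v) ≡ X u v
    go X zero = trans
      (initial-++ˡ (tabulate (X zero)) (rows (X ∘ suc)) (subst (toℕ v <_) (sym (List.length-tabulate (X zero))) (toℕ<n v)))
      (initial-tabulate (X zero) v)
    go X (suc u) = trans
      (cong (initial z (rows X)) (trans (+-assoc n (toℕ u * n) (toℕ v))
        (cong (_+ (toℕ u * n + toℕ v)) (sym (List.length-tabulate (X zero))))))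
      (trans (initial-++ʳ (tabulate (X zero)) (rows (X ∘ suc)) (toℕ u * n + toℕ v)) (go (X ∘ suc) u))

flat< : ∀ {m n} (u : Fin m) (v : Fin n) → toℕ u * n + toℕ v < m * n
flat< {m} {n} u v = subst (_< m * n)
  (trans (toℕ-combine u v) (cong (_+ toℕ v) (*-comm n (toℕ u)))) (toℕ<n (combine u v))

unflatten : ∀ m n {i} → i < m * n → ∃₂ λ (u : Fin m) (v : Fin n) → i ≡ toℕ u * n + toℕ v
unflatten m n {i} i<mn with combine-surjective {m} {n} (fromℕ< i<mn)
... | u , v , eq = u , v ,
  trans (sym (toℕ-fromℕ< i<mn)) (trans (cong toℕ (sym eq))
    (trans (toℕ-combine u v) (cong (_+ toℕ v) (*-comm n (toℕ u)))))

flat-injective : ∀ n {u u′ v v′} → v < n → v′ < n → u * n + v ≡ u′ * n + v′ → u ≡ u′ × v ≡ v′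
flat-injective n {zero}  {zero}   v< v′< eq = refl , eq
flat-injective n {zero}  {suc u′} {v} {v′} v< v′< eq with () ← <⇒≱ v<
  (subst (n ≤_) (sym eq) (≤-trans (m≤m+n n (u′ * n)) (m≤m+n (n + u′ * n) v′)))
flat-injective n {suc u} {zero}  {v} {v′}  v< v′< eq with () ← <⇒≱ v′<
  (subst (n ≤_) eq (≤-trans (m≤m+n n (u * n)) (m≤m+n (n + u * n) v)))
flat-injective n {suc u} {suc u′} {v} {v′} v< v′< eq =
  let p , q = flat-injective n v< v′< (+-cancelˡ-≡ n (u * n + v) (u′ * n + v′)
        (trans (sym (+-assoc n (u * n) v)) (trans eq (+-assoc n (u′ * n) v′))))
  in cong suc p , q

-- Matrix multiplication

module _ (a : ℕ → Memory ℕ) where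

  put-same : ∀ j i {x} → (a [ j ≔ a j [ i ≔ x ] ]) j i ≡ x
  put-same j i = trans (cong (λ f → f i) (upd-≡ a j)) (upd-≡ (a j) i)

  put-entry : ∀ j {i x} k {i′} → i ≢ i′ → (a [ j ≔ a j [ i ≔ x ] ]) k i′ ≡ a k i′
  put-entry j k i≢i′ with j ≟ k
  ... | yes refl = trans (cong (λ f → f _) (upd-≡ a j)) (upd-≢ (a j) i≢i′)
  ... | no j≢k   = cong (λ f → f _) (upd-≢ a j≢k)

record Setting : Set₁ where
  field
    bounds : Bounds
  open Bounds bounds public
  BoundedConfig : Config Store → Set
  BoundedConfig (_ , R , M) = (∀ a → R a < B₁) × (∀ a → OutI a → R a ≡ 0) × (∀ a → OutI a → M a ≡ false)
  input : ∀ {n} → BoolMatrix n → BoolMatrix n → Config Store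
  input {n} A B = 0 , initial 0 [ n ] , initial false (rowMajor A ++ rowMajor B)
  field
    workspace : Workspace
    n S       : ℕ
    100<B₁    : 100 < B₁
    S<B₁      : S < B₁
    L<B₁      : L < B₁
    ample     : 3 * (suc n * suc n) + 30 ≤ S
    inside    : ∀ {i} → i < S → ¬ OutI i
    outside   : ∀ {i} → S ≤ i → workspace ≡ quadratic → OutI i
    arrays    : firstSim + 2 + stride workspace * (3 * n) ≤ L
    p         : List FieldInstr
    constants<B₁ : allConstants p < B₁
    algorithm : ∀ (A B : BoolMatrix n) → Σ[ t ∈ ℕ ]
      ( head (drop (proj₁ (run p t (input A B))) p) ≡ nothing
      × StartsWith (proj₂ (proj₂ (run p t (input A B)))) (rowMajor (A · B))
      × (∀ u → u ≤ t → BoundedConfig (run p u (input A B))))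

module Verified-Multiply (setting : Setting) where
  open Setting setting
  open Logic bounds
  open Loops bounds 100<B₁

  Holds : Memory ℕ → BoolMatrix n → Set
  Holds a X = ∀ u v → a (toℕ u * n + toℕ v) ≡ bit (X u v)

  q : ℕ
  q = n * n

  flatten-holds : ∀ {a X} → Holds a X → ∀ {i} → i < q → a i ≡ bit (initial false (rowMajor X) i)
  flatten-holds {X = X} h i<q with unflatten n n i<q
  ... | u , v , refl = trans (h u v) (cong bit (sym (initial-rowMajor false X u v)))

  unflatten-holds : ∀ {a X} → (∀ {i} → i < q → a i ≡ bit (initial false (rowMajor X) i)) → Holds a X
  unflatten-holds {X = X} h u v = trans (h (flat< u v)) (cong bit (initial-rowMajor false X u v))

  2q≤S : q + q ≤ S
  2q≤S = begin
    q + q                          ≤⟨ +-mono-≤ q≤ q≤ ⟩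
    N + N                          ≤⟨ +-monoʳ-≤ N (m≤m+n N (N + 0)) ⟩
    3 * N                          ≤⟨ m≤m+n (3 * N) 30 ⟩
    3 * N + 30                     ≤⟨ ample ⟩
    S                              ∎
    where
    open ≤-Reasoning
    N = suc n * suc n
    q≤ : q ≤ N
    q≤ = *-mono-≤ (n≤1+n n) (n≤1+n n)

  q≤S : q ≤ S
  q≤S = ≤-trans (m≤m+n q q) 2q≤S

  n<S : n < S
  n<S = begin-strict
    n                    <⟨ n<1+n n ⟩
    suc n                ≤⟨ m≤m*n (suc n) (suc n) ⟩
    suc n * suc n        ≤⟨ m≤m+n (suc n * suc n) _ ⟩
    3 * (suc n * suc n)  ≤⟨ m≤m+n _ 30 ⟩
    3 * (suc n * suc n) + 30 ≤⟨ ample ⟩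
    S                    ∎
    where open ≤-Reasoning

  -- The state between calls: r more calls are allowed, and array j ≤ 8 holds
  -- the matrix X j.
  record Env (r m c : ℕ) (X : ℕ → BoolMatrix n) (κ : Regs) (a : ℕ → Memory ℕ) : Set where
    field
      N≡    : rN κ ≡ n
      Q≡    : rQ κ ≡ q
      S≡    : rS κ ≡ S
      M≡    : rM κ ≡ m
      C≡    : rC κ ≡ c
      9≤ρ   : firstSim ≤ rρ κ
      room  : suc (rρ κ) + stride workspace * r < L
      clean : ∀ j i → suc (rρ κ) < j → j < L → a j i ≡ 0
      mats  : ∀ j → 1 ≤ j → j < firstSim → Holds (a j) (X j)
      out0  : ∀ i → a aOut i ≡ 0

    μ<L : suc (rρ κ) < L
    μ<L = ≤-<-trans (m≤m+n _ _) room
    ρ<L : rρ κ < L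
    ρ<L = <-trans (n<1+n _) μ<L

  env-regs : ∀ {r m c X κ κ′ a} → rN κ′ ≡ rN κ → rQ κ′ ≡ rQ κ → rS κ′ ≡ rS κ → rM κ′ ≡ rM κ → rC κ′ ≡ rC κ →
             rρ κ′ ≡ rρ κ → Env r m c X κ a → Env r m c X κ′ a
  env-regs e₁ e₂ e₃ e₄ e₅ refl E = record
    { N≡ = trans e₁ N≡ ; Q≡ = trans e₂ Q≡ ; S≡ = trans e₃ S≡ ; M≡ = trans e₄ M≡ ; C≡ = trans e₅ C≡
    ; 9≤ρ = 9≤ρ ; room = room ; clean = clean ; mats = mats ; out0 = out0 }
    where open Env E

  env-arr : ∀ {r m c X κ a a′} → (∀ j → j ≢ rρ κ → j ≢ suc (rρ κ) → a′ j ≡ a j) →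
            Env r m c X κ a → Env r m c X κ a′
  env-arr {κ = κ} {a} {a′} same E = record
    { N≡ = N≡ ; Q≡ = Q≡ ; S≡ = S≡ ; M≡ = M≡ ; C≡ = C≡ ; 9≤ρ = 9≤ρ ; room = room
    ; clean = λ j i ρ<j j<L → trans (cong (λ f → f i)
        (same j (λ { refl → <⇒≱ ρ<j (n≤1+n j) }) (λ { refl → <-irrefl refl ρ<j }))) (clean j i ρ<j j<L)
    ; mats = λ j 1≤j j<9 u v → trans (cong (λ f → f (toℕ u * n + toℕ v)) (low j j<9)) (mats j 1≤j j<9 u v)
    ; out0 = λ i → trans (cong (λ f → f i) (low aOut (s≤s z≤n))) (out0 i) }
    where
    open Env E
    low : ∀ j → j < firstSim → a′ j ≡ a j
    low j j<9 = same j (λ { refl → <⇒≱ j<9 9≤ρ }) (λ { refl → <⇒≱ j<9 (m≤n⇒m≤1+n 9≤ρ) })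

  record Cleared (r m c : ℕ) (X : ℕ → BoolMatrix n) (κ : Regs) (a : ℕ → Memory ℕ) : Set where
    field
      env : Env r m c X κ a
      μ≡  : rμ κ ≡ suc (rρ κ)
      ρ0  : ∀ i → a (rρ κ) i ≡ 0
      μ0  : ∀ i → a (suc (rρ κ)) i ≡ 0

  freshTime : ℕ
  freshTime = length (emitOps (freshOps workspace)) + forEachTime S zeroSim

  -- Why all entries are zero and not just the `S` cleared ones: in the unrestricted case `vρ` has
  -- moved on to arrays that no call has used, and in the quadratic case entries beyond `S` are zero
  -- at all times.
  fresh-triple : ∀ {r m c X} → Triple (λ s → Env (suc r) m c X (regs s) (arr s)) (fresh workspace)
    (λ s → Cleared r m c X (regs s) (arr s)) freshTime
  fresh-triple {r} {m} {c} {X} =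
    _⨟_ {Q = λ s → On (J 0) s × s ⟨ vS ⟩ ≡ S}
      (ops-triple (freshOps workspace) enter)
      (conseq (λ _ _ P → P) leave ≤-refl (forEach-triple vS zeroSim J (λ _ _ → refl) body))
    where
    Zero : ℕ → Regs → (ℕ → Memory ℕ) → Set
    Zero i κ a = (∀ i′ → i′ < i ⊎ workspace ≡ unrestricted → a (rρ κ) i′ ≡ 0)
               × (∀ i′ → i′ < i ⊎ workspace ≡ unrestricted → a (suc (rρ κ)) i′ ≡ 0)
    J : ℕ → Pred
    J i κ a _ = Env r m c X κ a × rμ κ ≡ suc (rρ κ) × Zero i κ a
    enter : ∀ s → Wf s → Env (suc r) m c X (regs s) (arr s) →
            Oks (freshOps workspace) s × On (J 0) (effects (freshOps workspace) s) × effects (freshOps workspace) s ⟨ vS ⟩ ≡ S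
    enter s wf E = (small (stride-small workspace) , ≤-<-trans (n≤1+n _) (≤-<-trans ρ′<L L<B₁) ,
                    small (s≤s z≤n) , ≤-<-trans (≤-reflexive (+-comm _ 1)) (<-trans ρ′<L′ L<B₁) , tt) ,
        (record { N≡ = N≡ ; Q≡ = Q≡ ; S≡ = S≡ ; M≡ = M≡ ; C≡ = C≡
               ; 9≤ρ = ≤-trans 9≤ρ (m≤m+n _ _)
               ; room = room′
               ; clean = λ j i lt → clean j i (≤-<-trans (s≤s (m≤m+n ρ δ)) lt)
               ; mats = mats ; out0 = out0 }
        , +-comm _ 1 , zero-ρ , zero-μ) , S≡
      where
      open Env E
      ρ = s ⟨ vρ ⟩
      δ = stride workspace
      stride-small : ∀ w → stride w ≤ 100
      stride-small unrestricted = s≤s (s≤s z≤n)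
      stride-small quadratic    = z≤n
      room′ : suc (ρ + δ) + δ * r < L
      room′ = subst (_< L) (trans (cong (suc ρ +_) (*-suc δ r)) (sym (+-assoc (suc ρ) δ (δ * r)))) room
      ρ′<L′ : suc (ρ + δ) < L
      ρ′<L′ = ≤-<-trans (m≤m+n _ (δ * r)) room′
      ρ′<L : suc (ρ + δ) ≤ L
      ρ′<L = <⇒≤ ρ′<L′
      zero-ρ : ∀ i → i < 0 ⊎ workspace ≡ unrestricted → arr s (ρ + δ) i ≡ 0
      zero-ρ i (inj₂ refl) = clean (ρ + 2) i (subst (suc ρ <_) (+-comm 2 ρ) (n<1+n _)) (<-trans (n<1+n _) ρ′<L′)
      zero-μ : ∀ i → i < 0 ⊎ workspace ≡ unrestricted → arr s (suc (ρ + δ)) i ≡ 0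
      zero-μ i (inj₂ refl) = clean (suc (ρ + 2)) i (s≤s (subst (suc ρ ≤_) (+-comm 2 ρ) (n≤1+n _))) ρ′<L′
    body : ∀ i s → Wf s → i < S → On (J i) s → s ⟨ vI ⟩ ≡ i →
      Oks zeroSim s × On (J (suc i)) (effects zeroSim s)
      × effects zeroSim s ⟨ vI ⟩ ≡ s ⟨ vI ⟩ × effects zeroSim s ⟨ vK ⟩ ≡ s ⟨ vK ⟩
    body i s wf i<S (E , μ≡ , zρ , zμ) refl =
      (small z≤n , (ρ<L , λ _ → refl) , (subst (_< L) (sym μ≡) μ<L , λ _ → refl) , tt) ,
      (env-arr same E , μ≡ , zero-ρ , zero-μ) , refl , refl
      where
      open Env E
      κ = regs s
      a = arr s
      a₁ = a [ rρ κ ≔ a (rρ κ) [ i ≔ 0 ] ]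
      a₂ = a₁ [ rμ κ ≔ a₁ (rμ κ) [ i ≔ 0 ] ]
      same : ∀ j → j ≢ rρ κ → j ≢ suc (rρ κ) → a₂ j ≡ a j
      same j j≢ρ j≢μ = trans (upd-≢ a₁ (λ eq → j≢μ (trans (sym eq) μ≡))) (upd-≢ a (j≢ρ ∘ sym))
      off : ∀ j {i′} → i ≢ i′ → a₂ j i′ ≡ a j i′
      off j i≢i′ = trans (put-entry a₁ (rμ κ) j i≢i′) (put-entry a (rρ κ) j i≢i′)
      earlier : ∀ {i′} → i ≢ i′ → i′ < suc i ⊎ workspace ≡ unrestricted → i′ < i ⊎ workspace ≡ unrestricted
      earlier i≢i′ (inj₁ (s≤s i′≤i)) = inj₁ (≤∧≢⇒< i′≤i (i≢i′ ∘ sym))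
      earlier i≢i′ (inj₂ eq)         = inj₂ eq
      zero-ρ : ∀ i′ → i′ < suc i ⊎ workspace ≡ unrestricted → a₂ (rρ κ) i′ ≡ 0
      zero-ρ i′ p with i ≟ i′
      ... | yes refl = trans (cong (λ f → f i) (upd-≢ a₁ (λ eq → 1+n≢n (trans (sym μ≡) eq)))) (put-same a (rρ κ) i)
      ... | no i≢i′  = trans (off (rρ κ) i≢i′) (zρ i′ (earlier i≢i′ p))
      zero-μ : ∀ i′ → i′ < suc i ⊎ workspace ≡ unrestricted → a₂ (suc (rρ κ)) i′ ≡ 0
      zero-μ i′ p with i ≟ i′
      ... | yes refl = subst (λ j → a₂ j i ≡ 0) μ≡ (put-same a₁ (rμ κ) i)
      ... | no i≢i′  = trans (off (suc (rρ κ)) i≢i′) (zμ i′ (earlier i≢i′ p))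
    leave : ∀ s → Wf s → On (J S) s → Cleared r m c X (regs s) (arr s)
    leave s wf (E , μ≡ , zρ , zμ) = record
      { env = E ; μ≡ = μ≡
      ; ρ0 = λ i → all (rρ (regs s)) (Env.ρ<L E) zρ i
      ; μ0 = λ i → all (suc (rρ (regs s))) (Env.μ<L E) zμ i }
      where
      all : ∀ j → j < L → (∀ i → i < S ⊎ workspace ≡ unrestricted → arr s j i ≡ 0) → ∀ i → arr s j i ≡ 0
      all j j<L z i with i <? S | workspace in eq
      ... | yes i<S | _            = z i (inj₁ i<S)
      ... | no _    | unrestricted = z i (inj₂ refl)
      ... | no i≮S  | quadratic    = Wf.arr0 wf j i j<L (outside (≮⇒≥ i≮S) eq)

  module Copy (κ₀ : Regs) (a₀ : ℕ → Memory ℕ) where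
    src = rSrc κ₀
    dst = rDst κ₀
    off = rOff κ₀

    record Copied (i : ℕ) (κ : Regs) (a : ℕ → Memory ℕ) : Set where
      field
        κ≡     : κ ≡ κ₀
        others : ∀ j → j ≢ dst → a j ≡ a₀ j
        filled   : ∀ i′ → i′ < i → a dst (i′ + off) ≡ a₀ src i′
        rest   : ∀ b → (∀ i′ → i′ < i → b ≢ i′ + off) → a dst b ≡ a₀ dst b

    copy-triple : src ≢ dst → src < L → dst < L → off ≤ q → rQ κ₀ ≡ q →
      ∀ os → {s₀ : St} → Oks os s₀ → regs (effects os s₀) ≡ κ₀ → arr (effects os s₀) ≡ a₀ →
      Triple (λ s → s ≡ s₀) (copy os) (λ s → Copied q (regs s) (arr s))
        (length (emitOps os) + forEachTime q copyEntry)
    copy-triple src≢dst src<L dst<L off≤q Q≡ os {s₀} oks κ≡ a≡ =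
      exact os oks ⨟
      conseq (λ { s _ refl → record { κ≡ = κ≡ ; others = λ j _ → cong (λ a → a j) a≡ ; filled = λ _ ()
                                    ; rest = λ b _ → cong (λ a → a dst b) a≡ } ,
                             trans (cong rQ κ≡) Q≡ })
             (λ _ _ C → C) ≤-refl
        (forEach-triple vQ copyEntry (λ i κ a _ → Copied i κ a) (λ _ _ → refl) body)
      where
      body : ∀ i s → Wf s → i < q → Copied i (regs s) (arr s) → s ⟨ vI ⟩ ≡ i →
        Oks copyEntry s × Copied (suc i) (regs (effects copyEntry s)) (arr (effects copyEntry s))
        × effects copyEntry s ⟨ vI ⟩ ≡ s ⟨ vI ⟩ × effects copyEntry s ⟨ vK ⟩ ≡ s ⟨ vK ⟩
      body i s wf i<q C refl with Copied.κ≡ C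
      ... | refl = (src<L , <-trans i+off<S S<B₁ , (dst<L , λ o → contradiction o (inside i+off<S)) , tt) ,
        record { κ≡ = refl
               ; others = λ j j≢dst → trans (upd-≢ a (j≢dst ∘ sym)) (others j j≢dst)
               ; filled = filled′ ; rest = rest′ } , refl , refl
        where
        open Copied C
        a = arr s
        i+off<S : i + off < S
        i+off<S = <-≤-trans (+-mono-<-≤ i<q off≤q) 2q≤S
        filled′ : ∀ i′ → i′ < suc i → (a [ dst ≔ a dst [ i + off ≔ a src i ] ]) dst (i′ + off) ≡ a₀ src i′
        filled′ i′ (s≤s i′≤i) with i ≟ i′
        ... | yes refl = trans (put-same a dst (i + off)) (cong (λ f → f i) (others src src≢dst))
        ... | no i≢i′  = trans (put-entry a dst dst (i≢i′ ∘ +-cancelʳ-≡ off i i′)) (filled i′ (≤∧≢⇒< i′≤i (i≢i′ ∘ sym)))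
        rest′ : ∀ b → (∀ i′ → i′ < suc i → b ≢ i′ + off) → (a [ dst ≔ a dst [ i + off ≔ a src i ] ]) dst b ≡ a₀ dst b
        rest′ b b∉ = trans (put-entry a dst dst (λ eq → b∉ i (n<1+n i) (sym eq)))
          (rest b (λ i′ i′<i → b∉ i′ (m<n⇒m<1+n i′<i)))

  record Loaded (xs : List Bool) (r m c : ℕ) (X : ℕ → BoolMatrix n) (κ : Regs) (a : ℕ → Memory ℕ) : Set where
    field
      env : Env r m c X κ a
      μ≡  : rμ κ ≡ suc (rρ κ)
      ρ0  : ∀ i → a (rρ κ) i ≡ 0
      μ*  : ∀ i → a (suc (rρ κ)) i ≡ bit (initial false xs i)

  low≢μ : ∀ {r m c X κ a j} → Env r m c X κ a → j < firstSim → j ≢ suc (rρ κ)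
  low≢μ E j<9 refl = <⇒≱ j<9 (m≤n⇒m≤1+n (Env.9≤ρ E))

  small-id : ∀ {j} → j < firstSim → j < B₁
  small-id j<9 = <-trans j<9 (small (≤ᵇ⇒≤ 9 100 tt))

  copyTime : List Op → ℕ
  copyTime os = length (emitOps os) + forEachTime q copyEntry

  -- Serves both operands: `xs` is what has been loaded before, empty for the first and the first
  -- matrix for the second.
  load-triple : ∀ {r m c X xs ys} j → 1 ≤ j → j < firstSim → ∀ os →
    (∀ s → Loaded xs r m c X (regs s) (arr s) → Oks os s) →
    (∀ s → Loaded xs r m c X (regs s) (arr s) → let κ = regs (effects os s) in
       κ ≡ record (regs s) { rSrc = j ; rDst = rμ (regs s) ; rOff = length xs } × arr (effects os s) ≡ arr s) →
    length xs ≤ q → ys ≡ xs ++ rowMajor (X j) →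
    Triple (λ s → Loaded xs r m c X (regs s) (arr s)) (copy os) (λ s → Loaded ys r m c X (regs s) (arr s)) (copyTime os)
  load-triple {r} {m} {c} {X} {xs} j 1≤j j<9 os oks effect≡ len refl = ghost λ s₀ wf₀ Ld →
    let open Loaded Ld
        κ≡ , a≡ = effect≡ s₀ Ld
        κ₀ = record (regs s₀) { rSrc = j ; rDst = rμ (regs s₀) ; rOff = length xs }
        j≢dst : j ≢ rμ (regs s₀)
        j≢dst eq = low≢μ env j<9 (trans eq μ≡)
    in conseq (λ _ _ P → P) (λ s _ C → loaded s₀ Ld (regs s) (arr s) C) ≤-refl
         (Copy.copy-triple κ₀ (arr s₀) j≢dst
           (<-trans j<9 (≤-<-trans (Env.9≤ρ env) (Env.ρ<L env))) (subst (_< L) (sym μ≡) (Env.μ<L env))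
           len (Env.Q≡ env) os (oks s₀ Ld) κ≡ a≡)
    where
    loaded : ∀ s₀ → Loaded xs r m c X (regs s₀) (arr s₀) → ∀ κ a →
      Copy.Copied (record (regs s₀) { rSrc = j ; rDst = rμ (regs s₀) ; rOff = length xs }) (arr s₀) q κ a →
      Loaded (xs ++ rowMajor (X j)) r m c X κ a
    loaded s₀ Ld κ a C with Copy.Copied.κ≡ C
    ... | refl = record
      { env = env-regs {κ = regs s₀} refl refl refl refl refl refl (env-arr (λ k _ k≢μ → others k (λ eq → k≢μ (trans eq μ≡))) env)
      ; μ≡  = μ≡
      ; ρ0  = λ i → trans (cong (λ f → f i) (others (rρ (regs s₀)) (λ eq → 1+n≢n (sym (trans eq μ≡))))) (ρ0 i)
      ; μ*  = λ i → subst (λ k → a k i ≡ bit (initial false (xs ++ rowMajor (X j)) i)) μ≡ (content i)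
      }
      where
      open Loaded Ld
      open Copy.Copied C
      dst = rμ (regs s₀)
      before : ∀ i → arr s₀ dst i ≡ bit (initial false xs i)
      before i = subst (λ k → arr s₀ k i ≡ bit (initial false xs i)) (sym μ≡) (μ* i)
      zs = rowMajor (X j)
      content : ∀ i → a dst i ≡ bit (initial false (xs ++ zs) i)
      content i with i <? length xs
      ... | yes i< = trans (rest i (λ i′ _ eq → <⇒≱ i< (≤-trans (m≤n+m (length xs) i′) (≤-reflexive (sym eq)))))
        (trans (before i) (cong bit (sym (initial-++ˡ false xs zs i<))))
      ... | no i≮ with i ∸ length xs <? q | m+[n∸m]≡n (≮⇒≥ i≮)
      ...   | yes k< | eq = subst (λ i → a dst i ≡ bit (initial false (xs ++ zs) i)) (trans (+-comm (i ∸ length xs) (length xs)) eq)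
        (trans (filled (i ∸ length xs) k<) (trans (flatten-holds {arr s₀ j} {X j} (Env.mats env j 1≤j j<9) k<)
          (cong bit (trans (sym (initial-++ʳ false xs zs (i ∸ length xs)))
            (cong (initial false (xs ++ zs)) (+-comm (length xs) (i ∸ length xs)))))))
      ...   | no k≮  | eq = trans
        (rest i (λ i′ i′<q eq′ → k≮ (subst (_< q) (sym (trans (cong (_∸ length xs) eq′) (m+n∸n≡m i′ (length xs)))) i′<q)))
        (trans (before i) (cong bit (trans (initial-beyond false xs (≮⇒≥ i≮))
          (sym (trans (cong (initial false (xs ++ zs)) (sym eq))
            (trans (initial-++ʳ false xs zs (i ∸ length xs))
              (initial-beyond false zs (≤-trans (≤-reflexive (length-rowMajor false (X j))) (≮⇒≥ k≮)))))))))

  dim-triple : ∀ {r m c X xs} → Triple (λ s → Loaded xs r m c X (regs s) (arr s)) (ops dimOps)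
    (λ s → Env r m c X (regs s) (arr s) × rμ (regs s) ≡ suc (rρ (regs s))
         × (∀ i → arr s (rρ (regs s)) i ≡ initial 0 [ n ] i)
         × (∀ i → arr s (suc (rρ (regs s))) i ≡ bit (initial false xs i)))
    (length (emitOps dimOps))
  dim-triple = ops-triple dimOps λ s wf Ld → let open Loaded Ld in let open Env env in
    (small z≤n , (ρ<L , λ o → contradiction o (inside (≤-<-trans z≤n n<S))) , tt) ,
    env-arr (λ j j≢ρ _ → upd-≢ (arr s) (j≢ρ ∘ sym)) env , μ≡ ,
    (λ where
      zero    → trans (put-same (arr s) (s ⟨ vρ ⟩) 0) N≡
      (suc i) → trans (put-entry (arr s) (s ⟨ vρ ⟩) {0} {s ⟨ vN ⟩} (s ⟨ vρ ⟩) {suc i} (λ ())) (ρ0 (suc i))) ,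
    (λ i → trans (cong (λ f → f i) (upd-≢ (arr s) (λ eq → 1+n≢n (sym eq)))) (μ* i))

  simulate-triple : ∀ {r m c X} A B → let t , _ = algorithm A B in
    Triple (λ s → Env r m c X (regs s) (arr s) × rμ (regs s) ≡ suc (rρ (regs s))
                × (∀ i → arr s (rρ (regs s)) i ≡ initial 0 [ n ] i)
                × (∀ i → arr s (suc (rρ (regs s))) i ≡ bit (initial false (rowMajor A ++ rowMajor B) i)))
      (simulate p)
      (λ s → Env r m c X (regs s) (arr s) × rμ (regs s) ≡ suc (rρ (regs s)) × Holds (arr s (suc (rρ (regs s)))) (A · B))
      (t * 60)
  simulate-triple {r} {m} {c} {X} A B .exec {prog} {a} {R} {s} at rep (E , μ≡ , ρ* , μ*) =
    let t , halted , solved , bounded = algorithm A B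
        open Correctness bounds (small (s≤s z≤n)) s (Env.ρ<L E) (subst (_< L) (sym μ≡) (Env.μ<L E))
          (λ eq → 1+n≢n (sym (trans eq μ≡)))
        start : Agrees s (initial 0 [ n ]) (initial false (rowMajor A ++ rowMajor B))
        start = record { arrR = ρ* ; arrM = λ i → trans (cong (λ j → arr s j i) μ≡) (μ* i)
                       ; others = λ _ _ _ → refl ; vars≡ = λ _ _ → refl ; raw≡ = refl }
        t′ , t′≤ , R′ , s′ , e , rep′ , ag = run-sim p constants<B₁ at t {0}
          rep start bounded
        open Agrees ag using (vars≡; others; arrM)
        ρ≡ρ : s′ ⟨ vρ ⟩ ≡ s ⟨ vρ ⟩
        ρ≡ρ = vars≡ vρ (≤ᵇ⇒≤ 4 10 tt)
        μ≡μ : s′ ⟨ vμ ⟩ ≡ suc (s′ ⟨ vρ ⟩)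
        μ≡μ = trans (vars≡ vμ (≤ᵇ⇒≤ 5 10 tt)) (trans μ≡ (cong suc (sym ρ≡ρ)))
    in t′ , t′≤ , R′ , s′ ,
       subst₂ (λ b e → Exec prog t′ (b , R) (e , R′)) (trans (cong (a +_) (pos-zero p)) (+-identityʳ a))
         (cong (a +_) (pos-halted p _ halted)) e ,
       rep′ ,
       env-regs {κ = regs s} (vars≡ vN (≤ᵇ⇒≤ 1 10 tt)) (vars≡ vQ (≤ᵇ⇒≤ 2 10 tt)) (vars≡ vS (≤ᵇ⇒≤ 3 10 tt))
         (vars≡ vM (≤ᵇ⇒≤ 6 10 tt)) (vars≡ vC (≤ᵇ⇒≤ 7 10 tt)) ρ≡ρ
         (env-arr (λ j j≢ρ j≢μ → others j j≢ρ (λ eq → j≢μ (trans eq μ≡))) E) ,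
       μ≡μ ,
       unflatten-holds {X = A · B} (λ {i} i<q → trans (cong (λ j → arr s′ j i) (trans (sym μ≡μ) (vars≡ vμ (≤ᵇ⇒≤ 5 10 tt))))
         (trans (arrM i) (cong bit (startsWith⇒initial false _ (rowMajor (A · B)) solved
           (subst (i <_) (sym (length-rowMajor false (A · B))) i<q)))))

  stored : ∀ {r m c X Y κ₀ a₀} j → 1 ≤ j → j < firstSim → Env r m c X κ₀ a₀ → rDst κ₀ ≡ j → rOff κ₀ ≡ 0 →
           Holds (a₀ (rSrc κ₀)) Y → ∀ κ a → Copy.Copied κ₀ a₀ q κ a → Env r m c (X [ j ≔ Y ]) κ a
  stored {r} {m} {c} {X} {Y} {κ₀} {a₀} j 1≤j j<9 E refl off≡0 Y* κ a C with Copy.Copied.κ≡ C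
  ... | refl = record
    { N≡ = N≡ ; Q≡ = Q≡ ; S≡ = S≡ ; M≡ = M≡ ; C≡ = C≡ ; 9≤ρ = 9≤ρ ; room = room
    ; clean = λ k i lt k<L → trans
        (cong (λ f → f i) (others k (λ { refl → <⇒≱ lt (≤-trans (<⇒≤ j<9) (m≤n⇒m≤1+n 9≤ρ)) }))) (clean k i lt k<L)
    ; mats = mats′
    ; out0 = λ i → trans (cong (λ f → f i) (others aOut (λ eq → contradiction (subst (1 ≤_) (sym eq) 1≤j) λ ()))) (out0 i)
    }
    where
    open Env E
    open Copy.Copied C
    mats′ : ∀ k → 1 ≤ k → k < firstSim → Holds (a k) ((X [ j ≔ Y ]) k)
    mats′ k 1≤k k<9 u v with j ≟ k
    ... | no j≢k = trans (cong (λ f → f _) (others k (j≢k ∘ sym)))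
      (trans (mats k 1≤k k<9 u v) (cong (λ Z → bit (Z u v)) (sym (upd-≢ X j≢k))))
    ... | yes refl = trans (cong (a j) (sym (trans (cong (_ +_) off≡0) (+-identityʳ _))))
      (trans (filled _ (flat< u v))
        (trans (Y* u v) (cong (λ Z → bit (Z u v)) (sym (upd-≡ X j)))))

  store-triple : ∀ {r m c X Y} j → 1 ≤ j → j < firstSim →
    Triple (λ s → Env r m c X (regs s) (arr s) × rμ (regs s) ≡ suc (rρ (regs s)) × Holds (arr s (suc (rρ (regs s)))) Y)
      (copy (outOps j)) (λ s → Env r m c (X [ j ≔ Y ]) (regs s) (arr s)) (copyTime (outOps j))
  store-triple {r} {m} {c} {X} {Y} j 1≤j j<9 = ghost λ s₀ wf₀ (E , μ≡ , Y*) →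
    let κ₀ = record (regs s₀) { rSrc = rμ (regs s₀) + 0 ; rDst = j ; rOff = 0 }
        src≡ : rμ (regs s₀) + 0 ≡ suc (rρ (regs s₀))
        src≡ = trans (+-identityʳ _) μ≡
        E₀ : Env r m c X κ₀ (arr s₀)
        E₀ = env-regs {κ = regs s₀} refl refl refl refl refl refl E
    in conseq (λ _ _ P → P)
         (λ s _ C → stored {κ₀ = κ₀} j 1≤j j<9 E₀ refl refl (subst (λ k → Holds (arr s₀ k) Y) (sym src≡) Y*) (regs s) (arr s) C) ≤-refl
         (Copy.copy-triple κ₀ (arr s₀) (λ eq → low≢μ E j<9 (trans (sym eq) src≡))
           (subst (_< L) (sym src≡) (Env.μ<L E)) (<-trans j<9 (≤-<-trans (Env.9≤ρ E) (Env.ρ<L E))) z≤n (Env.Q≡ E)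
           (outOps j) (small z≤n , subst (_< B₁) (sym src≡) (<-trans (Env.μ<L E) L<B₁) , small-id j<9 , small z≤n , tt) refl refl)

  move-triple : ∀ {r m c X} j j′ → 1 ≤ j → j < firstSim → 1 ≤ j′ → j′ < firstSim → j ≢ j′ →
    Triple (λ s → Env r m c X (regs s) (arr s)) (copy (moveOps j j′))
      (λ s → Env r m c (X [ j′ ≔ X j ]) (regs s) (arr s)) (copyTime (moveOps j j′))
  move-triple {r} {m} {c} {X} j j′ 1≤j j<9 1≤j′ j′<9 j≢j′ = ghost λ s₀ wf₀ E →
    let κ₀ = record (regs s₀) { rSrc = j ; rDst = j′ ; rOff = 0 }
        E₀ : Env r m c X κ₀ (arr s₀)
        E₀ = env-regs {κ = regs s₀} refl refl refl refl refl refl E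
        <L : ∀ {j} → j < firstSim → j < L
        <L j<9 = <-trans j<9 (≤-<-trans (Env.9≤ρ E) (Env.ρ<L E))
    in conseq (λ _ _ P → P)
         (λ s _ C → stored {κ₀ = κ₀} j′ 1≤j′ j′<9 E₀ refl refl (Env.mats E j 1≤j j<9) (regs s) (arr s) C) ≤-refl
         (Copy.copy-triple κ₀ (arr s₀) j≢j′ (<L j<9) (<L j′<9) z≤n (Env.Q≡ E)
           (moveOps j j′) (small-id j<9 , small-id j′<9 , small z≤n , tt) refl refl)

  -- The length of the code does not depend on the array numbers in it, so 0 stands for any of them,
  -- here and in the other time bounds.
  multiplyTime : BoolMatrix n → BoolMatrix n → ℕ
  multiplyTime A B = freshTime + (copyTime (inOps₁ 0) + (copyTime (inOps₂ 0) +
    (length (emitOps dimOps) + (proj₁ (algorithm A B) * 60 + copyTime (outOps 0)))))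

  multiply-triple : ∀ {r m c X} j₁ j₂ j₃ → 1 ≤ j₁ → j₁ < firstSim → 1 ≤ j₂ → j₂ < firstSim → 1 ≤ j₃ → j₃ < firstSim →
    Triple (λ s → Env (suc r) m c X (regs s) (arr s)) (multiply workspace p j₁ j₂ j₃)
      (λ s → Env r m c (X [ j₃ ≔ X j₁ · X j₂ ]) (regs s) (arr s)) (multiplyTime (X j₁) (X j₂))
  multiply-triple {X = X} j₁ j₂ j₃ 1≤j₁ j₁< 1≤j₂ j₂< 1≤j₃ j₃< =
    fresh-triple ⨟
    conseq (λ s _ Cl → let open Cleared Cl in
              record { env = env ; μ≡ = μ≡ ; ρ0 = ρ0 ; μ* = λ i → trans (μ0 i) refl })
      (λ _ _ P → P) ≤-refl
      (load-triple {xs = []} j₁ 1≤j₁ j₁< (inOps₁ j₁)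
        (λ s Ld → let open Loaded Ld in
           small-id j₁< , small z≤n , μ-ok env μ≡ , small z≤n , tt)
        (λ s Ld → cong (λ d → record (regs s) { rSrc = j₁ ; rDst = d ; rOff = 0 }) (+-identityʳ _) , refl)
        z≤n refl) ⨟
    load-triple {xs = rowMajor (X j₁)} j₂ 1≤j₂ j₂< (inOps₂ j₂)
      (λ s Ld → let open Loaded Ld in
         small-id j₂< , small z≤n , μ-ok env μ≡ , small z≤n ,
         ≤-<-trans (≤-trans (≤-reflexive (trans (+-identityʳ _) (Env.Q≡ env))) q≤S) S<B₁ , tt)
      (λ s Ld → cong₂ (λ d o → record (regs s) { rSrc = j₂ ; rDst = d ; rOff = o }) (+-identityʳ _)
         (trans (+-identityʳ _) (trans (Env.Q≡ (Loaded.env Ld)) (sym (length-rowMajor false (X j₁))))) , refl)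
      (≤-reflexive (length-rowMajor false (X j₁))) refl ⨟
    dim-triple ⨟
    simulate-triple (X j₁) (X j₂) ⨟
    store-triple j₃ 1≤j₃ j₃<
    where
    μ-ok : ∀ {r m c X κ a} → Env r m c X κ a → rμ κ ≡ suc (rρ κ) → rμ κ + 0 < B₁
    μ-ok E μ≡ = subst (_< B₁) (sym (trans (+-identityʳ _) μ≡)) (<-trans (Env.μ<L E) L<B₁)

-- The search for the lowest coefficients

xorℕ : ℕ → ℕ → ℕ
xorℕ x y = x ∸ y + (y ∸ x)

xorℕ≤1 : ∀ {x y} → x ≤ 1 → y ≤ 1 → xorℕ x y ≤ 1
xorℕ≤1 {zero}  {zero}  _ _ = z≤n
xorℕ≤1 {zero}  {suc y} _ y≤1 = y≤1
xorℕ≤1 {suc zero} {zero}  _ _ = s≤s z≤n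
xorℕ≤1 {suc zero} {suc zero} _ _ = z≤n
xorℕ≤1 {suc (suc x)} (s≤s ()) _
xorℕ≤1 {suc zero} {suc (suc y)} _ (s≤s ())

*≤1 : ∀ {x y} → x ≤ 1 → y ≤ 1 → x * y ≤ 1
*≤1 p q = *-mono-≤ p q

-- A conditional assignment without a jump, so that the body of the search remains straight-line
-- code.
select : ∀ b s u → s ∸ s * bit b + u * bit b ≡ (if b then u else s)
select true  s u rewrite *-identityʳ s | *-identityʳ u | n∸n≡0 s = refl
select false s u rewrite *-zeroʳ s | *-zeroʳ u = +-identityʳ s

-- Whether vV is at the end of its row.
carry : ℕ → ℕ → ℕ
carry n V = 1 ∸ (n ∸ (V + 1))

module _ {n V : ℕ} (V<n : V < n) where

  carry-cases : (V + 1 < n × carry n V ≡ 0) ⊎ (V + 1 ≡ n × carry n V ≡ 1)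
  carry-cases with m≤n⇒m<n∨m≡n (subst (_≤ n) (+-comm 1 V) V<n)
  ... | inj₁ lt = inj₁ (lt , m≤n⇒m∸n≡0 (m<n⇒0<n∸m lt))
  ... | inj₂ eq = inj₂ (eq , cong (1 ∸_) (m≤n⇒m∸n≡0 (≤-reflexive (sym eq))))

  carry-flat : ∀ U → (U + carry n V) * n + (V + 1 ∸ carry n V * n) ≡ suc (U * n + V)
  carry-flat U with carry n V | carry-cases
  ... | _ | inj₁ (lt , refl) rewrite +-identityʳ U = trans (cong (U * n +_) (+-comm V 1)) (+-suc (U * n) V)
  ... | _ | inj₂ (end , refl) rewrite +-identityʳ n = begin
    (U + 1) * n + (V + 1 ∸ n)  ≡⟨ cong ((U + 1) * n +_) (m≤n⇒m∸n≡0 (≤-reflexive end)) ⟩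
    (U + 1) * n + 0            ≡⟨ +-identityʳ _ ⟩
    (U + 1) * n                ≡⟨ cong (_* n) (+-comm U 1) ⟩
    n + U * n                  ≡⟨ +-comm n (U * n) ⟩
    U * n + n                  ≡⟨ cong (U * n +_) (sym end) ⟩
    U * n + (V + 1)            ≡⟨ cong (U * n +_) (+-comm V 1) ⟩
    U * n + suc V              ≡⟨ +-suc (U * n) V ⟩
    suc (U * n + V)            ∎
    where open ≡-Reasoning

  carry-< : V + 1 ∸ carry n V * n < n
  carry-< with carry n V | carry-cases
  ... | _ | inj₁ (lt , refl) = lt
  ... | _ | inj₂ (end , refl) rewrite +-identityʳ n | end | n∸n≡0 n = ≤-<-trans z≤n V<n

  carry-≤1 : carry n V ≤ 1
  carry-≤1 = m∸n≤m 1 (n ∸ (V + 1))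

module Verified-Iterate (setting : Setting) where
  open Setting setting
  open Logic bounds
  open Loops bounds 100<B₁
  open Verified-Multiply setting

  lit : ∀ {k} → {T (k ≤ᵇ 100)} → k < B₁
  lit {k} {p} = small (≤ᵇ⇒≤ k 100 p)

  id<L : ∀ {j} → {T (j <ᵇ 11)} → j < L
  id<L {j} {p} = <-≤-trans (<ᵇ⇒< j 11 p) (≤-trans (m≤m+n 11 _) arrays)

  bounded : ∀ {k} → k ≤ S → k < B₁
  bounded k≤S = ≤-<-trans k≤S S<B₁

  1≤B : ∀ {k} → k ≤ 1 → k < B₁
  1≤B k≤1 = ≤-<-trans k≤1 lit

  put-ok : ∀ {j i x} → j < L → i < S → j < L × (OutI i → x ≡ 0)
  put-ok j<L i<S = j<L , λ o → contradiction o (inside i<S)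

  Kept : Set
  Kept = ℕ × ℕ × ℕ × ℕ × ℕ × ℕ

  kept : Regs → Kept
  kept κ = rN κ , rQ κ , rS κ , rM κ , rC κ , rρ κ

  env-kept : ∀ {r m c X κ κ′ a} → kept κ′ ≡ kept κ → Env r m c X κ a → Env r m c X κ′ a
  env-kept {κ = κ} {κ′} eq = env-regs {κ = κ} {κ′} (cong proj₁ eq) (cong (proj₁ ∘ proj₂) eq)
    (cong (proj₁ ∘ proj₂ ∘ proj₂) eq) (cong (proj₁ ∘ proj₂ ∘ proj₂ ∘ proj₂) eq)
    (cong (proj₁ ∘ proj₂ ∘ proj₂ ∘ proj₂ ∘ proj₂) eq) (cong (proj₂ ∘ proj₂ ∘ proj₂ ∘ proj₂ ∘ proj₂) eq)

  env-mats : ∀ {r m c X Y κ a} → (∀ j → 1 ≤ j → j < firstSim → ∀ u v → X j u v ≡ Y j u v) →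
             Env r m c X κ a → Env r m c Y κ a
  env-mats eq E = record
    { N≡ = N≡ ; Q≡ = Q≡ ; S≡ = S≡ ; M≡ = M≡ ; C≡ = C≡ ; 9≤ρ = 9≤ρ ; room = room ; clean = clean
    ; mats = λ j p q u v → trans (mats j p q u v) (cong bit (eq j p q u v)) ; out0 = out0 }
    where open Env E

  infixl 6 _⊕_
  infixl 7 _⊙_

  _⊕_ _⊙_ : BoolMatrix n → BoolMatrix n → BoolMatrix n
  (X ⊕ Y) u v = X u v xor Y u v
  (X ⊙ Y) u v = X u v ∧ Y u v

  macc-triple : ∀ {r m c X} d x y → 1 ≤ d → d < firstSim → 1 ≤ x → x < firstSim → 1 ≤ y → y < firstSim → d ≢ x → d ≢ y →
    Triple (λ s → Env r m c X (regs s) (arr s)) (forEach vQ (maccEntry d x y))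
      (λ s → Env r m c (X [ d ≔ X d ⊕ X x ⊙ X y ]) (regs s) (arr s)) (forEachTime q (maccEntry d x y))
  macc-triple {r} {m} {c} {X} d x y 1≤d d<9 1≤x x<9 1≤y y<9 d≢x d≢y = ghost λ s₀ wf₀ E →
    let open Ghost (regs s₀) (arr s₀) E in
    conseq (λ { s _ refl → start , Env.Q≡ E }) (λ s _ → finish (regs s) (arr s)) ≤-refl
      (forEach-triple vQ (maccEntry d x y) (λ i κ a _ → Partial i κ a) (λ _ _ → refl) body)
    where
    module Ghost (κ₀ : Regs) (a₀ : ℕ → Memory ℕ) (E : Env r m c X κ₀ a₀) where
      open Env E
      new : ℕ → ℕ
      new b = xorℕ (a₀ d b) (a₀ x b * a₀ y b)

      record Partial (i : ℕ) (κ : Regs) (a : ℕ → Memory ℕ) : Set where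
        field
          κ≡      : κ ≡ κ₀
          others  : ∀ j → j ≢ d → a j ≡ a₀ j
          later   : ∀ b → i ≤ b → a d b ≡ a₀ d b
          earlier : ∀ b → b < i → a d b ≡ new b

      start : Partial 0 κ₀ a₀
      start = record { κ≡ = refl ; others = λ _ _ → refl ; later = λ _ _ → refl ; earlier = λ _ () }

      bits≤ : ∀ j → 1 ≤ j → j < firstSim → ∀ {b} → b < q → a₀ j b ≤ 1
      bits≤ j 1≤j j<9 b<q = ≤-trans (≤-reflexive (flatten-holds {a₀ j} {X j} (mats j 1≤j j<9) b<q)) (bit-≤1 _)

      <L : ∀ {j} → j < firstSim → j < L
      <L j<9 = <-trans j<9 (≤-<-trans 9≤ρ ρ<L)

      body : ∀ i s → Wf s → i < q → Partial i (regs s) (arr s) → s ⟨ vI ⟩ ≡ i →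
        Oks (maccEntry d x y) s × Partial (suc i) (regs (effects (maccEntry d x y) s)) (arr (effects (maccEntry d x y) s))
        × effects (maccEntry d x y) s ⟨ vI ⟩ ≡ s ⟨ vI ⟩ × effects (maccEntry d x y) s ⟨ vK ⟩ ≡ s ⟨ vK ⟩
      body i s wf i<q Pa refl =
        ( small-id x<9 , <L x<9 , small-id y<9 , <L y<9 , 1≤B xy≤1
        , small-id d<9 , <L d<9 , tt , tt , 1≤B (xorℕ≤1 d≤1 xy≤1) , small-id d<9 , put-ok (<L d<9) (<-≤-trans i<q q≤S) , tt ) ,
        record
          { κ≡ = κ≡
          ; others = λ j j≢d → trans (upd-≢ a (j≢d ∘ sym)) (others j j≢d)
          ; later = λ b i<b → trans
              (put-entry a d {i} {xorℕ (a d i) (a x i * a y i)} d (λ { refl → <-irrefl refl i<b })) (later b (<⇒≤ i<b))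
          ; earlier = earlier′
          } , refl , refl
        where
        open Partial Pa
        a = arr s
        x≡ : a x i ≡ a₀ x i
        x≡ = cong (λ f → f i) (others x (d≢x ∘ sym))
        y≡ : a y i ≡ a₀ y i
        y≡ = cong (λ f → f i) (others y (d≢y ∘ sym))
        d≡ : a d i ≡ a₀ d i
        d≡ = later i ≤-refl
        xy≤1 : a x i * a y i ≤ 1
        xy≤1 = *≤1 (subst (_≤ 1) (sym x≡) (bits≤ x 1≤x x<9 i<q)) (subst (_≤ 1) (sym y≡) (bits≤ y 1≤y y<9 i<q))
        d≤1 : a d i ≤ 1
        d≤1 = subst (_≤ 1) (sym d≡) (bits≤ d 1≤d d<9 i<q)
        earlier′ : ∀ b → b < suc i → (a [ d ≔ a d [ i ≔ xorℕ (a d i) (a x i * a y i) ] ]) d b ≡ new b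
        earlier′ b (s≤s b≤i) with i ≟ b
        ... | yes refl = trans (put-same a d i) (cong₂ xorℕ d≡ (cong₂ _*_ x≡ y≡))
        ... | no i≢b   = trans (put-entry a d d i≢b) (earlier b (≤∧≢⇒< b≤i (i≢b ∘ sym)))

      finish : ∀ κ a → Partial q κ a → Env r m c (X [ d ≔ X d ⊕ X x ⊙ X y ]) κ a
      finish κ a Pa = env-kept {κ = κ₀} (cong kept κ≡) record
        { N≡ = N≡ ; Q≡ = Q≡ ; S≡ = S≡ ; M≡ = M≡ ; C≡ = C≡ ; 9≤ρ = 9≤ρ ; room = room
        ; clean = λ j i lt j<L → trans (cong (λ f → f i)
            (others j (λ { refl → <⇒≱ lt (≤-trans (<⇒≤ d<9) (m≤n⇒m≤1+n 9≤ρ)) }))) (clean j i lt j<L)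
        ; mats = mats′
        ; out0 = λ i → trans (cong (λ f → f i) (others aOut (λ { refl → contradiction 1≤d λ () }))) (out0 i)
        }
        where
        open Partial Pa
        mats′ : ∀ j → 1 ≤ j → j < firstSim → Holds (a j) ((X [ d ≔ X d ⊕ X x ⊙ X y ]) j)
        mats′ j 1≤j j<9 u v with d ≟ j
        ... | no d≢j = trans (cong (λ f → f (toℕ u * n + toℕ v)) (others j (d≢j ∘ sym)))
          (trans (mats j 1≤j j<9 u v) (cong (λ Z → bit (Z u v)) (sym (upd-≢ X d≢j))))
        ... | yes refl = trans (earlier _ (flat< u v)) (trans
          (cong₂ xorℕ (mats d 1≤d d<9 u v) (trans (cong₂ _*_ (mats x 1≤x x<9 u v) (mats y 1≤y y<9 u v)) (bit-∧ (X x u v) (X y u v))))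
          (trans (bit-xor (X d u v) (X x u v ∧ X y u v)) (cong (λ Z → bit (Z u v)) (sym (upd-≡ X d)))))

  Hit : (ℕ → BoolMatrix n) → Fin n → Fin n → Set
  Hit X u v = X aA u v ∧ X aX u v ≡ true

  -- The outcome of the search: either there is no hit and nothing has
  -- changed, or array aT maps the source of every hit to its target.
  Searched : ℕ → (ℕ → BoolMatrix n) → (ℕ → Memory ℕ) → Regs → (ℕ → Memory ℕ) → Set
  Searched i X a₀ κ a =
    (rFound κ ≡ 0 × (∀ u v → toℕ u * n + toℕ v < i → ¬ Hit X u v) × (∀ b → a aT b ≡ a₀ aT b))
    ⊎ (rFound κ ≢ 0 × (∃[ u ] ∃[ v ] rStart κ ≡ toℕ u × Hit X u v)
       × (∀ u v → toℕ u * n + toℕ v < i → Hit X u v → a aT (toℕ u) ≡ toℕ v))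

  record Position (i : ℕ) (κ : Regs) : Set where
    field
      flat≡ : rU κ * n + rV κ ≡ i
      -- The initial `rV κ = 0` is not below `n` when there are no vertices.
      V<n   : rV κ < n ⊎ n ≡ 0

  position-< : ∀ {i κ} → Position i κ → i < q → rV κ < n × rU κ < n
  position-< {i} {κ} P i<q = V<n′ , *-cancelʳ-< n (rU κ) n (≤-<-trans (≤-trans (m≤m+n _ (rV κ)) (≤-reflexive flat≡)) i<q)
    where
    open Position P
    V<n′ : rV κ < n
    V<n′ with V<n
    ... | inj₁ lt = lt
    ... | inj₂ refl = contradiction i<q λ ()

  n-bound : ∀ {k} → k ≤ n → k < B₁
  n-bound k≤n = bounded (≤-trans k≤n (<⇒≤ n<S))

  times-bit : ∀ k b → k * bit b ≤ k
  times-bit k b = ≤-trans (*-monoʳ-≤ k (bit-≤1 b)) (≤-reflexive (*-identityʳ k))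

  choose-P : ∀ (P : ℕ → Set) b {k l} → P k → P l → P (if b then l else k)
  choose-P P true  _ p = p
  choose-P P false p _ = p

  next-block : ∀ {κ a i k} → rN κ ≡ n → rV κ < n → rU κ < n →
    Block (Exactly κ a i k) nextBlock
      (Exactly (record κ { rU = rU κ + carry n (rV κ) ; rV = rV κ + 1 ∸ carry n (rV κ) * n }) a i k)
  next-block N≡ V<n U<n .step s (exactly refl refl refl refl) =
    ( lit , n-bound (≤-trans (≤-reflexive (+-comm _ 1)) V<n) , tt , tt
    , subst (λ k → s ⟨ vU ⟩ + carry k (s ⟨ vV ⟩) < B₁) (sym N≡)
        (n-bound (≤-trans (+-monoʳ-≤ (s ⟨ vU ⟩) (carry-≤1 V<n)) (≤-trans (≤-reflexive (+-comm _ 1)) U<n)))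
    , subst (λ k → carry k (s ⟨ vV ⟩) * k < B₁) (sym N≡)
        (n-bound (≤-trans (*-monoˡ-≤ n (carry-≤1 V<n)) (≤-reflexive (+-identityʳ n))))
    , tt , tt ) ,
    exactly (cong (λ k → record (regs s) { rU = s ⟨ vU ⟩ + carry k (s ⟨ vV ⟩) ; rV = s ⟨ vV ⟩ + 1 ∸ carry k (s ⟨ vV ⟩) * k }) N≡)
      refl refl refl

  hit-block : ∀ {κ a i k} b → a aA i * a aX i ≡ bit b →
    Block (Exactly κ a i k) hitBlock (λ s → Exactly κ a i k s × s ⟨ tx ⟩ ≡ bit b)
  hit-block b eq .step s (exactly refl refl refl refl) =
    (lit , id<L , lit , id<L , 1≤B (subst (_≤ 1) (sym eq) (bit-≤1 b)) , tt) , exactly refl refl refl refl , eq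

  found-block : ∀ {κ a i k} b → rFound κ + bit b ≤ S → rStart κ ≤ n → rU κ ≤ n →
    Block (λ s → Exactly κ a i k s × s ⟨ tx ⟩ ≡ bit b) foundBlock
      (λ s → Exactly (record κ { rFound = rFound κ + bit b ; rStart = if b then rU κ else rStart κ }) a i k s × s ⟨ tx ⟩ ≡ bit b)
  found-block b found≤ start≤ U≤ .step s (exactly refl refl refl refl , tx≡) =
    ( bounded (subst (λ x → s ⟨ vFound ⟩ + x ≤ S) (sym tx≡) found≤)
    , subst (λ x → s ⟨ vStart ⟩ * x < B₁) (sym tx≡) (n-bound (≤-trans (times-bit (s ⟨ vStart ⟩) b) start≤)) , tt
    , subst (λ x → s ⟨ vU ⟩ * x < B₁) (sym tx≡) (n-bound (≤-trans (times-bit (s ⟨ vU ⟩) b) U≤))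
    , subst (_< B₁) (sym start≡) (choose-P (_< B₁) b (n-bound start≤) (n-bound U≤)) , tt ) ,
    exactly (cong₂ (λ f u → record (regs s) { rFound = f ; rStart = u }) (cong (s ⟨ vFound ⟩ +_) tx≡) start≡) refl refl refl ,
    tx≡
    where
    start≡ : s ⟨ vStart ⟩ ∸ s ⟨ vStart ⟩ * s ⟨ tx ⟩ + s ⟨ vU ⟩ * s ⟨ tx ⟩ ≡ (if b then s ⟨ vU ⟩ else s ⟨ vStart ⟩)
    start≡ = trans (cong (λ x → s ⟨ vStart ⟩ ∸ s ⟨ vStart ⟩ * x + s ⟨ vU ⟩ * x) tx≡) (select b (s ⟨ vStart ⟩) (s ⟨ vU ⟩))

  target-block : ∀ {κ a i k} b → a aT (rU κ) < B₁ → rV κ ≤ n → rU κ < S →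
    Block (λ s → Exactly κ a i k s × s ⟨ tx ⟩ ≡ bit b) targetBlock
      (Exactly κ (a [ aT ≔ a aT [ rU κ ≔ (if b then rV κ else a aT (rU κ)) ] ]) i k)
  target-block b T<B V≤ U<S .step s (exactly refl refl refl refl , tx≡) =
    ( lit , id<L , subst (λ x → old * x < B₁) (sym tx≡) (≤-<-trans (times-bit old b) T<B) , tt
    , subst (λ x → s ⟨ vV ⟩ * x < B₁) (sym tx≡) (n-bound (≤-trans (times-bit (s ⟨ vV ⟩) b) V≤))
    , subst (_< B₁) (sym new≡) (choose-P (_< B₁) b T<B (n-bound V≤)) , put-ok id<L U<S , tt ) ,
    exactly refl (cong (λ x → arr s [ aT ≔ arr s aT [ s ⟨ vU ⟩ ≔ x ] ]) new≡) refl refl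
    where
    old = arr s aT (s ⟨ vU ⟩)
    new≡ : old ∸ old * s ⟨ tx ⟩ + s ⟨ vV ⟩ * s ⟨ tx ⟩ ≡ (if b then s ⟨ vV ⟩ else old)
    new≡ = trans (cong (λ x → old ∸ old * x + s ⟨ vV ⟩ * x) tx≡) (select b old (s ⟨ vV ⟩))

  -- Functional hits make repeated writes to the same table entry agree. Sharing `aT` between the
  -- last product and the table is harmless: without a hit it is unchanged, and after a hit no
  -- further product is taken.
  search-triple : ∀ {r m c X} → (∀ {u v v′} → Hit X u v → Hit X u v′ → v ≡ v′) → ∀ s₀ →
    Env r m c X (regs s₀) (arr s₀) → rU (regs s₀) ≡ 0 → rV (regs s₀) ≡ 0 → rFound (regs s₀) ≡ 0 → rStart (regs s₀) ≡ 0 →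
    Triple (λ s → s ≡ s₀) (forEach vQ searchEntry)
      (λ s → kept (regs s) ≡ kept (regs s₀) × (∀ j → j ≢ aT → arr s j ≡ arr s₀ j)
           × Searched q X (arr s₀) (regs s) (arr s))
      (forEachTime q searchEntry)
  search-triple {r} {m} {c} {X} functional s₀ E U≡0 V≡0 found≡0 start≡0 =
    conseq (λ { s _ refl → start , Env.Q≡ E }) (λ s _ Sc → Partial.kept≡ Sc , Partial.others Sc , Partial.searched Sc) ≤-refl
      (forEach-triple vQ searchEntry (λ i κ a _ → Partial i κ a) (λ _ _ → refl) body)
    where
    open Env E
    κ₀ = regs s₀
    a₀ = arr s₀
    record Partial (i : ℕ) (κ : Regs) (a : ℕ → Memory ℕ) : Set where
      field
        kept≡    : kept κ ≡ kept κ₀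
        others   : ∀ j → j ≢ aT → a j ≡ a₀ j
        position : Position i κ
        found≤   : rFound κ ≤ i
        start≤   : rStart κ ≤ n
        searched : Searched i X a₀ κ a
    start : Partial 0 κ₀ a₀
    start = record
      { kept≡ = refl ; others = λ _ _ → refl
      ; position = record { flat≡ = trans (cong₂ (λ u v → u * n + v) U≡0 V≡0) refl ; V<n = zero-< n V≡0 }
      ; found≤ = ≤-reflexive found≡0 ; start≤ = ≤-trans (≤-reflexive start≡0) z≤n
      ; searched = inj₁ (found≡0 , (λ _ _ ()) , λ _ → refl) }
      where
      zero-< : ∀ n {x} → x ≡ 0 → x < n ⊎ n ≡ 0
      zero-< zero    _    = inj₂ refl
      zero-< (suc n) refl = inj₁ (s≤s z≤n)

    module Step {i κ a} (i<q : i < q) (Pa : Partial i κ a) where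
      open Partial Pa
      V<n = proj₁ (position-< {κ = κ} position i<q)
      U<n = proj₂ (position-< {κ = κ} position i<q)
      u₁ = fromℕ< U<n
      v₁ = fromℕ< V<n
      U≡ : rU κ ≡ toℕ u₁
      U≡ = sym (toℕ-fromℕ< U<n)
      V≡ : rV κ ≡ toℕ v₁
      V≡ = sym (toℕ-fromℕ< V<n)
      n≡ : rN κ ≡ n
      n≡ = trans (cong proj₁ kept≡) N≡
      b : Bool
      b = X aA u₁ v₁ ∧ X aX u₁ v₁
      here≡ : toℕ u₁ * n + toℕ v₁ ≡ i
      here≡ = trans (cong₂ (λ u v → u * n + v) (sym U≡) (sym V≡)) (Position.flat≡ position)
      value : ∀ j → {T (1 ≤ᵇ j)} → {T (j <ᵇ firstSim)} → j ≢ aT → a j i ≡ bit (X j u₁ v₁)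
      value j {p} {q} j≢ = trans (cong (λ f → f i) (others j j≢))
        (subst (λ b → a₀ j b ≡ bit (X j u₁ v₁)) here≡ (mats j (≤ᵇ⇒≤ 1 j p) (<ᵇ⇒< j firstSim q) u₁ v₁))
      hit≡ : a aA i * a aX i ≡ bit b
      hit≡ = trans (cong₂ _*_ (value aA (λ ())) (value aX (λ ()))) (bit-∧ (X aA u₁ v₁) (X aX u₁ v₁))
      κ₁ κ₂ : Regs
      κ₁ = record κ { rFound = rFound κ + bit b ; rStart = if b then rU κ else rStart κ }
      κ₂ = record κ₁ { rU = rU κ + carry n (rV κ) ; rV = rV κ + 1 ∸ carry n (rV κ) * n }
      entry : ℕ
      entry = if b then rV κ else a aT (rU κ)
      a₁ : ℕ → Memory ℕ
      a₁ = a [ aT ≔ a aT [ rU κ ≔ entry ] ]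
      same-flat : ∀ {u v} → toℕ u * n + toℕ v ≡ i → u ≡ u₁ × v ≡ v₁
      same-flat {u} {v} eq = let p , q = flat-injective n (toℕ<n v) (toℕ<n v₁) (trans eq (sym here≡)) in
        toℕ-injective p , toℕ-injective q
      earlier : ∀ u v → (u ≡ u₁ → ¬ (v ≡ v₁)) → toℕ u * n + toℕ v < suc i → toℕ u * n + toℕ v < i
      earlier u v ne (s≤s le) = ≤∧≢⇒< le λ eq → let p , q = same-flat {u} {v} eq in ne p q
      found-hit : b ≡ true → Searched (suc i) X a₀ κ₂ a₁
      found-hit hit = inj₂
        ( (λ eq → contradiction (trans (sym (+-comm (rFound κ) 1)) (trans (cong (λ b → rFound κ + bit b) (sym hit)) eq)) λ ())
        , (u₁ , v₁ , trans (cong (λ b → if b then rU κ else rStart κ) hit) U≡ , hit) , table )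
        where
        entry≡ : entry ≡ toℕ v₁
        entry≡ = trans (cong (λ b → if b then rV κ else a aT (rU κ)) hit) V≡
        table : ∀ u v → toℕ u * n + toℕ v < suc i → Hit X u v → a₁ aT (toℕ u) ≡ toℕ v
        table u v lt h with rU κ ≟ toℕ u
        ... | yes eq = subst (λ w → a₁ aT w ≡ toℕ v) eq (trans (upd-≡ (a aT) (rU κ)) (trans entry≡
          (cong toℕ (functional hit (subst (λ u → Hit X u v) (toℕ-injective (trans (sym eq) U≡)) h)))))
        ... | no ne with searched
        ...   | inj₂ (_ , _ , tbl) = trans (upd-≢ (a aT) ne) (tbl u v (earlier u v (λ { refl _ → ne U≡ }) lt) h)
        ...   | inj₁ (_ , none , _) = contradiction h (none u v (earlier u v (λ { refl _ → ne U≡ }) lt))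
      found-miss : b ≡ false → Searched (suc i) X a₀ κ₂ a₁
      found-miss miss with searched
      ... | inj₁ (f≡0 , none , T≡) = inj₁
        ( trans found≡ f≡0 , (λ u v lt h → none u v (before u v lt h) h) , λ b → trans (unchanged b) (T≡ b) )
        where
        found≡ : rFound κ + bit b ≡ rFound κ
        found≡ = trans (cong (λ b → rFound κ + bit b) miss) (+-identityʳ _)
        before : ∀ u v → toℕ u * n + toℕ v < suc i → Hit X u v → toℕ u * n + toℕ v < i
        before u v lt h = earlier u v (λ { refl refl → contradiction (trans (sym miss) h) λ () }) lt
        unchanged : ∀ j → a₁ aT j ≡ a aT j
        unchanged j with rU κ ≟ j
        ... | yes refl = trans (upd-≡ (a aT) (rU κ)) (cong (λ b → if b then rV κ else a aT (rU κ)) miss)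
        ... | no ne = upd-≢ (a aT) ne
      ... | inj₂ (f≢0 , (u , v , st≡ , h) , tbl) = inj₂
        ( (λ eq → f≢0 (trans (sym found≡) eq))
        , (u , v , trans (cong (λ b → if b then rU κ else rStart κ) miss) st≡ , h)
        , λ u v lt h → trans (unchanged (toℕ u)) (tbl u v (before u v lt h) h) )
        where
        found≡ : rFound κ + bit b ≡ rFound κ
        found≡ = trans (cong (λ b → rFound κ + bit b) miss) (+-identityʳ _)
        before : ∀ u v → toℕ u * n + toℕ v < suc i → Hit X u v → toℕ u * n + toℕ v < i
        before u v lt h = earlier u v (λ { refl refl → contradiction (trans (sym miss) h) λ () }) lt
        unchanged : ∀ j → a₁ aT j ≡ a aT j
        unchanged j with rU κ ≟ j
        ... | yes refl = trans (upd-≡ (a aT) (rU κ)) (cong (λ b → if b then rV κ else a aT (rU κ)) miss)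
        ... | no ne = upd-≢ (a aT) ne
      next : Searched (suc i) X a₀ κ₂ a₁
      next = by-cases b refl
        where
        by-cases : ∀ b′ → b ≡ b′ → Searched (suc i) X a₀ κ₂ a₁
        by-cases true  = found-hit
        by-cases false = found-miss
      partial : Partial (suc i) κ₂ a₁
      partial = record
        { kept≡ = kept≡
        ; others = λ j j≢8 → trans (upd-≢ a (j≢8 ∘ sym)) (others j j≢8)
        ; position = record
          { flat≡ = trans (carry-flat V<n (rU κ)) (cong suc (Position.flat≡ position))
          ; V<n = inj₁ (carry-< V<n) }
        ; found≤ = ≤-trans (+-mono-≤ found≤ (bit-≤1 b)) (≤-reflexive (+-comm i 1))
        ; start≤ = choose-P (_≤ n) b start≤ (<⇒≤ U<n)
        ; searched = next
        }

    body : ∀ i s → Wf s → i < q → Partial i (regs s) (arr s) → s ⟨ vI ⟩ ≡ i →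
      Oks searchEntry s × Partial (suc i) (regs (effects searchEntry s)) (arr (effects searchEntry s))
      × effects searchEntry s ⟨ vI ⟩ ≡ s ⟨ vI ⟩ × effects searchEntry s ⟨ vK ⟩ ≡ s ⟨ vK ⟩
    body i s wf i<q Pa refl =
      let oks , exactly κ≡ a≡ i≡ k≡ = blocks .step s (exactly refl refl refl refl)
      in oks , subst₂ (Partial (suc i)) (sym κ≡) (sym a≡) (Step.partial i<q Pa) , i≡ , k≡
      where
      open Step i<q Pa
      open Partial Pa
      blocks : Block (Exactly (regs s) (arr s) i (s ⟨ vK ⟩)) searchEntry (Exactly κ₂ a₁ i (s ⟨ vK ⟩))
      blocks = hit-block b hit≡
        ▸ found-block b (≤-trans (+-mono-≤ found≤ (bit-≤1 b)) (≤-trans (≤-trans (≤-reflexive (+-comm i 1)) i<q) q≤S)) start≤ (<⇒≤ U<n)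
        ▸ target-block b (Wf.arr< wf aT _ id<L) (<⇒≤ V<n) (<-trans U<n n<S)
        ▸ next-block n≡ V<n U<n

  record Tour (X : ℕ → BoolMatrix n) (m : ℕ) (u : Fin n) : Set where
    field
      rest : List (Fin n)
      length≡ : length rest ≡ m
      hits : ∀ {x y} → (x , y) ∈ path u rest u → Hit X x y

  Output : Maybe (List (Fin n)) → Regs → (ℕ → Memory ℕ) → Set
  Output answer κ a = rN κ ≡ n × rC κ ≡ 0 × (∀ i → a aOut i ≡ initial 0 (answerOutput answer) i)

  -- The default of the lookup is the end `e` of the path, so the closing arc is included.
  path-step : ∀ {A : Set} (u : A) ws e l → l ≤ length ws → (initial e (u ∷ ws) l , initial e (u ∷ ws) (suc l)) ∈ path u ws e
  path-step u []       e zero    _       = here refl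
  path-step u (w ∷ ws) e zero    _       = here refl
  path-step u (w ∷ ws) e (suc l) (s≤s p) = there (path-step w ws e l p)

  initial-map : ∀ {A : Set} (f : A → ℕ) e xs l → l < length xs → initial 0 (map f xs) l ≡ f (initial e xs l)
  initial-map f e (x ∷ xs) zero    _       = refl
  initial-map f e (x ∷ xs) (suc l) (s≤s p) = initial-map f e xs l p

  reportTime : ℕ → ℕ
  reportTime m = length (emitOps reportOps) + (forEachTime (suc m) tourEntry + 1)

  reportTime-mono : ∀ {l m} → l ≤ m → reportTime l ≤ reportTime m
  reportTime-mono l≤m = +-monoʳ-≤ (length (emitOps reportOps)) (+-monoˡ-≤ 1
    (+-monoʳ-≤ 3 (s≤s (*-monoˡ-≤ (2 + length (emitOps (tourEntry ++ advance))) (s≤s l≤m)))))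

  -- Every arc of the tour is a hit, so following the table from `rStart` visits the vertices of the
  -- tour in order. With `m` the degree of the hit, `m + 1` vertices are written.
  report-triple : ∀ {m X u} s₀ → rN (regs s₀) ≡ n → rM (regs s₀) ≡ m → (∀ i → arr s₀ aOut i ≡ 0) →
    (tour : Tour X m u) → m < n → rStart (regs s₀) ≡ toℕ u →
    (∀ x y → Hit X x y → arr s₀ aT (toℕ x) ≡ toℕ y) →
    Triple (λ s → s ≡ s₀) report (λ s → Output (just (u ∷ Tour.rest tour)) (regs s) (arr s)) (reportTime m)
  report-triple {m} {X} {u} s₀ N≡ M≡ out0 tour m<n start≡ table =
    _⨟_ {Q = λ s → Partial 0 (regs s) (arr s) × s ⟨ vLim ⟩ ≡ suc m}
      (conseq (λ _ _ P → P) (λ { s _ refl → start , lim≡ }) ≤-refl (exact reportOps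
        ( lit , lit , lit , n-bound (≤-trans (≤-reflexive lim≡) m<n)
        , put-ok id<L (≤-<-trans z≤n n<S) , lit , n-bound (≤-trans (≤-reflexive cur≡) (<⇒≤ (toℕ<n u))) , tt )))
      (forEach-triple vLim tourEntry (λ i κ a _ → Partial i κ a) (λ _ _ → refl) body ⨟
       ops-triple (cst vC 0 ∷ []) λ s wf Pa → (lit , tt) , finish (regs s) (arr s) Pa)
    where
    open Tour tour
    a₀ = arr s₀
    κ₀ = regs s₀
    lim≡ : s₀ ⟨ vM ⟩ + 1 ≡ suc m
    lim≡ = trans (+-comm _ 1) (cong suc M≡)
    cur≡ : s₀ ⟨ vStart ⟩ + 0 ≡ toℕ u
    cur≡ = trans (+-identityʳ _) start≡
    vertex : ℕ → Fin n
    vertex = initial u (u ∷ rest)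
    record Partial (i : ℕ) (κ : Regs) (a : ℕ → Memory ℕ) : Set where
      field
        kept≡  : kept κ ≡ kept κ₀
        others : ∀ j → j ≢ aOut → a j ≡ a₀ j
        cur    : rCur κ ≡ toℕ (vertex i)
        size≡  : a aOut 0 ≡ suc m
        done′  : ∀ l → l < i → a aOut (suc l) ≡ toℕ (vertex l)
        rest′  : ∀ l → i ≤ l → a aOut (suc l) ≡ 0
    s₁ = effects reportOps s₀
    start : Partial 0 (regs s₁) (arr s₁)
    start = record
      { kept≡ = refl ; others = λ j j≢0 → upd-≢ a₀ (j≢0 ∘ sym)
      ; cur = cur≡ ; size≡ = lim≡ ; done′ = λ _ () ; rest′ = λ l _ → out0 (suc l) }
    body : ∀ i s → Wf s → i < suc m → Partial i (regs s) (arr s) → s ⟨ vI ⟩ ≡ i →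
      Oks tourEntry s × Partial (suc i) (regs (effects tourEntry s)) (arr (effects tourEntry s))
      × effects tourEntry s ⟨ vI ⟩ ≡ s ⟨ vI ⟩ × effects tourEntry s ⟨ vK ⟩ ≡ s ⟨ vK ⟩
    body i s wf (s≤s i≤m) Pa refl =
      ( lit , lit , n-bound (≤-trans (≤-reflexive (+-comm i 1)) i<n)
      , put-ok id<L (subst (_< S) (+-comm 1 i) (≤-<-trans i<n n<S)) , lit , id<L , tt ) ,
      record
        { kept≡ = kept≡
        ; others = λ j j≢0 → trans (upd-≢ a (j≢0 ∘ sym)) (others j j≢0)
        ; cur = trans (cong (λ f → f (s ⟨ vCur ⟩)) (others aT (λ ()))) (trans (cong (a₀ aT) cur)
            (table _ _ (hits (path-step u rest u i (subst (i ≤_) (sym length≡) i≤m)))))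
        ; size≡ = trans (upd-≢ (a aOut) (λ eq → contradiction (trans (+-comm 1 i) eq) λ ())) size≡
        ; done′ = λ l l≤i → done″ l l≤i
        ; rest′ = λ l i<l → trans (upd-≢ (a aOut) (λ eq → <-irrefl (suc-injective (trans (+-comm 1 i) eq)) i<l)) (rest′ l (<⇒≤ i<l))
        } , refl , refl
      where
      open Partial Pa
      a = arr s
      i<n : suc i ≤ n
      i<n = ≤-trans (s≤s i≤m) m<n
      done″ : ∀ l → l < suc i → (a aOut [ i + 1 ≔ s ⟨ vCur ⟩ ]) (suc l) ≡ toℕ (vertex l)
      done″ l (s≤s l≤i) with i ≟ l
      ... | yes refl = trans (cong (a aOut [ i + 1 ≔ s ⟨ vCur ⟩ ]) (+-comm 1 i)) (trans (upd-≡ (a aOut) (i + 1)) cur)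
      ... | no i≢l   = trans (upd-≢ (a aOut) (λ eq → i≢l (suc-injective (trans (+-comm 1 i) eq)))) (done′ l (≤∧≢⇒< l≤i (i≢l ∘ sym)))
    finish : ∀ κ a → Partial (suc m) κ a → Output (just (u ∷ rest)) (record κ { rC = 0 }) a
    finish κ a Pa = trans (cong proj₁ kept≡) N≡ , refl , λ where
        zero    → trans size≡ (cong suc (sym length≡))
        (suc l) → entry l
      where
      open Partial Pa
      entry : ∀ l → a aOut (suc l) ≡ initial 0 (map toℕ (u ∷ rest)) l
      entry l with l <? suc m
      ... | yes l< = trans (done′ l l<) (sym (initial-map toℕ u (u ∷ rest) l (subst (l <_) (cong suc (sym length≡)) l<)))
      ... | no l≮  = trans (rest′ l (≮⇒≥ l≮)) (sym (initial-beyond 0 (map toℕ (u ∷ rest))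
        (≤-trans (≤-reflexive (cong suc (trans (List.length-map toℕ rest) length≡))) (≮⇒≥ l≮))))

  updateTime : ℕ
  updateTime = forEachTime q (maccEntry 0 0 0) + (forEachTime q (maccEntry 0 0 0) +
    (forEachTime q (maccEntry 0 0 0) + (copyTime (moveOps 0 0) + copyTime (moveOps 0 0))))

  update-triple : ∀ {r m c X} → Triple (λ s → Env r m c X (regs s) (arr s)) update
    (λ s → Env r m c (X [ aP ≔ X aP ⊕ X aI ⊙ X aT ] [ aP ≔ X aP ⊕ X aI ⊙ X aT ⊕ X aAᵀ ⊙ X aPrev ]
      [ aX ≔ X aX ⊕ (X aP ⊕ X aI ⊙ X aT ⊕ X aAᵀ ⊙ X aPrev) ⊙ (X aP ⊕ X aI ⊙ X aT ⊕ X aAᵀ ⊙ X aPrev) ]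
      [ aPrev ≔ X aN ] [ aN ≔ X aT ]) (regs s) (arr s)) updateTime
  update-triple =
    macc-triple aP aI aT (≤ᵇ⇒≤ 1 6 tt) (≤ᵇ⇒≤ 7 9 tt) (≤ᵇ⇒≤ 1 3 tt) (≤ᵇ⇒≤ 4 9 tt) (≤ᵇ⇒≤ 1 8 tt) (≤ᵇ⇒≤ 9 9 tt) (λ ()) (λ ()) ⨟
    macc-triple aP aAᵀ aPrev (≤ᵇ⇒≤ 1 6 tt) (≤ᵇ⇒≤ 7 9 tt) (≤ᵇ⇒≤ 1 2 tt) (≤ᵇ⇒≤ 3 9 tt) (≤ᵇ⇒≤ 1 5 tt) (≤ᵇ⇒≤ 6 9 tt) (λ ()) (λ ()) ⨟
    macc-triple aX aP aP (≤ᵇ⇒≤ 1 7 tt) (≤ᵇ⇒≤ 8 9 tt) (≤ᵇ⇒≤ 1 6 tt) (≤ᵇ⇒≤ 7 9 tt) (≤ᵇ⇒≤ 1 6 tt) (≤ᵇ⇒≤ 7 9 tt) (λ ()) (λ ()) ⨟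
    move-triple aN aPrev (≤ᵇ⇒≤ 1 4 tt) (≤ᵇ⇒≤ 5 9 tt) (≤ᵇ⇒≤ 1 5 tt) (≤ᵇ⇒≤ 6 9 tt) (λ ()) ⨟
    move-triple aT aN (≤ᵇ⇒≤ 1 8 tt) (≤ᵇ⇒≤ 9 9 tt) (≤ᵇ⇒≤ 1 4 tt) (≤ᵇ⇒≤ 5 9 tt) (λ ())

  module OnGraph (G : Digraph n) (Tmax : ℕ) where
    module Q = Sequences G

    HitAt : ℕ → Fin n → Fin n → Set
    HitAt m u v = Q.A u v ∧ Q.X m u v ≡ true

    record Answer (m : ℕ) (u : Fin n) : Set where
      field
        rest     : List (Fin n)
        length≡  : length rest ≡ m
        hits     : ∀ {x y} → (x , y) ∈ path u rest u → HitAt m x y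
        shortest : IsShortestEvenCycle G (u ∷ rest)

    -- All that the program needs from the combinatorial part. It concerns a degree `m` only if no
    -- smaller one has a hit.
    Promise : Set
    Promise = ∀ m → (∀ m′ → m′ < m → ∀ u v → ¬ HitAt m′ u v) →
      (∀ {u v v′} → HitAt m u v → HitAt m u v′ → v ≡ v′) × (∀ {u v} → HitAt m u v → Answer m u)

    state : BoolMatrix n → ℕ → ℕ → BoolMatrix n
    state T m 1 = Q.A
    state T m 2 = Q.Aᵀ
    state T m 3 = Q.I
    state T m 4 = Q.power m
    state T m 5 = Q.previous m
    state T m 6 = Q.P m
    state T m 7 = Q.X m
    state T m _ = T

    -- Degrees up to `n ∸ 1` suffice, since a cycle of length at most `n` shows at its length minus
    -- one. Each remaining round reserves three calls, hence `c * 3`. `T` is whatever matrix `aT`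
    -- holds.
    Running : ℕ → St → Set
    Running c s = ∃[ T ] ∃[ m ] m + c ≡ n ∸ 1 × Env (c * 3) m c (state T m) (regs s) (arr s)
                                × (∀ m′ → m′ ≤ m → ∀ u v → ¬ HitAt m′ u v)

    Finished : St → Set
    Finished s = ∃[ C ] IsShortestEvenCycle G C × Output (just C) (regs s) (arr s)

    Fast : Set
    Fast = ∀ m → m < n → proj₁ (algorithm Q.A (Q.power m)) ≤ Tmax
                       × proj₁ (algorithm (Q.P m) Q.Aᵀ) ≤ Tmax × proj₁ (algorithm Q.Aᵀ (Q.X m)) ≤ Tmax

    callTime : ℕ
    callTime = freshTime + (copyTime (inOps₁ 0) + (copyTime (inOps₂ 0) +
      (length (emitOps dimOps) + (Tmax * 60 + copyTime (outOps 0)))))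

    multiplyTime-≤ : ∀ A B → proj₁ (algorithm A B) ≤ Tmax → multiplyTime A B ≤ callTime
    multiplyTime-≤ A B t≤ = +-monoʳ-≤ freshTime (+-monoʳ-≤ (copyTime (inOps₁ 0)) (+-monoʳ-≤ (copyTime (inOps₂ 0))
      (+-monoʳ-≤ (length (emitOps dimOps)) (+-monoˡ-≤ (copyTime (outOps 0)) (*-monoˡ-≤ 60 t≤)))))

    iterationTime : ℕ
    iterationTime = callTime + (callTime + (callTime + (updateTime + (length (emitOps stepOps) +
      (forEachTime q searchEntry + suc (reportTime n))))))

    env-cells : ∀ {r m c X κ a a′} → (∀ j b → a′ j b ≡ a j b) → Env r m c X κ a → Env r m c X κ a′
    env-cells eq E = record
      { N≡ = N≡ ; Q≡ = Q≡ ; S≡ = S≡ ; M≡ = M≡ ; C≡ = C≡ ; 9≤ρ = 9≤ρ ; room = room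
      ; clean = λ j i p l → trans (eq j i) (clean j i p l)
      ; mats = λ j p l u v → trans (eq j _) (mats j p l u v) ; out0 = λ i → trans (eq aOut i) (out0 i) }
      where open Env E

    next-state : ∀ T m → let X = state T m [ aT ≔ Q.A · Q.power m ] [ aP ≔ Q.P m · Q.Aᵀ ] [ aX ≔ Q.Aᵀ · Q.X m ] in
      ∀ j → 1 ≤ j → j < firstSim → ∀ u v →
      (X [ aP ≔ X aP ⊕ X aI ⊙ X aT ] [ aP ≔ X aP ⊕ X aI ⊙ X aT ⊕ X aAᵀ ⊙ X aPrev ]
      [ aX ≔ X aX ⊕ (X aP ⊕ X aI ⊙ X aT ⊕ X aAᵀ ⊙ X aPrev) ⊙ (X aP ⊕ X aI ⊙ X aT ⊕ X aAᵀ ⊙ X aPrev) ]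
      [ aPrev ≔ X aN ] [ aN ≔ X aT ]) j u v ≡ state (Q.A · Q.power m) (suc m) j u v
    next-state T m 1 _ _ u v = refl
    next-state T m 2 _ _ u v = refl
    next-state T m 3 _ _ u v = refl
    next-state T m 4 _ _ u v = refl
    next-state T m 5 _ _ u v = refl
    next-state T m 6 _ _ u v = refl
    next-state T m 7 _ _ u v = cong ((Q.Aᵀ · Q.X m) u v xor_) (Bool.∧-idem (Q.P (suc m) u v))
    next-state T m 8 _ _ u v = refl
    next-state T m (suc (suc (suc (suc (suc (suc (suc (suc (suc j))))))))) _
      (s≤s (s≤s (s≤s (s≤s (s≤s (s≤s (s≤s (s≤s (s≤s ()))))))))) u v

    module _ (promise : Promise) (fast : Fast) where

      find-triple : ∀ {T m c} → suc m + c ≡ n ∸ 1 → (∀ m′ → m′ ≤ m → ∀ u v → ¬ HitAt m′ u v) → ∀ s₀ →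
        Env (c * 3) (suc m) c (state T (suc m)) (regs s₀) (arr s₀) →
        rU (regs s₀) ≡ 0 → rV (regs s₀) ≡ 0 → rFound (regs s₀) ≡ 0 → rStart (regs s₀) ≡ 0 →
        Triple (λ s → s ≡ s₀) (forEach vQ searchEntry ⨾ when vFound report) (λ s → Running c s ⊎ Finished s)
          (forEachTime q searchEntry + suc (reportTime n))
      find-triple {T} {m} {c} m≡ none s₀ E U≡0 V≡0 found≡0 start≡0 =
        search-triple {X = state T (suc m)} (proj₁ known) s₀ E U≡0 V≡0 found≡0 start≡0 ⨟
        when-triple
          (λ s _ (kept≡ , others , sr) eq → inj₁ (missed s kept≡ others sr eq))
          (ghost λ s₁ _ ((kept≡ , others , sr) , found≢0) → reported s₁ kept≡ others sr found≢0)
        where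
        known = promise (suc m) (λ m′ lt → none m′ (s≤s⁻¹ lt))
        m<n : suc m < n
        m<n = ≤-<-trans (≤-trans (m≤m+n (suc m) c) (≤-reflexive m≡)) (pred-< n {subst (suc m ≤_) m≡ (m≤m+n (suc m) c)})
          where
          pred-< : ∀ n → {suc m ≤ n ∸ 1} → n ∸ 1 < n
          pred-< (suc n) = n<1+n n
        missed : ∀ s → kept (regs s) ≡ kept (regs s₀) → (∀ j → j ≢ aT → arr s j ≡ arr s₀ j) →
          Searched q (state T (suc m)) (arr s₀) (regs s) (arr s) → s ⟨ vFound ⟩ ≡ 0 → Running c s
        missed s kept≡ others (inj₂ (found≢0 , _)) eq = contradiction eq found≢0
        missed s kept≡ others (inj₁ (_ , no-hit , T≡)) eq = T , suc m , m≡ ,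
          env-cells {a = arr s₀} cells (env-kept {κ = regs s₀} kept≡ E) , none′
          where
          cells : ∀ j b → arr s j b ≡ arr s₀ j b
          cells j b with j ≟ aT
          ... | yes refl = T≡ b
          ... | no j≢    = cong (λ f → f b) (others j j≢)
          none′ : ∀ m′ → m′ ≤ suc m → ∀ u v → ¬ HitAt m′ u v
          none′ m′ le u v with m≤n⇒m<n∨m≡n le
          ... | inj₁ lt   = none m′ (s≤s⁻¹ lt) u v
          ... | inj₂ refl = no-hit u v (flat< u v)
        reported : ∀ s₁ → kept (regs s₁) ≡ kept (regs s₀) → (∀ j → j ≢ aT → arr s₁ j ≡ arr s₀ j) →
          Searched q (state T (suc m)) (arr s₀) (regs s₁) (arr s₁) → s₁ ⟨ vFound ⟩ ≢ 0 →
          Triple (λ s → s ≡ s₁) report (λ s → Running c s ⊎ Finished s) (reportTime n)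
        reported s₁ kept≡ others (inj₁ (found≡0 , _)) found≢0 = contradiction found≡0 found≢0
        reported s₁ kept≡ others (inj₂ (_ , (u , v , start≡ , hit) , table)) found≢0 =
          let open Answer (proj₂ known hit) in
          conseq (λ _ _ P → P) (λ s _ out → inj₂ (u ∷ rest , shortest , out))
            (reportTime-mono (<⇒≤ m<n))
            (report-triple {X = state T (suc m)} s₁ (trans (cong proj₁ kept≡) (Env.N≡ E))
              (trans (cong (proj₁ ∘ proj₂ ∘ proj₂ ∘ proj₂) kept≡) (Env.M≡ E))
              (λ i → trans (cong (λ f → f i) (others aOut (λ ()))) (Env.out0 E i))
              (record { rest = rest ; length≡ = length≡ ; hits = hits }) m<n start≡
              (λ x y h → table x y (flat< x y) h))

      step-triple : ∀ {m c T} → m + suc c ≡ n ∸ 1 →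
        Triple (λ s → Env (c * 3) m (suc c) (state T (suc m)) (regs s) (arr s)) (ops stepOps)
          (λ s → Env (c * 3) (suc m) c (state T (suc m)) (regs s) (arr s)
               × rU (regs s) ≡ 0 × rV (regs s) ≡ 0 × rFound (regs s) ≡ 0 × rStart (regs s) ≡ 0)
          (length (emitOps stepOps))
      step-triple {m} {c} m≡ = ops-triple stepOps λ s wf E → let open Env E in
        ( lit , n-bound (≤-trans (≤-reflexive (trans (cong (_+ 1) M≡) (+-comm m 1)))
            (≤-trans (≤-trans (m≤m+n (suc m) c) (≤-reflexive (trans (sym (+-suc m c)) m≡))) (m∸n≤m n 1))) , tt
        , lit , lit , lit , lit , tt ) ,
        record { N≡ = N≡ ; Q≡ = Q≡ ; S≡ = S≡ ; M≡ = trans (+-comm _ 1) (cong suc M≡) ; C≡ = cong (_∸ 1) C≡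
               ; 9≤ρ = 9≤ρ ; room = room ; clean = clean ; mats = mats ; out0 = out0 } ,
        refl , refl , refl , refl

      iteration-triple : ∀ c → Triple (Running (suc c)) (iteration workspace p) (λ s → Running c s ⊎ Finished s) iterationTime
      iteration-triple c = ghost λ { s₀ _ (T , m , m≡ , E , none) →
        let m<n : m < n
            m<n = <-≤-trans (subst (m <_) m≡ (m<m+n m (s≤s z≤n))) (m∸n≤m n 1)
            t₁ , t₂ , t₃ = fast m m<n in
        conseq (λ { s _ refl → E }) (λ _ _ P → P) ≤-refl
          (conseq (λ _ _ P → P) (λ _ _ P → P) (multiplyTime-≤ Q.A (Q.power m) t₁)
             (multiply-triple aA aN aT (≤ᵇ⇒≤ 1 1 tt) (≤ᵇ⇒≤ 2 9 tt) (≤ᵇ⇒≤ 1 4 tt) (≤ᵇ⇒≤ 5 9 tt) (≤ᵇ⇒≤ 1 8 tt) (≤ᵇ⇒≤ 9 9 tt)) ⨟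
           conseq (λ _ _ P → P) (λ _ _ P → P) (multiplyTime-≤ (Q.P m) Q.Aᵀ t₂)
             (multiply-triple aP aAᵀ aP (≤ᵇ⇒≤ 1 6 tt) (≤ᵇ⇒≤ 7 9 tt) (≤ᵇ⇒≤ 1 2 tt) (≤ᵇ⇒≤ 3 9 tt) (≤ᵇ⇒≤ 1 6 tt) (≤ᵇ⇒≤ 7 9 tt)) ⨟
           conseq (λ _ _ P → P) (λ _ _ P → P) (multiplyTime-≤ Q.Aᵀ (Q.X m) t₃)
             (multiply-triple aAᵀ aX aX (≤ᵇ⇒≤ 1 2 tt) (≤ᵇ⇒≤ 3 9 tt) (≤ᵇ⇒≤ 1 7 tt) (≤ᵇ⇒≤ 8 9 tt) (≤ᵇ⇒≤ 1 7 tt) (≤ᵇ⇒≤ 8 9 tt)) ⨟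
           update-triple ⨟
           conseq (λ s _ E → env-mats (next-state T m) E) (λ _ _ P → P) ≤-refl (step-triple m≡) ⨟
           ghost λ { s₁ _ (E , U≡0 , V≡0 , f≡0 , st≡0) →
             find-triple (trans (sym (+-suc m c)) m≡) none s₁ E U≡0 V≡0 f≡0 st≡0 }) }

-- The main program

-- The cells a, …, a + c - 1 of m, packed with the first one lowest.
-- Unfolding it on the literal number of packed cells would take exponential time.
opaque
  packedValue : Memory ℕ → ℕ → ℕ → ℕ
  packedValue m a zero    = 0
  packedValue m a (suc c) = m a + (packedValue m (suc a) c + packedValue m (suc a) c)

  packedValue-zero : ∀ m a → packedValue m a 0 ≡ 0
  packedValue-zero m a = refl

  packedValue-suc : ∀ m a c → packedValue m a (suc c) ≡ m a + (packedValue m (suc a) c + packedValue m (suc a) c)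
  packedValue-suc m a c = refl

half-packed : ∀ {b} y → b ≤ 1 → ⌊ b + (y + y) /2⌋ ≡ y
half-packed {zero}        y _        = sym (n≡⌊n+n/2⌋ y)
half-packed {suc zero}    y _        = sym (n≡⌈n+n/2⌉ y)
half-packed {suc (suc b)} y (s≤s ())

<∸⇒+< : ∀ i n k → i < n ∸ k → i + k < n
<∸⇒+< i n       zero    i<  = subst (_< n) (sym (+-identityʳ i)) i<
<∸⇒+< i (suc n) (suc k) i<  = subst (_< suc n) (sym (+-suc i k)) (s≤s (<∸⇒+< i n k i<))

record Job : Set₁ where
  field
    setting : Setting
  open Setting setting public
  field
    G′        : Digraph n
    Tmax C    : ℕ
    S≡        : S ≡ (C + 30) * (suc n * suc n)
    G≡        : G ≡ n * n + suc firstFree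
    L≡        : L ≡ 3 * stride workspace * n + (firstSim + 2)
    C<B₁      : C + 30 < B₁
    G<B₁      : G < B₁
    packed<B₁ : 2 ^ packed < B₁

module Verified-Main (job : Job) where
  open Job job
  open Logic bounds
  open Loops bounds 100<B₁
  open Verified-Multiply setting
  open Verified-Iterate setting
  open OnGraph G′ Tmax

  input′ : Memory ℕ
  input′ = initial 0 (graphInput G′)

  adjℕ : Matrix ℕ n n
  adjℕ u v = if adj G′ u v then 1 else 0

  input-beyond : ∀ {b} → q ≤ b → input′ (suc b) ≡ 0
  input-beyond q≤b = initial-beyond 0 (rowMajor adjℕ) (≤-trans (≤-reflexive (length-rowMajor 0 adjℕ)) q≤b)

  input-≤1 : ∀ b → input′ (suc b) ≤ 1
  input-≤1 b with b <? q
  ... | no b≮ = ≤-trans (≤-reflexive (input-beyond (≮⇒≥ b≮))) z≤n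
  ... | yes b< with unflatten n n b<
  ...   | u , v , refl = subst (_≤ 1) (sym (initial-rowMajor 0 adjℕ u v)) (lemma (adj G′ u v))
    where
    lemma : ∀ b → (if b then 1 else 0) ≤ 1
    lemma true  = s≤s z≤n
    lemma false = z≤n

  input-adj : ∀ u v → input′ (suc (toℕ u * n + toℕ v)) ≡ bit (adj G′ u v)
  input-adj u v = trans (initial-rowMajor 0 adjℕ u v) (lemma (adj G′ u v))
    where
    lemma : ∀ b → (if b then 1 else 0) ≡ bit b
    lemma true  = refl
    lemma false = refl

  30≤S : 30 ≤ S
  30≤S = ≤-trans (m≤n+m 30 (3 * (suc n * suc n))) ample

  record Start (s : St) : Set where
    field
      N≡   : s ⟨ vN ⟩ ≡ n
      E≡   : s ⟨ vE ⟩ ≡ packedValue input′ 1 packed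
      raw≡ : ∀ a → firstFree ≤ a → a < G → raw s a ≡ input′ a
      arr0 : ∀ j i → j < L → arr s j i ≡ 0

  record Base (κ : Regs) : Set where
    field
      N≡ : rN κ ≡ n
      Q≡ : rQ κ ≡ q
      S≡′ : rS κ ≡ S
      ρ≡ : rρ κ ≡ firstSim
      M≡ : rM κ ≡ 0
      C≡ : rC κ ≡ n ∸ 1

  Relocated : ℕ → Regs → (ℕ → Memory ℕ) → Memory ℕ → Set
  Relocated i κ a r = Base κ × (∀ b → b < i → a aA b ≡ input′ (suc b)) × (∀ b → i ≤ b → a aA b ≡ 0)
                    × (∀ j b → j < L → j ≢ aA → a j b ≡ 0) × (∀ b → firstFree ≤ b → b < G → r b ≡ input′ b)

  Unpacking : ℕ → Pred
  Unpacking i κ a r = rE κ ≡ packedValue input′ (suc i) (packed ∸ i) × Relocated i κ a r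

  setup-triple : Triple Start (ops (setupOps C)) (λ s → On (Unpacking 0) s × s ⟨ vLim ⟩ ≡ packed)
                   (length (emitOps (setupOps C)))
  setup-triple = ops-triple (setupOps C) λ s wf St₀ → let open Start St₀ in
    ( bounded (≤-trans (≤-reflexive (cong (λ k → k * k) N≡)) q≤S) , lit
    , subst (λ k → k + 1 < B₁) (sym N≡) (bounded (≤-trans (≤-reflexive (+-comm n 1)) n<S))
    , bounded (subst (λ k → (k + 1) * (k + 1) ≤ S) (sym N≡) (subst (λ k → k * k ≤ S) (+-comm 1 n) square≤S))
    , C<B₁ , bounded (≤-reflexive (S-value (s ⟨ vN ⟩) N≡))
    , lit , lit , lit , tt , lit , tt ) ,
    ( E≡ , record { N≡ = N≡ ; Q≡ = cong (λ k → k * k) N≡ ; S≡′ = S-value (s ⟨ vN ⟩) N≡ ; ρ≡ = refl ; M≡ = refl ; C≡ = cong (_∸ 1) N≡ }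
    , (λ _ ()) , (λ b _ → arr0 aA b id<L) , (λ j b j<L _ → arr0 j b j<L) , raw≡ ) , refl
    where
    S-value : ∀ k → k ≡ n → (C + 30) * ((k + 1) * (k + 1)) ≡ S
    S-value k refl = trans (cong (λ k → (C + 30) * (k * k)) (+-comm n 1)) (sym S≡)
    square≤S : suc n * suc n ≤ S
    square≤S = ≤-trans (m≤m+n _ _) (≤-trans (m≤m+n (3 * (suc n * suc n)) 30) ample)

  aA-put : ∀ (a : ℕ → Memory ℕ) i {x} → (∀ b → b < i → a aA b ≡ input′ (suc b)) → (∀ b → i ≤ b → a aA b ≡ 0) →
    (∀ j b → j < L → j ≢ aA → a j b ≡ 0) → x ≡ input′ (suc i) → let a′ = a [ aA ≔ a aA [ i ≔ x ] ] in
    (∀ b → b < suc i → a′ aA b ≡ input′ (suc b)) × (∀ b → suc i ≤ b → a′ aA b ≡ 0) × (∀ j b → j < L → j ≢ aA → a′ j b ≡ 0)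
  aA-put a i {x} done″ rest″ others x≡ = done′ , rest′ , λ j b j<L j≢ → trans (cong (λ f → f b) (upd-≢ a (j≢ ∘ sym))) (others j b j<L j≢)
    where
    done′ : ∀ b → b < suc i → (a aA [ i ≔ x ]) b ≡ input′ (suc b)
    done′ b (s≤s b≤i) with i ≟ b
    ... | yes refl = trans (upd-≡ (a aA) i) x≡
    ... | no i≢b   = trans (upd-≢ (a aA) i≢b) (done″ b (≤∧≢⇒< b≤i (i≢b ∘ sym)))
    rest′ : ∀ b → suc i ≤ b → (a aA [ i ≔ x ]) b ≡ 0
    rest′ b i<b = trans (upd-≢ (a aA) {i} {b} (λ { refl → <-irrefl refl i<b })) (rest″ b (<⇒≤ i<b))

  unpack-triple : Triple (λ s → On (Unpacking 0) s × s ⟨ vLim ⟩ ≡ packed) (forEach vLim unpackEntry)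
    (On (Unpacking packed)) (forEachTime packed unpackEntry)
  unpack-triple = forEach-triple vLim unpackEntry Unpacking (λ _ _ → refl) body
    where
    body : ∀ i s → Wf s → i < packed → On (Unpacking i) s → s ⟨ vI ⟩ ≡ i →
      Oks unpackEntry s × On (Unpacking (suc i)) (effects unpackEntry s)
      × effects unpackEntry s ⟨ vI ⟩ ≡ s ⟨ vI ⟩ × effects unpackEntry s ⟨ vK ⟩ ≡ s ⟨ vK ⟩
    body i s wf i<26 (E≡ , base , done″ , rest″ , others , raws) refl =
      ( tt , ≤-<-trans (≤-trans (+-monoʳ-≤ ⌊ e /2⌋ (⌊n/2⌋≤⌈n/2⌉ e)) (≤-reflexive (⌊n/2⌋+⌈n/2⌉≡n e))) (Wf.var< wf vE)
      , tt , lit , put-ok id<L (<-≤-trans i<26 (≤-trans (≤ᵇ⇒≤ 26 30 tt) 30≤S)) , lit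
      , ≤-<-trans (≤-trans (≤-reflexive (+-identityʳ _)) (⌊n/2⌋≤n e)) (Wf.var< wf vE) , tt ) ,
      ( trans (+-identityʳ _) half≡ , record { Base base } , proj₁ written-A , proj₁ (proj₂ written-A)
      , proj₂ (proj₂ written-A) , raws ) , refl , refl
      where
      e = s ⟨ vE ⟩
      y = packedValue input′ (suc (suc i)) (packed ∸ suc i)
      e≡ : e ≡ input′ (suc i) + (y + y)
      e≡ = trans E≡ (trans (cong (packedValue input′ (suc i)) (+-∸-assoc 1 {25} {i} (s≤s⁻¹ i<26)))
        (packedValue-suc input′ (suc i) (25 ∸ i)))
      half≡ : ⌊ e /2⌋ ≡ y
      half≡ = trans (cong ⌊_/2⌋ e≡) (half-packed y (input-≤1 i))
      low≡ : e ∸ (⌊ e /2⌋ + ⌊ e /2⌋) ≡ input′ (suc i)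
      low≡ = trans (cong₂ (λ e h → e ∸ (h + h)) e≡ half≡) (m+n∸n≡m (input′ (suc i)) (y + y))
      written-A = aA-put (arr s) i done″ rest″ others low≡

  relocate-triple : Triple (λ s → On (Relocated packed) s × s ⟨ vLim ⟩ ≡ q ∸ packed) (forEach vLim relocateEntry)
    (On (Relocated (q ∸ packed + packed))) (forEachTime (q ∸ packed) relocateEntry)
  relocate-triple = forEach-triple vLim relocateEntry (λ i → Relocated (i + packed)) (λ _ _ → refl) body
    where
    body : ∀ i s → Wf s → i < q ∸ packed → On (Relocated (i + packed)) s → s ⟨ vI ⟩ ≡ i →
      Oks relocateEntry s × On (Relocated (suc i + packed)) (effects relocateEntry s)
      × effects relocateEntry s ⟨ vI ⟩ ≡ s ⟨ vI ⟩ × effects relocateEntry s ⟨ vK ⟩ ≡ s ⟨ vK ⟩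
    body i s wf i< (base , done″ , rest″ , others , raws) refl =
      ( lit , bounded (≤-trans (≤-reflexive (+-suc i packed)) (≤-trans i+26<q q≤S)) , (free≤ , <G) , lit
      , bounded (≤-trans (<⇒≤ i+26<q) q≤S) , lit , put-ok id<L (<-≤-trans i+26<q q≤S) , tt ) ,
      ( base , proj₁ written-A , proj₁ (proj₂ written-A) , proj₂ (proj₂ written-A) , raws ) , refl , refl
      where
      i+26<q : i + packed < q
      i+26<q = <∸⇒+< i q packed i<
      free≤ : firstFree ≤ i + firstFree
      free≤ = m≤n+m firstFree i
      <G : i + firstFree < G
      <G = subst (i + firstFree <_) (sym G≡) (+-mono-≤-< (≤-trans (m≤m+n i packed) (<⇒≤ i+26<q)) (n<1+n firstFree))
      -- `firstFree` is `suc packed` and cell 0 holds `n`, so input cell `i + firstFree` is the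
      -- matrix entry `i + packed`.
      written-A = aA-put (arr s) (i + packed) done″ rest″ others
        (trans (raws (i + firstFree) free≤ <G) (cong input′ (+-suc i packed)))

  eqℕ : ℕ → ℕ → ℕ
  eqℕ U V = 1 ∸ (U ∸ V + (V ∸ U))

  eqℕ-correct : ∀ (u v : Fin n) → eqℕ (toℕ u) (toℕ v) ≡ bit (Q.I u v)
  eqℕ-correct u v with u Fin.≟ v
  ... | yes refl rewrite n∸n≡0 (toℕ u) = refl
  ... | no u≢v = m≤n⇒m∸n≡0 (positive (toℕ u) (toℕ v) (u≢v ∘ toℕ-injective))
    where
    positive : ∀ a b → a ≢ b → 1 ≤ a ∸ b + (b ∸ a)
    positive zero    zero    a≢b = contradiction refl a≢b
    positive zero    (suc b) a≢b = s≤s z≤n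
    positive (suc a) zero    a≢b = s≤s z≤n
    positive (suc a) (suc b) a≢b = positive a b (a≢b ∘ cong suc)

  transpose-block : ∀ {κ a i k} → rN κ ≡ n → rV κ * n + rU κ < q → i < q →
    Block (Exactly κ a i k) transposeBlock (Exactly κ (a [ aAᵀ ≔ a aAᵀ [ rV κ * n + rU κ ≔ a aA i ] ]) i k)
  transpose-block N≡ VU<q i<q .step s (exactly refl refl refl refl) =
    ( lit , id<L , ≤-<-trans (m≤m+n _ (s ⟨ vU ⟩)) VU<B , VU<B , lit
    , put-ok id<L (subst (_< S) (sym VU≡) (<-≤-trans VU<q q≤S)) , tt ) ,
    exactly refl (cong (λ b → arr s [ aAᵀ ≔ arr s aAᵀ [ b ≔ arr s aA (s ⟨ vI ⟩) ] ]) VU≡) refl refl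
    where
    VU≡ : s ⟨ vV ⟩ * s ⟨ vN ⟩ + s ⟨ vU ⟩ ≡ s ⟨ vV ⟩ * n + s ⟨ vU ⟩
    VU≡ = cong (λ k → s ⟨ vV ⟩ * k + s ⟨ vU ⟩) N≡
    VU<B : s ⟨ vV ⟩ * s ⟨ vN ⟩ + s ⟨ vU ⟩ < B₁
    VU<B = subst (_< B₁) (sym VU≡) (bounded (≤-trans (<⇒≤ VU<q) q≤S))

  equal-block : ∀ {κ a i k} → rU κ ≤ n → rV κ ≤ n →
    Block (Exactly κ a i k) equalBlock (λ s → Exactly κ a i k s × s ⟨ tx ⟩ ≡ eqℕ (rU κ) (rV κ) × s ⟨ tz ⟩ ≡ 1)
  equal-block U≤ V≤ .step s (exactly refl refl refl refl) =
    ( tt , tt , bounded (≤-trans (+-mono-≤ (≤-trans (m∸n≤m (s ⟨ vU ⟩) (s ⟨ vV ⟩)) U≤) (≤-trans (m∸n≤m (s ⟨ vV ⟩) (s ⟨ vU ⟩)) V≤)) 2n≤S)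
    , lit , tt , tt ) , exactly refl refl refl refl , refl , refl
    where
    2n≤S : n + n ≤ S
    2n≤S = ≤-trans (+-mono-≤ n≤N (≤-trans n≤N (m≤m+n N (N + 0)))) (≤-trans (m≤m+n (3 * N) 30) ample)
      where
      N = suc n * suc n
      n≤N : n ≤ N
      n≤N = ≤-trans (n≤1+n n) (m≤m*n (suc n) (suc n))

  tables-block : ∀ {κ a i k x} → x ≤ 1 → i < q →
    Block (λ s → Exactly κ a i k s × s ⟨ tx ⟩ ≡ x × s ⟨ tz ⟩ ≡ 1) tablesBlock
      (Exactly κ (a [ aI ≔ a aI [ i ≔ x ] ] [ aN ≔ a aN [ i ≔ x ] ] [ aPrev ≔ a aPrev [ i ≔ 1 ] ]) i k)
  tables-block x≤1 i<q .step s (exactly refl refl refl refl , refl , tz≡) =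
    ( lit , put-ok id<L i<S , lit , put-ok id<L i<S , lit , put-ok id<L i<S , tt ) ,
    exactly refl (cong (λ y → arr s [ aI ≔ arr s aI [ s ⟨ vI ⟩ ≔ s ⟨ tx ⟩ ] ] [ aN ≔ arr s aN [ s ⟨ vI ⟩ ≔ s ⟨ tx ⟩ ] ]
      [ aPrev ≔ arr s aPrev [ s ⟨ vI ⟩ ≔ y ] ]) tz≡) refl refl
    where i<S = <-≤-trans i<q q≤S

  record Tables (i : ℕ) (κ : Regs) (a : ℕ → Memory ℕ) : Set where
    field
      base     : Base κ
      position : Position i κ
      A*       : ∀ b → a aA b ≡ input′ (suc b)
      Aᵀ*      : ∀ u v → toℕ u * n + toℕ v < i → a aAᵀ (toℕ v * n + toℕ u) ≡ bit (adj G′ u v)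
      I*       : ∀ u v → toℕ u * n + toℕ v < i → a aI (toℕ u * n + toℕ v) ≡ bit (Q.I u v)
      N*       : ∀ u v → toℕ u * n + toℕ v < i → a aN (toℕ u * n + toℕ v) ≡ bit (Q.I u v)
      J*       : ∀ b → b < i → a aPrev b ≡ 1
      zeros    : ∀ j b → j < L → 5 < j ⊎ j ≡ 0 → a j b ≡ 0

  tables-triple : Triple (λ s → Tables 0 (regs s) (arr s) × s ⟨ vQ ⟩ ≡ q) (forEach vQ tableEntry)
    (λ s → Tables q (regs s) (arr s)) (forEachTime q tableEntry)
  tables-triple = forEach-triple vQ tableEntry (λ i κ a _ → Tables i κ a) (λ _ _ → refl) body
    where
    module Step {i κ a} (i<q : i < q) (Ta : Tables i κ a) where
      open Tables Ta
      open Base base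
      V<n = proj₁ (position-< {κ = κ} position i<q)
      U<n = proj₂ (position-< {κ = κ} position i<q)
      u₁ = fromℕ< U<n
      v₁ = fromℕ< V<n
      U≡ : rU κ ≡ toℕ u₁
      U≡ = sym (toℕ-fromℕ< U<n)
      V≡ : rV κ ≡ toℕ v₁
      V≡ = sym (toℕ-fromℕ< V<n)
      here≡ : toℕ u₁ * n + toℕ v₁ ≡ i
      here≡ = trans (cong₂ (λ u v → u * n + v) (sym U≡) (sym V≡)) (Position.flat≡ position)
      x = eqℕ (rU κ) (rV κ)
      x≡ : x ≡ bit (Q.I u₁ v₁)
      x≡ = trans (cong₂ eqℕ U≡ V≡) (eqℕ-correct u₁ v₁)
      VU<q : rV κ * n + rU κ < q
      VU<q = subst (_< q) (cong₂ (λ v u → v * n + u) (sym V≡) (sym U≡)) (flat< v₁ u₁)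
      κ₁ : Regs
      κ₁ = record κ { rU = rU κ + carry n (rV κ) ; rV = rV κ + 1 ∸ carry n (rV κ) * n }
      a₁ a₂ : ℕ → Memory ℕ
      a₁ = a [ aAᵀ ≔ a aAᵀ [ rV κ * n + rU κ ≔ a aA i ] ]
      a₂ = a₁ [ aI ≔ a₁ aI [ i ≔ x ] ] [ aN ≔ a₁ aN [ i ≔ x ] ] [ aPrev ≔ a₁ aPrev [ i ≔ 1 ] ]
      cases : ∀ u v → toℕ u * n + toℕ v < suc i → (u ≡ u₁ × v ≡ v₁) ⊎ (toℕ u * n + toℕ v ≢ i × toℕ u * n + toℕ v < i)
      cases u v (s≤s le) with toℕ u * n + toℕ v ≟ i
      ... | yes eq = let p , q = flat-injective n (toℕ<n v) (toℕ<n v₁) (trans eq (sym here≡)) in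
                     inj₁ (toℕ-injective p , toℕ-injective q)
      ... | no ne  = inj₂ (ne , ≤∧≢⇒< le ne)
      entry : ∀ (f : Memory ℕ) → (∀ u v → toℕ u * n + toℕ v < i → f (toℕ u * n + toℕ v) ≡ bit (Q.I u v)) →
              ∀ u v → toℕ u * n + toℕ v < suc i → (f [ i ≔ x ]) (toℕ u * n + toℕ v) ≡ bit (Q.I u v)
      entry f old u v lt with cases u v lt
      ... | inj₁ (refl , refl) = trans (cong (f [ i ≔ x ]) here≡) (trans (upd-≡ f i) x≡)
      ... | inj₂ (ne , lt′)    = trans (upd-≢ f (ne ∘ sym)) (old u v lt′)
      transposed : ∀ u v → toℕ u * n + toℕ v < suc i → (a aAᵀ [ rV κ * n + rU κ ≔ a aA i ]) (toℕ v * n + toℕ u) ≡ bit (adj G′ u v)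
      transposed u v lt with cases u v lt
      ... | inj₁ (refl , refl) = trans (cong (a aAᵀ [ rV κ * n + rU κ ≔ a aA i ]) (sym (cong₂ (λ v u → v * n + u) V≡ U≡)))
        (trans (upd-≡ (a aAᵀ) (rV κ * n + rU κ)) (trans (A* i) (trans (cong (input′ ∘ suc) (sym here≡)) (input-adj u₁ v₁))))
      ... | inj₂ (ne , lt′) = trans (upd-≢ (a aAᵀ) λ eq → let p , q = flat-injective n {rV κ} {toℕ v} U<n (toℕ<n u) eq in
            ne (trans (cong₂ (λ u v → u * n + v) (sym q) (sym p)) (Position.flat≡ position)))
          (Aᵀ* u v lt′)
      tables : Tables (suc i) κ₁ a₂
      tables = record
        { base = record { Base base }
        ; position = record
          { flat≡ = trans (carry-flat V<n (rU κ)) (cong suc (Position.flat≡ position))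
          ; V<n = inj₁ (carry-< V<n) }
        ; A* = A* ; Aᵀ* = transposed ; I* = entry (a aI) I* ; N* = entry (a aN) N*
        ; J* = ones
        ; zeros = λ { (suc (suc (suc (suc (suc (suc j)))))) b j<L p → zeros _ b j<L p
                    ; 0 b j<L p → zeros 0 b j<L p
                    ; 1 b j<L (inj₁ (s≤s ()))
                    ; 2 b j<L (inj₁ (s≤s (s≤s ())))
                    ; 3 b j<L (inj₁ (s≤s (s≤s (s≤s ()))))
                    ; 4 b j<L (inj₁ (s≤s (s≤s (s≤s (s≤s ())))))
                    ; 5 b j<L (inj₁ (s≤s (s≤s (s≤s (s≤s (s≤s ())))))) } }
        where
        ones : ∀ b → b < suc i → (a aPrev [ i ≔ 1 ]) b ≡ 1
        ones b (s≤s b≤i) with i ≟ b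
        ... | yes refl = upd-≡ (a aPrev) i
        ... | no i≢b   = trans (upd-≢ (a aPrev) i≢b) (J* b (≤∧≢⇒< b≤i (i≢b ∘ sym)))
    body : ∀ i s → Wf s → i < q → Tables i (regs s) (arr s) → s ⟨ vI ⟩ ≡ i →
      Oks tableEntry s × Tables (suc i) (regs (effects tableEntry s)) (arr (effects tableEntry s))
      × effects tableEntry s ⟨ vI ⟩ ≡ s ⟨ vI ⟩ × effects tableEntry s ⟨ vK ⟩ ≡ s ⟨ vK ⟩
    body i s wf i<q Ta refl =
      let oks , exactly κ≡ a≡ i≡ k≡ = blocks .step s (exactly refl refl refl refl)
      in oks , subst₂ (Tables (suc i)) (sym κ≡) (sym a≡) tables , i≡ , k≡
      where
      open Step i<q Ta
      N≡ = Base.N≡ (Tables.base Ta)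
      blocks : Block (Exactly (regs s) (arr s) i (s ⟨ vK ⟩)) tableEntry (Exactly κ₁ a₂ i (s ⟨ vK ⟩))
      blocks = transpose-block N≡ VU<q i<q ▸ equal-block (<⇒≤ U<n) (<⇒≤ V<n)
        ▸ tables-block (subst (_≤ 1) (sym x≡) (bit-≤1 _)) i<q ▸ next-block N≡ V<n U<n

  tables-start : ∀ κ a r → Relocated (q ∸ packed + packed) κ a r → Tables 0 (record κ { rU = 0 ; rV = 0 }) a
  tables-start κ a r (base , done″ , rest″ , others , _) = record
    { base = record { Base base }
    ; position = record { flat≡ = refl ; V<n = zero-< n }
    ; A* = all ; Aᵀ* = λ _ _ () ; I* = λ _ _ () ; N* = λ _ _ () ; J* = λ _ ()
    ; zeros = λ { j b j<L (inj₁ 5<j) → others j b j<L (λ { refl → contradiction 5<j λ { (s≤s ()) } })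
                ; j b j<L (inj₂ refl) → others 0 b j<L λ () } }
    where
    zero-< : ∀ n → 0 < n ⊎ n ≡ 0
    zero-< zero    = inj₂ refl
    zero-< (suc n) = inj₁ (s≤s z≤n)
    all : ∀ b → a aA b ≡ input′ (suc b)
    all b with b <? q ∸ packed + packed
    ... | yes b< = done″ b b<
    ... | no b≮  = trans (rest″ b (≮⇒≥ b≮)) (sym (input-beyond
      (≤-trans (≤-trans (m≤n+m∸n q packed) (≤-reflexive (+-comm packed (q ∸ packed)))) (≮⇒≥ b≮))))

  -- Degree 0 is settled without a search because `X 0` is the zero matrix; `aT`, `aP` and `aX` are
  -- still blank and thus hold the right initial matrices.
  running-start : ∀ s → Tables q (regs s) (arr s) → Running (n ∸ 1) s
  running-start s Ta = Q.O , 0 , refl , record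
      { N≡ = N≡ ; Q≡ = Q≡ ; S≡ = S≡′ ; M≡ = M≡ ; C≡ = C≡
      ; 9≤ρ = ≤-reflexive (sym ρ≡)
      ; room = subst (λ ρ → suc ρ + stride workspace * ((n ∸ 1) * 3) < L) (sym ρ≡)
          (≤-trans (s≤s (+-monoʳ-≤ 10 (*-monoʳ-≤ (stride workspace)
            (≤-trans (*-monoˡ-≤ 3 (m∸n≤m n 1)) (≤-reflexive (*-comm n 3)))))) arrays)
      ; clean = λ j i lt j<L → zeros j i j<L (inj₁ (<-trans (≤ᵇ⇒≤ 6 10 tt) (subst (λ ρ → suc ρ < j) ρ≡ lt)))
      ; mats = mats′
      ; out0 = λ i → zeros 0 i id<L (inj₂ refl) } ,
    (λ { zero z≤n u v hit → contradiction (trans (sym (Bool.∧-zeroʳ (Q.A u v))) hit) λ () })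
    where
    open Tables Ta
    open Base base
    zero-mat : ∀ j → 5 < j → j < firstSim → Holds (arr s j) Q.O
    zero-mat j 5<j j<9 u v = zeros j _ (<-≤-trans j<9 (≤-trans (≤ᵇ⇒≤ 9 11 tt) (≤-trans (m≤m+n 11 _) arrays))) (inj₁ 5<j)
    mats′ : ∀ j → 1 ≤ j → j < firstSim → Holds (arr s j) (state Q.O 0 j)
    mats′ 1 _ _ u v = trans (A* _) (input-adj u v)
    mats′ 2 _ _ u v = Aᵀ* v u (flat< v u)
    mats′ 3 _ _ u v = I* u v (flat< u v)
    mats′ 4 _ _ u v = N* u v (flat< u v)
    mats′ 5 _ _ u v = J* _ (flat< u v)
    mats′ 6 _ j<9 = zero-mat 6 (n<1+n 5) j<9
    mats′ 7 _ j<9 = zero-mat 7 (≤ᵇ⇒≤ 6 7 tt) j<9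
    mats′ 8 _ j<9 = zero-mat 8 (≤ᵇ⇒≤ 6 8 tt) j<9
    mats′ (suc (suc (suc (suc (suc (suc (suc (suc (suc j))))))))) _
      (s≤s (s≤s (s≤s (s≤s (s≤s (s≤s (s≤s (s≤s (s≤s ())))))))))

  Answered : Maybe (List (Fin n)) → St → Set
  Answered answer s = CorrectAnswer G′ answer × s ⟨ vN ⟩ ≡ n × (∀ b → arr s aOut b ≡ initial 0 (answerOutput answer) b)

  Printed : Maybe (List (Fin n)) → St → Set
  Printed answer s = CorrectAnswer G′ answer × (∀ b → arr s aOut b ≡ initial 0 (answerOutput answer) b)
                   × (∀ b → firstFree ≤ b → b ≤ n → raw s b ≡ initial 0 (answerOutput answer) b)

  -- Only cells from `firstFree` on are written here, because the lower ones are the registers still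
  -- in use. Cells up to `n` have room for a length and at most `n` vertices.
  output-triple : ∀ answer → Triple (Answered answer) (ops (beyondPacked vN) ⨾ forEach vLim outputEntry) (Printed answer)
    (length (emitOps (beyondPacked vN)) + forEachTime (n ∸ packed) outputEntry)
  output-triple answer =
    _⨟_ {Q = λ s → On (Writing 0) s × s ⟨ vLim ⟩ ≡ n ∸ packed}
      (ops-triple (beyondPacked vN) λ s wf (correct , N≡ , out) → (lit , tt , tt) ,
        (correct , out , λ b free≤ b< → contradiction free≤ (<⇒≱ b<)) , cong (_∸ packed) N≡)
      (conseq (λ _ _ P → P) (λ { s _ (correct , out , written) → correct , out , λ b free≤ b≤n → written b free≤ (end b b≤n) }) ≤-refl
        (forEach-triple vLim outputEntry Writing (λ _ _ → refl) body))
    where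
    out = initial 0 (answerOutput answer)
    end : ∀ b → b ≤ n → b < n ∸ packed + firstFree
    end b b≤n = ≤-<-trans (≤-trans b≤n (≤-trans (m≤n+m∸n n packed) (≤-reflexive (+-comm packed (n ∸ packed)))))
      (+-monoʳ-< (n ∸ packed) (n<1+n packed))
    Writing : ℕ → Pred
    Writing i κ a r = CorrectAnswer G′ answer × (∀ b → a aOut b ≡ out b) × (∀ b → firstFree ≤ b → b < i + firstFree → r b ≡ out b)
    body : ∀ i s → Wf s → i < n ∸ packed → On (Writing i) s → s ⟨ vI ⟩ ≡ i →
      Oks outputEntry s × On (Writing (suc i)) (effects outputEntry s)
      × effects outputEntry s ⟨ vI ⟩ ≡ s ⟨ vI ⟩ × effects outputEntry s ⟨ vK ⟩ ≡ s ⟨ vK ⟩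
    body i s wf i< (correct , a≡ , written) refl =
      ( lit , n-bound i+27≤n , lit , id<L , (m≤n+m firstFree i , <G) , tt ) ,
      ( correct , a≡ , λ b free≤ b< → next b free≤ b< ) , refl , refl
      where
      i+27≤n : i + firstFree ≤ n
      i+27≤n = ≤-trans (≤-reflexive (+-suc i packed)) (<∸⇒+< i n packed i<)
      <G : i + firstFree < G
      <G = subst (i + firstFree <_) (sym G≡) (≤-<-trans i+27≤n (n<G n))
        where
        n<G : ∀ n → n < n * n + suc firstFree
        n<G zero    = s≤s z≤n
        n<G (suc n) = ≤-<-trans (m≤m*n (suc n) (suc n)) (m<m+n (suc n * suc n) (s≤s z≤n))
      next : ∀ b → firstFree ≤ b → b < suc i + firstFree → (raw s [ i + firstFree ≔ arr s aOut (i + firstFree) ]) b ≡ out b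
      next b free≤ (s≤s b≤) with i + firstFree ≟ b
      ... | yes refl = trans (upd-≡ (raw s) (i + firstFree)) (a≡ (i + firstFree))
      ... | no ne    = trans (upd-≢ (raw s) ne) (written b free≤ (≤∧≢⇒< b≤ (ne ∘ sym)))

  mainTime : ℕ
  mainTime = length (emitOps (setupOps C)) + (forEachTime packed unpackEntry +
    (length (emitOps (beyondPacked vQ)) + (forEachTime (q ∸ packed) relocateEntry +
    (2 + (forEachTime q tableEntry + (suc ((n ∸ 1) * (2 + iterationTime)) +
    (length (emitOps (beyondPacked vN)) + forEachTime (n ∸ packed) outputEntry)))))))

  main-triple : Promise → Fast → ((∀ m → m < n → ∀ u v → ¬ HitAt m u v) → NoEvenCycle G′) →
    Triple Start (main workspace p C) (λ s → ∃[ answer ] Printed answer s) mainTime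
  main-triple promise fast absent =
    setup-triple ⨟ unpack-triple ⨟
    _⨟_ {Q = λ s → On (Relocated packed) s × s ⟨ vLim ⟩ ≡ q ∸ packed}
      (ops-triple (beyondPacked vQ) λ s wf (_ , base , rest) →
        (lit , tt , tt) , (record { Base base } , rest) , cong (_∸ packed) (Base.Q≡ base))
    (relocate-triple ⨟
    _⨟_ {Q = λ s → Tables 0 (regs s) (arr s) × s ⟨ vQ ⟩ ≡ q}
      (ops-triple (cst vU 0 ∷ cst vV 0 ∷ []) λ s wf R →
        (lit , lit , tt) , tables-start (regs s) (arr s) (raw s) R , Base.Q≡ (proj₁ R))
    (tables-triple ⨟
    conseq (λ s _ → running-start s) (λ s _ → answered s) ≤-refl
      (loop-triple {I = Running} {E = Finished}
        (λ { c s (_ , _ , _ , E , _) → Env.C≡ E }) (λ { s (_ , _ , _ , C≡ , _) → C≡ })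
        (iteration-triple promise fast) (n ∸ 1)) ⨟
    ghost λ { s₀ wf₀ (answer , A) → conseq (λ { s _ refl → A }) (λ s _ P → answer , P) ≤-refl (output-triple answer) }))
    where
    answered : ∀ s → Running 0 s ⊎ Finished s → ∃[ answer ] Answered answer s
    answered s (inj₂ (c , shortest , N≡ , _ , out)) = just c , shortest , N≡ , out
    answered s (inj₁ (_ , m , m≡ , E , none)) = nothing ,
      absent (λ m′ m′<n → none m′ (≤-trans (<⇒≤pred m′<n) (≤-reflexive (sym (trans (sym (+-identityʳ m)) m≡))))) ,
      Env.N≡ E , λ { zero → Env.out0 E 0 ; (suc b) → Env.out0 E (suc b) }

-- Packing the input and moving the answer

opaque
  unfolding packedValue

  packedValue-< : ∀ {m a} → (∀ b → a ≤ b → m b ≤ 1) → ∀ c → packedValue m a c < 2 ^ c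
  packedValue-< bits zero = s≤s z≤n
  packedValue-< {m} {a} bits (suc c) = begin-strict
    m a + (v + v)    ≤⟨ +-monoˡ-≤ (v + v) (bits a ≤-refl) ⟩
    1 + (v + v)      ≡⟨ cong suc (cong (v +_) (sym (+-identityʳ v))) ⟩
    1 + 2 * v        <⟨ n<1+n _ ⟩
    2 + 2 * v        ≡⟨ *-suc 2 v ⟨
    2 * suc v        ≤⟨ *-monoʳ-≤ 2 (packedValue-< (λ b le → bits b (<⇒≤ le)) c) ⟩
    2 * 2 ^ c        ∎
    where
    open ≤-Reasoning
    v : ℕ
    v = packedValue m (suc a) c

module Verified-Run (job : Job) where
  open Job job
  open Logic bounds
  open Loops bounds 100<B₁
  open Verified-Multiply setting
  open Verified-Iterate setting
  open OnGraph G′ Tmax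
  open Verified-Main job

  -- The invariant before `G` and `L` are in place: the cells from `G` on are untouched, so all
  -- arrays begin as zero.
  Small : Memory ℕ → Set
  Small R = (∀ a → R a < B₁) × (∀ a → G ≤ a → R a ≡ 0)

  small-good : ∀ {R} → Small R → Good R
  small-good (lt , zeros) = (λ a → <-≤-trans (lt a) B₁≤B) , λ a o → zeros a (≮⇒≥ (λ a<G → out-low a<G o))

  small-upd : ∀ {R a x} → Small R → x < B₁ → a < G → Small (R [ a ≔ x ])
  small-upd {R} {a} {x} (lt , zeros) x<B a<G = below , beyond
    where
    below : ∀ b → (R [ a ≔ x ]) b < B₁
    below b with a ≟ b
    ... | yes refl = subst (_< B₁) (sym (upd-≡ R a)) x<B
    ... | no a≢b   = subst (_< B₁) (sym (upd-≢ R a≢b)) (lt b)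
    beyond : ∀ b → G ≤ b → (R [ a ≔ x ]) b ≡ 0
    beyond b G≤b = trans (upd-≢ R {a} {b} (λ { refl → <⇒≱ a<G G≤b })) (zeros b G≤b)

  input-small : Small input′
  input-small = below , λ { zero G≤0 → contradiction (≤-trans free≤G G≤0) λ () ; (suc a) G≤a → input-beyond (s≤s⁻¹ (≤-trans q< G≤a)) }
    where
    q< : suc q ≤ G
    q< = subst (q <_) (sym G≡) (m<m+n q (s≤s z≤n))
    below : ∀ a → input′ a < B₁
    below zero    = n-bound ≤-refl
    below (suc a) = 1≤B (input-≤1 a)

  free<G : ∀ {a} → a < firstFree → a < G
  free<G a< = <-≤-trans a< free≤G

  module _ {prog : List Instr} where

    -- Cell `suc m` gains twice the cell above it, hence the two additions per step. At the end cell
    -- 1 holds all packed bits, while cell 0 still holds `n`.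
    packing-exec : ∀ m c {a R} → m + c ≡ packed → Small R → At prog a (packing m) →
      (∀ b → b ≤ m → R b ≡ input′ b) → R (suc m) ≡ packedValue input′ (suc m) c →
      ∃[ R′ ] Exec prog (length (packing m)) (a , R) (a + length (packing m) , R′) × Small R′
        × R′ 0 ≡ n × R′ 1 ≡ packedValue input′ 1 packed × (∀ b → firstFree ≤ b → R′ b ≡ R b)
    packing-exec zero c {a} {R} refl small at low top = R ,
      subst (λ b → Exec prog 0 (a , R) (b , R)) (sym (+-identityʳ a)) (done (small-good small)) ,
      small , low 0 z≤n , top , λ _ _ → refl
    packing-exec (suc m) c {a} {R} m+c≡ small (i₁ , i₂ , at) low top =
      let R′ , e , small′ , R0 , R1 , high = packing-exec m (suc c) (trans (+-suc m c) m+c≡) small₂ at low₂ top₂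
      in R′ , subst (λ b → Exec prog (2 + length (packing m)) (a , R) (b , R′))
                (sym (trans (+-suc a (suc (length (packing m)))) (cong suc (+-suc a (length (packing m))))))
                (tick (small-good small) i₁ (tick (small-good small₁) i₂ e)) ,
         small′ , R0 , R1 , λ b free≤ → trans (high b free≤) (trans (upd-≢ R₁ (≢b free≤)) (upd-≢ R (≢b free≤)))
      where
      x = R (suc m) + R (suc (suc m))
      R₁ = R [ suc m ≔ x ]
      R₂ = R₁ [ suc m ≔ R₁ (suc m) + R₁ (suc (suc m)) ]
      pv = packedValue input′ (suc (suc m)) c
      m<free : suc m < firstFree
      m<free = s≤s (≤-trans (m≤m+n (suc m) c) (≤-reflexive m+c≡))
      ≢b : ∀ {b} → firstFree ≤ b → suc m ≢ b
      ≢b free≤ refl = <⇒≱ m<free free≤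
      final : R₁ (suc m) + R₁ (suc (suc m)) ≡ packedValue input′ (suc m) (suc c)
      final = begin
        R₁ (suc m) + R₁ (suc (suc m))
          ≡⟨ cong₂ _+_ (upd-≡ R (suc m)) (upd-≢ R (λ eq → 1+n≢n (sym eq))) ⟩
        R (suc m) + R (suc (suc m)) + R (suc (suc m))
          ≡⟨ cong₂ (λ x y → x + y + y) (low (suc m) ≤-refl) top ⟩
        input′ (suc m) + pv + pv
          ≡⟨ +-assoc (input′ (suc m)) pv pv ⟩
        input′ (suc m) + (pv + pv)
          ≡⟨ packedValue-suc input′ (suc m) c ⟨
        packedValue input′ (suc m) (suc c) ∎
        where open ≡-Reasoning
      final<B : R₁ (suc m) + R₁ (suc (suc m)) < B₁
      final<B = subst (_< B₁) (sym final) (<-trans (packedValue-< (λ { zero () ; (suc b) _ → input-≤1 b }) (suc c))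
        (≤-<-trans (^-monoʳ-≤ 2 (≤-trans (m≤n+m (suc c) m) (≤-reflexive (trans (+-suc m c) m+c≡)))) packed<B₁))
      x<B : x < B₁
      x<B = ≤-<-trans (≤-trans (≤-reflexive (sym (upd-≡ R (suc m)))) (m≤m+n (R₁ (suc m)) (R₁ (suc (suc m))))) final<B
      small₁ : Small R₁
      small₁ = small-upd small x<B (free<G m<free)
      small₂ : Small R₂
      small₂ = small-upd small₁ final<B (free<G m<free)
      low₂ : ∀ b → b ≤ m → R₂ b ≡ input′ b
      low₂ b b≤m = trans (upd-≢ R₁ (λ eq → <⇒≢ (s≤s b≤m) (sym eq)))
        (trans (upd-≢ R (λ eq → <⇒≢ (s≤s b≤m) (sym eq))) (low b (m≤n⇒m≤1+n b≤m)))
      top₂ : R₂ (suc m) ≡ packedValue input′ (suc m) (suc c)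
      top₂ = trans (upd-≡ R₁ (suc m)) final

    prologue-exec : ∀ {a R} → Small R → At prog a (prologue workspace) → R 0 ≡ n → R 1 ≡ packedValue input′ 1 packed →
      (∀ b → firstFree ≤ b → R b ≡ input′ b) →
      ∃[ R′ ] ∃[ s ] Exec prog 10 (a , R) (a + 10 , R′) × Rep R′ s × Start s
    prologue-exec {a} {R} small (i₁ , i₂ , i₃ , i₄ , i₅ , i₆ , i₇ , i₈ , i₉ , i₁₀ , _) R0 R1 high =
      R₁₀ , s , subst (λ b → Exec prog 10 (a , R) (b , R₁₀)) (+-comm 10 a)
        (tick (small-good small) i₁ (tick (small-good small₁) i₂ (tick (small-good small₂) i₃ (tick (small-good small₃) i₄
          (tick (small-good small₄) i₅ (tick (small-good small₅) i₆ (tick (small-good small₆) i₇ (tick (small-good small₇) i₈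
          (tick (small-good small₈) i₉ (tick (small-good small₉) i₁₀ (done (small-good small₁₀)))))))))))) ,
      record { good = small-good small₁₀ ; R0 = G-value ; R1 = L-value ; vars = λ _ → refl ; raws = λ _ _ _ → refl ; arrs = λ _ _ _ → refl
             ; wf = record { var< = λ x → proj₁ small₁₀ (reg x) ; raw< = λ b _ _ → proj₁ small₁₀ b
                           ; arr< = λ j i _ → proj₁ small₁₀ (i * L + j + G)
                           ; arr0 = λ j i _ _ → proj₂ small₁₀ (i * L + j + G) (m≤n+m G (i * L + j)) } } ,
      record { N≡ = trans (+-identityʳ (R 0)) R0 ; E≡ = trans (+-identityʳ (R 1)) R1
             ; raw≡ = λ b free≤ _ → trans (unchanged b free≤) (high b free≤)
             ; arr0 = λ j i _ → proj₂ small₁₀ (i * L + j + G) (m≤n+m G (i * L + j)) }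
      where
      δ = 3 * stride workspace
      R₁ = R [ 2 ≔ 0 ]
      R₂ = R₁ [ 3 ≔ R 0 + 0 ]
      R₃ = R₂ [ 12 ≔ R 1 + 0 ]
      R₄ = R₃ [ 0 ≔ R 0 * R 0 ]
      R₅ = R₄ [ 2 ≔ suc firstFree ]
      R₆ = R₅ [ 0 ≔ R 0 * R 0 + suc firstFree ]
      R₇ = R₆ [ 1 ≔ δ ]
      R₈ = R₇ [ 1 ≔ δ * (R 0 + 0) ]
      R₉ = R₈ [ 2 ≔ firstSim + 2 ]
      R₁₀ = R₉ [ 1 ≔ δ * (R 0 + 0) + (firstSim + 2) ]
      G-value : R 0 * R 0 + suc firstFree ≡ G
      G-value = trans (cong (λ k → k * k + suc firstFree) R0) (sym G≡)
      L-value : δ * (R 0 + 0) + (firstSim + 2) ≡ L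
      L-value = trans (cong (λ k → δ * k + (firstSim + 2)) (trans (+-identityʳ (R 0)) R0)) (sym L≡)
      δ≤ : ∀ w → 3 * stride w ≤ 100
      δ≤ unrestricted = ≤ᵇ⇒≤ 6 100 tt
      δ≤ quadratic    = z≤n
      in-free : ∀ k → {T (k <ᵇ firstFree)} → k < G
      in-free k {p} = free<G (<ᵇ⇒< k firstFree p)
      small₁ = small-upd small lit (in-free 2)
      small₂ = small-upd small₁ (subst (_< B₁) (sym (+-identityʳ (R 0))) (proj₁ small 0)) (in-free 3)
      small₃ = small-upd small₂ (subst (_< B₁) (sym (+-identityʳ (R 1))) (proj₁ small 1)) (in-free 12)
      small₄ = small-upd small₃ (≤-<-trans (≤-trans (m≤m+n _ (suc firstFree)) (≤-reflexive G-value)) G<B₁) (in-free 0)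
      small₅ = small-upd small₄ lit (in-free 2)
      small₆ = small-upd small₅ (subst (_< B₁) (sym G-value) G<B₁) (in-free 0)
      small₇ = small-upd small₆ (small-k (δ≤ workspace)) (in-free 1)
        where
        small-k : ∀ {k} → k ≤ 100 → k < B₁
        small-k k≤ = ≤-<-trans k≤ 100<B₁
      small₈ = small-upd small₇ (≤-<-trans (≤-trans (m≤m+n _ (firstSim + 2)) (≤-reflexive L-value)) L<B₁) (in-free 1)
      small₉ = small-upd small₈ lit (in-free 2)
      small₁₀ : Small R₁₀
      small₁₀ = small-upd small₉ (subst (_< B₁) (sym L-value) L<B₁) (in-free 1)
      s : St
      s = st (λ x → R₁₀ (3 + x)) R₁₀ (λ j i → R₁₀ (i * L + j + G))
      unchanged : ∀ b → firstFree ≤ b → R₁₀ b ≡ R b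
      unchanged b free≤ = trans (off R₉ 1) (trans (off R₈ 2) (trans (off R₇ 1) (trans (off R₆ 1) (trans (off R₅ 0)
          (trans (off R₄ 2) (trans (off R₃ 0) (trans (off R₂ 12) (trans (off R₁ 3) (off R 2)))))))))
        where
        off : ∀ (m : Memory ℕ) k {x} → {p : T (k <ᵇ firstFree)} → (m [ k ≔ x ]) b ≡ m b
        off m k {p = p} = upd-≢ m {k} {b} (λ { refl → <⇒≱ (<ᵇ⇒< k firstFree p) free≤ })

    1≤L : 0 < L
    1≤L = subst (1 ≤_) (sym L≡) (≤-trans (s≤s z≤n) (m≤n+m (firstSim + 2) _))

    cell≥G : ∀ i → G ≤ i * L + 0 + G
    cell≥G i = m≤n+m G (i * L + 0)

    cell-off : ∀ (R : Memory ℕ) k {x} i → k < firstFree → (R [ k ≔ x ]) (i * L + 0 + G) ≡ R (i * L + 0 + G)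
    cell-off R k i k< = upd-≢ R (λ eq → <⇒≱ (free<G k<) (subst (G ≤_) (sym eq) (cell≥G i)))

    good-low : ∀ {R k x} → Good R → k < firstFree → x < B → Good (R [ k ≔ x ])
    good-low good k< x<B = Good-upd good x<B (λ o → contradiction o (out-low (free<G k<)))

    cell<B : ∀ {i} → i < firstFree → i * L + 0 + G < B
    cell<B {i} i< = address<B (≤-<-trans (≤-trans (<⇒≤ i<) (≤ᵇ⇒≤ firstFree 100 tt)) 100<B₁) 1≤L

    Done : (Memory ℕ) → ℕ → ℕ → Memory ℕ → Set
    Done out k a R = ∃[ R′ ] Exec prog (length (lowCells k)) (a , R) (a + length (lowCells k) , R′)
        × (∀ b → b ≤ k → R′ b ≡ out b) × (∀ b → k < b → R′ b ≡ R b)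

    low-0 : ∀ out {a R} → Good R → At prog a (lowCells 0) → R 0 ≡ G → R G ≡ out 0 → Done out 0 a R
    low-0 out {a} {R} good (i₁ , _) R0 RG = R₁ ,
      subst (λ b → Exec prog 1 (a , R) (b , R₁)) (+-comm 1 a) (tick good i₁ (done good₁)) ,
      (λ { zero z≤n → trans (cong R R0) RG }) , λ { (suc b) _ → refl }
      where
      R₁ = R [ 0 ≔ R (R 0) ]
      good₁ : Good R₁
      good₁ = good-low good (s≤s z≤n) (proj₁ good (R 0))

    low-1 : ∀ out {a R} → Good R → At prog a (lowCells 1) → R 0 ≡ G → R 1 ≡ L →
      (∀ i → R (i * L + 0 + G) ≡ out i) → Done out 1 a R
    low-1 out {a} {R} good (i₁ , i₂ , at) R0 R1 cells =
      let R′ , e , low , high = low-0 out good₂ at R0 (trans (cell-off R₁ 1 0 1<) (trans (cell-off R 1 0 1<) (cells 0)))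
      in R′ , subst (λ b → Exec prog 3 (a , R) (b , R′)) (trans (+-comm (2 + a) 1) (+-comm 3 a)) (tick good i₁ (tick good₁ i₂ e)) ,
         (λ { zero _ → low 0 z≤n
            ; (suc zero) _ → trans (high 1 (s≤s z≤n)) value
            ; (suc (suc b)) (s≤s ()) }) ,
         λ { (suc zero) (s≤s ()) ; (suc (suc b)) _ → high (suc (suc b)) (s≤s z≤n) }
      where
      1< : 1 < firstFree
      1< = s≤s (s≤s z≤n)
      R₁ = R [ 1 ≔ R 1 + R 0 ]
      R₂ = R₁ [ 1 ≔ R₁ (R 1 + R 0) ]
      addr≡ : R 1 + R 0 ≡ 1 * L + 0 + G
      addr≡ = cong₂ _+_ (trans R1 (sym (trans (+-identityʳ (1 * L)) (+-identityʳ L)))) R0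
      value : R₁ (R 1 + R 0) ≡ out 1
      value = trans (cong R₁ addr≡) (trans (cell-off R 1 1 1<) (cells 1))
      good₁ : Good R₁
      good₁ = good-low good 1< (subst (_< B) (sym addr≡) (cell<B 1<))
      good₂ : Good R₂
      good₂ = good-low good₁ 1< (proj₁ good₁ (R 1 + R 0))

    -- The array cells lie at `G` and beyond, so overwriting registers does not disturb the entries
    -- still to be loaded.
    low-exec : ∀ out k {a R} → k < firstFree → Good R → At prog a (lowCells k) → R 0 ≡ G → R 1 ≡ L →
      (∀ i → R (i * L + 0 + G) ≡ out i) → Done out k a R
    low-exec out 0 k< good at R0 R1 cells = low-0 out good at R0 (cells 0)
    low-exec out 1 k< good at R0 R1 cells = low-1 out good at R0 R1 cells
    low-exec out (suc (suc k′)) {a} {R} k< good (i₁ , i₂ , i₃ , i₄ , at) R0 R1 cells =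
      extend (low-exec out (suc k′) (<-trans (n<1+n _) k<) good₄ at R0 R1
        (λ i → trans (cell-off R₃ k i k<) (trans (cell-off R₂ k i k<) (trans (cell-off R₁ k i k<) (trans (cell-off R k i k<) (cells i))))))
      where
      k = suc (suc k′)
      shift : ∀ a l → 4 + a + l ≡ a + (4 + l)
      shift a l = trans (cong (_+ l) (+-comm 4 a)) (+-assoc a 4 l)
      R₁ = R [ k ≔ k ]
      R₂ = R₁ [ k ≔ R₁ k * R 1 ]
      R₃ = R₂ [ k ≔ R₂ k + R 0 ]
      R₄ = R₃ [ k ≔ R₃ (R₃ k) ]
      product≡ : R₁ k * R 1 ≡ k * L + 0
      product≡ = trans (cong₂ _*_ (upd-≡ R k) R1) (sym (+-identityʳ (k * L)))
      addr≡ : R₂ k + R 0 ≡ k * L + 0 + G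
      addr≡ = cong₂ _+_ (trans (upd-≡ R₁ k) product≡) R0
      value : R₃ (R₃ k) ≡ out k
      value = trans (cong R₃ (trans (upd-≡ R₂ k) addr≡))
        (trans (cell-off R₂ k k k<) (trans (cell-off R₁ k k k<) (trans (cell-off R k k k<) (cells k))))
      good₁ = good-low good k< (<-≤-trans (≤-<-trans (≤-trans (<⇒≤ k<) (≤ᵇ⇒≤ firstFree 100 tt)) 100<B₁) B₁≤B)
      good₂ = good-low good₁ k< (≤-<-trans (≤-trans (≤-reflexive product≡) (m≤m+n (k * L + 0) G)) (cell<B k<))
      good₃ = good-low good₂ k< (subst (_< B) (sym addr≡) (cell<B k<))
      good₄ : Good R₄
      good₄ = good-low good₃ k< (proj₁ good₃ (R₃ k))
      extend : Done out (suc k′) (4 + a) R₄ → Done out k a R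
      extend (R′ , e , low , high) = R′ ,
        subst (λ b → Exec prog (4 + length (lowCells (suc k′))) (a , R) (b , R′)) (shift a (length (lowCells (suc k′))))
          (tick good i₁ (tick good₁ i₂ (tick good₂ i₃ (tick good₃ i₄ e)))) ,
        below ,
        λ b k<b → trans (high b (<-trans (n<1+n _) k<b)) (trans (upd-≢ R₃ (<⇒≢ k<b)) (trans (upd-≢ R₂ (<⇒≢ k<b))
          (trans (upd-≢ R₁ (<⇒≢ k<b)) (upd-≢ R (<⇒≢ k<b)))))
        where
        below : ∀ b → b ≤ k → R′ b ≡ out b
        below b b≤k with m≤n⇒m<n∨m≡n b≤k
        ... | inj₁ (s≤s b<k) = low b b<k
        ... | inj₂ refl      = trans (high k (n<1+n (suc k′))) (trans (upd-≡ R₃ k) value)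

  1≤L′ : 0 < L
  1≤L′ = subst (1 ≤_) (sym L≡) (≤-trans (s≤s z≤n) (m≤n+m (firstSim + 2) _))

  n<G : n < G
  n<G = subst (n <_) (sym G≡) (lemma n)
    where
    lemma : ∀ n → n < n * n + suc firstFree
    lemma zero    = s≤s z≤n
    lemma (suc n) = ≤-<-trans (m≤m*n (suc n) (suc n)) (m<m+n (suc n * suc n) (s≤s z≤n))

  module _ {prog : List Instr} where

    Output-at : ℕ → ℕ → ℕ → Memory ℕ → Set
    Output-at T a b R = ∃[ t ] t ≤ T × ∃[ R′ ] Exec prog t (a , R) (b , R′)
      × ∃[ answer ] CorrectAnswer G′ answer × (∀ b → b ≤ n → R′ b ≡ initial 0 (answerOutput answer) b)

    finish : ∀ {a R s answer} → Rep R s → Printed answer s → At prog a (lowCells packed) →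
      Output-at (length (lowCells packed)) a (a + length (lowCells packed)) R
    finish {a} {R} {s} {answer} rep (correct , out , written) at =
      let R′ , e , low , high = low-exec {prog} (initial 0 (answerOutput answer)) packed {a} {R} (n<1+n packed) good at R0 R1
            (λ i → trans (arrs 0 i 1≤L′) (out i))
      in length (lowCells packed) , ≤-refl , R′ , e , answer , correct , λ b b≤n → final b (λ b< → low b (s≤s⁻¹ b<)) λ b≮ →
         trans (high b (≮⇒≥ b≮)) (trans (raws b (≮⇒≥ b≮) (≤-<-trans b≤n n<G)) (written b (≮⇒≥ b≮) b≤n))
      where
      open Rep rep
      final : ∀ b {A : Set} → (b < firstFree → A) → (¬ b < firstFree → A) → A
      final b yes′ no′ with b <? firstFree
      ... | yes b< = yes′ b<
      ... | no b≮  = no′ b≮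

    main-exec : ∀ {c T a R s} → Triple Start c (λ s → ∃[ answer ] Printed answer s) T →
      Rep R s → Start s → At prog a (emit c a) → At prog (a + size c) (lowCells packed) →
      Output-at (T + length (lowCells packed)) a (a + size c + length (lowCells packed)) R
    main-exec {c} {T} {a} {R} {s} main-triple rep start at-main at-low =
      let t , t≤ , R₁ , s₁ , e , rep₁ , answer , printed = main-triple .exec {prog} {a} {R} {s} at-main rep start
          t′ , t′≤ , R₂ , e′ , rest = finish rep₁ printed at-low
      in t + t′ , +-mono-≤ t≤ t′≤ , R₂ , e ▷ e′ , rest

  -- With the number of packed cells and the main part kept abstract, since
  -- normalising the actual program is expensive.
  around : ℕ → Code → List Instr
  around k c = start ++ emit c (length start) ++ lowCells packed
    where start = packing k ++ prologue workspace

  aroundTime : ℕ → ℕ → ℕ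
  aroundTime k T = length (packing k) + (10 + (T + length (lowCells packed)))

  packed-top : input′ packed ≡ packedValue input′ packed 1
  packed-top = sym (trans (packedValue-suc input′ packed 0)
    (trans (cong (λ v → input′ packed + (v + v)) (packedValue-zero input′ (suc packed))) (+-identityʳ _)))

  start-exec : ∀ {prog c T} k → packed ≡ suc k → Triple Start c (λ s → ∃[ answer ] Printed answer s) T →
    At prog 0 (packing k) → At prog (length (packing k)) (prologue workspace) →
    At prog (length (packing k) + 10) (emit c (length (packing k) + 10)) →
    At prog (length (packing k) + 10 + size c) (lowCells packed) →
    Output-at {prog} (aroundTime k T) 0
      (length (packing k) + 10 + size c + length (lowCells packed)) input′
  start-exec {prog} {c} {T} k packed≡ main at-pack at-pro at-main at-low =
    let R₁ , e₁ , small₁ , R0 , R1 , high₁ = packing-exec {prog} k 1 (trans (+-comm k 1) (sym packed≡))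
          input-small at-pack (λ _ _ → refl) (subst (λ k → input′ k ≡ packedValue input′ k 1) packed≡ packed-top)
        R₂ , s₂ , e₂ , rep₂ , start′ = prologue-exec {prog} {length (packing k)} {R₁} small₁ at-pro R0 R1 high₁
        t , t≤ , R₃ , e₃ , rest = main-exec {prog} {c} {T} {length (packing k) + 10} {R₂} {s₂} main rep₂ start′ at-main at-low
    in length (packing k) + (10 + t) , +-monoʳ-≤ (length (packing k)) (+-monoʳ-≤ 10 t≤) , R₃ , e₁ ▷ e₂ ▷ e₃ , rest

  around-exec : ∀ k c T → packed ≡ suc k → Triple Start c (λ s → ∃[ answer ] Printed answer s) T →
    Output-at {around k c} (aroundTime k T) 0 (length (around k c)) input′
  around-exec k c T packed≡ main =
    subst (λ b → Output-at {prog} (aroundTime k T) 0 b input′) end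
      (start-exec {prog} {c} {T} k packed≡ main (proj₁ at₁₂) (proj₂ at₁₂)
        (subst (λ a → At prog a (emit c a)) start≡ (proj₁ at₃₄))
        (subst (λ a → At prog a (lowCells packed)) (cong₂ _+_ start≡ (sized c (length start))) (proj₂ at₃₄)))
    where
    prog = around k c
    start = packing k ++ prologue workspace
    middle = emit c (length start)
    start≡ : length start ≡ length (packing k) + 10
    start≡ = List.length-++ (packing k)
    at = At-++ {prog} 0 start {middle ++ lowCells packed} (At-self prog)
    at₁₂ = At-++ {prog} 0 (packing k) {prologue workspace} (proj₁ at)
    at₃₄ = At-++ {prog} (length start) middle {lowCells packed} (proj₂ at)
    end : length (packing k) + 10 + size c + length (lowCells packed) ≡ length prog
    end = begin
      length (packing k) + 10 + size c + length (lowCells packed)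
        ≡⟨ cong₂ (λ a b → a + b + length (lowCells packed)) start≡ (sized c (length start)) ⟨
      length start + length middle + length (lowCells packed)
        ≡⟨ +-assoc (length start) (length middle) (length (lowCells packed)) ⟩
      length start + (length middle + length (lowCells packed))
        ≡⟨ cong (length start +_) (List.length-++ middle) ⟨
      length start + length (middle ++ lowCells packed)
        ≡⟨ List.length-++ start ⟨
      length prog ∎
      where open ≡-Reasoning

  program-exec : Promise → Fast → ((∀ m → m < n → ∀ u v → ¬ HitAt m u v) → NoEvenCycle G′) →
    Output-at {program workspace p C} (aroundTime (packed ∸ 1) mainTime) 0 (length (program workspace p C)) input′
  program-exec promise fast absent =
    around-exec (packed ∸ 1) (main workspace p C) mainTime refl (main-triple promise fast absent)

-- Lengths of binary representations

⌊/2⌋-< : ∀ {x y} → x < 2 * y → ⌊ x /2⌋ < y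
⌊/2⌋-< {x} {y} x<2y = ≰⇒> λ y≤ → <⇒≱ x<2y (begin
  2 * y                 ≡⟨ cong (y +_) (+-identityʳ y) ⟩
  y + y                 ≤⟨ +-mono-≤ y≤ (≤-trans y≤ (⌊n/2⌋≤⌈n/2⌉ x)) ⟩
  ⌊ x /2⌋ + ⌈ x /2⌉     ≡⟨ ⌊n/2⌋+⌈n/2⌉≡n x ⟩
  x                     ∎)
  where open ≤-Reasoning

⌊/2⌋-<⁻¹ : ∀ {x y} → ⌊ x /2⌋ < y → x < 2 * y
⌊/2⌋-<⁻¹ {x} {y} h<y = begin-strict
  x                     ≡⟨ ⌊n/2⌋+⌈n/2⌉≡n x ⟨
  ⌊ x /2⌋ + ⌈ x /2⌉     <⟨ +-mono-<-≤ h<y (≤-trans (⌈n/2⌉≤ x) h<y) ⟩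
  y + y                 ≡⟨ cong (y +_) (+-identityʳ y) ⟨
  2 * y                 ∎
  where
  open ≤-Reasoning
  ⌈n/2⌉≤ : ∀ n → ⌈ n /2⌉ ≤ suc ⌊ n /2⌋
  ⌈n/2⌉≤ n = ⌊n/2⌋-mono (n≤1+n (suc n))

-- `0 < w` is required because even 0 has one digit.
<2^⇒bits≤ : ∀ w {x} → 0 < w → x < 2 ^ w → bits x ≤ w
<2^⇒bits≤ (suc zero) {0} _ _ = s≤s z≤n
<2^⇒bits≤ (suc zero) {1} _ _ = s≤s z≤n
<2^⇒bits≤ (suc zero) {suc (suc x)} _ (s≤s (s≤s ()))
<2^⇒bits≤ (suc (suc w)) {x} _ x< =
  s≤s (suc-≤ (subst (_≤ w) (⌊log₂⌊n/2⌋⌋≡⌊log₂n⌋∸1 x) (s≤s⁻¹ (<2^⇒bits≤ (suc w) (s≤s z≤n) (⌊/2⌋-< x<)))))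
  where
  suc-≤ : ∀ {m} → m ∸ 1 ≤ w → m ≤ suc w
  suc-≤ {zero}  _ = z≤n
  suc-≤ {suc m} p = s≤s p

bits≤⇒<2^ : ∀ w {x} → bits x ≤ w → x < 2 ^ w
bits≤⇒<2^ (suc zero) {x} (s≤s le) = ≰⇒> λ 2≤x → contradiction (≤-trans (⌊log₂⌋-mono-≤ 2≤x) le) λ ()
bits≤⇒<2^ (suc (suc w)) {x} (s≤s le) = ⌊/2⌋-<⁻¹ (bits≤⇒<2^ (suc w)
  (s≤s (subst (_≤ w) (sym (⌊log₂⌊n/2⌋⌋≡⌊log₂n⌋∸1 x)) (∸-monoˡ-≤ 1 le))))

n<2^n : ∀ n → n < 2 ^ n
n<2^n zero    = s≤s z≤n
n<2^n (suc n) = ≤-trans (s≤s (n<2^n n)) (≤-trans (+-monoˡ-≤ (2 ^ n) (m^n>0 2 n)) (≤-reflexive (cong (2 ^ n +_) (sym (+-identityʳ _)))))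

-- Costs of executions

constantBits : Instr → ℕ
constantBits (const _ k) = bits k
constantBits _           = 0

programBits : List Instr → ℕ
programBits []      = 0
programBits (i ∷ p) = constantBits i + programBits p

constantBits-≤ : ∀ p a {i} → head (drop a p) ≡ just i → constantBits i ≤ programBits p
constantBits-≤ (i ∷ p) zero    refl = m≤m+n _ (programBits p)
constantBits-≤ (i ∷ p) (suc a) eq   = ≤-trans (constantBits-≤ p a eq) (m≤n+m (programBits p) (constantBits i))

-- `suc w` in place of `w` lets one square cover all cases: it exceeds the sum `w + w` of two
-- lengths and the cost 1 of a jump, even for `w = 0`.
bitCost-≤ : ∀ i {R w} → WordSize w R → bitCost i R ≤ constantBits i + suc w * suc w
bitCost-≤ i {R} {w} small = go i
  where
  twice : ∀ {a b} → a ≤ w → b ≤ w → a + b ≤ suc w * suc w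
  twice a≤ b≤ = +-mono-≤ (m≤n⇒m≤1+n a≤) (≤-trans b≤ (m≤m*n w (suc w)))
  once : ∀ {a} → a ≤ w → a ≤ suc w * suc w
  once {a} a≤ = ≤-trans (m≤m+n a 0) (twice a≤ z≤n)
  go : ∀ i → bitCost i R ≤ constantBits i + suc w * suc w
  go (const i k) = m≤m+n (bits k) _
  go (add i j k) = twice (small j) (small k)
  go (sub i j k) = twice (small j) (small k)
  go (mul i j k) = *-mono-≤ (m≤n⇒m≤1+n (small j)) (m≤n⇒m≤1+n (small k))
  go (half i j)  = once (small j)
  go (load i j)  = twice (small j) (small (R j))
  go (store i j) = twice (small i) (small j)
  go (jz i l)    = once (small i)
  go (jmp l)     = s≤s z≤n

drop-length : ∀ (p : List Instr) → head (drop (length p) p) ≡ nothing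
drop-length []      = refl
drop-length (_ ∷ p) = drop-length p

module _ (bounds : Bounds) {p : List Instr} where
  open Logic bounds

  step-fetch : ∀ {a i} {R : Memory ℕ} → head (drop a p) ≡ just i → RAM.step p (a , R) ≡ execute i (a , R)
  step-fetch eq rewrite eq = refl

  stepCost-fetch : ∀ {a i} {R : Memory ℕ} → head (drop a p) ≡ just i → RAM.stepCost p (a , R) ≡ bitCost i R
  stepCost-fetch eq rewrite eq = refl

  exec-run : ∀ {t c c′} → Exec p t c c′ → RAM.run p t c ≡ c′
  exec-run (done _) = refl
  exec-run {suc t} (tick {R = R} _ eq e) = trans (cong (RAM.run p t) (step-fetch {R = R} eq)) (exec-run e)

  exec-good : ∀ {t c c′} → Exec p t c c′ → ∀ s → s ≤ t → Good (proj₂ (RAM.run p s c))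
  exec-good (done g)     zero    _       = g
  exec-good (tick g _ _) zero    _       = g
  exec-good (tick {R = R} g eq e) (suc s) (s≤s s≤t) =
    subst (λ c → Good (proj₂ (RAM.run p s c))) (sym (step-fetch {R = R} eq)) (exec-good e s s≤t)

  exec-cost : ∀ {w} → (∀ {R} → Good R → WordSize w R) → ∀ {t c c′} → Exec p t c c′ →
    RAM.bitOperations p t c ≤ t * (programBits p + suc w * suc w)
  exec-cost small (done _) = z≤n
  exec-cost {w} small {suc t} (tick {a} {R} {i} g eq e) = +-mono-≤
    (≤-trans (≤-reflexive (stepCost-fetch {a} {R = R} eq))
      (≤-trans (bitCost-≤ i (small g)) (+-monoˡ-≤ _ (constantBits-≤ p a eq))))
    (subst (λ c → RAM.bitOperations p t c ≤ t * (programBits p + suc w * suc w)) (sym (step-fetch {R = R} eq))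
      (exec-cost small e))

-- Real exponents

^-distribʳ-* : ∀ m n o → (m * n) ^ o ≡ m ^ o * n ^ o
^-distribʳ-* m n zero    = refl
^-distribʳ-* m n (suc o) = trans (cong (m * n *_) (^-distribʳ-* m n o)) ([m*n]*[o*p]≡[m*o]*[n*p] m n (m ^ o) (n ^ o))

module _ {x : ℕ} {τ : ℝ} where

  ^ℝ-zero : ∀ {m} → 0 ≤ m · x ^ℝ τ
  ^ℝ-zero r@record{} _ = z≤n

  ^ℝ-≤ : ∀ {s} t {m′} m → s ≤ t → m ≤ m′ → t ≤ m · x ^ℝ τ → s ≤ m′ · x ^ℝ τ
  ^ℝ-≤ t m s≤t m≤m′ t≤ r u = ≤-trans (^-monoˡ-≤ (↧ₙ r) s≤t)
    (≤-trans (t≤ r u) (*-monoˡ-≤ (x ^ ∣ ↥ r ∣) (^-monoˡ-≤ (↧ₙ r) m≤m′)))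

  ^ℝ-* : ∀ k t m → t ≤ m · x ^ℝ τ → k * t ≤ (k * m) · x ^ℝ τ
  ^ℝ-* k t m t≤ r u = begin
    (k * t) ^ d             ≡⟨ ^-distribʳ-* k t d ⟩
    k ^ d * t ^ d           ≤⟨ *-monoʳ-≤ (k ^ d) (t≤ r u) ⟩
    k ^ d * (m ^ d * x ^ a) ≡⟨ *-assoc (k ^ d) (m ^ d) (x ^ a) ⟨
    k ^ d * m ^ d * x ^ a   ≡⟨ cong (_* x ^ a) (^-distribʳ-* k m d) ⟨
    (k * m) ^ d * x ^ a     ∎
    where
    open ≤-Reasoning
    d = ↧ₙ r
    a = ∣ ↥ r ∣

  ^ℝ-⊔ : ∀ s t m → s ≤ m · x ^ℝ τ → t ≤ m · x ^ℝ τ → s ⊔ t ≤ m · x ^ℝ τ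
  ^ℝ-⊔ s t m s≤ t≤ with ⊔-sel s t
  ... | inj₁ eq = ^ℝ-≤ s m (≤-reflexive eq) ≤-refl s≤
  ... | inj₂ eq = ^ℝ-≤ t m (≤-reflexive eq) ≤-refl t≤

  -- The relation compares powers and is not visibly additive. The sum is at most twice the maximum,
  -- and the maximum satisfies the bound because it is one of the two.
  ^ℝ-+ : ∀ s t m m′ → s ≤ m · x ^ℝ τ → t ≤ m′ · x ^ℝ τ → s + t ≤ (2 * (m ⊔ m′)) · x ^ℝ τ
  ^ℝ-+ s t m m′ s≤ t≤ = ^ℝ-≤ (2 * (s ⊔ t)) (2 * (m ⊔ m′))
    (≤-trans (+-mono-≤ (m≤m⊔n s t) (m≤n⊔m s t)) (≤-reflexive (cong (s ⊔ t +_) (sym (+-identityʳ (s ⊔ t))))))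
    ≤-refl
    (^ℝ-* 2 (s ⊔ t) (m ⊔ m′)
      (^ℝ-⊔ s t (m ⊔ m′) (^ℝ-≤ s m ≤-refl (m≤m⊔n m m′) s≤) (^ℝ-≤ t m′ ≤-refl (m≤n⊔m m m′) t≤)))

upper-above : ∀ {τ q} → ℝ.lower τ q → ∀ r → ℝ.upper τ r → q ℚ.< r
upper-above {τ} {q} below r above = ℚ.≰⇒> λ r≤q →
  let q′ , q′<r , above′ = Equivalence.to (ℝ.upper-rounded τ r) above
  in ℝ.disjoint τ q (below , Equivalence.from (ℝ.upper-rounded τ q) (q′ , ℚ.<-≤-trans q′<r r≤q , above′))

-- The point where `2 < τ` is used: every rational `a / b` above `τ` has `a ≥ 2 b`. It allows
-- clearing, copying and searching arrays of quadratic size to be charged to a matrix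
-- multiplication.
square-≤-^ℝ : ∀ {x τ} → (ℤ.+ 2 ℚ./ 1) <ℝ τ → suc x * suc x ≤ 1 · suc x ^ℝ τ
square-≤-^ℝ {x} {τ} 2<τ r u = begin
  (suc x * suc x) ^ d       ≡⟨ cong (λ y → (suc x * y) ^ d) (*-identityʳ (suc x)) ⟨
  (suc x ^ 2) ^ d           ≡⟨ ^-*-assoc (suc x) 2 d ⟩
  suc x ^ (2 * d)           ≤⟨ ^-monoʳ-≤ (suc x) (numerator r (upper-above {τ} 2<τ r u)) ⟩
  suc x ^ ∣ ↥ r ∣           ≡⟨ *-identityˡ _ ⟨
  1 * suc x ^ ∣ ↥ r ∣       ≡⟨ cong (_* suc x ^ ∣ ↥ r ∣) (^-zeroˡ d) ⟨
  1 ^ d * suc x ^ ∣ ↥ r ∣   ∎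
  where
  open ≤-Reasoning
  d = ↧ₙ r
  numerator : ∀ r → (ℤ.+ 2 ℚ./ 1) ℚ.< r → 2 * ↧ₙ r ≤ ∣ ↥ r ∣
  numerator (mkℚ (ℤ.+ a) d _)    2<r = ≤-trans (<⇒≤ (ℤ.drop‿+<+
    (subst₂ ℤ._<_ (sym (ℤ.pos-* 2 (suc d))) (sym (ℤ.pos-* a 1)) (ℚ.drop-*<* 2<r)))) (≤-reflexive (*-identityʳ a))
  numerator (mkℚ -[1+ a ] d _) (ℚ.*<* ())

-- Running time

-- A wrapper that lets the factors be inferred.
record _≤_units_ (x k U : ℕ) : Set where
  constructor bound
  field proof : x ≤ k * U

open _≤_units_

module _ {U : ℕ} (1≤U : 1 ≤ U) where

  fixed : ∀ k → k ≤ k units U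
  fixed k .proof = ≤-trans (≤-reflexive (sym (*-identityʳ k))) (*-monoʳ-≤ k 1≤U)

infixr 5 _⊕ᵘ_

_⊕ᵘ_ : ∀ {U x y k l} → x ≤ k units U → y ≤ l units U → (x + y) ≤ (k + l) units U
_⊕ᵘ_ {U} {k = k} {l} p q .proof = ≤-trans (+-mono-≤ (p .proof) (q .proof)) (≤-reflexive (sym (*-distribʳ-+ U k l)))

scaled : ∀ {U x k} c → x ≤ k units U → (x * c) ≤ (k * c) units U
scaled {U} {x} {k} c p .proof = ≤-trans (*-monoˡ-≤ c (p .proof)) (≤-reflexive (begin
  k * U * c     ≡⟨ *-assoc k U c ⟩
  k * (U * c)   ≡⟨ cong (k *_) (*-comm U c) ⟩
  k * (c * U)   ≡⟨ *-assoc k c U ⟨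
  k * c * U     ∎))
  where open ≡-Reasoning

-- These constants repeat the time bounds term by term, with loop counts and `Tmax` replaced by one
-- unit; the 4 is the setup of a loop and its last test.
loopK : List Op → ℕ
loopK body = 4 + (2 + length (emitOps (body ++ advance)))

copyK : List Op → ℕ
copyK os = length (emitOps os) + loopK copyEntry

callK iterationK mainK programK : Workspace → ℕ
callK w = length (emitOps (freshOps w)) + loopK zeroSim + (copyK (inOps₁ 0) + (copyK (inOps₂ 0) +
  (length (emitOps dimOps) + (1 * 60 + copyK (outOps 0)))))

updateK reportK : ℕ
updateK = loopK (maccEntry 0 0 0) + (loopK (maccEntry 0 0 0) +
  (loopK (maccEntry 0 0 0) + (copyK (moveOps 0 0) + copyK (moveOps 0 0))))
reportK = length (emitOps reportOps) + (loopK tourEntry + 1)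

iterationK w = callK w + (callK w + (callK w + (updateK + (length (emitOps stepOps) +
  (loopK searchEntry + (1 + reportK))))))

mainK w = length (emitOps (setupOps 0)) + (loopK unpackEntry +
  (length (emitOps (beyondPacked vQ)) + (loopK relocateEntry +
  (2 + (loopK tableEntry + (1 + (2 + iterationK w) +
  (length (emitOps (beyondPacked vN)) + loopK outputEntry)))))))

programK w = length (packing (packed ∸ 1)) + (10 + (mainK w + length (lowCells packed)))

module Timed (job : Job) where
  open Job job
  open Loops bounds 100<B₁
  open Verified-Multiply setting
  open Verified-Iterate setting
  open OnGraph G′ Tmax
  open Verified-Main job
  open Verified-Run job

  -- One unit is a slowest multiplication together with a pass over an array. A round takes a
  -- constant number of units, and the whole run a constant number of `V`, that is, of `n + 1`
  -- units.
  U : ℕ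
  U = Tmax + S

  S≤U : S ≤ U
  S≤U = m≤n+m S Tmax

  1≤U : 1 ≤ U
  1≤U = ≤-trans (≤-trans (s≤s z≤n) 30≤S) S≤U

  loop-units : ∀ {V c} body → 1 ≤ V → c ≤ V → forEachTime c body ≤ loopK body units V
  loop-units {V} {c} body 1≤V c≤V .proof = begin
    4 + c * k         ≤⟨ +-mono-≤ (fixed 1≤V 4 .proof) (*-monoˡ-≤ k c≤V) ⟩
    4 * V + V * k     ≡⟨ cong (4 * V +_) (*-comm V k) ⟩
    4 * V + k * V     ≡⟨ *-distribʳ-+ V 4 k ⟨
    (4 + k) * V       ∎
    where
    open ≤-Reasoning
    k = 2 + length (emitOps (body ++ advance))

  copy-units : ∀ os → copyTime os ≤ copyK os units U
  copy-units os = fixed 1≤U (length (emitOps os)) ⊕ᵘ loop-units copyEntry 1≤U (≤-trans q≤S S≤U)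

  call-units : callTime ≤ callK workspace units U
  call-units =
    (fixed 1≤U (length (emitOps (freshOps workspace))) ⊕ᵘ loop-units zeroSim 1≤U S≤U) ⊕ᵘ
    copy-units (inOps₁ 0) ⊕ᵘ copy-units (inOps₂ 0) ⊕ᵘ fixed 1≤U (length (emitOps dimOps)) ⊕ᵘ
    scaled 60 (bound {k = 1} (≤-trans (m≤m+n Tmax S) (m≤m+n U 0))) ⊕ᵘ copy-units (outOps 0)

  update-units : updateTime ≤ updateK units U
  update-units = loop-units (maccEntry 0 0 0) 1≤U q≤U ⊕ᵘ loop-units (maccEntry 0 0 0) 1≤U q≤U ⊕ᵘ
    loop-units (maccEntry 0 0 0) 1≤U q≤U ⊕ᵘ copy-units (moveOps 0 0) ⊕ᵘ copy-units (moveOps 0 0)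
    where q≤U = ≤-trans q≤S S≤U

  report-units : reportTime n ≤ reportK units U
  report-units = fixed 1≤U (length (emitOps reportOps)) ⊕ᵘ loop-units tourEntry 1≤U (≤-trans n<S S≤U) ⊕ᵘ fixed 1≤U 1

  iteration-units : iterationTime ≤ iterationK workspace units U
  iteration-units = call-units ⊕ᵘ call-units ⊕ᵘ call-units ⊕ᵘ update-units ⊕ᵘ
    fixed 1≤U (length (emitOps stepOps)) ⊕ᵘ loop-units searchEntry 1≤U (≤-trans q≤S S≤U) ⊕ᵘ
    (fixed 1≤U 1 ⊕ᵘ report-units)

  V : ℕ
  V = suc n * U

  U≤V : U ≤ V
  U≤V = m≤m+n U (n * U)

  1≤V : 1 ≤ V
  1≤V = ≤-trans 1≤U U≤V

  iterations-units : ((n ∸ 1) * (2 + iterationTime)) ≤ (2 + iterationK workspace) units V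
  iterations-units .proof = ≤-trans
    (*-mono-≤ (≤-trans (m∸n≤m n 1) (n≤1+n n)) (round .proof))
    (≤-reflexive (exchange (suc n) (2 + iterationK workspace)))
    where
    round : (2 + iterationTime) ≤ (2 + iterationK workspace) units U
    round = fixed 1≤U 2 ⊕ᵘ iteration-units
    exchange : ∀ l k → l * (k * U) ≡ k * (l * U)
    exchange l k = trans (sym (*-assoc l k U)) (trans (cong (_* U) (*-comm l k)) (*-assoc k l U))

  S≤V : S ≤ V
  S≤V = ≤-trans S≤U U≤V

  main-units : mainTime ≤ mainK workspace units V
  main-units = fixed 1≤V (length (emitOps (setupOps C))) ⊕ᵘ
    loop-units unpackEntry 1≤V (≤-trans (≤-trans (≤ᵇ⇒≤ packed 30 tt) 30≤S) S≤V) ⊕ᵘ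
    fixed 1≤V (length (emitOps (beyondPacked vQ))) ⊕ᵘ
    loop-units relocateEntry 1≤V (≤-trans (m∸n≤m q packed) (≤-trans q≤S S≤V)) ⊕ᵘ
    fixed 1≤V 2 ⊕ᵘ loop-units tableEntry 1≤V (≤-trans q≤S S≤V) ⊕ᵘ
    (fixed 1≤V 1 ⊕ᵘ iterations-units) ⊕ᵘ
    fixed 1≤V (length (emitOps (beyondPacked vN))) ⊕ᵘ
    loop-units outputEntry 1≤V (≤-trans (m∸n≤m n packed) (≤-trans (<⇒≤ n<S) S≤V))

  program-units : aroundTime (packed ∸ 1) mainTime ≤ programK workspace units V
  program-units = fixed 1≤V (length (packing (packed ∸ 1))) ⊕ᵘ
    fixed 1≤V 10 ⊕ᵘ main-units ⊕ᵘ fixed 1≤V (length (lowCells packed))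

-- Promised inputs

cycle-length-≤ : ∀ {n} {G : Digraph n} {c} → IsCycle G c → length c ≤ n
cycle-length-≤ cycle = ≤-trans (unique-length (λ _ → true) _ (IsCycle.simple cycle) (All.tabulate (λ _ → refl))) (degree-≤ (λ _ → true))

answer-startsWith : ∀ {n} {G : Digraph n} {R} answer → CorrectAnswer G answer →
  (∀ b → b ≤ n → R b ≡ initial 0 (answerOutput answer) b) → StartsWith R (answerOutput answer)
answer-startsWith {R = R} nothing  _       R≡ = initial⇒startsWith 0 R _ λ { zero _ → R≡ 0 z≤n ; (suc b) (s≤s ()) }
answer-startsWith {R = R} (just c) correct R≡ = initial⇒startsWith 0 R _ λ b b< → R≡ b
  (≤-trans (s≤s⁻¹ b<) (≤-trans (≤-reflexive (List.length-map _ c)) (cycle-length-≤ (proj₁ (proj₁ correct)))))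

module _ (setting : Setting) (G′ : Digraph (Setting.n setting)) (Tmax : ℕ) where
  open Setting setting
  open Verified-Iterate setting hiding (Tour; module Tour)
  open OnGraph G′ Tmax

  no-hits : ∀ {k} → (∀ c → IsEvenCycle G′ c → k < length c) → ∀ e → e < k → ∀ u v → ¬ HitAt e u v
  no-hits long e e<k u v hit =
    contradiction (trans (sym (Bool.∧-conicalʳ (Q.A u v) _ hit)) (no-hit G′ long e e<k u v (Bool.∧-conicalˡ _ _ hit))) λ ()

  -- Nothing is hit below degree `k`, and at `k` exactly the arcs of the cycle are. Larger degrees
  -- would require that `k` had passed without a hit. Without even cycles the bound on their lengths
  -- is vacuous, so no degree has a hit.
  hits : NoEvenCycle G′ ⊎ UniqueShortestEvenCycle G′ →
    Promise × ((∀ m → m < n → ∀ u v → ¬ HitAt m u v) → NoEvenCycle G′)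
  hits (inj₁ none) = (λ m _ → (λ hit → contradiction hit (never m)) , λ hit → contradiction hit (never m)) , λ _ → none
    where
    never : ∀ m {u v} → ¬ HitAt m u v
    never m = no-hits {suc m} (λ c even → contradiction even (none c)) m (n<1+n m) _ _
  hits (inj₂ ([] , shortest , _)) = contradiction refl (IsCycle.nonempty (proj₁ (proj₁ shortest)))
  hits (inj₂ (u ∷ us , least , unique)) = promise , λ missed → contradiction (complete (proj₂ first)) (missed k k<n _ _)
    where
    open Unique-Cycle G′ u us least unique
    sound : ∀ {a b} → HitAt k a b → (a , b) ∈ path u us u
    sound hit = hit-sound (Bool.∧-conicalˡ _ _ hit) (Bool.∧-conicalʳ _ _ hit)
    complete : ∀ {a b} → (a , b) ∈ path u us u → HitAt k a b
    complete p = let p₁ , p₂ = hit-complete p in cong₂ _∧_ p₁ p₂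
    first : ∃[ b ] (u , b) ∈ path u us u
    first = out-arc (here refl)
    promise : Promise
    promise m before with <-cmp m k
    ... | tri< m<k _ _ = (λ hit → contradiction hit (no-hits long m m<k _ _)) , λ hit → contradiction hit (no-hits long m m<k _ _)
    ... | tri> _ _ k<m = contradiction (complete (proj₂ first)) (before k k<m _ _)
    ... | tri≈ _ refl _ = (λ hit hit′ → functional D! (sound hit) (sound hit′)) , answer
      where
      answer : ∀ {a b} → HitAt k a b → Answer k a
      answer hit = record
        { rest = Tour.rest t ; length≡ = Tour.size t ; hits = λ p → complete (Tour.next t p) ; shortest = Tour.shortest t }
        where t = tour (source (sound hit))

-- The choice of the sizes

maximum : (ℕ → ℕ) → ℕ → ℕ
maximum f zero    = 0
maximum f (suc n) = maximum f n ⊔ f n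

maximum-≥ : ∀ f {m n} → m < n → f m ≤ maximum f n
maximum-≥ f {m} {suc n} (s≤s m≤n) with m≤n⇒m<n∨m≡n m≤n
... | inj₁ m<n  = ≤-trans (maximum-≥ f m<n) (m≤m⊔n (maximum f n) (f n))
... | inj₂ refl = m≤n⊔m (maximum f n) (f n)

module FromFast {w : Workspace} {τ : ℝ} (2<τ : (ℤ.+ 2 / 1) <ℝ τ) (fast : FastAlgorithm w τ multiplication) where

  p = proj₁ fast
  C₀ = proj₁ (proj₂ fast)

  C D : ℕ
  -- `C₀` accounts for the cells of the given algorithm; the 3, with the 30 added in `S`, provides
  -- for the operands and the fixed sizes collected in `ample`.
  C = C₀ + 3
  -- Makes `2 ^ (D * bits n)` exceed `S`, the packed bits, the constants of `p` and the registers of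
  -- the simulated program; 59 leaves a margin.
  D = C + 59 + allConstants p

  59≤D : 59 ≤ D
  59≤D = ≤-trans (m≤n+m 59 C) (m≤m+n (C + 59) (allConstants p))

  module _ (n : ℕ) where

    N b W₁ B₁ S G L : ℕ
    N  = suc n * suc n
    b  = bits n
    W₁ = D * b
    B₁ = 2 ^ W₁
    S  = (C + 30) * N
    G  = n * n + suc firstFree
    L  = 3 * stride w * n + (firstSim + 2)

    ≤W₁ : ∀ {e} → e ≤ D → e ≤ W₁
    ≤W₁ e≤ = ≤-trans e≤ (m≤m*n D b)

    <B₁ : ∀ {x e} → x < 2 ^ e → e ≤ W₁ → x < B₁
    <B₁ x< e≤ = <-≤-trans x< (^-monoʳ-≤ 2 e≤)

    100<B₁ : 100 < B₁
    100<B₁ = <B₁ {e = 7} (≤ᵇ⇒≤ 101 128 tt) (≤W₁ (≤-trans (≤ᵇ⇒≤ 7 59 tt) 59≤D))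

    packed<B₁ : 2 ^ packed < B₁
    packed<B₁ = ^-monoʳ-< 2 ≤-refl (≤W₁ (≤-trans (≤ᵇ⇒≤ 27 59 tt) 59≤D))

    N≤ : N ≤ 2 ^ (b + b)
    N≤ = ≤-trans (*-mono-≤ n<2^b n<2^b) (≤-reflexive (sym (^-distribˡ-+-* 2 b b)))
      where
      n<2^b : n < 2 ^ b
      n<2^b = bits≤⇒<2^ b ≤-refl

    S<B₁ : S < B₁
    S<B₁ = begin-strict
      (C + 30) * N                    ≤⟨ *-monoʳ-≤ (C + 30) N≤ ⟩
      (C + 30) * 2 ^ (b + b)          <⟨ *-monoˡ-< (2 ^ (b + b)) {{>-nonZero (m^n>0 2 (b + b))}} (n<2^n (C + 30)) ⟩
      2 ^ (C + 30) * 2 ^ (b + b)      ≡⟨ ^-distribˡ-+-* 2 (C + 30) (b + b) ⟨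
      2 ^ (C + 30 + (b + b))          ≤⟨ ^-monoʳ-≤ 2 exponent ⟩
      2 ^ W₁                          ∎
      where
      open ≤-Reasoning
      exponent : C + 30 + (b + b) ≤ W₁
      exponent = begin
        C + 30 + (b + b)           ≤⟨ +-monoˡ-≤ (b + b) (m≤m*n (C + 30) b) ⟩
        (C + 30) * b + (b + b)     ≡⟨ cong (λ x → (C + 30) * b + (b + x)) (+-identityʳ b) ⟨
        (C + 30) * b + 2 * b       ≡⟨ *-distribʳ-+ b (C + 30) 2 ⟨
        (C + 30 + 2) * b           ≤⟨ *-monoˡ-≤ b (≤-trans (≤-reflexive (+-assoc C 30 2))
                                          (≤-trans (+-monoʳ-≤ C (≤ᵇ⇒≤ 32 59 tt)) (m≤m+n (C + 59) (allConstants p)))) ⟩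
        D * b                      ∎

    30N≤S : 30 * N ≤ S
    30N≤S = *-monoˡ-≤ N (m≤n+m 30 C)

    stride≤2 : ∀ w → stride w ≤ 2
    stride≤2 unrestricted = ≤-refl
    stride≤2 quadratic    = z≤n

    L≤S : L ≤ S
    L≤S = begin
      3 * stride w * n + 11    ≤⟨ +-mono-≤ (*-mono-≤ (*-monoʳ-≤ 3 (stride≤2 w)) (≤-trans (n≤1+n n) (m≤m*n (suc n) (suc n)))) (m≤m*n 11 N) ⟩
      6 * N + 11 * N           ≡⟨ *-distribʳ-+ N 6 11 ⟨
      17 * N                   ≤⟨ *-monoˡ-≤ N (≤ᵇ⇒≤ 17 30 tt) ⟩
      30 * N                   ≤⟨ 30N≤S ⟩
      S                        ∎
      where open ≤-Reasoning

    G≤S : G ≤ S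
    G≤S = begin
      n * n + 28          ≤⟨ +-mono-≤ (*-mono-≤ (n≤1+n n) (n≤1+n n)) (m≤m*n 28 N) ⟩
      N + 28 * N          ≤⟨ *-monoˡ-≤ N (≤ᵇ⇒≤ 29 30 tt) ⟩
      30 * N              ≤⟨ 30N≤S ⟩
      S                   ∎
      where open ≤-Reasoning

    ample : 3 * N + 30 ≤ S
    ample = begin
      3 * N + 30          ≤⟨ +-monoʳ-≤ (3 * N) (m≤m*n 30 N) ⟩
      3 * N + 30 * N      ≡⟨ *-distribʳ-+ N 3 30 ⟨
      (3 + 30) * N        ≤⟨ *-monoˡ-≤ N (+-monoˡ-≤ 30 (m≤n+m 3 C₀)) ⟩
      S                   ∎
      where open ≤-Reasoning

    bounds : Bounds
    bounds = record
      -- `G` and `L` are below `B₁`, so addresses are below twice its square; the cube is again a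
      -- power of 2.
      { G = G ; L = L ; B₁ = B₁ ; B = 2 ^ (W₁ * 3)
      ; Out  = λ a → w ≡ quadratic × 12 * S ≤ a
      ; OutI = λ i → w ≡ quadratic × S ≤ i
      ; free≤G = ≤-trans (n≤1+n firstFree) (m≤n+m (suc firstFree) (n * n))
      ; address<B = entry<
      ; B₁≤B = ^-monoʳ-≤ 2 (m≤m*n W₁ 3)
      ; out-low = λ { a<G (_ , 12S≤a) → <⇒≱ a<G (≤-trans (≤-trans G≤S (m≤m+n S (11 * S))) 12S≤a) }
      ; out-array = λ { j<L (refl , 12S≤) → refl , inside j<L 12S≤ }
      }
      where
      row : ∀ {i j L X} → i < X → j < L → i * L + j < X * L
      row {i} {j} {L} {X} i<X j<L = begin-strict
        i * L + j    <⟨ +-monoʳ-< (i * L) j<L ⟩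
        i * L + L    ≡⟨ +-comm (i * L) L ⟩
        suc i * L    ≤⟨ *-monoˡ-≤ L i<X ⟩
        X * L        ∎
        where open ≤-Reasoning
      entry< : ∀ {i j} → i < B₁ → j < L → i * L + j + G < 2 ^ (W₁ * 3)
      entry< {i} {j} i<B₁ j<L = begin-strict
        i * L + j + G             <⟨ +-mono-<-≤ (row i<B₁ j<L) (<⇒≤ (≤-<-trans G≤S S<B₁)) ⟩
        B₁ * L + B₁               ≤⟨ +-mono-≤ (*-monoʳ-≤ B₁ (<⇒≤ (≤-<-trans L≤S S<B₁)))
                                                (≤-trans (≤-reflexive (sym (*-identityʳ B₁))) (*-monoʳ-≤ B₁ 1≤B₁)) ⟩
        B₁ * B₁ + B₁ * B₁         ≡⟨ cong (B₁ * B₁ +_) (+-identityʳ (B₁ * B₁)) ⟨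
        2 * (B₁ * B₁)             ≤⟨ *-monoˡ-≤ (B₁ * B₁) (≤-trans (≤ᵇ⇒≤ 2 101 tt) 100<B₁) ⟩
        B₁ * (B₁ * B₁)            ≡⟨ cong (λ x → B₁ * (B₁ * x)) (*-identityʳ B₁) ⟨
        B₁ ^ 3                    ≡⟨ ^-*-assoc 2 W₁ 3 ⟩
        2 ^ (W₁ * 3)              ∎
        where
        open ≤-Reasoning
        1≤B₁ : 1 ≤ B₁
        1≤B₁ = m^n>0 2 W₁
      inside : ∀ {j i} → j < 11 → 12 * S ≤ i * 11 + j + G → S ≤ i
      inside {j} {i} j< 12S≤ = ≮⇒≥ λ i<S → <⇒≱ (begin-strict
        i * 11 + j + G    <⟨ +-mono-<-≤ (row i<S j<) G≤S ⟩
        S * 11 + S        ≡⟨ trans (+-comm (S * 11) S) (cong (S +_) (*-comm S 11)) ⟩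
        12 * S            ∎) 12S≤
        where open ≤-Reasoning

    setting : Setting
    setting = record
      { bounds = bounds
      ; workspace = w ; n = n ; S = S
      ; 100<B₁ = 100<B₁ ; S<B₁ = S<B₁ ; L<B₁ = ≤-<-trans L≤S S<B₁
      ; ample = ample
      ; inside = λ { i<S (_ , S≤i) → <⇒≱ i<S S≤i }
      ; outside = λ S≤i w≡ → w≡ , S≤i
      ; arrays = ≤-reflexive (trans (+-comm 11 (stride w * (3 * n))) (cong (_+ 11)
          (trans (sym (*-assoc (stride w) 3 n)) (cong (_* n) (*-comm (stride w) 3)))))
      ; p = p
      ; constants<B₁ = <B₁ (n<2^n (allConstants p)) (≤W₁ (m≤n+m (allConstants p) (C + 59)))
      ; algorithm = λ X Y → let t , halted , solved , _ , within = proj₂ (proj₂ fast) 𝔽₂ n (X , Y) in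
          t , halted , solved , λ u u≤t → let small , cells , cells′ = within u u≤t in
            (λ a → <B₁ (bits≤⇒<2^ (C₀ * b) (small a)) (*-monoˡ-≤ b C₀≤D)) , vanish cells , vanish cells′
      }
      where
      C₀≤D : C₀ ≤ D
      C₀≤D = ≤-trans (m≤m+n C₀ 3) (≤-trans (m≤m+n C 59) (m≤m+n (C + 59) (allConstants p)))
      vanish : ∀ {A : Set} {z : A} {m w} → CellsWithin w C₀ n z m → ∀ a → w ≡ quadratic × S ≤ a → m a ≡ z
      vanish zeros a (refl , S≤a) = zeros a (≤-trans
        (*-mono-≤ (≤-trans (m≤m+n C₀ 3) (m≤m+n C 30)) (≤-reflexive (cong (suc n *_) (*-identityʳ (suc n))))) S≤a)

  prog : List Instr
  prog = program w p C

  κ timeC C₁ C₂ : ℕ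
  κ = programBits prog
  timeC = programK w * (κ + (D * 3 + 1) * (D * 3 + 1))
  C₁ = 2 * (C₀ ⊔ (C + 30))
  C₂ = timeC * C₁ + (D * 3 + 12 * (C + 30))

  module OnInput (n : ℕ) (G′ : Digraph n) (given : NoEvenCycle G′ ⊎ UniqueShortestEvenCycle G′) where
    open Setting (setting n) using (algorithm)
    module Q = Sequences G′

    t₁ t₂ t₃ calls : ℕ → ℕ
    t₁ m = proj₁ (algorithm Q.A (Q.power m))
    t₂ m = proj₁ (algorithm (Q.P m) Q.Aᵀ)
    t₃ m = proj₁ (algorithm Q.Aᵀ (Q.X m))
    calls m = t₁ m ⊔ (t₂ m ⊔ t₃ m)

    -- The algorithm promises a time for each pair of operands separately. The largest one occurring
    -- in this run is a single number that obeys the same bound, by `^ℝ-⊔`.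
    Tmax : ℕ
    Tmax = maximum calls n

    call-≤ : ∀ X Y → proj₁ (algorithm X Y) ≤ C₀ · suc n ^ℝ τ
    call-≤ X Y = proj₁ (proj₂ (proj₂ (proj₂ (proj₂ (proj₂ fast) 𝔽₂ n (X , Y)))))

    Tmax-≤ : ∀ l → maximum calls l ≤ C₀ · suc n ^ℝ τ
    Tmax-≤ zero    = ^ℝ-zero {suc n} {τ} {C₀}
    Tmax-≤ (suc l) = ^ℝ-⊔ {suc n} {τ} (maximum calls l) (calls l) C₀ (Tmax-≤ l)
      (^ℝ-⊔ {suc n} {τ} (t₁ l) (t₂ l ⊔ t₃ l) C₀ (call-≤ Q.A (Q.power l))
        (^ℝ-⊔ {suc n} {τ} (t₂ l) (t₃ l) C₀ (call-≤ (Q.P l) Q.Aᵀ) (call-≤ Q.Aᵀ (Q.X l))))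

    job : Job
    job = record
      { setting = setting n ; G′ = G′ ; Tmax = Tmax ; C = C
      ; S≡ = refl ; G≡ = refl ; L≡ = refl
      ; C<B₁ = ≤-<-trans (m≤m*n (C + 30) (N n)) (S<B₁ n)
      ; G<B₁ = ≤-<-trans (G≤S n) (S<B₁ n)
      ; packed<B₁ = packed<B₁ n
      }

    open Logic (bounds n)
    open Verified-Iterate.OnGraph (setting n) G′ Tmax using (Fast)
    open Verified-Main job using (mainTime; input′)
    open Verified-Run job
    open Timed job

    fast-calls : Fast
    fast-calls m m<n =
      ≤-trans (m≤m⊔n (t₁ m) _) most ,
      ≤-trans (≤-trans (m≤m⊔n (t₂ m) (t₃ m)) (m≤n⊔m (t₁ m) _)) most ,
      ≤-trans (≤-trans (m≤n⊔m (t₂ m) (t₃ m)) (m≤n⊔m (t₁ m) _)) most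
      where
      most : calls m ≤ Tmax
      most = maximum-≥ calls m<n

    U-≤ : U ≤ C₁ · suc n ^ℝ τ
    U-≤ = ^ℝ-+ {suc n} {τ} Tmax (S n) C₀ (C + 30) (Tmax-≤ n)
      (^ℝ-≤ {suc n} {τ} ((C + 30) * N n) ((C + 30) * 1) ≤-refl (≤-reflexive (*-identityʳ (C + 30)))
        (^ℝ-* {suc n} {τ} (C + 30) (N n) 1 (square-≤-^ℝ {n} {τ} 2<τ)))

    small : ∀ {R} → Good R → WordSize (W₁ n * 3) R
    small good a = <2^⇒bits≤ (W₁ n * 3) (≤-trans (≤W₁ n (≤-trans (s≤s z≤n) 59≤D)) (m≤m*n (W₁ n) 3)) (proj₁ good a)

    -- The origin of the logarithmic factor: all cells have O(log n) bits, and multiplying two of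
    -- them is charged quadratically.
    instruction-≤ : κ + suc (W₁ n * 3) * suc (W₁ n * 3) ≤ (κ + (D * 3 + 1) * (D * 3 + 1)) * b n ^ 2
    instruction-≤ = begin
      κ + suc W * suc W             ≤⟨ +-mono-≤ (m≤m*n κ (b n * b n)) (*-mono-≤ W≤ W≤) ⟩
      κ * (b n * b n) + E * b n * (E * b n) ≡⟨ cong (κ * (b n * b n) +_) ([m*n]*[o*p]≡[m*o]*[n*p] E (b n) E (b n)) ⟩
      κ * (b n * b n) + E * E * (b n * b n) ≡⟨ *-distribʳ-+ (b n * b n) κ (E * E) ⟨
      (κ + E * E) * (b n * b n)     ≡⟨ cong (λ x → (κ + E * E) * (b n * x)) (*-identityʳ (b n)) ⟨
      (κ + E * E) * b n ^ 2         ∎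
      where
      open ≤-Reasoning
      W = W₁ n * 3
      E = D * 3 + 1
      W≤ : suc W ≤ E * b n
      W≤ = begin
        suc (D * b n * 3)      ≡⟨ cong suc (trans (*-assoc D (b n) 3) (trans (cong (D *_) (*-comm (b n) 3)) (sym (*-assoc D 3 (b n))))) ⟩
        suc (D * 3 * b n)      ≡⟨ +-comm 1 (D * 3 * b n) ⟩
        D * 3 * b n + 1        ≤⟨ +-monoʳ-≤ (D * 3 * b n) (s≤s z≤n) ⟩
        D * 3 * b n + b n      ≡⟨ cong (D * 3 * b n +_) (+-identityʳ (b n)) ⟨
        D * 3 * b n + 1 * b n  ≡⟨ *-distribʳ-+ (b n) (D * 3) 1 ⟨
        E * b n                ∎

    operations-≤ : ∀ {t x} → t ≤ aroundTime (packed ∸ 1) mainTime →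
      x ≤ t * (κ + suc (W₁ n * 3) * suc (W₁ n * 3)) → x ≤ (C₂ * b n ^ 2 * suc n) · suc n ^ℝ τ
    operations-≤ {t} {x} t≤ x≤ = ^ℝ-≤ {suc n} {τ} (k * U) (k * C₁)
      (begin
        x                                                     ≤⟨ x≤ ⟩
        t * (κ + suc (W₁ n * 3) * suc (W₁ n * 3))             ≤⟨ *-mono-≤ (≤-trans t≤ (_≤_units_.proof program-units)) instruction-≤ ⟩
        programK w * (suc n * U) * (E * b n ^ 2)              ≡⟨ rearrange (programK w) (suc n) U E (b n ^ 2) ⟩
        k * U                                                 ∎)
      (begin
        k * C₁                                       ≡⟨ rearrange′ timeC (b n ^ 2) (suc n) C₁ ⟩
        timeC * C₁ * b n ^ 2 * suc n                 ≤⟨ *-monoˡ-≤ (suc n) (*-monoˡ-≤ (b n ^ 2) (m≤m+n (timeC * C₁) _)) ⟩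
        C₂ * b n ^ 2 * suc n                         ∎)
      (^ℝ-* {suc n} {τ} k U C₁ U-≤)
      where
      open ≤-Reasoning
      open +-*-Solver using (solve; _:=_; _:*_)
      E = κ + (D * 3 + 1) * (D * 3 + 1)
      k = timeC * b n ^ 2 * suc n
      rearrange : ∀ a s u e b → a * (s * u) * (e * b) ≡ a * e * b * s * u
      rearrange = solve 5 (λ a s u e b → a :* (s :* u) :* (e :* b) := a :* e :* b :* s :* u) refl
      rearrange′ : ∀ a b s c → a * b * s * c ≡ a * c * b * s
      rearrange′ = solve 4 (λ a b s c → a :* b :* s :* c := a :* c :* b :* s) refl

    space : ∀ v {R} → v ≡ w → Good R → SpaceWithin v C₂ n R
    space unrestricted _ _ = tt
    space quadratic refl good =
      (λ a → ≤-trans (small good a) (≤-trans (≤-reflexive W≡) (*-monoˡ-≤ (b n) (≤-trans (m≤m+n (D * 3) _) (m≤n+m _ (timeC * C₁)))))) ,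
      λ a C₂≤a → proj₂ good a (refl , ≤-trans (≤-reflexive S≡)
        (≤-trans (*-monoˡ-≤ (suc n ^ 2) (≤-trans (m≤n+m (12 * (C + 30)) (D * 3)) (m≤n+m _ (timeC * C₁)))) C₂≤a))
      where
      W≡ : W₁ n * 3 ≡ D * 3 * b n
      W≡ = trans (*-assoc D (b n) 3) (trans (cong (D *_) (*-comm (b n) 3)) (sym (*-assoc D 3 (b n))))
      S≡ : 12 * S n ≡ 12 * (C + 30) * suc n ^ 2
      S≡ = trans (sym (*-assoc 12 (C + 30) (N n))) (cong (λ x → 12 * (C + 30) * (suc n * x)) (sym (*-identityʳ (suc n))))

    Result : List Instr → Set
    Result prog = let start = 0 , initial 0 (graphInput G′) in Σ[ t ∈ ℕ ]
      ( RAM.Halted prog (RAM.run prog t start)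
      × (∃[ answer ] CorrectAnswer G′ answer × StartsWith (proj₂ (RAM.run prog t start)) (answerOutput answer))
      × RAM.bitOperations prog t start ≤ (C₂ * bits n ^ 2 * suc n) · suc n ^ℝ τ
      × (∀ s → s ≤ t → SpaceWithin w C₂ n (proj₂ (RAM.run prog s start))))

    -- For an abstract program, since normalising the actual one is expensive.
    conclude : ∀ prog → programBits prog ≡ κ →
      Output-at {prog} (aroundTime (packed ∸ 1) mainTime) 0 (length prog) input′ → Result prog
    conclude prog κ≡ (t , t≤ , R , e , answer , correct , R≡) =
      t , subst (RAM.Halted prog) (sym final) (drop-length prog) ,
      (answer , correct , subst (λ c → StartsWith (proj₂ c) (answerOutput answer)) (sym final)
        (answer-startsWith answer correct R≡)) ,
      operations-≤ t≤ (≤-trans (exec-cost (bounds n) small e)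
        (≤-reflexive (cong (λ κ → t * (κ + suc (W₁ n * 3) * suc (W₁ n * 3))) κ≡))) ,
      λ s s≤t → space w refl (exec-good (bounds n) e s s≤t)
      where final = exec-run (bounds n) e

    result : Result prog
    result = let promise , absent = hits (setting n) G′ Tmax given in
      conclude prog refl (program-exec promise fast-calls absent)

-- One program text for both workspaces: `w` decides whether the arrays of the simulation are
-- reused, and the space bound is inherited from the given multiplication. That algorithm, uniform
-- in the field, is run over 𝔽₂ only.
unique-shortest-even-cycle : ∀ {w τ} → (ℤ.+ 2 / 1) <ℝ τ → FastAlgorithm w τ multiplication → FindsUniqueShortestEvenCycle w τ
unique-shortest-even-cycle {w} {τ} 2<τ fast = prog , C₂ , 2 , OnInput.result
  where open FromFast {w} {τ} 2<τ fast

open import Data.Integer.Base using (+_)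

corollary6p4 : (τ : ℝ) → (+ 2 / 1) <ℝ τ → τ ≤ℝ (+ 3 / 1) →
    FastMatrixMultiplication τ →
    FindsUniqueShortestEvenCycle unrestricted τ
    × (QuadraticWorkspaceLinearAlgebra τ → FindsUniqueShortestEvenCycle quadratic τ)
corollary6p4 τ 2<τ _ multiplies =
  unique-shortest-even-cycle {τ = τ} 2<τ multiplies ,
  λ algebra → unique-shortest-even-cycle {τ = τ} 2<τ (QuadraticWorkspaceLinearAlgebra.fastMultiplication algebra)
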